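{- Let $\mathcal{M}_1,\ldots,\mathcal{M}_k$ be graph matroid families and let $\mathcal{M}$ be their union, i.e., $\mathcal{M}(G)=\mathcal{M}_1(G)\cup\cdots\cup\mathcal{M}_k(G)$ (matroid union) for every graph $G$. If each of $\mathcal{M}_1,\ldots,\mathcal{M}_k$ has the Whitney property, then so does $\mathcal{M}$.
   Context: All graphs are finite and simple, with vertex sets taken from a fixed countably infinite set, and are assumed to have no isolated vertices. A graph matroid family $\mathcal{M}$ assigns to every graph $G$ a matroid $\mathcal{M}(G)$ on $E(G)$ such that (i) every graph isomorphism $\varphi:V(G)\to V(H)$ induces, via $uv\mapsto\varphi(u)\varphi(v)$, an isomorphism $\mathcal{M}(G)\to\mathcal{M}(H)$, and (ii) for every subgraph $H$ of $G$, $\mathcal{M}(H)$ is the restriction of $\mathcal{M}(G)$ to $E(H)$. The union of matroids $(E,\mathcal{I}_1),\ldots,(E,\mathcal{I}_k)$ on a common ground set is the matroid on $E$ whose independent sets are the sets $I_1\cup\cdots\cup I_k$ with $I_j\in\mathcal{I}_j$. A graph $G$ is $\mathcal{M}$-reconstructible if for every graph $H$ and every matroid isomorphism $\psi:E(G)\to E(H)$ between $\mathcal{M}(G)$ and $\mathcal{M}(H)$, there is a graph isomorphism $\varphi:V(G)\to V(H)$ with $\psi(uv)=\varphi(u)\varphi(v)$ for all $uv\in E(G)$. $\mathcal{M}$ has the Whitney property if there is a nonnegative integer $c$ such that every $c$-connected graph is $\mathcal{M}$-reconstructible. -}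

module Defs where

open import Data.Nat using (ℕ; suc; _<_; _≟_)
open import Data.Fin using (Fin)
open import Data.Fin.Properties using (any?)
open import Data.Fin.Subset as S using (Subset; ⊥; _⊆_; _∪_; ⁅_⁆; ∣_∣)
open import Data.Vec using (tabulate; lookup)
open import Data.List using (List; length)
import Data.List.Membership.Propositional as LM
open import Data.List.Relation.Unary.All using (All)
open import Data.List.Relation.Unary.Unique.Propositional using (Unique)
open import Data.Product using (Σ; ∃; _×_; _,_; proj₁)
open import Data.Sum using (_⊎_; inj₁; inj₂)
open import Relation.Binary.PropositionalEquality using (_≡_; refl)
open import Relation.Nullary using (Dec; ¬_)
open import Relation.Nullary.Decidable using (True; fromWitness; _⊎-dec_)
open import Function.Bundles using (_⤖_; _⇔_; Bijection)
open import Function.Definitions using (Injective)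

-- Graphs.  Vertices are natural numbers (the fixed countably infinite
-- vertex set).  An edge is an unordered pair {lo,hi} of distinct
-- vertices, stored with lo < hi.  A graph is a finite set of edges,
-- given as an injective enumeration Fin m → Edge; its edge set E(G)
-- is identified with Fin m.  Its vertex set is the set of endpoints of
-- edges (graphs have no isolated vertices).

record Edge : Set where
  constructor mkEdge
  field
    lo hi : ℕ
    lo<hi : lo < hi
open Edge public

record Graph : Set where
  field
    m        : ℕ
    edge     : Fin m → Edge
    edge-inj : Injective _≡_ _≡_ edge
open Graph public

joins : Edge → ℕ → ℕ → Set
joins e u v = (lo e ≡ u × hi e ≡ v) ⊎ (lo e ≡ v × hi e ≡ u)

Adj : Graph → ℕ → ℕ → Set
Adj G u v = ∃ λ i → joins (edge G i) u v

isVertex? : (G : Graph) (v : ℕ) → Dec (∃ λ i → v ≡ lo (edge G i) ⊎ v ≡ hi (edge G i))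
isVertex? G v = any? (λ i → (v ≟ lo (edge G i)) ⊎-dec (v ≟ hi (edge G i)))

-- v ∈ V(G)  (a proof-irrelevant predicate)
IsVertex : Graph → ℕ → Set
IsVertex G v = True (isVertex? G v)

V : Graph → Set
V G = Σ ℕ (IsVertex G)

loV : (G : Graph) → Fin (m G) → V G
loV G i = lo (edge G i) , fromWitness (i , inj₁ refl)

hiV : (G : Graph) → Fin (m G) → V G
hiV G i = hi (edge G i) , fromWitness (i , inj₂ refl)

GraphIso : Graph → Graph → Set
GraphIso G H = Σ (V G ⤖ V H) λ φ →
  ∀ (u v : V G) → Adj G (proj₁ u) (proj₁ v) ⇔
                  Adj H (proj₁ (Bijection.to φ u)) (proj₁ (Bijection.to φ v))

Induced : (G H : Graph) → GraphIso G H → (Fin (m G) → Fin (m H)) → Set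
Induced G H (φ , _) ψ = ∀ i →
  joins (edge H (ψ i)) (proj₁ (Bijection.to φ (loV G i)))
                       (proj₁ (Bijection.to φ (hiV G i)))

SubgraphEmb : (H G : Graph) → (Fin (m H) → Fin (m G)) → Set
SubgraphEmb H G ι = ∀ i → edge G (ι i) ≡ edge H i

IndepSystem : ℕ → Set₁
IndepSystem n = Subset n → Set

record IsMatroid {n : ℕ} (I : IndepSystem n) : Set where
  field
    indep-∅   : I ⊥
    indep-⊆   : ∀ X Y → X ⊆ Y → I Y → I X
    indep-aug : ∀ X Y → I X → I Y → ∣ X ∣ < ∣ Y ∣ →
                ∃ λ e → e S.∈ Y × e S.∉ X × I (X ∪ ⁅ e ⁆)

preimage : ∀ {n n'} → (Fin n → Fin n') → Subset n' → Subset n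
preimage ψ Y = tabulate (λ i → lookup Y (ψ i))

-- the bijection ψ : Fin n → Fin n' is a matroid isomorphism I → J:
-- X is I-independent iff ψ(X) is J-independent
-- (equivalently, for every Y, Y is J-independent iff ψ⁻¹(Y) is I-independent)
IsMatroidIso : ∀ {n n'} → IndepSystem n → IndepSystem n' → (Fin n → Fin n') → Set
IsMatroidIso I J ψ = ∀ Y → J Y ⇔ I (preimage ψ Y)

GraphIndep : Set₁
GraphIndep = (G : Graph) → IndepSystem (m G)

record GraphMatroidFamily : Set₁ where
  field
    Ind      : GraphIndep
    matroid  : ∀ G → IsMatroid (Ind G)
    iso-inv  : ∀ G H (φ : GraphIso G H) (ψ : Fin (m G) → Fin (m H)) →
               Induced G H φ ψ → IsMatroidIso (Ind G) (Ind H) ψ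
    restrict : ∀ H G (ι : Fin (m H) → Fin (m G)) → SubgraphEmb H G ι →
               ∀ (X : Subset (m H)) (Y : Subset (m G)) →
               (∀ j → j S.∈ Y ⇔ (∃ λ i → i S.∈ X × ι i ≡ j)) →
               Ind H X ⇔ Ind G Y
open GraphMatroidFamily public

UnionInd : ∀ {k} → (Fin k → GraphMatroidFamily) → GraphIndep
UnionInd {k} 𝓜 G X = Σ (Fin k → Subset (m G)) λ I →
  (∀ j → Ind (𝓜 j) G (I j)) × (∀ e → e S.∈ X ⇔ (∃ λ j → e S.∈ I j))

data Reach (G : Graph) (X : List ℕ) (u : ℕ) : ℕ → Set where
  here : Reach G X u u
  step : ∀ {w v} → Reach G X u w → Adj G w v → ¬ (v LM.∈ X) → Reach G X u v

ConnectedMinus : Graph → List ℕ → Set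
ConnectedMinus G X = ∀ u v → IsVertex G u → IsVertex G v →
  ¬ (u LM.∈ X) → ¬ (v LM.∈ X) → Reach G X u v

IsConnected : ℕ → Graph → Set
IsConnected c G =
  (∃ λ (L : List ℕ) → Unique L × length L ≡ suc c × All (IsVertex G) L) ×
  (∀ (X : List ℕ) → length X < c → ConnectedMinus G X)

Reconstructible : GraphIndep → Graph → Set
Reconstructible Ind G = ∀ (H : Graph) (ψ : Fin (m G) ⤖ Fin (m H)) →
  IsMatroidIso (Ind G) (Ind H) (Bijection.to ψ) →
  Σ (GraphIso G H) λ φ → Induced G H φ (Bijection.to ψ)

WhitneyProperty : GraphIndep → Set
WhitneyProperty Ind = ∃ λ (c : ℕ) → ∀ G → IsConnected c G → Reconstructible Ind G

module Submission where

-- Since the conclusion is decidable once the two graphs are given, one may argue classically. By matroid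
-- union, the rank of a set X of edges is the minimum of R(F) + |X ∖ F| over F ⊆ X, where R is the sum of the
-- rank functions of the families. The Whitney property of a family forces all sufficiently connected
-- graphs on n vertices to have the rank of K_n: otherwise two edges could be exchanged by an automorphism of
-- the matroid of a highly connected graph. It suffices to show that stars are mapped to stars.
--
-- If in some family a pendant edge always raises the rank, then counting edges, highly connected pieces of G
-- and H correspond to each other; they can be merged to a single piece on all vertices, both in G and in
-- every G - v, and this determines the stars. If no family is of this kind, then each of them has bounded
-- rank, with a bound depending only on c: a circuit of a highly connected graph of bounded degree without
-- short cycles is covered by few vertices whose stars it spans, and the rank of a union of stars is a concave
-- function of their number. In this case stars are the only large sets of small rank.

open import Defs using (IndepSystem; IsMatroid; module IsMatroid)
open import Data.Bool using (Bool; true; false; not; _∧_; _∨_; if_then_else_)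
import Data.Bool.Properties as Bool
open import Data.Empty using (⊥; ⊥-elim)
open import Data.Fin using (Fin; zero; suc; toℕ; fromℕ<; splitAt; _↑ˡ_; _↑ʳ_; remQuot; combine)
import Data.Fin.Properties as Fin
import Data.Fin.Subset as S
import Data.Fin.Subset.Properties as S
open import Data.List as List using (List; length; []; _∷_)
import Data.List.Membership.DecPropositional as LMD
import Data.List.Membership.Propositional as LM
import Data.List.Membership.Propositional.Properties as LM
import Data.List.Properties as List
open import Data.List.Relation.Unary.All as All using (All; []; _∷_)
import Data.List.Relation.Unary.All.Properties as All
import Data.List.Relation.Unary.AllPairs as AllPairs
open import Data.List.Relation.Unary.Any as Any using ()
import Data.List.Relation.Unary.Any.Properties as Any
open import Data.List.Relation.Unary.Unique.Propositional using (Unique)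
import Data.List.Relation.Unary.Unique.Propositional.Properties as Unique
open import Data.Nat
open import Data.Nat.Properties
open import Data.Nat.Tactic.RingSolver using (solve-∀)
open import Data.Product using (Σ; ∃; _×_; _,_; proj₁; proj₂)
open import Data.Sum using (_⊎_; inj₁; inj₂; [_,_]′)
open import Data.Vec using (tabulate; lookup)
open import Data.Vec.Properties using (lookup∘tabulate; lookup⇒[]=; []=⇒lookup; tabulate∘lookup; tabulate-cong)
open import Function using (_∘_; id; case_of_)
open import Function.Bundles using (_⤖_; _⇔_; mk⇔; mk⤖; Equivalence; Bijection)
open import Relation.Binary.Definitions using (tri<; tri≈; tri>)
open import Relation.Binary.PropositionalEquality using (_≡_; _≢_; refl; sym; trans; cong; cong₂; subst; subst₂)
open import Relation.Nullary using (Dec; yes; no; ¬_; contradiction; does)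
open import Relation.Nullary.Decidable using (decidable-stable; _×-dec_; _⊎-dec_; ¬?; map′; dec-true; toWitness; ¬¬-excluded-middle; toSum; fromWitness)

-- The double negation monad: the conclusion of the theorem is decidable, so all of the
-- matroid theory may be carried out classically.

Cl : ∀ {ℓ} → Set ℓ → Set ℓ
Cl A = ¬ ¬ A

ret : ∀ {ℓ} {A : Set ℓ} → A → Cl A
ret a k = k a

infixl 1 _>>=_
_>>=_ : ∀ {ℓ ℓ'} {A : Set ℓ} {B : Set ℓ'} → Cl A → (A → Cl B) → Cl B
(m >>= f) k = m λ a → f a k

em : (A : Set) → Cl (Dec A)
em A = ¬¬-excluded-middle

Cl-Fin : ∀ {ℓ n} {P : Fin n → Set ℓ} → (∀ i → Cl (P i)) → Cl (∀ i → P i)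
Cl-Fin {n = zero} h = ret λ ()
Cl-Fin {n = suc n} h = h zero >>= λ p → Cl-Fin (h ∘ suc) >>= λ q → ret λ { zero → p ; (suc i) → q i }

stable : {A : Set} → Dec A → Cl A → A
stable = decidable-stable

-- Linear arithmetic by certificate: a ≤ b follows from l ≤ r as soon as a + r + s ≡ b + l.
lin : ∀ {a b l r} s → l ≤ r → a + r + s ≡ b + l → a ≤ b
lin {a} {b} {l} {r} s h e =
  +-cancelʳ-≤ r a b (≤-trans (m≤m+n (a + r) s) (≤-trans (≤-reflexive e) (+-monoʳ-≤ b h)))

infixl 5 _⊕_
_⊕_ : ∀ {a b c d} → a ≤ b → c ≤ d → a + c ≤ b + d
_⊕_ = +-mono-≤

infixr 6 _⊛_
_⊛_ : ∀ {a b} k → a ≤ b → k * a ≤ k * b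
k ⊛ h = *-monoʳ-≤ k h

-- Sets with decidable membership

infix 4 _∈_ _∉_ _⊆_
infixr 6 _∪_
infixr 7 _∩_
infixl 7 _∖_

opaque
  _∈_ : {A : Set} → A → (A → Bool) → Set
  x ∈ X = X x ≡ true

  ∈⁺ : {A : Set} {X : A → Bool} {x : A} → X x ≡ true → x ∈ X
  ∈⁺ e = e

  ∈⁻ : {A : Set} {X : A → Bool} {x : A} → x ∈ X → X x ≡ true
  ∈⁻ e = e

  _∈?_ : {A : Set} (x : A) (X : A → Bool) → Dec (x ∈ X)
  x ∈? X = X x Bool.≟ true

_∉_ : {A : Set} → A → (A → Bool) → Set
x ∉ X = ¬ (x ∈ X)

_⊆_ : {A : Set} → (A → Bool) → (A → Bool) → Set
X ⊆ Y = ∀ {x} → x ∈ X → x ∈ Y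

opaque
  unfolding _∈_

  _∪_ _∩_ _∖_ : {A : Set} → (A → Bool) → (A → Bool) → A → Bool
  (X ∪ Y) x = X x ∨ Y x
  (X ∩ Y) x = X x ∧ Y x
  (X ∖ Y) x = X x ∧ not (Y x)

  ∅ : {A : Set} → A → Bool
  ∅ _ = false

  ∅⁻ : {A B : Set} {x : A} → x ∈ ∅ → B
  ∅⁻ ()

  ⟪_⟫ : {A : Set} {P : A → Set} → (∀ x → Dec (P x)) → A → Bool
  ⟪ d ⟫ x = does (d x)

  ∈⟪⟫ : {A : Set} {P : A → Set} (d : ∀ x → Dec (P x)) {x : A} → P x → x ∈ ⟪ d ⟫
  ∈⟪⟫ d {x} p = dec-true (d x) p

  ∈⟪⟫⁻ : {A : Set} {P : A → Set} (d : ∀ x → Dec (P x)) {x : A} → x ∈ ⟪ d ⟫ → P x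
  ∈⟪⟫⁻ d {x} e with d x
  ... | yes p = p

  ∪ˡ : {A : Set} {X Y : A → Bool} {x : A} → x ∈ X → x ∈ X ∪ Y
  ∪ˡ e rewrite e = refl

  ∪ʳ : {A : Set} {X Y : A → Bool} {x : A} → x ∈ Y → x ∈ X ∪ Y
  ∪ʳ {X = X} {Y} {x} e rewrite e = Bool.∨-zeroʳ (X x)

  ∪⁻ : {A : Set} {X Y : A → Bool} {x : A} → x ∈ X ∪ Y → x ∈ X ⊎ x ∈ Y
  ∪⁻ {X = X} {Y} {x} e with X x
  ... | true = inj₁ refl
  ... | false = inj₂ e

  ∩⁺ : {A : Set} {X Y : A → Bool} {x : A} → x ∈ X → x ∈ Y → x ∈ X ∩ Y
  ∩⁺ {X = X} {Y} {x} e f rewrite e = f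

  ∩ˡ : {A : Set} {X Y : A → Bool} {x : A} → x ∈ X ∩ Y → x ∈ X
  ∩ˡ {X = X} {Y} {x} e with X x
  ... | true = refl

  ∩ʳ : {A : Set} {X Y : A → Bool} {x : A} → x ∈ X ∩ Y → x ∈ Y
  ∩ʳ {X = X} {Y} {x} e with X x
  ... | true = e

  ∖⁺ : {A : Set} {X Y : A → Bool} {x : A} → x ∈ X → x ∉ Y → x ∈ X ∖ Y
  ∖⁺ {X = X} {Y} {x} e f with X x | Y x
  ... | true | true = ⊥-elim (f refl)
  ... | true | false = refl

  ∖ˡ : {A : Set} {X Y : A → Bool} {x : A} → x ∈ X ∖ Y → x ∈ X
  ∖ˡ {X = X} {Y} {x} e with X x
  ... | true = refl

  ∖ʳ : {A : Set} {X Y : A → Bool} {x : A} → x ∈ X ∖ Y → x ∉ Y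
  ∖ʳ {X = X} {Y} {x} e f with X x | Y x
  ∖ʳ {X = X} {Y} {x} () f | true | true
  ∖ʳ e () | true | false

∪-⊆ : {A : Set} {X Y Z : A → Bool} → X ⊆ Z → Y ⊆ Z → X ∪ Y ⊆ Z
∪-⊆ f g e = [ f , g ]′ (∪⁻ e)

∪-mono : {A : Set} {X Y X' Y' : A → Bool} → X ⊆ X' → Y ⊆ Y' → X ∪ Y ⊆ X' ∪ Y'
∪-mono f g e = [ ∪ˡ ∘ f , ∪ʳ ∘ g ]′ (∪⁻ e)

∖∪ : {A : Set} {X Y : A → Bool} → X ⊆ Y ∪ (X ∖ Y)
∖∪ {X = X} {Y} {x} e with x ∈? Y
... | yes p = ∪ˡ p
... | no p = ∪ʳ (∖⁺ e p)

-- Finite sums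

opaque
  Sum : ∀ {n} → (Fin n → ℕ) → ℕ
  Sum {zero} f = 0
  Sum {suc n} f = f zero + Sum (f ∘ suc)

  Sum-mono : ∀ {n} {f g : Fin n → ℕ} → (∀ i → f i ≤ g i) → Sum f ≤ Sum g
  Sum-mono {zero} h = z≤n
  Sum-mono {suc n} h = h zero ⊕ Sum-mono (h ∘ suc)

  Sum-cong : ∀ {n} {f g : Fin n → ℕ} → (∀ i → f i ≡ g i) → Sum f ≡ Sum g
  Sum-cong h = ≤-antisym (Sum-mono (≤-reflexive ∘ h)) (Sum-mono (≤-reflexive ∘ sym ∘ h))

  +-interchange : ∀ a b c d → a + b + (c + d) ≡ (a + c) + (b + d)
  +-interchange = solve-∀

  Sum-+ : ∀ {n} (f g : Fin n → ℕ) → Sum (λ i → f i + g i) ≡ Sum f + Sum g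
  Sum-+ {zero} f g = refl
  Sum-+ {suc n} f g rewrite Sum-+ (f ∘ suc) (g ∘ suc) =
    +-interchange (f zero) (g zero) (Sum (f ∘ suc)) (Sum (g ∘ suc))

  Sum-0 : ∀ {n} {f : Fin n → ℕ} → (∀ i → f i ≡ 0) → Sum f ≡ 0
  Sum-0 {zero} h = refl
  Sum-0 {suc n} h rewrite h zero = Sum-0 (h ∘ suc)

  Sum-swap : ∀ {n m} (f : Fin n → Fin m → ℕ) → Sum (λ i → Sum (f i)) ≡ Sum (λ j → Sum (λ i → f i j))
  Sum-swap {zero} {m} f = sym (Sum-0 {m} λ _ → refl)
  Sum-swap {suc n} f rewrite Sum-swap (f ∘ suc) = sym (Sum-+ (f zero) _)

  Sum-*ˡ : ∀ {n} k (f : Fin n → ℕ) → Sum (λ i → k * f i) ≡ k * Sum f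
  Sum-*ˡ {zero} k f = sym (*-zeroʳ k)
  Sum-*ˡ {suc n} k f rewrite Sum-*ˡ k (f ∘ suc) = sym (*-distribˡ-+ k (f zero) _)

  Sum-const : ∀ {n} k → Sum {n} (λ _ → k) ≡ n * k
  Sum-const {zero} k = refl
  Sum-const {suc n} k = cong (k +_) (Sum-const {n} k)

  term≤Sum : ∀ {n} (f : Fin n → ℕ) i → f i ≤ Sum f
  term≤Sum f zero = m≤m+n _ _
  term≤Sum f (suc i) = ≤-trans (term≤Sum (f ∘ suc) i) (m≤n+m _ (f zero))

  Sum-strict : ∀ {n} {f g : Fin n → ℕ} → (∀ i → f i ≤ g i) → ∀ i → f i < g i → Sum f < Sum g
  Sum-strict h zero l = +-mono-≤ l (Sum-mono (h ∘ suc))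
  Sum-strict {suc n} {f} {g} h (suc i) l =
    ≤-trans (≤-reflexive (sym (+-suc (f zero) (Sum (f ∘ suc))))) (+-mono-≤ (h zero) (Sum-strict (h ∘ suc) i l))

  Sum-pos : ∀ {n} (f : Fin n → ℕ) → 0 < Sum f → ∃ λ i → 0 < f i
  Sum-pos {suc n} f l with f zero in e
  ... | suc x = zero , subst (0 <_) (sym e) (s≤s z≤n)
  ... | zero with Sum-pos (f ∘ suc) l
  ...   | i , p = suc i , p

  Sum-suc : ∀ {n} (f : Fin (suc n) → ℕ) → Sum f ≡ f zero + Sum (f ∘ suc)
  Sum-suc f = refl

-- Cardinality and weight

⟦_⟧ : Bool → ℕ
⟦ true ⟧ = 1
⟦ false ⟧ = 0

⟦⟧≤1 : ∀ b → ⟦ b ⟧ ≤ 1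
⟦⟧≤1 true = ≤-refl
⟦⟧≤1 false = z≤n

⟦⟧-mono : ∀ {a b} → (a ≡ true → b ≡ true) → ⟦ a ⟧ ≤ ⟦ b ⟧
⟦⟧-mono {false} h = z≤n
⟦⟧-mono {true} h rewrite h refl = ≤-refl

⟦⟧-∈ : ∀ {a} → a ≡ true → ⟦ a ⟧ ≡ 1
⟦⟧-∈ refl = refl

⟦⟧-∉ : ∀ {a} → ¬ (a ≡ true) → ⟦ a ⟧ ≡ 0
⟦⟧-∉ {true} h = ⊥-elim (h refl)
⟦⟧-∉ {false} h = refl

⟦⟧-pos : ∀ {a} → 0 < ⟦ a ⟧ → a ≡ true
⟦⟧-pos {true} h = refl

0<*⁻ : ∀ {a b} → 0 < a * b → 0 < a × 0 < b
0<*⁻ {suc a} {suc b} h = s≤s z≤n , s≤s z≤n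
0<*⁻ {suc a} {zero} h rewrite *-zeroʳ a = ⊥-elim (n≮0 h)

opaque
  # : ∀ {n} → (Fin n → Bool) → ℕ
  # X = Sum (λ i → ⟦ X i ⟧)

  wt : ∀ {n} → (Fin n → ℕ) → (Fin n → Bool) → ℕ
  wt w X = Sum (λ i → ⟦ X i ⟧ * w i)

  #-Sum : ∀ {n} (X : Fin n → Bool) → # X ≡ Sum (λ i → ⟦ X i ⟧)
  #-Sum X = refl

  wt-Sum : ∀ {n} (w : Fin n → ℕ) (X : Fin n → Bool) → wt w X ≡ Sum (λ i → ⟦ X i ⟧ * w i)
  wt-Sum w X = refl

  #-mono : ∀ {n} {X Y : Fin n → Bool} → X ⊆ Y → # X ≤ # Y
  #-mono h = Sum-mono λ i → ⟦⟧-mono λ e → ∈⁻ (h {i} (∈⁺ e))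

  wt-mono : ∀ {n} (w : Fin n → ℕ) {X Y : Fin n → Bool} → X ⊆ Y → wt w X ≤ wt w Y
  wt-mono w h = Sum-mono λ i → *-monoˡ-≤ (w i) (⟦⟧-mono λ e → ∈⁻ (h {i} (∈⁺ e)))

  #≡wt : ∀ {n} (X : Fin n → Bool) → # X ≡ wt (λ _ → 1) X
  #≡wt X = Sum-cong λ i → sym (*-identityʳ _)

  #-strict : ∀ {n} {X Y : Fin n → Bool} → X ⊆ Y → ∀ {y} → y ∈ Y → y ∉ X → # X < # Y
  #-strict {X = X} {Y} h {y} y∈ y∉ = Sum-strict {f = λ i → ⟦ X i ⟧} (λ i → ⟦⟧-mono λ e → ∈⁻ (h {i} (∈⁺ e))) y
    (subst₂ _<_ (sym (⟦⟧-∉ (y∉ ∘ ∈⁺))) (sym (⟦⟧-∈ (∈⁻ y∈))) (s≤s z≤n))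

  #-pos : ∀ {n} {X : Fin n → Bool} → 0 < # X → ∃ λ x → x ∈ X
  #-pos {X = X} l with Sum-pos (λ i → ⟦ X i ⟧) l
  ... | i , p = i , ∈⁺ (⟦⟧-pos p)

  wt-pos : ∀ {n} (w : Fin n → ℕ) {X : Fin n → Bool} → 0 < wt w X → ∃ λ x → x ∈ X × 0 < w x
  wt-pos w {X} l with Sum-pos (λ i → ⟦ X i ⟧ * w i) l
  ... | i , p = i , ∈⁺ (⟦⟧-pos (proj₁ (0<*⁻ p))) , proj₂ (0<*⁻ {⟦ X i ⟧} p)

  wt-≥ : ∀ {n} (w : Fin n → ℕ) {X : Fin n → Bool} {i : Fin n} → i ∈ X → w i ≤ wt w X
  wt-≥ w {X} {i} i∈ = ≤-trans (≤-reflexive (sym (trans (cong (_* w i) (⟦⟧-∈ (∈⁻ i∈))) (+-identityʳ _))))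
    (term≤Sum (λ i → ⟦ X i ⟧ * w i) i)

opaque
  unfolding _∪_ #

  #≤n : ∀ {n} (X : Fin n → Bool) → # X ≤ n
  #≤n {n} X = ≤-trans (Sum-mono λ i → ⟦⟧≤1 (X i)) (≤-reflexive (trans (Sum-const {n} 1) (*-identityʳ n)))

  #-∅ : ∀ {n} → # {n} ∅ ≡ 0
  #-∅ = Sum-0 λ _ → refl

  #-∩∪ : ∀ {n} (X Y : Fin n → Bool) → # (X ∪ Y) + # (X ∩ Y) ≡ # X + # Y
  #-∩∪ X Y = trans (sym (Sum-+ _ _)) (trans (Sum-cong λ i → pt (X i) (Y i)) (Sum-+ _ _))
    where
    pt : ∀ a b → ⟦ a ∨ b ⟧ + ⟦ a ∧ b ⟧ ≡ ⟦ a ⟧ + ⟦ b ⟧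
    pt true true = refl
    pt true false = refl
    pt false true = refl
    pt false false = refl

  wt-∖ : ∀ {n} (w : Fin n → ℕ) (X Y : Fin n → Bool) → wt w X ≡ wt w (X ∩ Y) + wt w (X ∖ Y)
  wt-∖ w X Y = trans (Sum-cong λ i → pt (X i) (Y i) (w i)) (Sum-+ _ _)
    where
    pt : ∀ a b c → ⟦ a ⟧ * c ≡ ⟦ a ∧ b ⟧ * c + ⟦ a ∧ not b ⟧ * c
    pt true true c = sym (+-identityʳ _)
    pt true false c = refl
    pt false b c = refl

#-∖ : ∀ {n} (X Y : Fin n → Bool) → # X ≡ # (X ∩ Y) + # (X ∖ Y)
#-∖ X Y = trans (#≡wt X) (trans (wt-∖ _ X Y) (sym (cong₂ _+_ (#≡wt _) (#≡wt _))))

#-∪≤ : ∀ {n} (X Y : Fin n → Bool) → # (X ∪ Y) ≤ # X + # Y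
#-∪≤ X Y = ≤-trans (m≤m+n _ _) (≤-reflexive (#-∩∪ X Y))

∈⇒#-pos : ∀ {n} {X : Fin n → Bool} {x : Fin n} → x ∈ X → 0 < # X
∈⇒#-pos {X = X} x∈ = ≤-trans (wt-≥ (λ _ → 1) x∈) (≤-reflexive (sym (#≡wt X)))

⊆-or-∃ : ∀ {n} (X Y : Fin n → Bool) → (X ⊆ Y) ⊎ ∃ λ x → x ∈ X × x ∉ Y
⊆-or-∃ X Y with Fin.any? (λ y → (y ∈? X) ×-dec ¬? (y ∈? Y))
... | yes p = inj₂ p
... | no ¬p = inj₁ λ {x} x∈ → stable (x ∈? Y) λ x∉ → ¬p (x , x∈ , x∉)

#<⇒∃ : ∀ {n} (X Y : Fin n → Bool) → # X < # Y → ∃ λ y → y ∈ Y × y ∉ X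
#<⇒∃ X Y l with ⊆-or-∃ Y X
... | inj₁ h = ⊥-elim (<⇒≱ l (#-mono h))
... | inj₂ p = p

⊆-#-⊇ : ∀ {n} {X Y : Fin n → Bool} → X ⊆ Y → # Y ≤ # X → Y ⊆ X
⊆-#-⊇ {X = X} {Y} h l {y} y∈ = stable (y ∈? X) λ y∉ → <⇒≱ (#-strict h y∈ y∉) l

wt-⊆ : ∀ {n} (w : Fin n → ℕ) {X Y : Fin n → Bool} → X ⊆ Y → wt w Y ≡ wt w X + wt w (Y ∖ X)
wt-⊆ w {X} {Y} h = trans (wt-∖ w Y X) (cong (_+ wt w (Y ∖ X))
  (≤-antisym (wt-mono w ∩ʳ) (wt-mono w λ e → ∩⁺ (h e) e)))

#-⊆ : ∀ {n} {X Y : Fin n → Bool} → X ⊆ Y → # Y ≡ # X + # (Y ∖ X)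
#-⊆ {X = X} {Y} h = trans (#≡wt Y) (trans (wt-⊆ _ h) (sym (cong₂ _+_ (#≡wt _) (#≡wt _))))

opaque
  unfolding #

  ⁅_⁆ : ∀ {n} → Fin n → Fin n → Bool
  ⁅ x ⁆ = ⟪ x Fin.≟_ ⟫

  ∈⁅⁆ : ∀ {n} (x : Fin n) → x ∈ ⁅ x ⁆
  ∈⁅⁆ x = ∈⟪⟫ (x Fin.≟_) refl

  ∈⁅⁆⁻ : ∀ {n} {x y : Fin n} → y ∈ ⁅ x ⁆ → x ≡ y
  ∈⁅⁆⁻ {x = x} {y} = ∈⟪⟫⁻ (x Fin.≟_)

opaque
  unfolding # ⁅_⁆ ⟪_⟫ Sum

  Sum-⁅⁆ : ∀ {n} (f : Fin n → ℕ) x → Sum (λ i → ⟦ ⁅ x ⁆ i ⟧ * f i) ≡ f x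
  Sum-⁅⁆ {suc n} f zero = trans (cong (f zero + 0 +_) (Sum-0 {n} λ _ → refl)) (trans (+-identityʳ _) (+-identityʳ _))
  Sum-⁅⁆ {suc n} f (suc x) = trans (Sum-cong {n} pt) (Sum-⁅⁆ (f ∘ suc) x)
    where
    pt : ∀ i → ⟦ ⁅ suc x ⁆ (suc i) ⟧ * f (suc i) ≡ ⟦ ⁅ x ⁆ i ⟧ * f (suc i)
    pt i with x Fin.≟ i
    ... | yes refl = refl
    ... | no _ = refl

  #-⁅⁆ : ∀ {n} (x : Fin n) → # ⁅ x ⁆ ≡ 1
  #-⁅⁆ x = trans (#≡wt ⁅ x ⁆) (Sum-⁅⁆ (λ _ → 1) x)

#-add≤ : ∀ {n} (X : Fin n → Bool) (x : Fin n) → # (X ∪ ⁅ x ⁆) ≤ suc (# X)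
#-add≤ X x = ≤-trans (#-∪≤ X ⁅ x ⁆) (≤-reflexive (trans (cong (# X +_) (#-⁅⁆ x)) (+-comm _ 1)))

#-add : ∀ {n} (X : Fin n → Bool) {x : Fin n} → x ∉ X → # (X ∪ ⁅ x ⁆) ≡ suc (# X)
#-add X {x} x∉ = ≤-antisym (#-add≤ X x) (#-strict ∪ˡ (∪ʳ (∈⁅⁆ x)) x∉)

⁅⁆-⊆ : ∀ {n} {X : Fin n → Bool} {x : Fin n} → x ∈ X → ⁅ x ⁆ ⊆ X
⁅⁆-⊆ {X = X} x∈ p = subst (_∈ X) (∈⁅⁆⁻ p) x∈

#-del : ∀ {n} (X : Fin n → Bool) {x : Fin n} → x ∈ X → # X ≡ suc (# (X ∖ ⁅ x ⁆))
#-del X {x} x∈ = trans (#-⊆ (⁅⁆-⊆ x∈)) (cong (_+ # (X ∖ ⁅ x ⁆)) (#-⁅⁆ x))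

#≤1 : ∀ {n} (X : Fin n → Bool) → (∀ {i j} → i ∈ X → j ∈ X → i ≡ j) → # X ≤ 1
#≤1 X h with Fin.any? (_∈? X)
... | yes (x , x∈) = ≤-trans (#-mono {Y = ⁅ x ⁆} λ i∈ → subst (_∈ ⁅ x ⁆) (h x∈ i∈) (∈⁅⁆ x)) (≤-reflexive (#-⁅⁆ x))
... | no ¬p = ≤-trans (≮⇒≥ λ l → ¬p (#-pos l)) z≤n

opaque
  unfolding # _∪_

  #-inj : ∀ {n m} (f : Fin n → Fin m) {X : Fin n → Bool} {S : Fin m → Bool} →
    (∀ {i} → i ∈ X → f i ∈ S) → (∀ {i j} → i ∈ X → j ∈ X → f i ≡ f j → i ≡ j) → # X ≤ # S
  #-inj {n} {m} f {X} {S} into inj = ≤-trans (≤-reflexive (trans (Sum-cong λ i → sym (expand i)) (Sum-swap _)))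
    (Sum-mono fiber)
    where
    F : Fin n → Fin m → Bool
    F i u = X i ∧ ⁅ f i ⁆ u
    Fˡ : ∀ {i u} → F i u ≡ true → i ∈ X
    Fˡ {i} {u} p = ∩ˡ {X = X} {λ i → ⁅ f i ⁆ u} {i} p
    Fʳ : ∀ {i u} → F i u ≡ true → f i ≡ u
    Fʳ {i} {u} p = ∈⁅⁆⁻ {x = f i} {u} (∩ʳ {X = X} {λ i → ⁅ f i ⁆ u} {i} p)
    expand : ∀ i → Sum (λ u → ⟦ F i u ⟧) ≡ ⟦ X i ⟧
    expand i with X i
    ... | true = #-⁅⁆ (f i)
    ... | false = Sum-0 λ _ → refl
    fiber : ∀ u → Sum (λ i → ⟦ F i u ⟧) ≤ ⟦ S u ⟧
    fiber u with u ∈? S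
    ... | yes e = ≤-trans (#≤1 (λ i → F i u) λ {i} {j} p q →
            inj (Fˡ {i} {u} p) (Fˡ {j} {u} q) (trans (Fʳ {i} p) (sym (Fʳ {j} q))))
            (≤-reflexive (sym (⟦⟧-∈ e)))
    ... | no ¬e = ≤-trans (≤-reflexive (Sum-0 λ i → ⟦⟧-∉ λ p → ¬e (subst (_∈ S) (Fʳ {i} p) (into (Fˡ {i} {u} p))))) z≤n

  enumerate : ∀ {n} (X : Fin n → Bool) → Σ (Fin (# X) → Fin n) λ f →
    (∀ i → f i ∈ X) × (∀ {i j} → f i ≡ f j → i ≡ j) × (∀ {x} → x ∈ X → ∃ λ i → f i ≡ x)
  enumerate {zero} X = no∈ , (λ i → ⊥-elim (empty i)) , (λ {i} → ⊥-elim (empty i)) , λ { {()} }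
    where
    empty : Fin (# X) → ⊥
    empty i = case subst Fin (Sum-0 {0} {λ i → ⟦ X i ⟧} λ ()) i of λ ()
    no∈ : Fin (# X) → Fin zero
    no∈ i = ⊥-elim (empty i)
  enumerate {suc n} X = subst Good (sym (Sum-suc (λ i → ⟦ X i ⟧))) (go (X zero) refl (enumerate (X ∘ suc)))
    where
    Good : ℕ → Set
    Good k = Σ (Fin k → Fin (suc n)) λ f →
      (∀ i → f i ∈ X) × (∀ {i j} → f i ≡ f j → i ≡ j) × (∀ {x} → x ∈ X → ∃ λ i → f i ≡ x)
    go : ∀ b → X zero ≡ b → (Σ (Fin (# (X ∘ suc)) → Fin n) λ f →
      (∀ i → f i ∈ X ∘ suc) × (∀ {i j} → f i ≡ f j → i ≡ j) × (∀ {x} → x ∈ X ∘ suc → ∃ λ i → f i ≡ x)) →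
      Good (⟦ b ⟧ + # (X ∘ suc))
    go true e (f , f∈ , inj , onto) = g , g∈ , ginj , gonto
      where
      g : Fin (suc (# (X ∘ suc))) → Fin (suc n)
      g zero = zero
      g (suc i) = suc (f i)
      g∈ : ∀ i → g i ∈ X
      g∈ zero = e
      g∈ (suc i) = f∈ i
      ginj : ∀ {i j} → g i ≡ g j → i ≡ j
      ginj {zero} {zero} p = refl
      ginj {suc i} {suc j} p = cong suc (inj (Fin.suc-injective p))
      gonto : ∀ {x} → x ∈ X → ∃ λ i → g i ≡ x
      gonto {zero} p = zero , refl
      gonto {suc x} p with onto (p)
      ... | i , q = suc i , cong suc q
    go false e (f , f∈ , inj , onto) = suc ∘ f , (λ i → f∈ i) , (inj ∘ Fin.suc-injective) , gonto
      where
      gonto : ∀ {x} → x ∈ X → ∃ λ i → suc (f i) ≡ x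
      gonto {zero} p = contradiction (trans (sym e) p) λ ()
      gonto {suc x} p with onto (p)
      ... | i , q = i , cong suc q

subset-of-size : ∀ {n} (X : Fin n → Bool) t → t ≤ # X → Σ (Fin n → Bool) λ Y → Y ⊆ X × # Y ≡ t
subset-of-size X zero h = ∅ , ∅⁻ , #-∅
subset-of-size X (suc t) h with subset-of-size X t (≤-trans (n≤1+n t) h)
... | Y , Y⊆ , e with #<⇒∃ Y X (subst (_< # X) (sym e) h)
... | y , y∈ , y∉ = Y ∪ ⁅ y ⁆ , ∪-⊆ Y⊆ (⁅⁆-⊆ y∈) , trans (#-add Y y∉) (cong suc e)

-- Search over all subsets of a finite set

Respects : ∀ {n} → ((Fin n → Bool) → Set) → Set
Respects {n} P = ∀ {X Y : Fin n → Bool} → (∀ i → X i ≡ Y i) → P X → P Y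

cons : ∀ {n} → Bool → (Fin n → Bool) → Fin (suc n) → Bool
cons b X zero = b
cons b X (suc i) = X i

anySet? : ∀ {n} {P : (Fin n → Bool) → Set} → Respects P → (∀ X → Dec (P X)) → Dec (∃ P)
anySet? {zero} resp d with d ∅
... | yes p = yes (∅ , p)
... | no ¬p = no λ { (X , p) → ¬p (resp (λ ()) p) }
anySet? {suc n} {P} resp d with anySet? (λ {X} {Y} e → resp {cons true X} {cons true Y} λ { zero → refl ; (suc i) → e i }) (d ∘ cons true)
                        | anySet? (λ {X} {Y} e → resp {cons false X} {cons false Y} λ { zero → refl ; (suc i) → e i }) (d ∘ cons false)
... | yes (X , p) | _ = yes (_ , p)
... | no _ | yes (X , p) = yes (_ , p)
... | no ¬p | no ¬q = no λ { (X , p) → split (X zero) refl X p }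
  where
  split : ∀ b → b ≡ b → ∀ X → P X → ⊥
  split _ _ X p with X zero in e
  ... | true = ¬p (X ∘ suc , resp (λ { zero → e ; (suc i) → refl }) p)
  ... | false = ¬q (X ∘ suc , resp (λ { zero → e ; (suc i) → refl }) p)

-- An increasing iteration over the elements of a finite set

iterate∪ : ∀ {n} {A : Set} (P : (A → Bool) → Set) (Q : Fin n → (A → Bool) → Set) →
  (∀ {i X Y} → X ⊆ Y → Q i X → Q i Y) → ∀ X → P X →
  (∀ i Y → X ⊆ Y → P Y → Σ (A → Bool) λ Z → Y ⊆ Z × P Z × Q i Z) →
  Σ (A → Bool) λ Z → X ⊆ Z × P Z × ∀ i → Q i Z
iterate∪ {zero} P Q mono X p step = X , id , p , λ ()
iterate∪ {suc n} P Q mono X p step with step zero X id p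
... | Y , X⊆Y , pY , q with iterate∪ P (Q ∘ suc) mono Y pY (λ i Z Y⊆Z → step (suc i) Z (Y⊆Z ∘ X⊆Y))
... | Z , Y⊆Z , pZ , qs = Z , (λ e → Y⊆Z (X⊆Y e)) , pZ , λ { zero → mono Y⊆Z q ; (suc i) → qs i }

tab∈ : ∀ {n} {X : Fin n → Bool} {x} → x ∈ X → x S.∈ tabulate X
tab∈ {X = X} {x} e = lookup⇒[]= x _ (trans (lookup∘tabulate X x) (∈⁻ e))

tab∈⁻ : ∀ {n} {X : Fin n → Bool} {x} → x S.∈ tabulate X → x ∈ X
tab∈⁻ {X = X} {x} e = ∈⁺ (trans (sym (lookup∘tabulate X x)) ([]=⇒lookup e))

tab⊆ : ∀ {n} {X Y : Fin n → Bool} → X ⊆ Y → tabulate X S.⊆ tabulate Y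
tab⊆ h e = tab∈ (h (tab∈⁻ e))

∣tabulate∣ : ∀ {n} (X : Fin n → Bool) → S.∣ tabulate X ∣ ≡ # X
∣tabulate∣ {n} X = trans (go n X) (sym (#-Sum X))
  where
  go : ∀ n (X : Fin n → Bool) → S.∣ tabulate X ∣ ≡ Sum (λ i → ⟦ X i ⟧)
  go zero X = sym (Sum-0 λ ())
  go (suc n) X with X zero in e
  ... | true = trans (cong suc (go n (X ∘ suc))) (sym (trans (Sum-suc (λ i → ⟦ X i ⟧)) (cong (λ b → ⟦ b ⟧ + Sum (λ i → ⟦ X (suc i) ⟧)) e)))
  ... | false = trans (go n (X ∘ suc)) (sym (trans (Sum-suc (λ i → ⟦ X i ⟧)) (cong (λ b → ⟦ b ⟧ + Sum (λ i → ⟦ X (suc i) ⟧)) e)))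

-- Submodularity is stated with arbitrary W, I in place of X ∪ Y and X ∩ Y.
record Submodular {n} (r : (Fin n → Bool) → ℕ) : Set where
  field
    mono : ∀ {X Y} → X ⊆ Y → r X ≤ r Y
    submod : ∀ {W I X Y} → I ⊆ X → I ⊆ Y → W ⊆ X ∪ Y → r W + r I ≤ r X + r Y

  ext : ∀ {X Y} → (∀ i → X i ≡ Y i) → r X ≡ r Y
  ext e = ≤-antisym (mono λ {i} p → ∈⁺ (trans (sym (e i)) (∈⁻ p))) (mono λ {i} p → ∈⁺ (trans (e i) (∈⁻ p)))

  diminishing : ∀ {A B Z} → A ⊆ B → r (B ∪ Z) + r A ≤ r B + r (A ∪ Z)
  diminishing h = submod h ∪ˡ (∪-⊆ ∪ˡ (∪ʳ ∘ ∪ʳ))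

  -- the span of a set contains the union of sets that it contains one by one
  ∪-absorb : ∀ {S : Fin n → Bool} {X} → (∀ {e} → e ∈ S → r (X ∪ ⁅ e ⁆) ≤ r X) → r (X ∪ S) ≤ r X
  ∪-absorb {S} {X} h = ≤-trans (mono ⊆Z) rZ
    where
    add : ∀ i Y → X ⊆ Y → r Y ≤ r X → Σ (Fin n → Bool) λ Z → Y ⊆ Z × r Z ≤ r X × (i ∈ S → i ∈ Z)
    add i Y X⊆Y rY with i ∈? S
    ... | yes i∈ = Y ∪ ⁅ i ⁆ , ∪ˡ ,
            +-cancelʳ-≤ (r X) _ _ (≤-trans (diminishing {X} {Y} {⁅ i ⁆} X⊆Y) (+-mono-≤ rY (h i∈))) , λ _ → ∪ʳ (∈⁅⁆ i)
    ... | no i∉ = Y , id , rY , λ i∈ → ⊥-elim (i∉ i∈)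
    result = iterate∪ (λ Z → r Z ≤ r X) (λ i Z → i ∈ S → i ∈ Z) (λ sub q i∈ → sub (q i∈)) X ≤-refl add
    ⊆Z : X ∪ S ⊆ proj₁ result
    ⊆Z = ∪-⊆ (proj₁ (proj₂ result)) λ {i} i∈ → proj₂ (proj₂ (proj₂ result)) i i∈
    rZ = proj₁ (proj₂ (proj₂ result))

record RankFn (n : ℕ) : Set where
  field
    rk : (Fin n → Bool) → ℕ
    isSubmodular : Submodular rk
    rk≤# : ∀ X → rk X ≤ # X
  open Submodular isSubmodular public

  rk-∅ : rk ∅ ≡ 0
  rk-∅ = n≤0⇒n≡0 (≤-trans (rk≤# ∅) (≤-reflexive #-∅))

  rk-add : ∀ X e → rk (X ∪ ⁅ e ⁆) ≤ suc (rk X)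
  rk-add X e = ≤-trans (m≤m+n _ (rk ∅)) (≤-trans (submod {I = ∅} ∅⁻ ∅⁻ id)
    (≤-trans (+-monoʳ-≤ (rk X) (≤-trans (rk≤# ⁅ e ⁆) (≤-reflexive (#-⁅⁆ e)))) (≤-reflexive (+-comm _ 1))))

  Indep : (Fin n → Bool) → Set
  Indep X = # X ≤ rk X

  indep-⊆' : ∀ {X Y} → X ⊆ Y → Indep Y → Indep X
  indep-⊆' {X} {Y} h i = +-cancelʳ-≤ (# (Y ∖ X)) (# X) (rk X) (begin
    # X + # (Y ∖ X)       ≡⟨ #-⊆ h ⟨
    # Y                   ≤⟨ i ⟩
    rk Y                  ≤⟨ m≤m+n _ _ ⟩
    rk Y + rk ∅           ≤⟨ submod ∅⁻ ∅⁻ ∖∪ ⟩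
    rk X + rk (Y ∖ X)     ≤⟨ +-monoʳ-≤ (rk X) (rk≤# (Y ∖ X)) ⟩
    rk X + # (Y ∖ X)      ∎)
    where
      open ≤-Reasoning

module MatroidRank {n} {I : IndepSystem n} (M : IsMatroid I) (dec : ∀ X → Dec (I X)) where
  open IsMatroid M

  In : (Fin n → Bool) → Set
  In X = I (tabulate X)

  In-⊆ : ∀ {X Y} → X ⊆ Y → In Y → In X
  In-⊆ h = indep-⊆ _ _ (tab⊆ h)

  In-aug : ∀ {X Y} → In X → In Y → # X < # Y → ∃ λ e → e ∈ Y × e ∉ X × In (X ∪ ⁅ e ⁆)
  In-aug {X} {Y} x y l with indep-aug _ _ x y (subst₂ _<_ (sym (∣tabulate∣ X)) (sym (∣tabulate∣ Y)) l)
  ... | e , e∈ , e∉ , i = e , tab∈⁻ e∈ , e∉ ∘ tab∈ , indep-⊆ _ _ sub i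
    where
    sub : tabulate (X ∪ ⁅ e ⁆) S.⊆ tabulate X S.∪ S.⁅ e ⁆
    sub p with ∪⁻ (tab∈⁻ p)
    ... | inj₁ q = S.x∈p∪q⁺ (inj₁ (tab∈ q))
    ... | inj₂ q = S.x∈p∪q⁺ (inj₂ (subst (S._∈ S.⁅ e ⁆) (∈⁅⁆⁻ q) (S.x∈⁅x⁆ e)))

  In-∅ : In ∅
  In-∅ = indep-⊆ _ _ (λ p → ∅⁻ (tab∈⁻ p)) indep-∅

  Basis : (B X J : Fin n → Bool) → Set
  Basis B X J = B ⊆ J × J ⊆ X × In J × (∀ {B'} → B' ⊆ X → In B' → # B' ≤ # J)

  extend : ∀ {X} B → In B → B ⊆ X → ∃ (Basis B X)
  extend {X} B i h = go n B i h (≤-trans (m≤m+n n (# B)) ≤-refl)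
    where
    go : ∀ fuel B → In B → B ⊆ X → n ≤ fuel + # B → ∃ (Basis B X)
    go fuel B i h l with Fin.any? (λ e → (e ∈? X) ×-dec (¬? (e ∈? B) ×-dec dec (tabulate (B ∪ ⁅ e ⁆))))
    ... | no ¬p = B , id , h , i , λ {B'} h' i' → ≮⇒≥ λ l →
            let e , e∈ , e∉ , j = In-aug i i' l in ¬p (e , h' e∈ , e∉ , j)
    go zero B i h l | yes (e , e∈ , e∉ , j) =
      ⊥-elim (<⇒≱ (≤-trans (s≤s l) (≤-reflexive (sym (#-add B e∉)))) (#≤n (B ∪ ⁅ e ⁆)))
    go (suc fuel) B i h l | yes (e , e∈ , e∉ , j)
      with go fuel (B ∪ ⁅ e ⁆) j (∪-⊆ h (⁅⁆-⊆ e∈))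
             (≤-trans l (≤-reflexive (trans (sym (+-suc fuel (# B))) (cong (fuel +_) (sym (#-add B e∉))))))
    ... | J , b , c = J , b ∘ ∪ˡ , c

  rank : (Fin n → Bool) → ℕ
  rank X = # (proj₁ (extend {X} ∅ In-∅ ∅⁻))

  module _ (X : Fin n → Bool) where
    base : Fin n → Bool
    base = proj₁ (extend {X} ∅ In-∅ ∅⁻)
    base-⊆ : base ⊆ X
    base-⊆ = proj₁ (proj₂ (proj₂ (extend {X} ∅ In-∅ ∅⁻)))
    base-In : In base
    base-In = proj₁ (proj₂ (proj₂ (proj₂ (extend {X} ∅ In-∅ ∅⁻))))
    ≤rank : ∀ {B} → B ⊆ X → In B → # B ≤ rank X
    ≤rank = proj₂ (proj₂ (proj₂ (proj₂ (extend {X} ∅ In-∅ ∅⁻))))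

  In⇒rank : ∀ {X} → In X → # X ≤ rank X
  In⇒rank {X} = ≤rank X id

  rank⇒In : ∀ {X} → # X ≤ rank X → In X
  rank⇒In {X} l = In-⊆ (⊆-#-⊇ (base-⊆ X) l) (base-In X)

  rank-submod : ∀ {W K X Y} → K ⊆ X → K ⊆ Y → W ⊆ X ∪ Y → rank W + rank K ≤ rank X + rank Y
  rank-submod {W} {K} {X} {Y} kx ky w with extend {X ∪ Y} (base K) (base-In K) (∪ˡ ∘ kx ∘ base-⊆ K)
  ... | J , K⊆J , J⊆ , inJ , max = begin
    rank W + rank K                     ≤⟨ max (w ∘ base-⊆ W) (base-In W) ⊕ ≤-refl ⟩
    # J + # (base K)                    ≤⟨ #-mono {Y = (J ∩ X) ∪ (J ∩ Y)} (λ j → [ ∪ˡ ∘ ∩⁺ j , ∪ʳ ∘ ∩⁺ j ]′ (∪⁻ (J⊆ j))) ⊕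
                                           #-mono {Y = (J ∩ X) ∩ (J ∩ Y)} (λ b → ∩⁺ (∩⁺ (K⊆J b) (kx (base-⊆ K b))) (∩⁺ (K⊆J b) (ky (base-⊆ K b)))) ⟩
    # ((J ∩ X) ∪ (J ∩ Y)) + # ((J ∩ X) ∩ (J ∩ Y)) ≡⟨ #-∩∪ (J ∩ X) (J ∩ Y) ⟩
    # (J ∩ X) + # (J ∩ Y)               ≤⟨ ≤rank X ∩ʳ (In-⊆ ∩ˡ inJ) ⊕ ≤rank Y ∩ʳ (In-⊆ ∩ˡ inJ) ⟩
    rank X + rank Y ∎
    where
      open ≤-Reasoning

  rankFn : RankFn n
  rankFn = record
    { rk = rank
    ; isSubmodular = record
      { mono = λ {X} {Y} h → ≤rank Y (h ∘ base-⊆ X) (base-In X)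
      ; submod = rank-submod }
    ; rk≤# = λ X → #-mono (base-⊆ X) }

-- Matroid union

_⊆?_ : ∀ {n} (X Y : Fin n → Bool) → Dec (X ⊆ Y)
X ⊆? Y with ⊆-or-∃ X Y
... | inj₁ h = yes h
... | inj₂ (x , x∈ , x∉) = no λ h → x∉ (h x∈)

module _ {n : ℕ} {X Y : Fin n → Bool} (e : ∀ i → X i ≡ Y i) where
  ≗⇒⊆ : X ⊆ Y
  ≗⇒⊆ {i} p = ∈⁺ (trans (sym (e i)) (∈⁻ p))

  ≗⇒⊇ : Y ⊆ X
  ≗⇒⊇ {i} p = ∈⁺ (trans (e i) (∈⁻ p))

  #-cong : # X ≡ # Y
  #-cong = ≤-antisym (#-mono ≗⇒⊆) (#-mono ≗⇒⊇)

Submodular-Sum : ∀ {k n} {r : Fin k → (Fin n → Bool) → ℕ} → (∀ i → Submodular (r i)) →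
  Submodular (λ X → Sum (λ i → r i X))
Submodular-Sum {r = r} s = record
  { mono = λ h → Sum-mono λ i → Submodular.mono (s i) h
  ; submod = λ {W} {I} {X} {Y} a b c → subst₂ _≤_ (Sum-+ (λ i → r i W) (λ i → r i I)) (Sum-+ (λ i → r i X) (λ i → r i Y))
      (Sum-mono λ i → Submodular.submod (s i) a b c) }

Submodular-∪ : ∀ {n} {r : (Fin n → Bool) → ℕ} → Submodular r → (J : Fin n → Bool) → Submodular (λ X → r (X ∪ J))
Submodular-∪ s J = record
  { mono = λ h → Submodular.mono s (∪-mono h id)
  ; submod = λ a b c → Submodular.submod s (∪-mono a id) (∪-mono b id)
      (∪-⊆ (λ w → [ ∪ˡ ∘ ∪ˡ , ∪ʳ ∘ ∪ˡ ]′ (∪⁻ (c w))) (∪ˡ ∘ ∪ʳ)) }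

-- Spread R Z is the condition of the matroid union theorem for Z to be independent in a
-- matroid union with total rank function R.
Spread : ∀ {n} → ((Fin n → Bool) → ℕ) → (Fin n → Bool) → Set
Spread R Z = ∀ F → F ⊆ Z → # F ≤ R F

module MatroidUnion {n k : ℕ} (r : Fin k → RankFn n) where
  private
    module r i = RankFn (r i)

  totalRank : (Fin n → Bool) → ℕ
  totalRank X = Sum (λ i → r.rk i X)

  module Step (I : Fin k → Fin n → Bool) where
    s : ℕ
    s = Sum (λ i → # (I i))

    G : (Fin n → Bool) → ℕ
    G F = Sum (λ i → r.rk i (F ∪ I i))

    G-submodular : Submodular G
    G-submodular = Submodular-Sum {r = λ i F → r.rk i (F ∪ I i)} λ i → Submodular-∪ (r.isSubmodular i) (I i)

    Invariant : (Fin n → Bool) → Set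
    Invariant Z = ∀ F → F ⊆ Z → # F + s ≤ G F

    Tight : (Fin n → Bool) → Set
    Tight F = G F ≤ # F + s

    Tight-∪ : ∀ {Z X Y} → Invariant Z → X ⊆ Z → Y ⊆ Z → Tight X → Tight Y → Tight (X ∪ Y)
    Tight-∪ {Z} {X} {Y} inv hx hy tx ty = lin 0
      (Submodular.submod G-submodular {X ∪ Y} {X ∩ Y} ∩ˡ ∩ʳ id ⊕ inv (X ∩ Y) (hx ∘ ∩ˡ) ⊕ tx ⊕ ty)
      (trans (arith (G (X ∪ Y)) (G X) (G Y) (G (X ∩ Y)) (# X) (# Y) s)
        (trans (cong (λ c → c + s + (G (X ∪ Y) + G (X ∩ Y) + s + G X + G Y)) (sym (#-∩∪ X Y)))
          (arith' (# (X ∪ Y)) (# (X ∩ Y)) s (G (X ∪ Y)) (G (X ∩ Y)) (G X) (G Y))))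
      where
      arith : ∀ u x y i a b s → u + (x + y + i + (a + s) + (b + s)) + 0 ≡ (a + b) + s + (u + i + s + x + y)
      arith = solve-∀
      arith' : ∀ c d s u i x y → c + d + s + (u + i + s + x + y) ≡ c + s + (u + i + (d + s) + x + y)
      arith' = solve-∀

  addTo : Fin k → Fin n → Fin k → Fin n → Bool
  addTo i e l with i Fin.≟ l
  ... | yes _ = ⁅ e ⁆
  ... | no _ = ∅

  addTo-∈ : ∀ i e → e ∈ addTo i e i
  addTo-∈ i e with i Fin.≟ i
  ... | yes _ = ∈⁅⁆ e
  ... | no ¬p = ⊥-elim (¬p refl)

  addTo-⊆ : ∀ i e l → addTo i e l ⊆ ⁅ e ⁆
  addTo-⊆ i e l p with i Fin.≟ l
  ... | yes _ = p
  ... | no _ = ∅⁻ p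

  #addTo : ∀ i e → Sum (λ l → # (addTo i e l)) ≤ 1
  #addTo i e = ≤-trans (Sum-mono pt) (≤-reflexive (Sum-⁅⁆ (λ _ → 1) i))
    where
    pt : ∀ l → # (addTo i e l) ≤ ⟦ ⁅ i ⁆ l ⟧ * 1
    pt l with i Fin.≟ l
    ... | yes refl = ≤-reflexive (trans (#-⁅⁆ e) (sym (cong (_* 1) (⟦⟧-∈ (∈⁻ (∈⁅⁆ i))))))
    ... | no _ = ≤-trans (≤-reflexive #-∅) z≤n

  Partition : (I : Fin k → Fin n → Bool) (Z : Fin n → Bool) → Set
  Partition I Z = Σ (Fin k → Fin n → Bool) λ J → (∀ i → r.Indep i (J i)) × (∀ {e} → e ∈ Z → ∃ λ i → e ∈ J i) ×
    (∀ i → I i ⊆ J i) × (∀ i → J i ⊆ I i ∪ Z)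

  Bad : (Z : Fin n → Bool) (I : Fin k → Fin n → Bool) → Fin n → Fin k → (Fin n → Bool) → Set
  Bad Z I e i F = F ⊆ Z ∖ ⁅ e ⁆ × Step.G (λ l → I l ∪ addTo i e l) F ≤ # F + Step.s I

  bad? : ∀ Z I e i → Dec (∃ (Bad Z I e i))
  bad? Z I e i = anySet? resp′ λ F → (F ⊆? (Z ∖ ⁅ e ⁆)) ×-dec (Step.G (λ l → I l ∪ addTo i e l) F ≤? # F + Step.s I)
    where
    resp′ : Respects (Bad Z I e i)
    resp′ eq (h , t) = h ∘ ≗⇒⊇ eq , subst₂ _≤_ (Submodular.ext (Step.G-submodular (λ l → I l ∪ addTo i e l)) eq) (cong (_+ Step.s I) (#-cong eq)) t

  partition : ∀ fuel Z I → # Z ≤ fuel → Step.Invariant I Z → Partition I Z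
  partition fuel Z I l inv with Fin.any? (_∈? Z)
  ... | no ¬p = I , indep , (λ e∈ → ⊥-elim (¬p (_ , e∈))) , (λ i → id) , λ i → ∪ˡ
    where
    open Step I
    indep : ∀ i → r.Indep i (I i)
    indep i = ≮⇒≥ λ lt → <⇒≱ (Sum-strict (λ l → r.rk≤# l (I l)) i lt) (≤-trans (m≤n+m s (# {n} ∅))
      (≤-trans (inv ∅ ∅⁻) (Sum-mono λ l → r.mono l (∪-⊆ ∅⁻ id))))
  partition zero Z I l inv | yes (e , e∈) = ⊥-elim (<⇒≱ (∈⇒#-pos e∈) l)
  partition (suc fuel) Z I l inv | yes (e , e∈) with Fin.all? (bad? Z I e)
  ... | no ¬all with Fin.¬∀⟶∃¬ k _ (bad? Z I e) ¬all
  ... | i , good = J , ind , cover , (λ l → sub l ∘ ∪ˡ) , sup'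
    where
    open Step I
    I' : Fin k → Fin n → Bool
    I' l = I l ∪ addTo i e l
    s' : Step.s I' ≤ s + 1
    s' = ≤-trans (Sum-mono λ l → #-∪≤ (I l) (addTo i e l)) (≤-trans (≤-reflexive (Sum-+ _ _)) (+-monoʳ-≤ s (#addTo i e)))
    rec : Partition I' (Z ∖ ⁅ e ⁆)
    rec = partition fuel (Z ∖ ⁅ e ⁆) I' (s≤s⁻¹ (≤-trans (≤-reflexive (sym (#-del Z e∈))) l))
      λ F h → ≤-trans (+-monoʳ-≤ (# F) s') (≤-trans (≤-reflexive (trans (sym (+-assoc (# F) s 1)) (+-comm _ 1)))
        (≰⇒> λ t → good (F , h , t)))
    J = proj₁ rec
    ind = proj₁ (proj₂ rec)
    sub = proj₁ (proj₂ (proj₂ (proj₂ rec)))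
    sup = proj₂ (proj₂ (proj₂ (proj₂ rec)))
    cover : ∀ {x} → x ∈ Z → ∃ λ i → x ∈ J i
    cover {x} x∈ with x ∈? ⁅ e ⁆
    ... | yes p = i , sub i (∪ʳ (subst (_∈ addTo i e i) (∈⁅⁆⁻ p) (addTo-∈ i e)))
    ... | no ¬p = proj₁ (proj₂ (proj₂ rec)) (∖⁺ x∈ ¬p)
    sup' : ∀ l → J l ⊆ I l ∪ Z
    sup' l p with ∪⁻ (sup l p)
    ... | inj₂ q = ∪ʳ (∖ˡ q)
    ... | inj₁ q with ∪⁻ q
    ...   | inj₁ q' = ∪ˡ q'
    ...   | inj₂ q' = ∪ʳ (⁅⁆-⊆ e∈ (addTo-⊆ i e l q'))
  partition (suc fuel) Z I l inv | yes (e , e∈) | yes all = ⊥-elim (<⇒≱ over bound)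
    where
    open Step I
    module S' i = Step (λ l → I l ∪ addTo i e l)
    F : Fin k → Fin n → Bool
    F i = proj₁ (all i)
    F⊆ : ∀ i → F i ⊆ Z ∖ ⁅ e ⁆
    F⊆ i = proj₁ (proj₂ (all i))
    F-bad : ∀ i → S'.G i (F i) ≤ # (F i) + s
    F-bad i = proj₂ (proj₂ (all i))
    G≤ : ∀ i l → r.rk l (F i ∪ I l) ≤ r.rk l (F i ∪ (I l ∪ addTo i e l))
    G≤ i l = r.mono l (∪-mono id ∪ˡ)
    F-tight : ∀ i → Tight (F i)
    F-tight i = ≤-trans (Sum-mono (G≤ i)) (F-bad i)
    F-spans : ∀ i → r.rk i ((F i ∪ I i) ∪ ⁅ e ⁆) ≤ r.rk i (F i ∪ I i)
    F-spans i = ≤-trans (r.mono i (∪-⊆ (∪-mono id ∪ˡ) (∪ʳ ∘ ∪ʳ ∘ ⁅⁆-⊆ (addTo-∈ i e))))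
      (≮⇒≥ λ lt → <⇒≱ (Sum-strict (G≤ i) i lt) (≤-trans (F-bad i) (inv (F i) (∖ˡ ∘ F⊆ i))))
    union : Σ (Fin n → Bool) λ T → ∅ ⊆ T × (T ⊆ Z ∖ ⁅ e ⁆ × Tight T) × (∀ i → F i ⊆ T)
    union = iterate∪ (λ T → T ⊆ Z ∖ ⁅ e ⁆ × Tight T) (λ i T → F i ⊆ T) (λ sub q p → sub (q p)) ∅
      (∅⁻ , ≤-trans (Sum-mono λ l → ≤-trans (r.mono l (∪-⊆ ∅⁻ id)) (r.rk≤# l (I l))) (m≤n+m s (# {n} ∅)))
      λ i Y _ (h , t) → Y ∪ F i , ∪ˡ , (∪-⊆ h (F⊆ i) , Tight-∪ inv (∖ˡ ∘ h) (∖ˡ ∘ F⊆ i) t (F-tight i)) , ∪ʳ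
    T = proj₁ union
    T⊆ = proj₁ (proj₁ (proj₂ (proj₂ union)))
    T-tight = proj₂ (proj₁ (proj₂ (proj₂ union)))
    F⊆T = proj₂ (proj₂ (proj₂ union))
    T-spans : ∀ i → r.rk i ((T ∪ ⁅ e ⁆) ∪ I i) ≤ r.rk i (T ∪ I i)
    T-spans i = ≤-trans (r.mono i (∪-⊆ (∪-⊆ (∪ˡ ∘ ∪ˡ) ∪ʳ) (∪ˡ ∘ ∪ʳ)))
      (+-cancelʳ-≤ (r.rk i (F i ∪ I i)) _ _ (≤-trans (r.diminishing i (∪-mono (F⊆T i) id)) (+-monoʳ-≤ _ (F-spans i))))
    over : # T + s < # (T ∪ ⁅ e ⁆) + s
    over = ≤-reflexive (cong (_+ s) (sym (#-add T λ p → ∖ʳ (T⊆ p) (∈⁅⁆ e))))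
    bound : # (T ∪ ⁅ e ⁆) + s ≤ # T + s
    bound = ≤-trans (inv (T ∪ ⁅ e ⁆) (∪-⊆ (∖ˡ ∘ T⊆) (⁅⁆-⊆ e∈))) (≤-trans (Sum-mono T-spans) T-tight)

  spread⇒partition : ∀ {Z} → Spread totalRank Z → Partition (λ _ → ∅) Z
  spread⇒partition {Z} sp = partition (# Z) Z (λ _ → ∅) ≤-refl λ F h →
    ≤-trans (≤-reflexive (trans (cong (# F +_) (Sum-0 λ _ → #-∅)) (+-identityʳ _)))
      (≤-trans (sp F h) (Sum-mono λ i → r.mono i ∪ˡ))

module UnionRank {n} {R : (Fin n → Bool) → ℕ} (sub : Submodular R) where
  open Submodular sub

  private
    Violates : (Fin n → Bool) → (Fin n → Bool) → Set
    Violates Z F = F ⊆ Z × R F < # F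

    violation? : ∀ Z → Dec (∃ (Violates Z))
    violation? Z = anySet? (λ eq (h , l) → h ∘ ≗⇒⊇ eq , subst₂ _<_ (ext eq) (#-cong eq) l)
      λ F → (F ⊆? Z) ×-dec (R F <? # F)

  spread-or-violation : ∀ Z → Spread R Z ⊎ ∃ (Violates Z)
  spread-or-violation Z with violation? Z
  ... | yes p = inj₂ p
  ... | no ¬p = inj₁ λ F h → ≮⇒≥ λ l → ¬p (F , h , l)

  private
    Maximal : (X Z : Fin n → Bool) → Set
    Maximal X Z = ∀ {e} → e ∈ X → e ∉ Z → ∃ λ T → T ⊆ Z × R (T ∪ ⁅ e ⁆) ≤ # T

    maximal : R ∅ ≡ 0 → ∀ X → ∃ λ Z → Z ⊆ X × Spread R Z × Maximal X Z
    maximal R∅ X =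
      let Z , _ , (h , sp) , q = iterate∪ (λ Z → Z ⊆ X × Spread R Z) Q
            (λ sub q e∈ e∉ → let T , h , t = q e∈ (λ p → e∉ (sub p)) in T , (λ p → sub (h p)) , t)
            ∅ (∅⁻ , λ F h → ≤-trans (#-mono h) (≤-trans (≤-reflexive #-∅) z≤n)) step
      in Z , h , sp , λ {e} → q e
      where
      Q : Fin n → (Fin n → Bool) → Set
      Q e Z = e ∈ X → e ∉ Z → ∃ λ T → T ⊆ Z × R (T ∪ ⁅ e ⁆) ≤ # T
      step : ∀ e Z → ∅ ⊆ Z → Z ⊆ X × Spread R Z → Σ (Fin n → Bool) λ Z' → Z ⊆ Z' × (Z' ⊆ X × Spread R Z') × Q e Z'
      step e Z _ (h , sp) with e ∈? X | spread-or-violation (Z ∪ ⁅ e ⁆)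
      ... | no e∉ | _ = Z , id , (h , sp) , λ e∈ → ⊥-elim (e∉ e∈)
      ... | yes e∈ | inj₁ sp' = Z ∪ ⁅ e ⁆ , ∪ˡ , (∪-⊆ h (⁅⁆-⊆ e∈) , sp') , λ _ e∉ → ⊥-elim (e∉ (∪ʳ (∈⁅⁆ e)))
      ... | yes e∈ | inj₂ (F , F⊆ , l) = Z , id , (h , sp) , λ _ e∉ → F ∖ ⁅ e ⁆ , T⊆ , T-tight e∉
        where
        T⊆ : F ∖ ⁅ e ⁆ ⊆ Z
        T⊆ p with ∪⁻ (F⊆ (∖ˡ p))
        ... | inj₁ z = z
        ... | inj₂ z = ⊥-elim (∖ʳ p z)
        e∈F : e ∈ F
        e∈F = stable (e ∈? F) λ e∉ → <⇒≱ l (sp F λ {x} p → [ id , (λ z → ⊥-elim (e∉ (subst (_∈ F) (sym (∈⁅⁆⁻ z)) p))) ]′ (∪⁻ (F⊆ p)))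
        T-tight : e ∉ Z → R ((F ∖ ⁅ e ⁆) ∪ ⁅ e ⁆) ≤ # (F ∖ ⁅ e ⁆)
        T-tight e∉ = s≤s⁻¹ (≤-trans (s≤s (mono (∪-⊆ ∖ˡ (⁅⁆-⊆ e∈F)))) (≤-trans l (≤-reflexive (#-del F e∈F))))

  -- the min-max formula for the rank function of a union
  minmax : R ∅ ≡ 0 → ∀ X → ∃ λ Z → Z ⊆ X × Spread R Z × ∃ λ F → F ⊆ X × R F + # (X ∖ F) ≤ # Z
  minmax R∅ X with maximal R∅ X
  ... | Z , Z⊆ , sp , max = Z , Z⊆ , sp , T ∪ (X ∖ Z) , ∪-⊆ (Z⊆ ∘ T⊆) ∖ˡ , (begin
      R (T ∪ (X ∖ Z)) + # (X ∖ (T ∪ (X ∖ Z))) ≤⟨ ∪-absorb {S = X ∖ Z} {X = T} absorb ⊕ #-mono {Y = Z ∖ T} rest ⟩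
      R T + # (Z ∖ T)                         ≤⟨ +-monoˡ-≤ _ T-tight ⟩
      # T + # (Z ∖ T)                         ≡⟨ #-⊆ T⊆ ⟨
      # Z                                     ∎)
    where
    open ≤-Reasoning
    Spans : Fin n → (Fin n → Bool) → Set
    Spans e T = e ∈ X → e ∉ Z → R (T ∪ ⁅ e ⁆) ≤ R T
    monoQ : ∀ {e Y Y'} → Y ⊆ Y' → Spans e Y → Spans e Y'
    monoQ {e} {Y} {Y'} h q e∈ e∉ = +-cancelʳ-≤ (R Y) _ _ (≤-trans (diminishing h) (+-monoʳ-≤ _ (q e∈ e∉)))
    step : ∀ e Y → ∅ ⊆ Y → Y ⊆ Z × R Y ≤ # Y → Σ (Fin n → Bool) λ Y' → Y ⊆ Y' × (Y' ⊆ Z × R Y' ≤ # Y') × Spans e Y'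
    step e Y _ (h , t) with e ∈? X | e ∈? Z
    ... | no e∉ | _ = Y , id , (h , t) , λ e∈ → ⊥-elim (e∉ e∈)
    ... | yes _ | yes e∈ = Y , id , (h , t) , λ _ e∉ → ⊥-elim (e∉ e∈)
    ... | yes e∈ | no e∉ with max e∈ e∉
    ...   | U , U⊆ , U-tight = Y ∪ U , ∪ˡ , (∪-⊆ h U⊆ , tight∪) , λ _ _ →
              monoQ {e} ∪ʳ (λ _ _ → ≤-trans U-tight (sp U U⊆)) e∈ e∉
      where
      tight∪ : R (Y ∪ U) ≤ # (Y ∪ U)
      tight∪ = +-cancelʳ-≤ (# (Y ∩ U)) _ _ (begin
        R (Y ∪ U) + # (Y ∩ U) ≤⟨ +-monoʳ-≤ _ (sp (Y ∩ U) (h ∘ ∩ˡ)) ⟩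
        R (Y ∪ U) + R (Y ∩ U) ≤⟨ submod ∩ˡ ∩ʳ id ⟩
        R Y + R U             ≤⟨ t ⊕ ≤-trans (mono ∪ˡ) U-tight ⟩
        # Y + # U             ≡⟨ #-∩∪ Y U ⟨
        # (Y ∪ U) + # (Y ∩ U) ∎)
    union : Σ (Fin n → Bool) λ T → ∅ ⊆ T × (T ⊆ Z × R T ≤ # T) × (∀ e → Spans e T)
    union = iterate∪ (λ Y → Y ⊆ Z × R Y ≤ # Y) Spans (λ {e} → monoQ {e}) ∅ (∅⁻ , ≤-trans (≤-reflexive R∅) z≤n) step
    T = proj₁ union
    T⊆ = proj₁ (proj₁ (proj₂ (proj₂ union)))
    T-tight = proj₂ (proj₁ (proj₂ (proj₂ union)))
    absorb : ∀ {e} → e ∈ X ∖ Z → R (T ∪ ⁅ e ⁆) ≤ R T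
    absorb {e} p = proj₂ (proj₂ (proj₂ union)) e (∖ˡ p) (∖ʳ p)
    rest : X ∖ (T ∪ (X ∖ Z)) ⊆ Z ∖ T
    rest {x} p = ∖⁺ (stable (x ∈? Z) λ x∉ → ∖ʳ p (∪ʳ (∖⁺ (∖ˡ p) x∉))) (∖ʳ p ∘ ∪ˡ)

  spread≤ : ∀ {Z X F} → Spread R Z → Z ⊆ X → # Z ≤ R F + # (X ∖ F)
  spread≤ {Z} {X} {F} sp h = ≤-trans (≤-reflexive (#-∖ Z F))
    (≤-trans (sp (Z ∩ F) ∩ˡ) (mono ∩ʳ) ⊕ #-mono λ p → ∖⁺ (h (∖ˡ p)) (∖ʳ p))

-- Weights and fibers

term-∈ : ∀ {n} {X : Fin n → Bool} {i : Fin n} (k : ℕ) → i ∈ X → ⟦ X i ⟧ * k ≡ k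
term-∈ k p = trans (cong (_* k) (⟦⟧-∈ (∈⁻ p))) (+-identityʳ k)

term-∉ : ∀ {n} {X : Fin n → Bool} {i : Fin n} (k : ℕ) → i ∉ X → ⟦ X i ⟧ * k ≡ 0
term-∉ k p = cong (_* k) (⟦⟧-∉ (p ∘ ∈⁺))

module _ {n : ℕ} where

  wt≤Sum : {w f : Fin n → ℕ} {X : Fin n → Bool} → (∀ {i} → i ∈ X → w i ≤ f i) → wt w X ≤ Sum f
  wt≤Sum {w} {f} {X} h = ≤-trans (≤-reflexive (wt-Sum w X)) (Sum-mono pt)
    where
    pt : ∀ i → ⟦ X i ⟧ * w i ≤ f i
    pt i with i ∈? X
    ... | yes p = ≤-trans (≤-reflexive (term-∈ (w i) p)) (h p)
    ... | no ¬p = ≤-trans (≤-reflexive (term-∉ (w i) ¬p)) z≤n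

  wt-monoʷ : {w w' : Fin n → ℕ} {X : Fin n → Bool} → (∀ {i} → i ∈ X → w i ≤ w' i) → wt w X ≤ wt w' X
  wt-monoʷ {w} {w'} {X} h = ≤-trans (wt≤Sum λ {i} p → ≤-trans (h p) (≤-reflexive (sym (term-∈ (w' i) p)))) (≤-reflexive (sym (wt-Sum w' X)))

  wt-const : (k : ℕ) (X : Fin n → Bool) → wt (λ _ → k) X ≡ # X * k
  wt-const k X = trans (wt-Sum _ X) (trans (Sum-cong λ i → *-comm ⟦ X i ⟧ k)
    (trans (Sum-*ˡ k (λ i → ⟦ X i ⟧)) (trans (cong (k *_) (sym (#-Sum X))) (*-comm k (# X)))))

  wt-+ : (w w' : Fin n → ℕ) (X : Fin n → Bool) → wt (λ i → w i + w' i) X ≡ wt w X + wt w' X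
  wt-+ w w' X = trans (wt-Sum _ X) (trans (Sum-cong λ i → *-distribˡ-+ ⟦ X i ⟧ (w i) (w' i))
    (trans (Sum-+ _ _) (sym (cong₂ _+_ (wt-Sum w X) (wt-Sum w' X)))))

  fib : ∀ {m} → (Fin n → Fin m) → Fin m → Fin n → Bool
  fib f v = ⟪ (λ j → f j Fin.≟ v) ⟫

  ∈fib : ∀ {m} {f : Fin n → Fin m} {v j} → f j ≡ v → j ∈ fib f v
  ∈fib {f = f} {v} = ∈⟪⟫ (λ j → f j Fin.≟ v)

  ∈fib⁻ : ∀ {m} {f : Fin n → Fin m} {v j} → j ∈ fib f v → f j ≡ v
  ∈fib⁻ {f = f} {v} = ∈⟪⟫⁻ (λ j → f j Fin.≟ v)

  wt-fibers : ∀ {m} (f : Fin n → Fin m) (w : Fin n → ℕ) (X : Fin n → Bool) → wt w X ≡ Sum (λ v → wt w (X ∩ fib f v))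
  wt-fibers f w X = trans (wt-Sum w X) (trans (Sum-cong expand) (trans (Sum-swap _) (Sum-cong λ v → sym (wt-Sum w _))))
    where
    expand : ∀ i → ⟦ X i ⟧ * w i ≡ Sum (λ v → ⟦ (X ∩ fib f v) i ⟧ * w i)
    expand i with i ∈? X
    ... | no ¬p = trans (term-∉ (w i) ¬p) (sym (Sum-0 λ v → term-∉ (w i) (¬p ∘ ∩ˡ)))
    ... | yes p = trans (term-∈ (w i) p) (trans (sym (Sum-⁅⁆ (λ _ → w i) (f i))) (Sum-cong pt))
      where
      pt : ∀ v → ⟦ ⁅ f i ⁆ v ⟧ * w i ≡ ⟦ (X ∩ fib f v) i ⟧ * w i
      pt v with f i Fin.≟ v
      ... | yes refl = trans (term-∈ {X = ⁅ f i ⁆} (w i) (∈⁅⁆ (f i))) (sym (term-∈ (w i) (∩⁺ p (∈fib refl))))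
      ... | no ¬e = trans (term-∉ {X = ⁅ f i ⁆} (w i) (¬e ∘ ∈⁅⁆⁻)) (sym (term-∉ (w i) λ r → ¬e (∈fib⁻ (∩ʳ r))))

  #-fibers : ∀ {m} (f : Fin n → Fin m) (X : Fin n → Bool) → # X ≡ Sum (λ v → # (X ∩ fib f v))
  #-fibers f X = trans (#≡wt X) (trans (wt-fibers f _ X) (Sum-cong λ v → sym (#≡wt _)))

-- Weighted hypergraphs with a rank function.  Small edges are the edges of a graph; a big
-- edge stands for a rigid subgraph and is treated as a clique.

record Parameters : Set where
  field
    c K τ T β h : ℕ
    1≤c : 1 ≤ c
    2c≤τ : c + c ≤ τ
    T≡2h : T ≡ h + h
    16τ≤h : 16 * τ ≤ h
    β4τ : T * (K + 2) ≤ β * (4 * τ)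
    split-cost : T * c + T * K + β * (c * (16 * τ)) ≤ T * τ
    4β<T : 4 * β + 2 ≤ T

  δ : ℕ
  δ = 8 * τ

  1≤τ : 1 ≤ τ
  1≤τ = ≤-trans 1≤c (≤-trans (m≤m+n c c) 2c≤τ)

  32τ≤T : 32 * τ ≤ T
  32τ≤T = ≤-trans (≤-reflexive (e τ)) (≤-trans (16τ≤h ⊕ 16τ≤h) (≤-reflexive (sym T≡2h)))
    where
    e : ∀ t → 32 * t ≡ 16 * t + 16 * t
    e = solve-∀

record Hypergraph (P : Parameters) (N μ : ℕ) : Set where
  open Parameters P
  field
    V : Fin μ → Fin N → Bool
    w : Fin μ → ℕ
    p q : Fin μ → Fin N
    big : Fin μ → Bool
    small-w : ∀ {j} → j ∉ big → w j ≤ 1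
    small-V : ∀ {j x} → j ∉ big → x ∈ V j → x ≡ p j ⊎ x ≡ q j
    p∈V : ∀ {j} → j ∉ big → 0 < w j → p j ∈ V j
    q∈V : ∀ {j} → j ∉ big → 0 < w j → q j ∈ V j
    pq-inj : ∀ {i j} → i ∉ big → j ∉ big → 0 < w i → 0 < w j → p i ≡ p j → q i ≡ q j → i ≡ j
    big-V : ∀ {j} → j ∈ big → h < # (V j)
    big-w : ∀ {j} → j ∈ big → δ ≤ w j

  Within : (Fin N → Bool) → (Fin μ → Bool) → Set
  Within A Y = ∀ {j} → j ∈ Y → V j ⊆ A

  Separates : (A A₁ A₂ : Fin N → Bool) (Y : Fin μ → Bool) → Set
  Separates A A₁ A₂ Y = A ⊆ A₁ ∪ A₂ × A₁ ⊆ A × A₂ ⊆ A × (∀ {j} → j ∈ Y → V j ⊆ A₁ ⊎ V j ⊆ A₂) ×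
    (∃ λ u → u ∈ A × u ∉ A₂) × (∃ λ v → v ∈ A × v ∉ A₁)

  Connected : (Fin N → Bool) → (Fin μ → Bool) → Set
  Connected A Y = ∀ {A₁ A₂} → Separates A A₁ A₂ Y → c ≤ # (A₁ ∩ A₂)

  at : Fin N → Fin μ → Bool
  at v = ⟪ (λ j → v ∈? V j) ⟫

  ∈at : ∀ {v j} → v ∈ V j → j ∈ at v
  ∈at {v} = ∈⟪⟫ (λ j → v ∈? V j)

  ∈at⁻ : ∀ {v j} → j ∈ at v → v ∈ V j
  ∈at⁻ {v} = ∈⟪⟫⁻ (λ j → v ∈? V j)

  deg : (Fin μ → Bool) → Fin N → ℕ
  deg Y v = wt w (Y ∩ at v)

  -- total degree deficiency
  Q : (Fin N → Bool) → (Fin μ → Bool) → ℕ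
  Q A Y = wt (λ v → δ ∸ deg Y v) A

  Heavy : (Fin N → Bool) → (Fin μ → Bool) → Set
  Heavy A Y = T * # A < wt w Y + T * τ

  HeavyConnected : (Fin N → Bool) → (Fin μ → Bool) → Set
  HeavyConnected A Y = Σ (Fin N → Bool) λ A' → Σ (Fin μ → Bool) λ Y' →
    A' ⊆ A × Y' ⊆ Y × Within A' Y' × Connected A' Y' × 2 * τ < # A' × Heavy A' Y'

  module _ {A Y} (within : Within A Y) (allSmall : ∀ {j} → j ∈ Y → j ∉ big) where
    private
      W : Fin μ → Bool
      W = ⟪ (λ j → (j ∈? Y) ×-dec (0 <? w j)) ⟫

      W⁻ : ∀ {j} → j ∈ W → j ∈ Y × 0 < w j
      W⁻ = ∈⟪⟫⁻ (λ j → (j ∈? Y) ×-dec (0 <? w j))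

      W⁺ : ∀ {j} → j ∈ Y → 0 < w j → j ∈ W
      W⁺ j∈ l = ∈⟪⟫ (λ j → (j ∈? Y) ×-dec (0 <? w j)) (j∈ , l)

      fiber-p : ∀ v → # (W ∩ fib p v) ≤ # A
      fiber-p v = #-inj q (λ r → let y , l = W⁻ (∩ˡ r) in within y (q∈V (allSmall y) l))
        λ r s e → let y , l = W⁻ (∩ˡ r); y' , l' = W⁻ (∩ˡ s) in
          pq-inj (allSmall y) (allSmall y') l l' (trans (∈fib⁻ (∩ʳ r)) (sym (∈fib⁻ (∩ʳ s)))) e

      fiber-q : ∀ v → # (W ∩ fib q v) ≤ # A
      fiber-q v = #-inj p (λ r → let y , l = W⁻ (∩ˡ r) in within y (p∈V (allSmall y) l))
        λ r s e → let y , l = W⁻ (∩ˡ r); y' , l' = W⁻ (∩ˡ s) in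
          pq-inj (allSmall y) (allSmall y') l l' e (trans (∈fib⁻ (∩ʳ r)) (sym (∈fib⁻ (∩ʳ s))))

    deg≤2# : ∀ v → deg Y v ≤ # A + # A
    deg≤2# v = ≤-trans (wt≤Sum pt) (≤-trans (≤-reflexive (trans (Sum-+ _ _) (sym (cong₂ _+_ (#-Sum _) (#-Sum _)))))
      (fiber-p v ⊕ fiber-q v))
      where
      pt : ∀ {j} → j ∈ Y ∩ at v → w j ≤ ⟦ (W ∩ fib p v) j ⟧ + ⟦ (W ∩ fib q v) j ⟧
      pt {j} r with w j in e | small-w (allSmall (∩ˡ r))
      ... | zero | _ = z≤n
      ... | suc zero | _ with small-V (allSmall (∩ˡ r)) (∈at⁻ (∩ʳ r))
      ...   | inj₁ v≡ = ≤-trans (≤-reflexive (sym (⟦⟧-∈ (∈⁻ (∩⁺ (W⁺ (∩ˡ r) (subst (0 <_) (sym e) ≤-refl)) (∈fib (sym v≡))))))) (m≤m+n _ _)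
      ...   | inj₂ v≡ = ≤-trans (≤-reflexive (sym (⟦⟧-∈ (∈⁻ (∩⁺ (W⁺ (∩ˡ r) (subst (0 <_) (sym e) ≤-refl)) (∈fib (sym v≡))))))) (m≤n+m _ ⟦ (W ∩ fib p v) j ⟧)
      pt {j} r | suc (suc _) | s≤s ()

    wt≤#² : wt w Y ≤ # A * # A
    wt≤#² = ≤-trans (wt≤Sum pt) (≤-trans (≤-reflexive (sym (#-Sum W))) (≤-trans (≤-reflexive (#-fibers p W))
      (≤-trans (Sum-mono fiber) (≤-reflexive (trans (sym (wt-Sum (λ _ → # A) A)) (wt-const (# A) A))))))
      where
      pt : ∀ {j} → j ∈ Y → w j ≤ ⟦ W j ⟧
      pt {j} y with w j in e | small-w (allSmall y)
      ... | zero | _ = z≤n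
      ... | suc zero | _ = ≤-reflexive (sym (⟦⟧-∈ (∈⁻ (W⁺ y (subst (0 <_) (sym e) ≤-refl)))))
      ... | suc (suc _) | s≤s ()
      fiber : ∀ v → # (W ∩ fib p v) ≤ ⟦ A v ⟧ * # A
      fiber v with v ∈? A
      ... | yes v∈ = ≤-trans (fiber-p v) (≤-reflexive (sym (term-∈ (# A) v∈)))
      ... | no v∉ = ≤-trans (≮⇒≥ λ l → let j , r = #-pos l; y , l' = W⁻ (∩ˡ r) in
              v∉ (subst (_∈ A) (∈fib⁻ (∩ʳ r)) (within y (p∈V (allSmall y) l')))) z≤n

  allSmall-of : ∀ {A Y} → Within A Y → # A ≤ h → ∀ {j} → j ∈ Y → j ∉ big
  allSmall-of within l y b = <⇒≱ (big-V b) (≤-trans (#-mono (within y)) l)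

  private
    ∸-shift : ∀ m n o → m ∸ n ≤ (m ∸ (n + o)) + o
    ∸-shift m n o = m≤n+o⇒m∸n≤o m n (≤-trans (m≤n+m∸n m (n + o)) (≤-reflexive (e n o (m ∸ (n + o)))))
      where
      e : ∀ a b c → a + b + c ≡ a + (c + b)
      e = solve-∀

  -- deleting a vertex of small degree
  module Delete {A Y} (v : Fin N) (v∈A : v ∈ A) (small : ∀ {j} → j ∈ Y ∩ at v → j ∉ big) where
    A' : Fin N → Bool
    A' = A ∖ ⁅ v ⁆
    Y' : Fin μ → Bool
    Y' = Y ∖ at v

    wt-Y : wt w Y ≡ deg Y v + wt w Y'
    wt-Y = wt-∖ w Y (at v)

    within' : Within A Y → Within A' Y'
    within' h j x = ∖⁺ (h (∖ˡ j) x) λ e → ∖ʳ j (∈at (subst (_∈ V _) (sym (∈⁅⁆⁻ e)) x))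

    private
      lost : Fin N → ℕ
      lost u = wt w ((Y ∩ at u) ∩ at v)

      deg-Y : ∀ u → deg Y u ≤ deg Y' u + lost u
      deg-Y u = ≤-trans (≤-reflexive (trans (wt-∖ w (Y ∩ at u) (at v)) (+-comm (lost u) _)))
        (+-monoˡ-≤ (lost u) (wt-mono w λ r → ∩⁺ (∖⁺ (∩ˡ (∖ˡ r)) (∖ʳ r)) (∩ʳ (∖ˡ r))))

      q≤ : ∀ u → δ ∸ deg Y' u ≤ (δ ∸ deg Y u) + lost u
      q≤ u = ≤-trans (∸-shift δ (deg Y' u) (lost u)) (+-monoˡ-≤ (lost u) (∸-monoʳ-≤ δ (deg-Y u)))

      lost≤ : wt lost A' ≤ deg Y v
      lost≤ = begin
        wt lost A'                                                     ≡⟨ wt-Sum lost A' ⟩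
        Sum (λ u → ⟦ A' u ⟧ * lost u)                                  ≡⟨ Sum-cong (λ u → trans (cong (⟦ A' u ⟧ *_) (wt-Sum w _)) (sym (Sum-*ˡ ⟦ A' u ⟧ _))) ⟩
        Sum (λ u → Sum (λ j → ⟦ A' u ⟧ * (⟦ ((Y ∩ at u) ∩ at v) j ⟧ * w j))) ≡⟨ Sum-swap _ ⟩
        Sum (λ j → Sum (λ u → ⟦ A' u ⟧ * (⟦ ((Y ∩ at u) ∩ at v) j ⟧ * w j))) ≤⟨ Sum-mono pt ⟩
        Sum (λ j → ⟦ (Y ∩ at v) j ⟧ * w j)                             ≡⟨ wt-Sum w (Y ∩ at v) ⟨
        deg Y v                                                        ∎
        where
        open ≤-Reasoning
        pt : ∀ j → Sum (λ u → ⟦ A' u ⟧ * (⟦ ((Y ∩ at u) ∩ at v) j ⟧ * w j)) ≤ ⟦ (Y ∩ at v) j ⟧ * w j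
        pt j with j ∈? (Y ∩ at v)
        ... | no ¬r = ≤-trans (≤-reflexive (Sum-0 λ u → trans (cong (⟦ A' u ⟧ *_) (term-∉ {X = (Y ∩ at u) ∩ at v} (w j)
                        λ r → ¬r (∩⁺ (∩ˡ (∩ˡ r)) (∩ʳ r)))) (*-zeroʳ ⟦ A' u ⟧))) z≤n
        ... | yes r = begin
            Sum (λ u → ⟦ A' u ⟧ * (⟦ ((Y ∩ at u) ∩ at v) j ⟧ * w j)) ≤⟨ Sum-mono pt' ⟩
            Sum (λ u → w j * ⟦ (V j ∖ ⁅ v ⁆) u ⟧)                    ≡⟨ trans (Sum-*ˡ (w j) _) (cong (w j *_) (sym (#-Sum _))) ⟩
            w j * # (V j ∖ ⁅ v ⁆)                                    ≤⟨ *-monoʳ-≤ (w j) (#≤1 _ unique) ⟩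
            w j * 1                                                  ≡⟨ trans (*-identityʳ _) (sym (term-∈ (w j) r)) ⟩
            ⟦ (Y ∩ at v) j ⟧ * w j                                   ∎
          where
          pt' : ∀ u → ⟦ A' u ⟧ * (⟦ ((Y ∩ at u) ∩ at v) j ⟧ * w j) ≤ w j * ⟦ (V j ∖ ⁅ v ⁆) u ⟧
          pt' u with u ∈? A' | j ∈? ((Y ∩ at u) ∩ at v)
          ... | no ¬a | _ = ≤-trans (≤-reflexive (term-∉ {X = A'} _ ¬a)) z≤n
          ... | yes a | no ¬s = ≤-trans (≤-reflexive (trans (term-∈ {X = A'} _ a) (term-∉ {X = (Y ∩ at u) ∩ at v} _ ¬s))) z≤n
          ... | yes a | yes s = ≤-reflexive (trans (term-∈ {X = A'} _ a) (trans (term-∈ {X = (Y ∩ at u) ∩ at v} _ s)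
                  (trans (sym (*-identityʳ _)) (cong (w j *_) (sym (⟦⟧-∈ (∈⁻ (∖⁺ (∈at⁻ (∩ʳ (∩ˡ s))) (∖ʳ a)))))))))
          unique : ∀ {x y} → x ∈ V j ∖ ⁅ v ⁆ → y ∈ V j ∖ ⁅ v ⁆ → x ≡ y
          unique {x} {y} a b = pick (small-V s (∖ˡ a)) (small-V s (∖ˡ b)) (small-V s (∈at⁻ (∩ʳ r)))
            where
            s = small r
            x≢ : v ≢ x
            x≢ e = ∖ʳ a (subst (_∈ ⁅ v ⁆) e (∈⁅⁆ v))
            y≢ : v ≢ y
            y≢ e = ∖ʳ b (subst (_∈ ⁅ v ⁆) e (∈⁅⁆ v))
            pick : x ≡ p j ⊎ x ≡ q j → y ≡ p j ⊎ y ≡ q j → v ≡ p j ⊎ v ≡ q j → x ≡ y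
            pick (inj₁ a) (inj₁ b) _ = trans a (sym b)
            pick (inj₂ a) (inj₂ b) _ = trans a (sym b)
            pick (inj₁ a) _ (inj₁ e) = ⊥-elim (x≢ (trans e (sym a)))
            pick (inj₂ a) _ (inj₂ e) = ⊥-elim (x≢ (trans e (sym a)))
            pick _ (inj₁ b) (inj₁ e) = ⊥-elim (y≢ (trans e (sym b)))
            pick _ (inj₂ b) (inj₂ e) = ⊥-elim (y≢ (trans e (sym b)))

    Q-Y : Q A' Y' + δ ≤ Q A Y + (deg Y v + deg Y v)
    Q-Y = begin
      Q A' Y' + δ                                                     ≤⟨ wt-monoʷ {X = A'} (λ {u} _ → q≤ u) ⊕ m≤n+m∸n δ (deg Y v) ⟩
      wt (λ u → (δ ∸ deg Y u) + lost u) A' + (deg Y v + (δ ∸ deg Y v)) ≡⟨ cong (_+ (deg Y v + (δ ∸ deg Y v))) (wt-+ _ _ A') ⟩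
      wt (λ u → δ ∸ deg Y u) A' + wt lost A' + (deg Y v + (δ ∸ deg Y v)) ≤⟨ +-monoˡ-≤ _ (+-monoʳ-≤ (wt (λ u → δ ∸ deg Y u) A') lost≤) ⟩
      wt (λ u → δ ∸ deg Y u) A' + deg Y v + (deg Y v + (δ ∸ deg Y v)) ≡⟨ e (wt (λ u → δ ∸ deg Y u) A') (deg Y v) (δ ∸ deg Y v) ⟩
      ((δ ∸ deg Y v) + wt (λ u → δ ∸ deg Y u) A') + (deg Y v + deg Y v) ≤⟨ +-monoˡ-≤ _ total ⟩
      Q A Y + (deg Y v + deg Y v)                                     ∎
      where
      open ≤-Reasoning
      e : ∀ a d x → a + d + (d + x) ≡ x + a + (d + d)
      e = solve-∀
      total : (δ ∸ deg Y v) + wt (λ u → δ ∸ deg Y u) A' ≤ Q A Y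
      total = ≤-trans (+-monoˡ-≤ _ (≤-trans (wt-≥ (λ u → δ ∸ deg Y u) (∈⁅⁆ v))
        (wt-mono _ λ x → ∩⁺ (⁅⁆-⊆ v∈A x) x))) (≤-reflexive (sym (wt-∖ _ A ⁅ v ⁆)))

  -- splitting along a separation
  module Split {A A₁ A₂ Y} (A⊆ : A ⊆ A₁ ∪ A₂) (A₁⊆ : A₁ ⊆ A) (A₂⊆ : A₂ ⊆ A)
               (inside : ∀ {j} → j ∈ Y → V j ⊆ A₁ ⊎ V j ⊆ A₂) where
    private
      in₁ : Fin μ → Bool
      in₁ = ⟪ (λ j → V j ⊆? A₁) ⟫

    Y₁ Y₂ : Fin μ → Bool
    Y₁ = Y ∩ in₁
    Y₂ = Y ∖ in₁

    within₁ : Within A₁ Y₁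
    within₁ r = ∈⟪⟫⁻ (λ j → V j ⊆? A₁) (∩ʳ r)

    within₂ : Within A₂ Y₂
    within₂ r with inside (∖ˡ r)
    ... | inj₁ h = ⊥-elim (∖ʳ r (∈⟪⟫ (λ j → V j ⊆? A₁) h))
    ... | inj₂ h = h

    wt-Y : wt w Y ≡ wt w Y₁ + wt w Y₂
    wt-Y = wt-∖ w Y in₁

    #A : # A + # (A₁ ∩ A₂) ≡ # A₁ + # A₂
    #A = trans (cong (_+ # (A₁ ∩ A₂)) (≤-antisym (#-mono A⊆) (#-mono (∪-⊆ A₁⊆ A₂⊆)))) (#-∩∪ A₁ A₂)

    deg₁ : ∀ {v} → v ∉ A₂ → deg Y v ≤ deg Y₁ v
    deg₁ {v} v∉ = wt-mono w λ {j} r → ∩⁺ (∩⁺ (∩ˡ r) (∈⟪⟫ (λ j → V j ⊆? A₁) (go r))) (∩ʳ r)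
      where
      go : ∀ {j} → j ∈ Y ∩ at v → V j ⊆ A₁
      go {j} r with inside (∩ˡ r)
      ... | inj₁ h = h
      ... | inj₂ h = ⊥-elim (v∉ (h (∈at⁻ (∩ʳ r))))

    deg₂ : ∀ {v} → v ∉ A₁ → deg Y v ≤ deg Y₂ v
    deg₂ {v} v∉ = wt-mono w λ {j} r → ∩⁺ (∖⁺ (∩ˡ r) λ s → v∉ (∈⟪⟫⁻ (λ j → V j ⊆? A₁) s (∈at⁻ (∩ʳ r)))) (∩ʳ r)

    Q-split : Q A₁ Y₁ + Q A₂ Y₂ ≤ Q A Y + # (A₁ ∩ A₂) * (δ + δ)
    Q-split = begin
      Q A₁ Y₁ + Q A₂ Y₂                                     ≡⟨ cong₂ _+_ (wt-Sum _ A₁) (wt-Sum _ A₂) ⟩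
      Sum (λ v → ⟦ A₁ v ⟧ * (δ ∸ deg Y₁ v)) + Sum (λ v → ⟦ A₂ v ⟧ * (δ ∸ deg Y₂ v)) ≡⟨ sym (Sum-+ _ _) ⟩
      Sum (λ v → ⟦ A₁ v ⟧ * (δ ∸ deg Y₁ v) + ⟦ A₂ v ⟧ * (δ ∸ deg Y₂ v)) ≤⟨ Sum-mono pt ⟩
      Sum (λ v → ⟦ A v ⟧ * (δ ∸ deg Y v) + ⟦ (A₁ ∩ A₂) v ⟧ * (δ + δ)) ≡⟨ Sum-+ _ _ ⟩
      Sum (λ v → ⟦ A v ⟧ * (δ ∸ deg Y v)) + Sum (λ v → ⟦ (A₁ ∩ A₂) v ⟧ * (δ + δ)) ≡⟨ cong₂ _+_ (sym (wt-Sum _ A)) (trans (sym (wt-Sum (λ _ → δ + δ) (A₁ ∩ A₂))) (wt-const (δ + δ) (A₁ ∩ A₂))) ⟩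
      Q A Y + # (A₁ ∩ A₂) * (δ + δ)                         ∎
      where
      open ≤-Reasoning
      pt : ∀ v → ⟦ A₁ v ⟧ * (δ ∸ deg Y₁ v) + ⟦ A₂ v ⟧ * (δ ∸ deg Y₂ v) ≤ ⟦ A v ⟧ * (δ ∸ deg Y v) + ⟦ (A₁ ∩ A₂) v ⟧ * (δ + δ)
      pt v with v ∈? A₁ | v ∈? A₂
      ... | yes a | yes b = ≤-trans (≤-reflexive (cong₂ _+_ (term-∈ {X = A₁} _ a) (term-∈ {X = A₂} _ b)))
              (≤-trans (m∸n≤m δ (deg Y₁ v) ⊕ m∸n≤m δ (deg Y₂ v)) (≤-trans (≤-reflexive (sym (term-∈ {X = A₁ ∩ A₂} (δ + δ) (∩⁺ a b)))) (m≤n+m _ _)))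
      ... | yes a | no b = ≤-trans (≤-reflexive (trans (cong₂ _+_ (term-∈ {X = A₁} _ a) (term-∉ {X = A₂} _ b)) (+-identityʳ _)))
              (≤-trans (∸-monoʳ-≤ δ (deg₁ b)) (≤-trans (≤-reflexive (sym (term-∈ {X = A} _ (A₁⊆ a)))) (m≤m+n _ _)))
      ... | no a | yes b = ≤-trans (≤-reflexive (cong₂ _+_ (term-∉ {X = A₁} _ a) (term-∈ {X = A₂} _ b)))
              (≤-trans (∸-monoʳ-≤ δ (deg₂ a)) (≤-trans (≤-reflexive (sym (term-∈ {X = A} _ (A₂⊆ b)))) (m≤m+n _ _)))
      ... | no a | no b = ≤-trans (≤-reflexive (cong₂ _+_ (term-∉ {X = A₁} _ a) (term-∉ {X = A₂} _ b))) z≤n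

record Ranked {P N μ} (H : Hypergraph P N μ) : Set where
  open Parameters P
  open Hypergraph H
  field
    R : (Fin μ → Bool) → ℕ
    ρ : ℕ → ℕ
    R-mono : ∀ {X Y} → X ⊆ Y → R X ≤ R Y
    ρ≤ : ∀ {a} → a ≤ N → ρ a ≤ K * a
    ρ-step : ∀ {a} → suc a ≤ N → ρ (suc a) ≤ K + ρ a
    repair : ∀ {A A₁ A₂ Y Y₁ Y₂} → A ⊆ A₁ ∪ A₂ → A₁ ⊆ A → A₂ ⊆ A → Within A₁ Y₁ → Within A₂ Y₂ →
      Y₁ ⊆ Y → Y₂ ⊆ Y → τ ≤ # A₁ → τ ≤ # A₂ → ρ (# A) + (R Y₁ + R Y₂) ≤ R Y + (ρ (# A₁) + ρ (# A₂)) + K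
    rigid : ∀ {A Y} → Within A Y → Connected A Y → 2 * τ < # A → ρ (# A) ≤ R Y

-- The main estimate: a hypergraph without heavy highly connected parts has a rank
-- deficiency that is paid for by its small weight.
module MainEstimate {P N μ} {H : Hypergraph P N μ} (ranked : Ranked H) where
  open Parameters P
  open Hypergraph H
  open Ranked ranked

  Bound : (Fin N → Bool) → (Fin μ → Bool) → Set
  Bound A Y = wt w Y + (T * ρ (# A) + T * τ) ≤ T * # A + (T * R Y + β * Q A Y)

  HeavyConnected-mono : ∀ {A A' Y Y'} → A' ⊆ A → Y' ⊆ Y → HeavyConnected A' Y' → HeavyConnected A Y
  HeavyConnected-mono hA hY (B , Z , B⊆ , Z⊆ , rest) = B , Z , (λ b → hA (B⊆ b)) , (λ z → hY (Z⊆ z)) , rest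

  private
    2τ≤T : 2 * τ ≤ T
    2τ≤T = ≤-trans (*-monoˡ-≤ τ {2} {32} (s≤s (s≤s z≤n))) 32τ≤T

    2τ≤h : 2 * τ ≤ h
    2τ≤h = ≤-trans (*-monoˡ-≤ τ {2} {16} (s≤s (s≤s z≤n))) 16τ≤h

    base-arith : ∀ {W a ρ τ T K β R Q} → τ ≤ a → a ≤ T → W ≤ a * a → ρ ≤ K * a → T * (K + 2) ≤ β * (4 * τ) →
      a * (4 * τ) ≤ Q → W + (T * ρ + T * τ) ≤ T * a + (T * R + β * Q)
    base-arith {W} {a} {ρ} {τ} {T} {K} {β} {R} {Q} τa aT Wa ρa ββ Qa =
      lin (T * a + T * R) (Wa ⊕ (*-monoˡ-≤ a aT) ⊕ T ⊛ ρa ⊕ T ⊛ τa ⊕ *-monoˡ-≤ a ββ ⊕ β ⊛ Qa) (e W a ρ τ T K β R Q)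
      where
      e : ∀ W a ρ τ T K β R Q → W + (T * ρ + T * τ) + (a * a + T * a + T * (K * a) + T * a + β * (4 * τ) * a + β * Q) + (T * a + T * R)
            ≡ T * a + (T * R + β * Q) + (W + a * a + T * ρ + T * τ + T * (K + 2) * a + β * (a * (4 * τ)))
      e = solve-∀

    delete-arith : ∀ {W W' d a' ρ ρ' τ T K β R R' Q Q'} → W ≡ d + W' → d ≤ 2 * τ → 2 * τ ≤ T → ρ ≤ K + ρ' → R' ≤ R →
      Q' + 8 * τ ≤ Q + (d + d) → T * (K + 2) ≤ β * (4 * τ) →
      W' + (T * ρ' + T * τ) ≤ T * a' + (T * R' + β * Q') →
      W + (T * ρ + T * τ) ≤ T * suc a' + (T * R + β * Q)
    delete-arith {W} {W'} {d} {a'} {ρ} {ρ'} {τ} {T} {K} {β} {R} {R'} {Q} {Q'} refl dτ τT ρρ RR QQ ββ ih =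
      lin (T + T) (ih ⊕ dτ ⊕ τT ⊕ T ⊛ ρρ ⊕ T ⊛ RR ⊕ β ⊛ QQ ⊕ β ⊛ dτ ⊕ β ⊛ dτ ⊕ ββ)
        (e W' d a' ρ ρ' τ T K β R R' Q Q')
      where
      e : ∀ W' d a' ρ ρ' τ T K β R R' Q Q' →
        d + W' + (T * ρ + T * τ) + (T * a' + (T * R' + β * Q') + 2 * τ + T + T * (K + ρ') + T * R + β * (Q + (d + d)) + β * (2 * τ) + β * (2 * τ) + β * (4 * τ)) + (T + T)
        ≡ T * (1 + a') + (T * R + β * Q) + (W' + (T * ρ' + T * τ) + d + 2 * τ + T * ρ + T * R' + β * (Q' + 8 * τ) + β * d + β * d + T * (K + 2))
      e = solve-∀

    split-arith : ∀ {W W₁ W₂ a a₁ a₂ o ρ ρ₁ ρ₂ τ T K c β R R₁ R₂ Q Q₁ Q₂} → W ≡ W₁ + W₂ → a + o ≡ a₁ + a₂ → o ≤ c →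
      ρ + (R₁ + R₂) ≤ R + (ρ₁ + ρ₂) + K → Q₁ + Q₂ ≤ Q + o * (8 * τ + 8 * τ) →
      T * c + T * K + β * (c * (16 * τ)) ≤ T * τ →
      W₁ + (T * ρ₁ + T * τ) ≤ T * a₁ + (T * R₁ + β * Q₁) → W₂ + (T * ρ₂ + T * τ) ≤ T * a₂ + (T * R₂ + β * Q₂) →
      W + (T * ρ + T * τ) ≤ T * a + (T * R + β * Q)
    split-arith {W} {W₁} {W₂} {a} {a₁} {a₂} {o} {ρ} {ρ₁} {ρ₂} {τ} {T} {K} {c} {β} {R} {R₁} {R₂} {Q} {Q₁} {Q₂} refl ae oc rep QQ cost ih₁ ih₂ =
      lin 0 (ih₁ ⊕ ih₂ ⊕ T ⊛ ≤-reflexive (sym ae) ⊕ T ⊛ oc ⊕ T ⊛ rep ⊕ β ⊛ QQ ⊕ β ⊛ *-monoˡ-≤ (8 * τ + 8 * τ) oc ⊕ cost)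
        (e W₁ W₂ a a₁ a₂ o ρ ρ₁ ρ₂ τ T K c β R R₁ R₂ Q Q₁ Q₂)
      where
      e : ∀ W₁ W₂ a a₁ a₂ o ρ ρ₁ ρ₂ τ T K c β R R₁ R₂ Q Q₁ Q₂ →
        W₁ + W₂ + (T * ρ + T * τ) + (T * a₁ + (T * R₁ + β * Q₁) + (T * a₂ + (T * R₂ + β * Q₂)) + T * (a + o) + T * c
           + T * (R + (ρ₁ + ρ₂) + K) + β * (Q + o * (8 * τ + 8 * τ)) + β * (c * (8 * τ + 8 * τ)) + T * τ) + 0
        ≡ T * a + (T * R + β * Q) + (W₁ + (T * ρ₁ + T * τ) + (W₂ + (T * ρ₂ + T * τ)) + T * (a₁ + a₂) + T * o
           + T * (ρ + (R₁ + R₂)) + β * (Q₁ + Q₂) + β * (o * (8 * τ + 8 * τ)) + (T * c + T * K + β * (c * (16 * τ))))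
      e = solve-∀

    base : ∀ {A Y} → Within A Y → τ ≤ # A → # A ≤ 2 * τ → Bound A Y
    base {A} {Y} within τ≤ ≤2τ = base-arith {β = β} {R Y} {Q A Y} τ≤ (≤-trans ≤2τ 2τ≤T) (wt≤#² within small) (ρ≤ (#≤n A)) β4τ
      (≤-trans (≤-reflexive (sym (wt-const (4 * τ) A))) (wt-monoʷ λ {v} _ → m+n≤o⇒m≤o∸n (4 * τ)
        (≤-trans (+-monoʳ-≤ (4 * τ) (≤-trans (deg≤2# within small v) (≤2τ ⊕ ≤2τ))) (≤-reflexive (e τ)))))
      where
      small : ∀ {j} → j ∈ Y → j ∉ big
      small = allSmall-of within (≤-trans ≤2τ 2τ≤h)
      e : ∀ t → 4 * t + (2 * t + 2 * t) ≡ 8 * t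
      e = solve-∀

    Separated : (Fin N → Bool) → (Fin μ → Bool) → Set
    Separated A Y = Σ (Fin N → Bool) λ A₁ → Σ (Fin N → Bool) λ A₂ → Separates A A₁ A₂ Y × # (A₁ ∩ A₂) < c

    side : ∀ {A Y v} → Within A Y → 2 * τ ≤ deg Y v → τ ≤ # A
    side {A} {Y} {v} within l with # A ≤? h
    ... | no big = ≤-trans (m≤m+n τ _) (≤-trans 2τ≤h (<⇒≤ (≰⇒> big)))
    ... | yes small = *-cancelˡ-≤ 2 (≤-trans l (≤-trans (deg≤2# within (allSmall-of within small) v)
            (≤-reflexive (cong (# A +_) (sym (+-identityʳ (# A)))))))

  estimate : ∀ n {A Y} → # A ≤ n → Within A Y → τ ≤ # A → Cl (HeavyConnected A Y ⊎ Bound A Y)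
  estimate zero l within τ≤ = ⊥-elim (<⇒≱ (≤-trans 1≤τ τ≤) l)
  estimate (suc n) {A} {Y} l within τ≤ with # A ≤? 2 * τ
  ... | yes small = ret (inj₂ (base within τ≤ small))
  ... | no large with Fin.any? (λ v → (v ∈? A) ×-dec (deg Y v <? 2 * τ))
  ... | yes (v , v∈ , low) = estimate n {A'} {Y'} (s≤s⁻¹ (≤-trans (≤-reflexive (sym #A)) l)) (within' within)
          (s≤s⁻¹ (≤-trans (≤-trans (s≤s (m≤m+n τ _)) (≰⇒> large)) (≤-reflexive #A)))
          >>= λ { (inj₁ hc) → ret (inj₁ (HeavyConnected-mono ∖ˡ ∖ˡ hc))
                ; (inj₂ b) → ret (inj₂ (subst (λ a → wt w Y + (T * ρ a + T * τ) ≤ T * a + (T * R Y + β * Q A Y)) (sym #A)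
                    (delete-arith {τ = τ} {T} {K} {β} {R Y} {R Y'} {Q A Y} {Q A' Y'} wt-Y (<⇒≤ low) 2τ≤T (ρ-step (subst (_≤ N) #A (#≤n A))) (R-mono ∖ˡ) Q-Y β4τ b))) }
    where
    open Delete {A} {Y} v v∈ (λ r b → <⇒≱ low (≤-trans (*-monoˡ-≤ τ {2} {8} (s≤s (s≤s z≤n))) (≤-trans (big-w b) (wt-≥ w r))))
    #A : # A ≡ suc (# A')
    #A = #-del A v∈
  ... | no high = em (Separated A Y) >>= λ { (yes s) → separated s ; (no ¬s) → connected λ s → ≮⇒≥ λ l → ¬s (_ , _ , s , l) }
    where
    degree : ∀ {v} → v ∈ A → 2 * τ ≤ deg Y v
    degree v∈ = ≮⇒≥ λ l → high (_ , v∈ , l)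
    separated : Separated A Y → Cl (HeavyConnected A Y ⊎ Bound A Y)
    separated (A₁ , A₂ , (A⊆ , A₁⊆ , A₂⊆ , inside , (u , u∈ , u∉) , (v , v∈ , v∉)) , o<c) =
      estimate n {A₁} {Y₁} (s≤s⁻¹ (≤-trans (#-strict A₁⊆ v∈ v∉) l)) within₁ τ₁ >>= λ
      { (inj₁ hc) → ret (inj₁ (HeavyConnected-mono A₁⊆ ∩ˡ hc))
      ; (inj₂ b₁) → estimate n {A₂} {Y₂} (s≤s⁻¹ (≤-trans (#-strict A₂⊆ u∈ u∉) l)) within₂ τ₂ >>= λ
        { (inj₁ hc) → ret (inj₁ (HeavyConnected-mono A₂⊆ ∖ˡ hc))
        ; (inj₂ b₂) → ret (inj₂ (split-arith {wt w Y} {wt w Y₁} {wt w Y₂} {# A} {# A₁} {# A₂} {# (A₁ ∩ A₂)} {ρ (# A)} {ρ (# A₁)} {ρ (# A₂)} {τ} {T} {K} {c} {β} {R Y} {R Y₁} {R Y₂} {Q A Y} {Q A₁ Y₁} {Q A₂ Y₂} wt-Y #A (<⇒≤ o<c)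
            (repair A⊆ A₁⊆ A₂⊆ within₁ within₂ ∩ˡ ∖ˡ τ₁ τ₂) Q-split split-cost b₁ b₂)) } }
      where
      open Split {A} {A₁} {A₂} {Y} A⊆ A₁⊆ A₂⊆ inside
      τ₁ : τ ≤ # A₁
      τ₁ = side {v = u} within₁ (≤-trans (degree u∈) (deg₁ u∉))
      τ₂ : τ ≤ # A₂
      τ₂ = side {v = v} within₂ (≤-trans (degree v∈) (deg₂ v∉))
    connected : Connected A Y → Cl (HeavyConnected A Y ⊎ Bound A Y)
    connected con with T * # A <? wt w Y + T * τ
    ... | yes heavy = ret (inj₁ whole)
      where
      whole : HeavyConnected A Y
      whole = A , Y , id , id , within , con , ≰⇒> large , heavy
    ... | no light = ret (inj₂ (lin (β * Q A Y) (≮⇒≥ light ⊕ T ⊛ rigid within con (≰⇒> large)) (e (wt w Y) T (ρ (# A)) τ (# A) (R Y) (β * Q A Y))))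
      where
      e : ∀ W T ρ τ a R Q → W + (T * ρ + T * τ) + (T * a + T * R) + Q ≡ T * a + (T * R + Q) + (W + T * τ + T * ρ)
      e = solve-∀

-- Sets of edges of the complete graph: (u , v) stands for the unordered pair {u,v}, and
-- pairs (u , u) are irrelevant.

ESet : ℕ → Set
ESet N = Fin N × Fin N → Bool

infix 4 _⊑_
_⊑_ : ∀ {N} → ESet N → ESet N → Set
X ⊑ Y = ∀ {u v} → (u , v) ∈ X → u ≢ v → (u , v) ∈ Y ⊎ (v , u) ∈ Y

module _ {N : ℕ} where
  ⊆⇒⊑ : {X Y : ESet N} → X ⊆ Y → X ⊑ Y
  ⊆⇒⊑ h x _ = inj₁ (h x)

  ⊑-refl : {X : ESet N} → X ⊑ X
  ⊑-refl x _ = inj₁ x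

  ⊑-trans : {X Y Z : ESet N} → X ⊑ Y → Y ⊑ Z → X ⊑ Z
  ⊑-trans f g x ne with f x ne
  ... | inj₁ y = g y ne
  ... | inj₂ y with g y (ne ∘ sym)
  ...   | inj₁ z = inj₂ z
  ...   | inj₂ z = inj₁ z

  ⊑-∪ : {X Y Z : ESet N} → X ⊑ Z → Y ⊑ Z → X ∪ Y ⊑ Z
  ⊑-∪ f g x with ∪⁻ x
  ... | inj₁ y = f y
  ... | inj₂ y = g y

  ⊑-∪ˡ : {X Y Z : ESet N} → X ⊑ Y → X ⊑ Y ∪ Z
  ⊑-∪ˡ f x ne = [ inj₁ ∘ ∪ˡ , inj₂ ∘ ∪ˡ ]′ (f x ne)

  ⊑-∪ʳ : {X Y Z : ESet N} → X ⊑ Z → X ⊑ Y ∪ Z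
  ⊑-∪ʳ f x ne = [ inj₁ ∘ ∪ʳ , inj₂ ∘ ∪ʳ ]′ (f x ne)

  clique : (Fin N → Bool) → ESet N
  clique A = ⟪ (λ e → (proj₁ e ∈? A) ×-dec (proj₂ e ∈? A)) ⟫

  ∈clique : ∀ {A : Fin N → Bool} {u v} → u ∈ A → v ∈ A → (u , v) ∈ clique A
  ∈clique {A} a b = ∈⟪⟫ (λ e → (proj₁ e ∈? A) ×-dec (proj₂ e ∈? A)) (a , b)

  ∈clique⁻ : ∀ {A : Fin N → Bool} {u v} → (u , v) ∈ clique A → u ∈ A × v ∈ A
  ∈clique⁻ {A} = ∈⟪⟫⁻ (λ e → (proj₁ e ∈? A) ×-dec (proj₂ e ∈? A))

  single : Fin N → Fin N → ESet N
  single u v = ⟪ (λ e → (proj₁ e Fin.≟ u) ×-dec (proj₂ e Fin.≟ v)) ⟫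

  ∈single : ∀ {u v} → (u , v) ∈ single u v
  ∈single {u} {v} = ∈⟪⟫ (λ e → (proj₁ e Fin.≟ u) ×-dec (proj₂ e Fin.≟ v)) (refl , refl)

  ∈single⁻ : ∀ {u v x y} → (x , y) ∈ single u v → x ≡ u × y ≡ v
  ∈single⁻ {u} {v} = ∈⟪⟫⁻ (λ e → (proj₁ e Fin.≟ u) ×-dec (proj₂ e Fin.≟ v))

  single-⊑ : ∀ {u v} {X : ESet N} → (u , v) ∈ X ⊎ (v , u) ∈ X → single u v ⊑ X
  single-⊑ h x _ with ∈single⁻ x
  ... | refl , refl = h

  Avoids : ESet N → Fin N → Set
  Avoids X v = ∀ {a b} → (a , b) ∈ X → a ≢ v × b ≢ v

  WithinE : (Fin N → Bool) → ESet N → Set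
  WithinE A X = ∀ {u v} → (u , v) ∈ X → u ∈ A × v ∈ A

  SeparatesE : (A A₁ A₂ : Fin N → Bool) → ESet N → Set
  SeparatesE A A₁ A₂ X = A ⊆ A₁ ∪ A₂ × A₁ ⊆ A × A₂ ⊆ A ×
    (∀ {u v} → (u , v) ∈ X → (u ∈ A₁ × v ∈ A₁) ⊎ (u ∈ A₂ × v ∈ A₂)) ×
    (∃ λ u → u ∈ A × u ∉ A₂) × (∃ λ v → v ∈ A × v ∉ A₁)

  ConnectedE : ℕ → (Fin N → Bool) → ESet N → Set
  ConnectedE c A X = ∀ {A₁ A₂} → SeparatesE A A₁ A₂ X → c ≤ # (A₁ ∩ A₂)

-- The total rank function of the families, on subgraphs of a complete graph.
record GraphRank (P : Parameters) (N : ℕ) : Set where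
  open Parameters P
  field
    R : ESet N → ℕ
    ρ : ℕ → ℕ
    mono : ∀ {X Y} → X ⊑ Y → R X ≤ R Y
    submod : ∀ {W I X Y} → I ⊑ X → I ⊑ Y → W ⊑ X ∪ Y → R W + R I ≤ R X + R Y
    R-clique : ∀ A → R (clique A) ≡ ρ (# A)
    ρ≤ : ∀ {a} → a ≤ N → ρ a ≤ K * a
    ρ-step : ∀ {a} → suc a ≤ N → ρ (suc a) ≤ K + ρ a
    repair : ∀ {A A₁ A₂} → A ⊆ A₁ ∪ A₂ → A₁ ⊆ A → A₂ ⊆ A → τ ≤ # A₁ → τ ≤ # A₂ →
      ∃ λ M → ρ (# A) ≤ R ((clique A₁ ∪ clique A₂) ∪ M) × (∀ X → R (X ∪ M) ≤ R X + K)
    rigid : ∀ {A X} → WithinE A X → ConnectedE c A X → 2 * τ < # A → ρ (# A) ≤ R X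

  Free : Set
  Free = ∀ {X u v} → u ≢ v → Avoids X v → suc (R X) ≤ R (X ∪ single u v)

-- Two graphs G and H with a common edge set, and the rank function rM of a matroid on this
-- edge set that is the union of the matroids of G and also of the matroids of H.
record TwoGraphs {P N} (GR : GraphRank P N) : Set where
  open GraphRank GR
  field
    m : ℕ
    p q : Bool → Fin m → Fin N
    p≢q : ∀ σ e → p σ e ≢ q σ e
    pq-inj : ∀ σ {e f} → p σ e ≡ p σ f → q σ e ≡ q σ f → e ≡ f

  Touches : Bool → Fin N → Fin m → Set
  Touches σ v e = v ≡ p σ e ⊎ v ≡ q σ e

  touches? : ∀ σ v e → Dec (Touches σ v e)
  touches? σ v e = (v Fin.≟ p σ e) ⊎-dec (v Fin.≟ q σ e)

  supp : Bool → (Fin m → Bool) → Fin N → Bool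
  supp σ X = ⟪ (λ v → Fin.any? λ e → (e ∈? X) ×-dec touches? σ v e) ⟫

  ∈supp : ∀ {σ X v e} → e ∈ X → Touches σ v e → v ∈ supp σ X
  ∈supp {σ} {X} e∈ t = ∈⟪⟫ (λ v → Fin.any? λ e → (e ∈? X) ×-dec touches? σ v e) (_ , e∈ , t)

  ∈supp⁻ : ∀ {σ X v} → v ∈ supp σ X → ∃ λ e → e ∈ X × Touches σ v e
  ∈supp⁻ {σ} {X} = ∈⟪⟫⁻ (λ v → Fin.any? λ e → (e ∈? X) ×-dec touches? σ v e)

  img : Bool → (Fin m → Bool) → ESet N
  img σ X = ⟪ (λ x → Fin.any? λ e → (e ∈? X) ×-dec ((p σ e Fin.≟ proj₁ x) ×-dec (q σ e Fin.≟ proj₂ x))) ⟫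

  ∈img : ∀ {σ X e} → e ∈ X → (p σ e , q σ e) ∈ img σ X
  ∈img {σ} {X} e∈ = ∈⟪⟫ (λ x → Fin.any? λ e → (e ∈? X) ×-dec ((p σ e Fin.≟ proj₁ x) ×-dec (q σ e Fin.≟ proj₂ x))) (_ , e∈ , refl , refl)

  ∈img⁻ : ∀ {σ X u v} → (u , v) ∈ img σ X → ∃ λ e → e ∈ X × p σ e ≡ u × q σ e ≡ v
  ∈img⁻ {σ} {X} = ∈⟪⟫⁻ (λ x → Fin.any? λ e → (e ∈? X) ×-dec ((p σ e Fin.≟ proj₁ x) ×-dec (q σ e Fin.≟ proj₂ x)))

  field
    rM : (Fin m → Bool) → ℕ
    rM≤ : ∀ σ {X F} → F ⊆ X → rM X ≤ R (img σ F) + # (X ∖ F)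
    rM≥ : ∀ σ X → ∃ λ F → F ⊆ X × R (img σ F) + # (X ∖ F) ≤ rM X

  img-mono : ∀ {σ X Y} → X ⊆ Y → img σ X ⊆ img σ Y
  img-mono h {u , v} x with ∈img⁻ x
  ... | e , e∈ , refl , refl = ∈img (h e∈)

  rM≤R : ∀ σ X → rM X ≤ R (img σ X)
  rM≤R σ X = ≤-trans (rM≤ σ {F = X} id) (≤-trans (+-monoʳ-≤ _ (≤-trans (#-mono {Y = ∅} λ r → ⊥-elim (∖ʳ r (∖ˡ r))) (≤-reflexive #-∅))) (≤-reflexive (+-identityʳ _)))

  img⊆clique : ∀ {σ X A} → supp σ X ⊆ A → img σ X ⊆ clique A
  img⊆clique h {u , v} x with ∈img⁻ x
  ... | e , e∈ , refl , refl = ∈clique (h (∈supp e∈ (inj₁ refl))) (h (∈supp e∈ (inj₂ refl)))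

  rM≤ρ : ∀ σ {X A} → supp σ X ⊆ A → rM X ≤ ρ (# A)
  rM≤ρ σ {X} {A} h = ≤-trans (rM≤R σ X) (≤-trans (mono (⊆⇒⊑ (img⊆clique h))) (≤-reflexive (R-clique A)))

  rM-mono : ∀ {X Y} → X ⊆ Y → rM X ≤ rM Y
  rM-mono {X} {Y} h with rM≥ true Y
  ... | F , F⊆ , l = ≤-trans (rM≤ true {F = F ∩ X} ∩ʳ) (≤-trans (mono (⊆⇒⊑ (img-mono ∩ˡ)) ⊕ #-mono (λ r → ∖⁺ (h (∖ˡ r)) λ f → ∖ʳ r (∩⁺ f (∖ˡ r)))) l)

  -- an edge at a new vertex raises the rank
  rM-pendant : Free → ∀ σ {X Y v e} → X ⊆ Y → v ∉ supp σ X → e ∈ Y → Touches σ v e → suc (rM X) ≤ rM Y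
  rM-pendant free σ {X} {Y} {v} {e} h v∉ e∈ t with rM≥ σ Y
  ... | F , F⊆ , l with e ∈? F
  ...   | no e∉ = ≤-trans (s≤s (rM≤ σ {F = F ∩ X} ∩ʳ)) (≤-trans (≤-trans (≤-reflexive (sym (+-suc _ _)))
            (mono (⊆⇒⊑ (img-mono ∩ˡ)) ⊕ #-strict (λ r → ∖⁺ (h (∖ˡ r)) λ f → ∖ʳ r (∩⁺ f (∖ˡ r))) (∖⁺ e∈ e∉) e∉')) l)
    where
    e∉' : e ∉ X ∖ (F ∩ X)
    e∉' r = v∉ (∈supp (∖ˡ r) t)
  ...   | yes e∈F = ≤-trans (s≤s (rM≤ σ {F = F ∩ X} ∩ʳ)) (≤-trans
            (≤-trans (gain t) (mono (⊑-∪ (⊆⇒⊑ (img-mono ∩ˡ)) (single-⊑ (inj e∈F t)))) ⊕ #-mono (λ r → ∖⁺ (h (∖ˡ r)) λ f → ∖ʳ r (∩⁺ f (∖ˡ r)))) l)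
    where
    other : Touches σ v e → Fin N
    other (inj₁ _) = q σ e
    other (inj₂ _) = p σ e
    other≢ : ∀ t → other t ≢ v
    other≢ (inj₁ refl) r = p≢q σ e (sym r)
    other≢ (inj₂ refl) r = p≢q σ e r
    inj : e ∈ F → ∀ t → (other t , v) ∈ img σ F ⊎ (v , other t) ∈ img σ F
    inj f (inj₁ refl) = inj₂ (∈img f)
    inj f (inj₂ refl) = inj₁ (∈img f)
    avoids : Avoids (img σ (F ∩ X)) v
    avoids x with ∈img⁻ x
    ... | f , f∈ , refl , refl = (λ { refl → v∉ (∈supp (∩ʳ f∈) (inj₁ refl)) }) , λ { refl → v∉ (∈supp (∩ʳ f∈) (inj₂ refl)) }
    gain : ∀ t → suc (R (img σ (F ∩ X))) ≤ R (img σ (F ∩ X) ∪ single (other t) v)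
    gain t = free (other≢ t) avoids

-- A partition of a set Ω of common edges into single edges and big classes that are rigid
-- in G and in H on equally many vertices.
record Classes {P N} {GR : GraphRank P N} (TG : TwoGraphs GR) : Set where
  open Parameters P
  open GraphRank GR
  open TwoGraphs TG
  field
    Ω : Fin m → Bool
    lab : Fin m → Fin m
    big : Fin m → Bool

  E : Fin m → Fin m → Bool
  E j = Ω ∩ fib lab j

  V : Bool → Fin m → Fin N → Bool
  V σ j = supp σ (E j)

  field
    small-lab : ∀ {e} → e ∈ Ω → lab e ∉ big → lab e ≡ e
    big-size : ∀ {j} → j ∈ big → h < # (V true j)
    big-same : ∀ {j} → j ∈ big → # (V true j) ≡ # (V false j)
    big-rigid : ∀ {j} → j ∈ big → ρ (# (V true j)) ≤ rM (E j)

  big-same' : ∀ σ {j} → j ∈ big → # (V true j) ≡ # (V σ j)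
  big-same' true b = refl
  big-same' false b = big-same b

  w : Fin m → ℕ
  w j with j ∈? big
  ... | yes _ = T * (# (V true j) ∸ τ)
  ... | no _ = # (E j)

  w-big : ∀ {j} → j ∈ big → w j ≡ T * (# (V true j) ∸ τ)
  w-big {j} b with j ∈? big
  ... | yes _ = refl
  ... | no ¬b = ⊥-elim (¬b b)

  w-small : ∀ {j} → j ∉ big → w j ≡ # (E j)
  w-small {j} ¬b with j ∈? big
  ... | yes b = ⊥-elim (¬b b)
  ... | no _ = refl

  E-small : ∀ {j e} → j ∉ big → e ∈ E j → e ≡ j
  E-small ¬b r with ∈fib⁻ (∩ʳ r)
  ... | refl = sym (small-lab (∩ˡ r) ¬b)

  private
    self : ∀ {j} → j ∉ big → 0 < w j → j ∈ E j
    self {j} ¬b l with #-pos (subst (0 <_) (w-small ¬b) l)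
    ... | e , e∈ = subst (_∈ E j) (E-small ¬b e∈) e∈

  hyper : Bool → Hypergraph P N m
  hyper σ = record
    { V = V σ
    ; w = w
    ; p = p σ
    ; q = q σ
    ; big = big
    ; small-w = λ ¬b → ≤-trans (≤-reflexive (w-small ¬b)) (#≤1 _ λ r s → trans (E-small ¬b r) (sym (E-small ¬b s)))
    ; small-V = small
    ; p∈V = λ ¬b l → ∈supp (self ¬b l) (inj₁ refl)
    ; q∈V = λ ¬b l → ∈supp (self ¬b l) (inj₂ refl)
    ; pq-inj = λ _ _ _ _ → pq-inj σ
    ; big-V = λ b → subst (h <_) (big-same' σ b) (big-size b)
    ; big-w = λ {j} b → ≤-trans (*-monoʳ-≤ 8 (m≤m+n τ 0)) (≤-trans (≤-reflexive (cong (8 *_) (+-identityʳ τ)))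
        (≤-trans (≤-trans (*-monoˡ-≤ τ {8} {32} (≤ᵇ⇒≤ 8 32 _)) 32τ≤T) (≤-trans (≤-trans (≤-reflexive (sym (*-identityʳ T)))
          (*-monoʳ-≤ T (m+n≤o⇒m≤o∸n 1 (≤-trans (s≤s (≤-trans (≤-trans (m≤m+n τ _) 16τ≤h) ≤-refl)) (big-size b)))))
          (≤-reflexive (sym (w-big b)))))) }
    where
    small : ∀ {j x} → j ∉ big → x ∈ V σ j → x ≡ p σ j ⊎ x ≡ q σ j
    small ¬b x∈ with ∈supp⁻ x∈
    ... | e , e∈ , t with E-small ¬b e∈
    ...   | refl = t

  module Side (σ : Bool) where
    open Hypergraph (hyper σ) public hiding (V; w; p; q; big)

    clq : (Fin m → Bool) → ESet N
    clq Y = ⟪ (λ x → Fin.any? λ j → (j ∈? Y) ×-dec ((proj₁ x ∈? V σ j) ×-dec (proj₂ x ∈? V σ j))) ⟫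

    ∈clq : ∀ {Y j u v} → j ∈ Y → u ∈ V σ j → v ∈ V σ j → (u , v) ∈ clq Y
    ∈clq {Y} j∈ a b = ∈⟪⟫ (λ x → Fin.any? λ j → (j ∈? Y) ×-dec ((proj₁ x ∈? V σ j) ×-dec (proj₂ x ∈? V σ j))) (_ , j∈ , a , b)

    ∈clq⁻ : ∀ {Y u v} → (u , v) ∈ clq Y → ∃ λ j → j ∈ Y × u ∈ V σ j × v ∈ V σ j
    ∈clq⁻ {Y} = ∈⟪⟫⁻ (λ x → Fin.any? λ j → (j ∈? Y) ×-dec ((proj₁ x ∈? V σ j) ×-dec (proj₂ x ∈? V σ j)))

    clq-mono : ∀ {X Y} → X ⊆ Y → clq X ⊆ clq Y
    clq-mono h {u , v} x with ∈clq⁻ x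
    ... | j , j∈ , a , b = ∈clq (h j∈) a b

    clq⊆clique : ∀ {A Y} → Within A Y → clq Y ⊆ clique A
    clq⊆clique h {u , v} x with ∈clq⁻ x
    ... | j , j∈ , a , b = ∈clique (h j∈ a) (h j∈ b)

    ranked : Ranked (hyper σ)
    ranked = record
      { R = λ Y → R (clq Y)
      ; ρ = ρ
      ; R-mono = λ h → mono (⊆⇒⊑ (clq-mono h))
      ; ρ≤ = ρ≤
      ; ρ-step = ρ-step
      ; repair = repair'
      ; rigid = λ within con l → rigid (λ x → ∈clique⁻ (clq⊆clique within x)) (conE within con) l }
      where
      conE : ∀ {A Y} → Within A Y → Connected A Y → ConnectedE c A (clq Y)
      conE {A} {Y} within con {A₁} {A₂} (A⊆ , A₁⊆ , A₂⊆ , inside , r) = con (A⊆ , A₁⊆ , A₂⊆ , (λ {j} → side {j}) , r)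
        where
        side : ∀ {j} → j ∈ Y → V σ j ⊆ A₁ ⊎ V σ j ⊆ A₂
        side {j} j∈ with ⊆-or-∃ (V σ j) A₁ | ⊆-or-∃ (V σ j) A₂
        ... | inj₁ h | _ = inj₁ h
        ... | inj₂ _ | inj₁ h = inj₂ h
        ... | inj₂ (x , x∈ , x∉) | inj₂ (y , y∈ , y∉) with inside (∈clq j∈ x∈ y∈)
        ...   | inj₁ (a , _) = ⊥-elim (x∉ a)
        ...   | inj₂ (_ , b) = ⊥-elim (y∉ b)
      repair' : ∀ {A A₁ A₂ Y Y₁ Y₂} → A ⊆ A₁ ∪ A₂ → A₁ ⊆ A → A₂ ⊆ A → Within A₁ Y₁ → Within A₂ Y₂ →
        Y₁ ⊆ Y → Y₂ ⊆ Y → τ ≤ # A₁ → τ ≤ # A₂ →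
        ρ (# A) + (R (clq Y₁) + R (clq Y₂)) ≤ R (clq Y) + (ρ (# A₁) + ρ (# A₂)) + K
      repair' {A} {A₁} {A₂} {Y} {Y₁} {Y₂} A⊆ A₁⊆ A₂⊆ w₁ w₂ Y₁⊆ Y₂⊆ τ₁ τ₂ with repair A⊆ A₁⊆ A₂⊆ τ₁ τ₂
      ... | M , full , cheap = lin 0 (full ⊕ step₂ ⊕ step₁ ⊕ cheap (clq Y) ⊕ ≤-reflexive (R-clique A₁) ⊕ ≤-reflexive (R-clique A₂))
              (e (ρ (# A)) (R (clq Y₁)) (R (clq Y₂)) (R ((clique A₁ ∪ clique A₂) ∪ M)) (R (clique A₁ ∪ (clq Y ∪ M))) (R (clique A₂))
                (R (clq Y ∪ M)) (R (clique A₁)) (R (clq Y)) K (ρ (# A₁)) (ρ (# A₂)))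
        where
        step₁ : R (clique A₁ ∪ (clq Y ∪ M)) + R (clq Y₁) ≤ R (clq Y ∪ M) + R (clique A₁)
        step₁ = submod (⊆⇒⊑ (∪ˡ ∘ clq-mono Y₁⊆)) (⊆⇒⊑ (clq⊆clique w₁)) (⊑-∪ (⊑-∪ʳ ⊑-refl) (⊑-∪ˡ ⊑-refl))
        step₂ : R ((clique A₁ ∪ clique A₂) ∪ M) + R (clq Y₂) ≤ R (clique A₁ ∪ (clq Y ∪ M)) + R (clique A₂)
        step₂ = submod (⊆⇒⊑ (∪ʳ ∘ ∪ˡ ∘ clq-mono Y₂⊆)) (⊆⇒⊑ (clq⊆clique w₂))
          (⊑-∪ (⊑-∪ (⊑-∪ˡ (⊑-∪ˡ ⊑-refl)) (⊑-∪ʳ ⊑-refl)) (⊑-∪ˡ (⊑-∪ʳ (⊑-∪ʳ ⊑-refl))))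
        e : ∀ a y₁ y₂ f g k₂ ym k₁ y K r₁ r₂ → a + (y₁ + y₂) + (f + (g + k₂) + (ym + k₁) + (y + K) + r₁ + r₂) + 0
              ≡ y + (r₁ + r₂) + K + (a + (f + y₂) + (g + y₁) + ym + k₁ + k₂)
        e = solve-∀

  edges : (Fin m → Bool) → Fin m → Bool
  edges Y = Ω ∩ (Y ∘ lab)

  ∈edges : ∀ {Y e} → e ∈ Ω → lab e ∈ Y → e ∈ edges Y
  ∈edges a b = ∩⁺ a (∈⁺ (∈⁻ b))

  ∈edges-lab : ∀ {Y e} → e ∈ edges Y → lab e ∈ Y
  ∈edges-lab {Y} r = ∈⁺ (∈⁻ (∩ʳ {Y = Y ∘ lab} r))

  E⊆edges : ∀ {Y j} → j ∈ Y → E j ⊆ edges Y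
  E⊆edges {Y} j∈ r = ∈edges (∩ˡ r) (subst (_∈ Y) (sym (∈fib⁻ (∩ʳ r))) j∈)

  class-within : ∀ {σ A Y} → supp σ (edges Y) ⊆ A → ∀ {j} → j ∈ Y → V σ j ⊆ A
  class-within h j∈ x with ∈supp⁻ x
  ... | e , e∈ , t = h (∈supp (E⊆edges j∈ e∈) t)

  supp-edges : ∀ {σ Y v} → v ∈ supp σ (edges Y) → ∃ λ j → j ∈ Y × v ∈ V σ j
  supp-edges {σ} {Y} v∈ with ∈supp⁻ v∈
  ... | e , e∈ , t = lab e , ∈edges-lab e∈ , ∈supp (∩⁺ (∩ˡ e∈) (∈fib refl)) t

  module _ (σ : Bool) where
    open Side σ

    img⊆clq : ∀ {Y} → img σ (edges Y) ⊆ clq Y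
    img⊆clq {Y} {u , v} x with ∈img⁻ x
    ... | e , e∈ , refl , refl = ∈clq (∈edges-lab e∈) (∈supp (∩⁺ (∩ˡ e∈) (∈fib refl)) (inj₁ refl)) (∈supp (∩⁺ (∩ˡ e∈) (∈fib refl)) (inj₂ refl))

    -- in the minimum of rM≥, the big classes may be taken as a whole, being tight
    rM≥clq : ∀ Y → ∃ λ F → F ⊆ Y × (∀ {j} → j ∈ Y ∖ F → j ∉ big) × R (clq F) + wt w (Y ∖ F) ≤ rM (edges Y)
    rM≥clq Y with rM≥ σ (edges Y)
    ... | F₀ , F₀⊆ , l = F , proj₁ ∘ F⁻ , (λ r b → ∖ʳ r (F⁺ (∖ˡ r) (inj₁ b))) , ≤-trans total l
      where
      F : Fin m → Bool
      F = ⟪ (λ j → (j ∈? Y) ×-dec ((j ∈? big) ⊎-dec (j ∈? F₀))) ⟫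
      F⁻ : ∀ {j} → j ∈ F → j ∈ Y × (j ∈ big ⊎ j ∈ F₀)
      F⁻ = ∈⟪⟫⁻ (λ j → (j ∈? Y) ×-dec ((j ∈? big) ⊎-dec (j ∈? F₀)))
      F⁺ : ∀ {j} → j ∈ Y → (j ∈ big ⊎ j ∈ F₀) → j ∈ F
      F⁺ y b = ∈⟪⟫ (λ j → (j ∈? Y) ×-dec ((j ∈? big) ⊎-dec (j ∈? F₀))) (y , b)
      X : ESet N
      X = img σ F₀
      defect : Fin m → ℕ
      defect j = # (E j ∖ F₀)
      absorb : ∀ n B → # B ≤ n → B ⊆ Y ∩ big → R (X ∪ clq B) ≤ R X + wt defect B
      absorb n B l h with Fin.any? (_∈? B)
      ... | no ¬p = ≤-trans (mono (⊑-∪ ⊑-refl λ {u} {v} x _ → ⊥-elim (let j , j∈ , _ = ∈clq⁻ x in ¬p (j , j∈)))) (m≤m+n _ _)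
      absorb zero B l h | yes (j , j∈) = ⊥-elim (<⇒≱ (∈⇒#-pos j∈) l)
      absorb (suc n) B l h | yes (j , j∈) =
        lin 0 (step ⊕ absorb n B' (s≤s⁻¹ (≤-trans (≤-reflexive (sym (#-del B j∈))) l)) (h ∘ ∖ˡ) ⊕ tight ⊕ ≤-reflexive (R-clique (V σ j)) ⊕ ≤-reflexive (sym wtB))
            (e (R (X ∪ clq B)) (R (img σ (F₀ ∩ E j))) (R (X ∪ clq B')) (R (clique (V σ j))) (R X) (wt defect B') (wt defect B) (ρ (# (V σ j))) (defect j))
        where
        B' : Fin m → Bool
        B' = B ∖ ⁅ j ⁆
        step : R (X ∪ clq B) + R (img σ (F₀ ∩ E j)) ≤ R (X ∪ clq B') + R (clique (V σ j))
        step = submod (⊆⇒⊑ (∪ˡ ∘ img-mono ∩ˡ)) (⊆⇒⊑ (img⊆clique λ v → let f , f∈ , t = ∈supp⁻ v in ∈supp (∩ʳ f∈) t))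
          (⊑-∪ (⊑-∪ˡ (⊑-∪ˡ ⊑-refl)) λ x _ → inj₁ (last x))
          where
          last : clq B ⊆ (X ∪ clq B') ∪ clique (V σ j)
          last {u , v} x with ∈clq⁻ x
          ... | i , i∈ , a , b with j Fin.≟ i
          ...   | yes refl = ∪ʳ (∈clique a b)
          ...   | no ¬e = ∪ˡ (∪ʳ (∈clq (∖⁺ i∈ (¬e ∘ ∈⁅⁆⁻)) a b))
        tight : ρ (# (V σ j)) ≤ R (img σ (F₀ ∩ E j)) + defect j
        tight = ≤-trans (≤-reflexive (cong ρ (sym (big-same' σ (∩ʳ (h j∈)))))) (≤-trans (big-rigid (∩ʳ (h j∈)))
          (≤-trans (rM≤ σ {F = F₀ ∩ E j} ∩ʳ) (+-monoʳ-≤ _ (#-mono λ r → ∖⁺ (∖ˡ r) λ f → ∖ʳ r (∩⁺ f (∖ˡ r))))))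
        wtB : wt defect B ≡ defect j + wt defect B'
        wtB = trans (wt-⊆ defect (⁅⁆-⊆ j∈)) (cong (_+ wt defect B') (trans (wt-Sum defect ⁅ j ⁆) (Sum-⁅⁆ defect j)))
        e : ∀ xb i xb' k x d' d r s → xb + (xb' + k + (x + d') + (i + s) + r + d) + 0 ≡ x + d + (xb + i + xb' + r + k + (s + d'))
        e = solve-∀
      clqF : clq F ⊑ X ∪ clq (Y ∩ big)
      clqF {u} {v} x u≢v with ∈clq⁻ x
      ... | j , j∈ , a , b with j ∈? big
      ...   | yes bg = inj₁ (∪ʳ (∈clq (∩⁺ (proj₁ (F⁻ j∈)) bg) a b))
      ...   | no ¬b with F⁻ j∈ | small-V ¬b a | small-V ¬b b
      ...     | _ , inj₁ bg | _ | _ = ⊥-elim (¬b bg)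
      ...     | _ , inj₂ f | inj₁ refl | inj₁ refl = ⊥-elim (u≢v refl)
      ...     | _ , inj₂ f | inj₂ refl | inj₂ refl = ⊥-elim (u≢v refl)
      ...     | _ , inj₂ f | inj₁ refl | inj₂ refl = inj₁ (∪ˡ (∈img f))
      ...     | _ , inj₂ f | inj₂ refl | inj₁ refl = inj₂ (∪ˡ (∈img f))
      count : wt defect (Y ∩ big) + wt w (Y ∖ F) ≤ # (edges Y ∖ F₀)
      count = ≤-trans (≤-reflexive (trans (cong₂ _+_ (wt-Sum defect _) (wt-Sum w _)) (sym (Sum-+ _ _))))
        (≤-trans (Sum-mono pt) (≤-reflexive (sym (#-fibers lab (edges Y ∖ F₀)))))
        where
        pt : ∀ j → ⟦ (Y ∩ big) j ⟧ * defect j + ⟦ (Y ∖ F) j ⟧ * w j ≤ # ((edges Y ∖ F₀) ∩ fib lab j)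
        pt j with j ∈? (Y ∩ big) | j ∈? (Y ∖ F)
        ... | no a | no b = ≤-trans (≤-reflexive (cong₂ _+_ (term-∉ {X = Y ∩ big} _ a) (term-∉ {X = Y ∖ F} _ b))) z≤n
        ... | yes a | yes b = ⊥-elim (∖ʳ b (F⁺ (∩ˡ a) (inj₁ (∩ʳ a))))
        ... | yes a | no b = ≤-trans (≤-reflexive (trans (cong₂ _+_ (term-∈ {X = Y ∩ big} _ a) (term-∉ {X = Y ∖ F} _ b)) (+-identityʳ _)))
                (#-mono λ r → ∩⁺ (∖⁺ (E⊆edges (∩ˡ a) (∖ˡ r)) (∖ʳ r)) (∩ʳ (∖ˡ r)))
        ... | no a | yes b = ≤-trans (≤-reflexive (trans (cong₂ _+_ (term-∉ {X = Y ∩ big} _ a) (term-∈ {X = Y ∖ F} _ b)) (w-small ¬b)))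
                (#-mono λ r → ∩⁺ (∖⁺ (E⊆edges (∖ˡ b) r) λ f → ∖ʳ b (F⁺ (∖ˡ b) (inj₂ (subst (_∈ F₀) (E-small ¬b r) f)))) (∩ʳ r))
          where
          ¬b : j ∉ big
          ¬b bg = ∖ʳ b (F⁺ (∖ˡ b) (inj₁ bg))
      total : R (clq F) + wt w (Y ∖ F) ≤ R X + # (edges Y ∖ F₀)
      total = lin 0 (mono clqF ⊕ absorb (# (Y ∩ big)) (Y ∩ big) ≤-refl id ⊕ count)
        (e (R (clq F)) (wt w (Y ∖ F)) (R (X ∪ clq (Y ∩ big))) (R X) (wt defect (Y ∩ big)) (# (edges Y ∖ F₀)))
        where
        e : ∀ a b c x d n → a + b + (c + (x + d) + n) + 0 ≡ x + n + (a + c + (d + b))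
        e = solve-∀

contra : ∀ {l r} s → l ≤ r → 1 + r + s ≡ l → ⊥
contra s h e = n≮0 (lin {1} {0} s h e)

both-sides : {A : Set} (f : Bool → A) {x : A} → ∀ σ σ' → f σ ≡ x → f (not σ) ≡ x → f σ' ≡ x
both-sides f true true e _ = e
both-sides f false false e _ = e
both-sides f true false _ e = e
both-sides f false true _ e = e

module GraphRankProperties {P N} (GR : GraphRank P N) where
  open Parameters P
  open GraphRank GR

  ρ-mono : ∀ {A B : Fin N → Bool} → # A ≤ # B → ρ (# A) ≤ ρ (# B)
  ρ-mono {A} {B} l with subset-of-size B (# A) l
  ... | A' , A'⊆ , e = subst (λ a → ρ a ≤ ρ (# B)) e (subst₂ _≤_ (R-clique A') (R-clique B)
          (mono (⊆⇒⊑ λ { {u , v} x → let a , b = ∈clique⁻ x in ∈clique (A'⊆ a) (A'⊆ b) })))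

  module _ (free : Free) where
    ρ-strict : ∀ {A B : Fin N → Bool} → 1 ≤ # A → # A < # B → ρ (# A) < ρ (# B)
    ρ-strict {A} {B} 1≤ l with subset-of-size B (# A) (<⇒≤ l)
    ... | A' , A'⊆ , e with #<⇒∃ A' B (subst (_< # B) (sym e) l) | #-pos (subst (1 ≤_) (sym e) 1≤)
    ... | v , v∈ , v∉ | u , u∈ = subst (λ a → ρ a < ρ (# B)) e (subst₂ _<_ (R-clique A') (R-clique B)
          (≤-trans (free {u = u} {v} (λ { refl → v∉ u∈ }) λ x → let a , b = ∈clique⁻ x in (λ { refl → v∉ a }) , (λ { refl → v∉ b }))
            (mono (⊑-∪ (⊆⇒⊑ λ { {u , v} x → let a , b = ∈clique⁻ x in ∈clique (A'⊆ a) (A'⊆ b) }) (single-⊑ (inj₁ (∈clique (A'⊆ u∈) v∈)))))))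

    ρ-gap : ∀ n {A B : Fin N → Bool} → 1 ≤ # A → # B ≡ n + # A → ρ (# A) + n ≤ ρ (# B)
    ρ-gap zero {A} {B} 1≤ e = ≤-reflexive (trans (+-identityʳ _) (cong ρ (sym e)))
    ρ-gap (suc n) {A} {B} 1≤ e with subset-of-size B (n + # A) (≤-trans (n≤1+n _) (≤-reflexive (sym e)))
    ... | C , _ , eC = ≤-trans (≤-reflexive (+-suc _ n)) (≤-trans (s≤s (ρ-gap n {A} {C} 1≤ eC))
          (ρ-strict {C} {B} (≤-trans 1≤ (≤-trans (m≤n+m _ n) (≤-reflexive (sym eC)))) (≤-reflexive (trans (cong suc eC) (sym e)))))

module _ {P N μ} (H : Hypergraph P N μ) where
  open Parameters P
  open Hypergraph H

  handshake : ∀ {X} A → (∀ {j} → j ∈ X → j ∉ big) → wt (deg X) A ≤ wt w X + wt w X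
  handshake {X} A small = begin
    wt (deg X) A                                            ≤⟨ wt≤Sum {f = deg X} (λ _ → ≤-refl) ⟩
    Sum (deg X)                                             ≡⟨ Sum-cong (λ v → wt-Sum w (X ∩ at v)) ⟩
    Sum (λ v → Sum (λ j → ⟦ (X ∩ at v) j ⟧ * w j))          ≡⟨ Sum-swap _ ⟩
    Sum (λ j → Sum (λ v → ⟦ (X ∩ at v) j ⟧ * w j))          ≤⟨ Sum-mono pt ⟩
    Sum (λ j → ⟦ X j ⟧ * w j + ⟦ X j ⟧ * w j)               ≡⟨ trans (Sum-+ _ _) (sym (cong₂ _+_ (wt-Sum w X) (wt-Sum w X))) ⟩
    wt w X + wt w X                                         ∎
    where
    open ≤-Reasoning
    pt : ∀ j → Sum (λ v → ⟦ (X ∩ at v) j ⟧ * w j) ≤ ⟦ X j ⟧ * w j + ⟦ X j ⟧ * w j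
    pt j with j ∈? X
    ... | no ¬x = ≤-trans (≤-reflexive (Sum-0 λ v → term-∉ {X = X ∩ at v} _ (¬x ∘ ∩ˡ))) z≤n
    ... | yes x = begin
        Sum (λ v → ⟦ (X ∩ at v) j ⟧ * w j)                       ≤⟨ Sum-mono pt' ⟩
        Sum (λ v → ⟦ ⁅ p j ⁆ v ⟧ * w j + ⟦ ⁅ q j ⁆ v ⟧ * w j)    ≡⟨ trans (Sum-+ _ _) (cong₂ _+_ (Sum-⁅⁆ (λ _ → w j) (p j)) (Sum-⁅⁆ (λ _ → w j) (q j))) ⟩
        w j + w j                                                ≡⟨ sym (cong₂ _+_ (term-∈ {X = X} _ x) (term-∈ {X = X} _ x)) ⟩
        ⟦ X j ⟧ * w j + ⟦ X j ⟧ * w j                            ∎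
      where
      pt' : ∀ v → ⟦ (X ∩ at v) j ⟧ * w j ≤ ⟦ ⁅ p j ⁆ v ⟧ * w j + ⟦ ⁅ q j ⁆ v ⟧ * w j
      pt' v with j ∈? (X ∩ at v)
      ... | no ¬r = ≤-trans (≤-reflexive (term-∉ {X = X ∩ at v} _ ¬r)) z≤n
      ... | yes r with small-V (small x) (∈at⁻ (∩ʳ r))
      ...   | inj₁ refl = ≤-trans (*-monoˡ-≤ (w j) (≤-trans (⟦⟧≤1 ((X ∩ at v) j)) (≤-reflexive (sym (⟦⟧-∈ (∈⁻ (∈⁅⁆ v))))))) (m≤m+n _ _)
      ...   | inj₂ refl = ≤-trans (*-monoˡ-≤ (w j) (≤-trans (⟦⟧≤1 ((X ∩ at v) j)) (≤-reflexive (sym (⟦⟧-∈ (∈⁻ (∈⁅⁆ v))))))) (m≤n+m _ _)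

  deg-∖ : ∀ {F Y} v → F ⊆ Y → deg Y v ≡ deg F v + deg (Y ∖ F) v
  deg-∖ {F} {Y} v h = trans (wt-∖ w (Y ∩ at v) F) (cong₂ _+_
    (≤-antisym (wt-mono w λ r → ∩⁺ (∩ʳ r) (∩ʳ (∩ˡ r))) (wt-mono w λ r → ∩⁺ (∩⁺ (h (∩ˡ r)) (∩ʳ r)) (∩ˡ r)))
    (≤-antisym (wt-mono w λ r → ∩⁺ (∖⁺ (∩ˡ (∖ˡ r)) (∖ʳ r)) (∩ʳ (∖ˡ r))) (wt-mono w λ r → ∖⁺ (∩⁺ (∖ˡ (∩ˡ r)) (∩ʳ r)) (∖ʳ (∩ˡ r)))))

  -- removing small edges of total weight s from a hypergraph without deficiency
  Q-∖ : ∀ {A F Y} → F ⊆ Y → (∀ {j} → j ∈ Y ∖ F → j ∉ big) → (∀ {v} → v ∈ A → δ ≤ deg Y v) →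
    Q A F ≤ wt w (Y ∖ F) + wt w (Y ∖ F)
  Q-∖ {A} {F} {Y} h small d = ≤-trans (wt-monoʷ λ {v} v∈ → m≤n+o⇒m∸n≤o δ (deg F v) (≤-trans (d v∈) (≤-reflexive (deg-∖ v h)))) (handshake A small)

  Q≡0 : ∀ {A F} → (∀ {v} → v ∈ A → δ ≤ deg F v) → Q A F ≡ 0
  Q≡0 {A} d = n≤0⇒n≡0 (≤-trans (wt-monoʷ {w' = λ _ → 0} {A} λ v∈ → ≤-reflexive (m≤n⇒m∸n≡0 (d v∈))) (≤-reflexive (trans (wt-const 0 A) (*-zeroʳ (# A)))))

  deg≤wt : ∀ Y v → deg Y v ≤ wt w Y
  deg≤wt Y v = wt-mono w ∩ˡ

module Merging {P N} {GR : GraphRank P N} (free : GraphRank.Free GR) {TG : TwoGraphs GR} (C : Classes TG) where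
  open Parameters P
  open GraphRank GR
  open GraphRankProperties GR
  open TwoGraphs TG
  open Classes C

  Used : Fin m → Set
  Used j = ∃ λ e → e ∈ E j

  record Mergeable : Set where
    field
      Y : Fin m → Bool
      size : h < # (supp true (edges Y))
      same : # (supp true (edges Y)) ≡ # (supp false (edges Y))
      rigidY : ρ (# (supp true (edges Y))) ≤ rM (edges Y)
      j₀ j₁ : Fin m
      j₀≢j₁ : j₀ ≢ j₁
      j₀∈ : j₀ ∈ Y
      j₁∈ : j₁ ∈ Y
      used₀ : Used j₀
      used₁ : Used j₁

  private
    2τ≤h : 2 * τ ≤ h
    2τ≤h = ≤-trans (*-monoˡ-≤ τ {2} {16} (≤ᵇ⇒≤ 2 16 _)) 16τ≤h

    τ≤2τ : τ ≤ 2 * τ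
    τ≤2τ = m≤m+n τ _

    1≤T : 1 ≤ T
    1≤T = ≤-trans (m≤n+m 1 _) (≤-trans (≤-reflexive (+-assoc (4 * β) 1 1)) 4β<T)

    δ≤T : δ ≤ T
    δ≤T = ≤-trans (*-monoˡ-≤ τ {8} {32} (≤ᵇ⇒≤ 8 32 _)) 32τ≤T

  big-full : ∀ {j} → j ∈ big → w j + T * τ ≡ T * # (V true j)
  big-full {j} b = trans (cong (_+ T * τ) (w-big b)) (trans (sym (*-distribˡ-+ T _ τ))
    (cong (T *_) (m∸n+n≡m (≤-trans τ≤2τ (≤-trans 2τ≤h (<⇒≤ (big-size b)))))))

  big-T : ∀ {j} → j ∈ big → T ≤ w j
  big-T {j} b = ≤-trans (≤-trans (≤-reflexive (sym (*-identityʳ T))) (T ⊛ m+n≤o⇒m≤o∸n 1 (≤-trans (s≤s (≤-trans τ≤2τ 2τ≤h)) (big-size b))))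
    (≤-reflexive (sym (w-big b)))

  w-used : ∀ {j} → 0 < w j → Used j
  w-used {j} l = go (j ∈? big)
    where
    go : Dec (j ∈ big) → Used j
    go (no ¬b) = #-pos (subst (0 <_) (w-small ¬b) l)
    go (yes b) with #-pos (≤-trans (s≤s z≤n) (big-size b))
    ... | v , v∈ with ∈supp⁻ v∈
    ...   | e , e∈ , _ = e , e∈

  private
    open module Sides σ = Side σ using () renaming (Heavy to HeavyOn; Within to WithinOn)

  Goal : ℕ → Set
  Goal y = ∀ {σ A Y} → # Y ≤ y → WithinOn σ A Y → 2 * τ ≤ # A → HeavyOn σ A Y → Cl Mergeable

  module Step {σ A Y} (within : WithinOn σ A Y) (2τ≤A : 2 * τ ≤ # A) (heavy : HeavyOn σ A Y)
              (smaller : ∀ {σ' A' Y'} → # Y' < # Y → WithinOn σ' A' Y' → 2 * τ ≤ # A' → HeavyOn σ' A' Y' → Cl Mergeable)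
              (narrower : ∀ {A' Y'} → # A' < # A → # Y' ≤ # Y → WithinOn σ A' Y' → 2 * τ ≤ # A' → HeavyOn σ A' Y' → Cl Mergeable) where
    open Side σ
    open MainEstimate ranked

    h<A : h < # A
    h<A = ≰⇒> λ l → contra 0 (heavy ⊕ ≤-trans (wt≤#² within (allSmall-of within l)) (*-monoˡ-≤ (# A) l) ⊕ h ⊛ 2τ≤A ⊕ ≤-reflexive (cong (_* τ) T≡2h) ⊕ ≤-reflexive (cong (_* # A) (sym T≡2h)))
      (e (wt w Y) (# A) τ T h)
      where
      e : ∀ W a τ T h → 1 + (W + T * τ + h * a + h * a + (h + h) * τ + T * a) + 0 ≡ suc (T * a) + W + h * (2 * τ) + T * τ + (h + h) * a
      e = solve-∀

    result-low : ∀ {v} → v ∈ A → deg Y v < T → Cl Mergeable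
    result-low {v} v∈ low = narrower {A'} {Y'} (≤-reflexive (sym #A)) (#-mono ∖ˡ) (within' within)
      (≤-trans 2τ≤h (s≤s⁻¹ (≤-trans h<A (≤-reflexive #A))))
      (lin 1 (heavy ⊕ low ⊕ ≤-reflexive wt-Y ⊕ ≤-reflexive (cong (T *_) (sym #A)))
        (e (deg Y v) (wt w Y) (wt w Y') (# A) (# A') T (T * τ)))
      where
      open Delete {A} {Y} v v∈ (λ r b → <⇒≱ low (≤-trans (big-T b) (wt-≥ w r)))
      #A : # A ≡ suc (# A')
      #A = #-del A v∈
      e : ∀ d W W' a a' T x → suc (T * a') + (W + x + T + (d + W') + T * a) + 1 ≡ W' + x + (suc (T * a) + suc d + W + T * (1 + a'))
      e = solve-∀

    module High (degrees : ∀ {v} → v ∈ A → T ≤ deg Y v) where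
      R≤ρ : R (clq Y) ≤ ρ (# A)
      R≤ρ = ≤-trans (mono (⊆⇒⊑ (clq⊆clique within))) (≤-reflexive (R-clique A))

      result-connected : (Connected A Y → Cl Mergeable) → Cl Mergeable
      result-connected k = estimate (# A) {A} {Y} ≤-refl within (≤-trans τ≤2τ 2τ≤A) >>= λ
        { (inj₂ b) → ⊥-elim (contra 0 (heavy ⊕ b ⊕ T ⊛ R≤ρ ⊕ β ⊛ ≤-reflexive (Q≡0 (hyper σ) {A} {Y} λ v → ≤-trans δ≤T (degrees v)))
            (e (wt w Y) T (ρ (# A)) τ (# A) (R (clq Y)) β (Q A Y)))
        ; (inj₁ (A' , Y' , A'⊆ , Y'⊆ , within' , con , large , heavy')) → cases A' Y' A'⊆ Y'⊆ within' con large heavy' (# A' <? # A) }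
        where
        e : ∀ W T ρ τ a R β Q → 1 + (W + T * τ + (T * a + (T * R + β * Q)) + T * ρ + β * 0) + 0 ≡ suc (T * a) + (W + (T * ρ + T * τ)) + T * R + β * Q
        e = solve-∀
        cases : ∀ A' Y' → A' ⊆ A → Y' ⊆ Y → Within A' Y' → Connected A' Y' → 2 * τ < # A' → HeavyOn σ A' Y' → Dec (# A' < # A) → Cl Mergeable
        cases A' Y' A'⊆ Y'⊆ within' con large heavy' (yes l) = narrower {A'} {Y'} l (#-mono Y'⊆) within' (<⇒≤ large) heavy'
        cases A' Y' A'⊆ Y'⊆ within' con large heavy' (no l) = k λ
          (A⊆ , A₁⊆ , A₂⊆ , inside , (u , u∈ , u∉) , (v , v∈ , v∉)) →
            con ((λ x → A⊆ (A'⊆ x)) , (λ x → A⊆' (A₁⊆ x)) , (λ x → A⊆' (A₂⊆ x)) , (λ j → inside (Y'⊆ j)) , (u , A⊆' u∈ , u∉) , (v , A⊆' v∈ , v∉))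
          where
          A⊆' : A ⊆ A'
          A⊆' = ⊆-#-⊇ A'⊆ (≮⇒≥ l)

      module Con (con : Connected A Y) where
        ρ≤R : ρ (# A) ≤ R (clq Y)
        ρ≤R = Ranked.rigid ranked within con (≤-trans (s≤s 2τ≤h) h<A)

        -- deleting few small edges does not lower the rank
        robust : ∀ D → (∀ {j} → j ∈ D → j ∉ big) → wt w D < δ → Cl (Mergeable ⊎ ρ (# A) ≤ rM (edges (Y ∖ D)))
        robust D small t<δ = decide (ρ (# A) ≤? rM (edges (Y ∖ D)))
          where
          deficient : ¬ (ρ (# A) ≤ rM (edges (Y ∖ D))) → ∀ F → F ⊆ Y ∖ D → (∀ {j} → j ∈ (Y ∖ D) ∖ F → j ∉ big) → R (clq F) + wt w ((Y ∖ D) ∖ F) ≤ rM (edges (Y ∖ D)) →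
            Dec (# F < # Y) → Cl (Mergeable ⊎ ρ (# A) ≤ rM (edges (Y ∖ D)))
          deficient bad F F⊆ smallF l (no F≥) = ⊥-elim (bad (≤-trans ρ≤R (≤-trans (mono (⊆⇒⊑ (clq-mono (⊆-#-⊇ (∖ˡ ∘ F⊆) (≮⇒≥ F≥))))) (≤-trans (m≤m+n _ _) l))))
          deficient bad F F⊆ smallF l (yes F<) = estimate (# A) {A} {F} ≤-refl (λ j → within (∖ˡ (F⊆ j))) (≤-trans τ≤2τ 2τ≤A) >>= λ
                { (inj₁ (A' , Y' , A'⊆ , Y'⊆ , within' , _ , large , heavy')) →
                    smaller {σ} {A'} {Y'} (≤-trans (s≤s (#-mono Y'⊆)) F<) within' (<⇒≤ large) heavy' >>= λ M → ret (inj₁ M)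
                ; (inj₂ b) → ⊥-elim (absurd b (s + δ ≤? T)) }
            where
            F⊆Y : F ⊆ Y
            F⊆Y = ∖ˡ ∘ F⊆
            X : Fin m → Bool
            X = Y ∖ F
            s s₂ t : ℕ
            s = wt w X
            s₂ = wt w ((Y ∖ D) ∖ F)
            t = wt w D
            smallX : ∀ {j} → j ∈ X → j ∉ big
            smallX {j} r = [ small , (λ ¬d → smallF (∖⁺ (∖⁺ (∖ˡ r) ¬d) (∖ʳ r))) ]′ (toSum (j ∈? D))
            s≤ : s ≤ t + s₂
            s≤ = ≤-trans (≤-reflexive (wt-∖ w X D)) (wt-mono w ∩ʳ ⊕ wt-mono w λ r → ∖⁺ (∖⁺ (∖ˡ (∖ˡ r)) (∖ʳ r)) (∖ʳ (∖ˡ r)))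
            wtY : wt w Y ≡ wt w F + s
            wtY = wt-⊆ w F⊆Y
            key : ∀ {wF T ρ τ a RF W rM s s₂ x} → suc (T * a) ≤ W + T * τ → W ≡ wF + s → wF + (T * ρ + T * τ) ≤ T * a + (T * RF + x) →
              RF + s₂ ≤ rM → suc rM ≤ ρ → T * s₂ + T < s + x
            key {wF} {T} {ρ} {τ} {a} {RF} {W} {rM} {s} {s₂} {x} hv refl b l bad =
              lin 0 (hv ⊕ b ⊕ T ⊛ l ⊕ T ⊛ bad) (e wF T ρ τ a RF rM s s₂ x)
              where
              e : ∀ wF T ρ τ a RF rM s s₂ x → suc (T * s₂ + T) + (wF + s + T * τ + (T * a + (T * RF + x)) + T * rM + T * ρ) + 0
                    ≡ s + x + (suc (T * a) + (wF + (T * ρ + T * τ)) + T * (RF + s₂) + T * (1 + rM))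
              e = solve-∀
            absurd : Bound A F → Dec (s + δ ≤ T) → ⊥
            absurd b (yes s≤T) = contra 1 (key {wt w F} {T} {ρ (# A)} {τ} {# A} {R (clq F)} {wt w Y} {rM (edges (Y ∖ D))} {s} {s₂} {β * Q A F} heavy wtY b l (≰⇒> bad) ⊕ β ⊛ ≤-reflexive Q0 ⊕ s≤ ⊕ t<δ ⊕ δ≤T ⊕ *-monoˡ-≤ s₂ 1≤T)
              (e T s s₂ t δ β (Q A F))
              where
              Q0 : Q A F ≡ 0
              Q0 = Q≡0 (hyper σ) {A} {F} λ {v} v∈ → +-cancelˡ-≤ s _ _ (≤-trans s≤T (≤-trans (degrees v∈)
                (≤-trans (≤-reflexive (trans (deg-∖ (hyper σ) v F⊆Y) (+-comm (deg F v) _))) (+-monoˡ-≤ (deg F v) (deg≤wt (hyper σ) X v)))))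
              e : ∀ T s s₂ t δ β Q → 1 + (s + β * Q + β * 0 + (t + s₂) + δ + T + T * s₂) + 1 ≡ suc (T * s₂ + T) + β * Q + s + suc t + δ + 1 * s₂
              e = solve-∀
            absurd b (no s≰T) = contra T (key {wt w F} {T} {ρ (# A)} {τ} {# A} {R (clq F)} {wt w Y} {rM (edges (Y ∖ D))} {s} {s₂} {β * Q A F} heavy wtY b l (≰⇒> bad)
                 ⊕ β ⊛ Q-∖ (hyper σ) {A} F⊆Y smallX (λ v → ≤-trans δ≤T (degrees v)) ⊕ (1 + (β + β)) ⊛ s≤ ⊕ (1 + (β + β)) ⊛ t≤s₂ ⊕ *-monoˡ-≤ s₂ 4β<T)
              (e T s s₂ t β (Q A F))
              where
              t≤s₂ : t ≤ s₂
              t≤s₂ = lin (8 * τ + 3) (≰⇒> s≰T ⊕ s≤ ⊕ t<δ ⊕ t<δ ⊕ 32τ≤T) (e' T s s₂ t τ)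
                where
                e' : ∀ T s s₂ t τ → t + (s + 8 * τ + (t + s₂) + 8 * τ + 8 * τ + T) + (8 * τ + 3) ≡ s₂ + (suc T + s + suc t + suc t + 32 * τ)
                e' = solve-∀
              e : ∀ T s s₂ t β Q → 1 + (s + β * Q + β * (s + s) + (1 + (β + β)) * (t + s₂) + (1 + (β + β)) * s₂ + T * s₂) + T
                    ≡ suc (T * s₂ + T) + β * Q + (1 + (β + β)) * s + (1 + (β + β)) * t + (4 * β + 2) * s₂
              e = solve-∀
          decide : Dec (ρ (# A) ≤ rM (edges (Y ∖ D))) → Cl (Mergeable ⊎ ρ (# A) ≤ rM (edges (Y ∖ D)))
          decide (yes ok) = ret (inj₂ ok)
          decide (no bad) = let F , F⊆ , smallF , l = rM≥clq σ (Y ∖ D) in deficient bad F F⊆ smallF l (# F <? # Y)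

        supp⊆A : supp σ (edges Y) ⊆ A
        supp⊆A x = let j , j∈ , v = supp-edges x in within j∈ v

        rM≤ρA : rM (edges Y) ≤ ρ (# A)
        rM≤ρA = rM≤ρ σ supp⊆A

        A⊆supp : A ⊆ supp σ (edges Y)
        A⊆supp {v} v∈ = let j , r , _ = wt-pos w (≤-trans 1≤T (degrees v∈)); e , e∈ , t = ∈supp⁻ (∈at⁻ (∩ʳ r)) in ∈supp (E⊆edges (∩ˡ r) e∈) t

        #supp : # (supp σ (edges Y)) ≡ # A
        #supp = ≤-antisym (#-mono supp⊆A) (#-mono A⊆supp)

        TwoClasses : Set
        TwoClasses = ∃ λ j₀ → ∃ λ j₁ → j₀ ≢ j₁ × j₀ ∈ Y × j₁ ∈ Y × Used j₀ × Used j₁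

        second-class : ∀ j₀ → j₀ ∈ Y → 0 < w j₀ → Dec (∃ λ j₁ → j₁ ∈ Y ∖ ⁅ j₀ ⁆ × 0 < w j₁) → TwoClasses
        second-class j₀ j₀∈ l₀ (yes (j₁ , j₁∈ , l₁)) = j₀ , j₁ , (λ h → ∖ʳ j₁∈ (subst (_∈ ⁅ j₀ ⁆) h (∈⁅⁆ j₀))) , j₀∈ , ∖ˡ j₁∈ , w-used l₀ , w-used l₁
        second-class j₀ j₀∈ l₀ (no ¬p) = ⊥-elim (alone (j₀ ∈? big))
          where
          wtY : wt w Y ≤ w j₀
          wtY = ≤-trans (≤-reflexive (trans (wt-⊆ w (⁅⁆-⊆ j₀∈)) (cong (_+ wt w (Y ∖ ⁅ j₀ ⁆)) (trans (wt-Sum w ⁅ j₀ ⁆) (Sum-⁅⁆ w j₀)))))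
            (≤-trans (+-monoʳ-≤ (w j₀) (≮⇒≥ λ l → let j , r , x = wt-pos w l in ¬p (j , r , x))) (≤-reflexive (+-identityʳ _)))
          alone : Dec (j₀ ∈ big) → ⊥
          alone (yes b) = contra 0 (heavy ⊕ wtY ⊕ ≤-reflexive (big-full b) ⊕ T ⊛ ≤-trans (≤-reflexive (big-same' σ b)) (#-mono (within j₀∈)))
            (e (wt w Y) (w j₀) (T * τ) (T * # A) (T * # (V true j₀)))
            where
            e : ∀ W w t a v → 1 + (W + t + w + v + a) + 0 ≡ suc a + W + (w + t) + v
            e = solve-∀
          alone (no ¬b) = contra 0 (heavy ⊕ wtY ⊕ small-w ¬b ⊕ T ⊛ 2τ≤A ⊕ (1≤T ⊛' 1≤τ)) (e (wt w Y) (w j₀) T τ (# A))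
            where
            _⊛'_ : 1 ≤ T → 1 ≤ τ → 1 ≤ T * τ
            a ⊛' b = *-mono-≤ a b
            e : ∀ W w T τ a → 1 + (W + T * τ + w + 1 + T * a + T * τ) + 0 ≡ suc (T * a) + W + w + T * (2 * τ) + 1
            e = solve-∀

        two-classes : TwoClasses
        two-classes = let j₀ , j₀∈ , l₀ = wt-pos w {Y} (lin 0 (heavy ⊕ T ⊛ ≤-trans τ≤2τ 2τ≤A) (e (wt w Y) (T * # A) (T * τ))) in
            second-class j₀ j₀∈ l₀ (Fin.any? (λ j₁ → (j₁ ∈? (Y ∖ ⁅ j₀ ⁆)) ×-dec (0 <? w j₁)))
          where
          e : ∀ W a t → 1 + (W + t + a) + 0 ≡ W + (suc a + t)
          e = solve-∀

        mergeable : (∀ {A*} → # A* ≡ # (supp (not σ) (edges Y)) → # A* ≡ # A) → ρ (# A) ≤ rM (edges Y) → Mergeable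
        mergeable same rig = let j₀ , j₁ , ne , a , b , u₀ , u₁ = two-classes in record
          { Y = Y ; size = subst (h <_) (sym (sizes true)) h<A ; same = trans (sizes true) (sym (sizes false))
          ; rigidY = subst (λ x → ρ x ≤ rM (edges Y)) (sym (sizes true)) rig
          ; j₀ = j₀ ; j₁ = j₁ ; j₀≢j₁ = ne ; j₀∈ = a ; j₁∈ = b ; used₀ = u₀ ; used₁ = u₁ }
          where
          sizes : ∀ σ' → # (supp σ' (edges Y)) ≡ # A
          sizes σ' = both-sides (λ σ → # (supp σ (edges Y))) σ σ' #supp (same {supp (not σ) (edges Y)} refl)

        conclude : Cl Mergeable
        conclude = robust ∅ ∅⁻ (subst (_< δ) (sym (trans (wt-Sum w ∅) (Sum-0 λ i → term-∉ {X = ∅} (w i) ∅⁻))) (≤-trans 1≤τ (m≤m+n τ _))) >>= λ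
          { (inj₁ M) → ret M ; (inj₂ r) → other (≤-trans r (rM-mono λ x → ∈edges (∩ˡ x) (∖ˡ (∈edges-lab x)))) }
          where
          σ' : Bool
          σ' = not σ
          A* : Fin N → Bool
          A* = supp σ' (edges Y)
          module S' = Side σ'
          module M' = MainEstimate S'.ranked
          within* : S'.Within A* Y
          within* = class-within {σ'} {A*} {Y} id
          1≤A : 1 ≤ # A
          1≤A = ≤-trans 1≤τ (≤-trans τ≤2τ 2τ≤A)
          transfer : ρ (# A) ≤ rM (edges Y) → ¬ (∃ λ v → v ∈ A* × S'.deg Y v < δ) → ∀ F → F ⊆ Y → (∀ {j} → j ∈ Y ∖ F → j ∉ big) → R (S'.clq F) + wt w (Y ∖ F) ≤ rM (edges Y) → Cl Mergeable
          transfer rig high F F⊆ smallF l = M'.estimate (# A*) {A*} {F} ≤-refl (λ j → within* (F⊆ j)) (≤-trans τ≤2τ (≤-trans 2τ≤A A≤A*)) >>= λ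
                { (inj₁ (A' , Y' , A'⊆ , Y'⊆ , within' , con' , large , heavy')) → cases A' Y' A'⊆ Y'⊆ within' con' large heavy' (# Y' <? # Y)
                ; (inj₂ b) → ⊥-elim (absurd b) }
            where
            A≤A* : # A ≤ # A*
            A≤A* = ≮⇒≥ λ lt → <⇒≱ (ρ-strict free {A*} {A} nonempty lt) (≤-trans rig (rM≤ρ σ' id))
              where
              nonempty : 1 ≤ # A*
              nonempty = let j₀ , _ , _ , j₀∈ , _ , (e , e∈) , _ = two-classes in ∈⇒#-pos (∈supp {σ'} (E⊆edges j₀∈ e∈) (inj₁ refl))
            degrees' : ∀ {v} → v ∈ A* → δ ≤ S'.deg Y v
            degrees' v∈ = ≮⇒≥ λ l → high (_ , v∈ , l)
            gap : ρ (# A) + (# A* ∸ # A) ≤ ρ (# A*)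
            gap = ρ-gap free (# A* ∸ # A) {A} {A*} 1≤A (sym (m∸n+n≡m A≤A*))
            absurd : M'.Bound A* F → ⊥
            absurd b = contra (β * (s + s) + s) (heavy ⊕ b ⊕ T ⊛ l ⊕ T ⊛ rM≤ρA ⊕ T ⊛ gap ⊕ T ⊛ ≤-reflexive (sym (m∸n+n≡m A≤A*)) ⊕ β ⊛ Q-∖ (hyper σ') {A*} F⊆ smallF degrees'
                ⊕ *-monoˡ-≤ s 4β<T ⊕ ≤-reflexive (wt-⊆ w F⊆))
              (e (wt w Y) (wt w F) s T τ β (# A) (# A*) (# A* ∸ # A) (ρ (# A)) (ρ (# A*)) (R (S'.clq F)) (rM (edges Y)) (S'.Q A* F))
              where
              s = wt w (Y ∖ F)
              e : ∀ W wF s T τ β a a* g ρ ρ* RF rM Q →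
                1 + (W + T * τ + (T * a* + (T * RF + β * Q)) + T * rM + T * ρ + T * ρ* + T * (g + a) + β * (s + s) + T * s + (wF + s)) + (β * (s + s) + s)
                ≡ suc (T * a) + (wF + (T * ρ* + T * τ)) + T * (RF + s) + T * rM + T * (ρ + g) + T * a* + β * Q + (4 * β + 2) * s + W
              e = solve-∀
            cases : ∀ A' Y' → A' ⊆ A* → Y' ⊆ F → S'.Within A' Y' → S'.Connected A' Y' → 2 * τ < # A' → HeavyOn σ' A' Y' → Dec (# Y' < # Y) → Cl Mergeable
            cases A' Y' A'⊆ Y'⊆ within' con' large heavy' (yes lt) = smaller {σ'} {A'} {Y'} lt within' (<⇒≤ large) heavy'
            cases A' Y' A'⊆ Y'⊆ within' con' large heavy' (no ge) = ret (mergeable (λ e → trans e (≤-antisym A*≤A A≤A*)) rig)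
              where
              Y⊆Y' : Y ⊆ Y'
              Y⊆Y' = ⊆-#-⊇ (λ x → F⊆ (Y'⊆ x)) (≮⇒≥ ge)
              A*⊆A' : A* ⊆ A'
              A*⊆A' x = let j , j∈ , v = supp-edges x in within' (Y⊆Y' j∈) v
              A'≤A : # A' ≤ # A
              A'≤A = ≮⇒≥ λ lt → <⇒≱ (ρ-strict free {A} {A'} 1≤A lt) (≤-trans (Ranked.rigid S'.ranked within' con' large)
                (≤-trans (mono (⊆⇒⊑ (S'.clq-mono Y'⊆))) (≤-trans (m≤m+n _ _) (≤-trans l rM≤ρA))))
              A*≤A : # A* ≤ # A
              A*≤A = ≤-trans (#-mono A*⊆A') A'≤A

          other : ρ (# A) ≤ rM (edges Y) → Cl Mergeable
          other rig = decide (Fin.any? (λ v → (v ∈? A*) ×-dec (S'.deg Y v <? δ)))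
            where
            decide : Dec (∃ λ v → v ∈ A* × S'.deg Y v < δ) → Cl Mergeable
            decide (no high) = let F , F⊆ , smallF , l = rM≥clq σ' Y in transfer rig high F F⊆ smallF l
            decide (yes (v , v∈ , low)) = robust (Y ∩ S'.at v) (λ r b → <⇒≱ low (≤-trans (S'.big-w b) (wt-≥ w r))) low >>= λ
                  { (inj₁ M) → ret M
                  ; (inj₂ r) → let e , e∈ , t = ∈supp⁻ v∈ in ⊥-elim (<⇒≱ (rM-pendant free σ' {edges (Y ∖ (Y ∩ S'.at v))} {edges Y} {v} {e}
                      (λ x → ∈edges (∩ˡ x) (∖ˡ (∈edges-lab x)))
                      (λ s → let j , j∈ , x = supp-edges s in ∖ʳ j∈ (∩⁺ (∖ˡ j∈) (S'.∈at x))) e∈ t)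
                      (≤-trans rM≤ρA r)) }

  find : ∀ y → Goal y
  find y {σ} {A} l within 2τ≤ heavy = outer y (# A) l ≤-refl within 2τ≤ heavy
    where
    outer : ∀ y a {σ A Y} → # Y ≤ y → # A ≤ a → WithinOn σ A Y → 2 * τ ≤ # A → HeavyOn σ A Y → Cl Mergeable
    smallerThan : ∀ y {σ A Y} → # Y < y → WithinOn σ A Y → 2 * τ ≤ # A → HeavyOn σ A Y → Cl Mergeable
    narrowerThan : ∀ y a {σ A Y} → # Y ≤ y → # A < a → WithinOn σ A Y → 2 * τ ≤ # A → HeavyOn σ A Y → Cl Mergeable
    outer y a {σ} {A} {Y} ly la within 2τ≤ heavy = decide (Fin.any? (λ v → (v ∈? A) ×-dec (Side.deg σ Y v <? T)))
      where
      smaller : ∀ {σ' A' Y'} → # Y' < # Y → WithinOn σ' A' Y' → 2 * τ ≤ # A' → HeavyOn σ' A' Y' → Cl Mergeable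
      smaller {σ'} {A'} {Y'} lt = smallerThan y {σ'} {A'} {Y'} (≤-trans lt ly)
      narrower : ∀ {A' Y'} → # A' < # A → # Y' ≤ # Y → WithinOn σ A' Y' → 2 * τ ≤ # A' → HeavyOn σ A' Y' → Cl Mergeable
      narrower {A'} {Y'} lt le = narrowerThan y a {σ} {A'} {Y'} (≤-trans le ly) (≤-trans lt la)
      open Step {σ} {A} {Y} within 2τ≤ heavy smaller narrower
      decide : Dec (∃ λ v → v ∈ A × Side.deg σ Y v < T) → Cl Mergeable
      decide (yes (v , v∈ , low)) = result-low v∈ low
      decide (no high) = High.result-connected (λ v∈ → ≮⇒≥ λ l → high (_ , v∈ , l)) (High.Con.conclude λ v∈ → ≮⇒≥ λ l → high (_ , v∈ , l))
    smallerThan zero () within 2τ≤ heavy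
    smallerThan (suc y) {σ} {A} {Y} (s≤s l) within 2τ≤ heavy = outer y (# A) l ≤-refl within 2τ≤ heavy
    narrowerThan y zero l () within 2τ≤ heavy
    narrowerThan y (suc a) l (s≤s la) within 2τ≤ heavy = outer y a l la within 2τ≤ heavy

full : {A : Set} → A → Bool
full _ = true

∈full : {A : Set} {x : A} → x ∈ full
∈full = ∈⁺ refl

#-cover : ∀ {n m} {S : Fin n → Bool} (F : Fin m → Fin n → Bool) → (∀ {u} → u ∈ S → ∃ λ j → u ∈ F j) → # S ≤ Sum (λ j → # (F j))
#-cover {S = S} F h = begin
  # S                                ≡⟨ #-Sum S ⟩
  Sum (λ u → ⟦ S u ⟧)                ≤⟨ Sum-mono pt ⟩
  Sum (λ u → Sum (λ j → ⟦ F j u ⟧))  ≡⟨ Sum-swap _ ⟩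
  Sum (λ j → Sum (λ u → ⟦ F j u ⟧))  ≡⟨ Sum-cong (λ j → sym (#-Sum (F j))) ⟩
  Sum (λ j → # (F j))                ∎
  where
  open ≤-Reasoning
  pt : ∀ u → ⟦ S u ⟧ ≤ Sum (λ j → ⟦ F j u ⟧)
  pt u with u ∈? S
  ... | no u∉ = ≤-trans (≤-reflexive (⟦⟧-∉ (u∉ ∘ ∈⁺))) z≤n
  ... | yes u∈ with h u∈
  ...   | j , u∈F = ≤-trans (⟦⟧≤1 (S u)) (≤-trans (≤-reflexive (sym (⟦⟧-∈ (∈⁻ u∈F)))) (term≤Sum (λ j → ⟦ F j u ⟧) j))

#≤1-unique : ∀ {n} {X : Fin n → Bool} {i j} → # X ≤ 1 → i ∈ X → j ∈ X → i ≡ j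
#≤1-unique {X = X} {i} {j} l i∈ j∈ with i Fin.≟ j
... | yes e = e
... | no ¬e = ⊥-elim (<⇒≱ (#-strict {X = ⁅ i ⁆} {X} (⁅⁆-⊆ i∈) j∈ (¬e ∘ ∈⁅⁆⁻)) (≤-trans l (≤-reflexive (sym (#-⁅⁆ i)))))

module _ {P N μ} (H : Hypergraph P N μ) where
  open Parameters P
  open Hypergraph H

  incidence : ∀ {A B} (f : Fin N → ℕ) → (∀ {j} → j ∈ B → V j ⊆ A) → wt (λ v → # (B ∩ at v) * f v) A ≡ wt (λ j → wt f (V j)) B
  incidence {A} {B} f h = trans (wt-Sum _ A) (trans (Sum-cong left) (trans (Sum-swap _) (trans (Sum-cong right) (sym (wt-Sum _ B)))))
    where
    F : Fin N → Fin μ → ℕ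
    F v j = ⟦ B j ⟧ * (⟦ V j v ⟧ * f v)
    left : ∀ v → ⟦ A v ⟧ * (# (B ∩ at v) * f v) ≡ Sum (F v)
    left v = trans (cong (⟦ A v ⟧ *_) (sym (wt-const (f v) (B ∩ at v)))) (trans (cong (⟦ A v ⟧ *_) (wt-Sum _ (B ∩ at v)))
      (trans (sym (Sum-*ˡ ⟦ A v ⟧ _)) (Sum-cong pt)))
      where
      pt : ∀ j → ⟦ A v ⟧ * (⟦ (B ∩ at v) j ⟧ * f v) ≡ F v j
      pt j with j ∈? B | v ∈? V j
      ... | no b | _ = trans (cong (⟦ A v ⟧ *_) (term-∉ {X = B ∩ at v} _ (b ∘ ∩ˡ))) (trans (*-zeroʳ ⟦ A v ⟧) (sym (term-∉ {X = B} _ b)))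
      ... | yes b | no x = trans (cong (⟦ A v ⟧ *_) (term-∉ {X = B ∩ at v} _ (x ∘ ∈at⁻ ∘ ∩ʳ))) (trans (*-zeroʳ ⟦ A v ⟧)
              (sym (trans (term-∈ {X = B} _ b) (term-∉ {X = V j} _ x))))
      ... | yes b | yes x = trans (term-∈ {X = A} _ (h b x)) (trans (term-∈ {X = B ∩ at v} _ (∩⁺ b (∈at x)))
              (sym (trans (term-∈ {X = B} _ b) (term-∈ {X = V j} _ x))))
    right : ∀ j → Sum (λ v → F v j) ≡ ⟦ B j ⟧ * wt f (V j)
    right j = trans (Sum-*ˡ ⟦ B j ⟧ _) (cong (⟦ B j ⟧ *_) (sym (wt-Sum f (V j))))

-- A set of edges that is rigid in G and in H on equally many vertices.
record Birigid {P N} {GR : GraphRank P N} (TG : TwoGraphs GR) (Ω : Fin (TwoGraphs.m TG) → Bool) : Set where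
  open GraphRank GR
  open TwoGraphs TG
  field
    B : Fin m → Bool
    B⊆ : B ⊆ Ω
    spans : # (supp true Ω) ≤ # (supp true B)
    same : # (supp true B) ≡ # (supp false B)
    rigidB : ρ (# (supp true B)) ≤ rM B

module CoreI {P N} {GR : GraphRank P N} (free : GraphRank.Free GR) (TG : TwoGraphs GR) (Ω : Fin (TwoGraphs.m TG) → Bool)
             (κ : ℕ) (κ-large : 2 * Parameters.T P + 2 * (Parameters.T P * Parameters.τ P) ≤ κ)
             (connected : ConnectedE κ (TwoGraphs.supp TG true Ω) (TwoGraphs.img TG true Ω))
             (κ<A : κ < # (TwoGraphs.supp TG true Ω)) where
  open Parameters P
  open GraphRank GR
  open TwoGraphs TG

  A : Fin N → Bool
  A = supp true Ω

  supp-mono : ∀ {σ X Y} → X ⊆ Y → supp σ X ⊆ supp σ Y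
  supp-mono h x with ∈supp⁻ x
  ... | e , e∈ , t = ∈supp (h e∈) t

  -- the weight is large as long as no class spans G
  module Count (C : Classes TG) (Ω≡ : Classes.Ω C ≡ Ω) (proper : ∀ {j} → j ∈ Classes.big C → # (Classes.V C true j) < # A) where
    open Classes C renaming (Ω to Ω')
    open Side true
    open Merging free C using (big-full; w-used)

    V⊆A : ∀ {j} → V true j ⊆ A
    V⊆A = supp-mono λ r → subst (_ ∈_) Ω≡ (∩ˡ r)

    sm : Fin m → Bool
    sm = full ∖ big

    sm⁻ : ∀ {j} → j ∈ sm → j ∉ big
    sm⁻ = ∖ʳ

    s b g : Fin N → ℕ
    s = deg sm
    b v = # (big ∩ at v)
    g v with 2 ≤? b v
    ... | yes _ = T
    ... | no _ = s v

    1≤T : 1 ≤ T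
    1≤T = ≤-trans (m≤n+m 1 _) (≤-trans (≤-reflexive (+-assoc (4 * β) 1 1)) 4β<T)

    label-at : ∀ {e v} → e ∈ Ω → Touches true v e → v ∈ V true (lab e)
    label-at e∈ t = ∈supp (∩⁺ (subst (_ ∈_) (sym Ω≡) e∈) (∈fib refl)) t

    s-pos : ∀ {e v} → e ∈ Ω → Touches true v e → lab e ∉ big → 0 < s v
    s-pos {e} e∈ t ¬b = ≤-trans (≤-trans (∈⇒#-pos (∩⁺ (subst (e ∈_) (sym Ω≡) e∈) (∈fib refl))) (≤-reflexive (sym (w-small ¬b))))
      (wt-≥ w {sm ∩ at _} (∩⁺ (∖⁺ ∈full ¬b) (∈at (label-at e∈ t))))

    nbr : Fin N → Fin N → Bool
    nbr v = ⟪ (λ u → Fin.any? λ e → (e ∈? Ω) ×-dec ((touches? true u e ×-dec touches? true v e) ×-dec ¬? (u Fin.≟ v))) ⟫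

    nbr⁻ : ∀ {u v} → u ∈ nbr v → ∃ λ e → e ∈ Ω × (Touches true u e × Touches true v e) × u ≢ v
    nbr⁻ {v = v} = ∈⟪⟫⁻ (λ u → Fin.any? λ e → (e ∈? Ω) ×-dec ((touches? true u e ×-dec touches? true v e) ×-dec ¬? (u Fin.≟ v)))

    nbr⁺ : ∀ {u v} → (∃ λ e → e ∈ Ω × (Touches true u e × Touches true v e) × u ≢ v) → u ∈ nbr v
    nbr⁺ {v = v} = ∈⟪⟫ (λ u → Fin.any? λ e → (e ∈? Ω) ×-dec ((touches? true u e ×-dec touches? true v e) ×-dec ¬? (u Fin.≟ v)))

    min-degree : ∀ {v} → v ∈ A → κ ≤ # (nbr v)
    min-degree {v} v∈ = bound (⊆-or-∃ A (nbr v ∪ ⁅ v ⁆))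
      where
      nbr⊆A : nbr v ⊆ A
      nbr⊆A y = let e , e∈ , (t , _) , _ = nbr⁻ y in ∈supp e∈ t
      cover : ∀ {y} → y ∈ A → Dec (y ≡ v) → y ∈ (nbr v ∪ ⁅ v ⁆) ∪ (A ∖ ⁅ v ⁆)
      cover y∈ (yes refl) = ∪ˡ (∪ʳ (∈⁅⁆ v))
      cover y∈ (no ¬e) = ∪ʳ (∖⁺ y∈ λ r → ¬e (sym (∈⁅⁆⁻ r)))
      inside : ∀ {u y} → (u , y) ∈ img true Ω → (u ∈ nbr v ∪ ⁅ v ⁆ × y ∈ nbr v ∪ ⁅ v ⁆) ⊎ (u ∈ A ∖ ⁅ v ⁆ × y ∈ A ∖ ⁅ v ⁆)
      inside z = split (∈img⁻ z)
        where
        split : ∀ {u y} → (∃ λ e → e ∈ Ω × p true e ≡ u × q true e ≡ y) → (u ∈ nbr v ∪ ⁅ v ⁆ × y ∈ nbr v ∪ ⁅ v ⁆) ⊎ (u ∈ A ∖ ⁅ v ⁆ × y ∈ A ∖ ⁅ v ⁆)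
        split (e , e∈ , refl , refl) = decide (v Fin.≟ p true e) (v Fin.≟ q true e)
          where
          decide : Dec (v ≡ p true e) → Dec (v ≡ q true e) → (p true e ∈ nbr v ∪ ⁅ v ⁆ × q true e ∈ nbr v ∪ ⁅ v ⁆) ⊎ (p true e ∈ A ∖ ⁅ v ⁆ × q true e ∈ A ∖ ⁅ v ⁆)
          decide (yes a) _ = inj₁ (∪ʳ (subst (_∈ ⁅ v ⁆) a (∈⁅⁆ v)) , ∪ˡ (nbr⁺ (e , e∈ , (inj₂ refl , inj₁ a) , λ r → p≢q true e (sym (trans r a)))))
          decide (no _) (yes b) = inj₁ (∪ˡ (nbr⁺ (e , e∈ , (inj₁ refl , inj₂ b) , λ r → p≢q true e (trans r b))) , ∪ʳ (subst (_∈ ⁅ v ⁆) b (∈⁅⁆ v)))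
          decide (no ¬a) (no ¬b) = inj₂ (∖⁺ (∈supp e∈ (inj₁ refl)) (¬a ∘ ∈⁅⁆⁻) , ∖⁺ (∈supp e∈ (inj₂ refl)) (¬b ∘ ∈⁅⁆⁻))
      bound : (A ⊆ nbr v ∪ ⁅ v ⁆) ⊎ (∃ λ x → x ∈ A × x ∉ nbr v ∪ ⁅ v ⁆) → κ ≤ # (nbr v)
      bound (inj₁ h) = s≤s⁻¹ (≤-trans κ<A (≤-trans (#-mono h) (#-add≤ (nbr v) v)))
      bound (inj₂ (x , x∈ , x∉)) = ≤-trans (connected ((λ {y} y∈ → cover y∈ (y Fin.≟ v)) , ∪-⊆ nbr⊆A (⁅⁆-⊆ v∈) , ∖ˡ , inside ,
          (v , v∈ , λ r → ∖ʳ r (∈⁅⁆ v)) , (x , x∈ , x∉))) (#-mono λ r → [ id , (λ y → ⊥-elim (∖ʳ (∩ʳ r) y)) ]′ (∪⁻ (∩ˡ r)))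

    -- neighbours of v along small edges
    M : Fin N → Fin m → Fin N → Bool
    M v j = ⟪ (λ u → (j ∈? (sm ∩ at v)) ×-dec (u ∈? (V true j ∖ ⁅ v ⁆))) ⟫

    M⁻ : ∀ {v j u} → u ∈ M v j → j ∈ sm ∩ at v × u ∈ V true j ∖ ⁅ v ⁆
    M⁻ {v} {j} = ∈⟪⟫⁻ (λ u → (j ∈? (sm ∩ at v)) ×-dec (u ∈? (V true j ∖ ⁅ v ⁆)))

    M≤ : ∀ v j → # (M v j) ≤ ⟦ (sm ∩ at v) j ⟧ * w j
    M≤ v j = [ inside , (λ ¬r → ≤-trans (≮⇒≥ λ l → ¬r (proj₁ (M⁻ (proj₂ (#-pos l))))) z≤n) ]′ (toSum (j ∈? (sm ∩ at v)))
     where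
     inside : j ∈ sm ∩ at v → # (M v j) ≤ ⟦ (sm ∩ at v) j ⟧ * w j
     inside r = ≤-trans (#≤1 _ λ x y → unique (proj₂ (M⁻ x)) (proj₂ (M⁻ y))) (≤-trans w≥1 (≤-reflexive (sym (term-∈ {X = sm ∩ at v} _ r))))
      where
      ¬b : j ∉ big
      ¬b = sm⁻ (∩ˡ r)
      w≥1 : 1 ≤ w j
      w≥1 with ∈supp⁻ (∈at⁻ (∩ʳ r))
      ... | e , e∈ , _ = ≤-trans (∈⇒#-pos e∈) (≤-reflexive (sym (w-small ¬b)))
      unique : ∀ {x y} → x ∈ V true j ∖ ⁅ v ⁆ → y ∈ V true j ∖ ⁅ v ⁆ → x ≡ y
      unique {x} {y} a c = pick (small-V ¬b (∖ˡ a)) (small-V ¬b (∖ˡ c)) (small-V ¬b (∈at⁻ (∩ʳ r)))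
        where
        x≢ : v ≢ x
        x≢ e = ∖ʳ a (subst (_∈ ⁅ v ⁆) e (∈⁅⁆ v))
        y≢ : v ≢ y
        y≢ e = ∖ʳ c (subst (_∈ ⁅ v ⁆) e (∈⁅⁆ v))
        pick : x ≡ p true j ⊎ x ≡ q true j → y ≡ p true j ⊎ y ≡ q true j → v ≡ p true j ⊎ v ≡ q true j → x ≡ y
        pick (inj₁ a) (inj₁ b) _ = trans a (sym b)
        pick (inj₂ a) (inj₂ b) _ = trans a (sym b)
        pick (inj₁ a) _ (inj₁ e) = ⊥-elim (x≢ (trans e (sym a)))
        pick (inj₂ a) _ (inj₂ e) = ⊥-elim (x≢ (trans e (sym a)))
        pick _ (inj₁ b) (inj₁ e) = ⊥-elim (y≢ (trans e (sym b)))
        pick _ (inj₂ b) (inj₂ e) = ⊥-elim (y≢ (trans e (sym b)))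

    small-nbrs : ∀ {S v} → (∀ {u} → u ∈ S → u ∈ nbr v × (∀ {e} → e ∈ Ω → Touches true u e → Touches true v e → lab e ∉ big)) → # S ≤ s v
    small-nbrs {S} {v} h = ≤-trans (#-cover (M v) cover) (≤-trans (Sum-mono (M≤ v)) (≤-reflexive (sym (wt-Sum w _))))
      where
      cover : ∀ {u} → u ∈ S → ∃ λ j → u ∈ M v j
      cover {u} u∈ with h u∈
      ... | n , sm' with nbr⁻ n
      ...   | e , e∈ , (tu , tv) , u≢v = lab e , ∈⟪⟫ (λ u → (lab e ∈? (sm ∩ at v)) ×-dec (u ∈? (V true (lab e) ∖ ⁅ v ⁆)))
                (∩⁺ (∖⁺ ∈full (sm' e∈ tu tv)) (∈at (label-at e∈ tv)) , ∖⁺ (label-at e∈ tu) λ r → u≢v (sym (∈⁅⁆⁻ r)))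

    g≥2 : ∀ {v} → 2 ≤ b v → g v ≡ T
    g≥2 {v} l with 2 ≤? b v
    ... | yes _ = refl
    ... | no ¬l = ⊥-elim (¬l l)

    g<2 : ∀ {v} → ¬ (2 ≤ b v) → g v ≡ s v
    g<2 {v} ¬l with 2 ≤? b v
    ... | yes l = ⊥-elim (¬l l)
    ... | no _ = refl

    pointwise : ∀ {v} → v ∈ A → 2 * T + b v * g v ≤ s v + 2 * T * b v
    pointwise {v} v∈ = [ (λ l → subst (λ x → 2 * T + b v * x ≤ s v + 2 * T * b v) (sym (g≥2 l)) (≤-trans (lin 0 (T ⊛ l) (e T (b v))) (m≤n+m _ (s v)))) ,
                         (λ ¬l → subst (λ x → 2 * T + b v * x ≤ s v + 2 * T * b v) (sym (g<2 ¬l)) (few ¬l (b v) refl)) ]′ (toSum (2 ≤? b v))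
      where
      e : ∀ T b → 2 * T + b * T + T * b + 0 ≡ 2 * T * b + T * 2
      e = solve-∀
      e' : ∀ T s → 2 * T + 1 * s ≡ s + 2 * T * 1
      e' = solve-∀
      few : ¬ (2 ≤ b v) → ∀ n → b v ≡ n → 2 * T + n * s v ≤ s v + 2 * T * n
      few ¬l (suc (suc _)) eq = ⊥-elim (¬l (≤-trans (s≤s (s≤s z≤n)) (≤-reflexive (sym eq))))
      few ¬l (suc zero) eq = ≤-reflexive (e' T (s v))
      few ¬l zero eq = ≤-trans (≤-trans (≤-reflexive (+-identityʳ _)) (≤-trans (≤-trans (m≤m+n _ _) κ-large) (≤-trans (min-degree v∈)
                     (small-nbrs {nbr v} λ u → u , λ e∈ tu tv bg → n≮0 (subst (0 <_) eq (∈⇒#-pos (∩⁺ bg (∈at (label-at e∈ tv)))))))))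
                   (m≤m+n _ _)

    big-gain : ∀ {j} → j ∈ big → 2 * (T * τ) ≤ wt g (V true j)
    big-gain {j} j∈ = gain (⊆-or-∃ (V true j) ⟪ (λ v → 1 ≤? g v) ⟫)
      where
      gain : (V true j ⊆ ⟪ (λ v → 1 ≤? g v) ⟫) ⊎ (∃ λ x → x ∈ V true j × x ∉ ⟪ (λ v → 1 ≤? g v) ⟫) → 2 * (T * τ) ≤ wt g (V true j)
      gain (inj₂ (x , x∈ , x∉)) = ≤-trans (≤-trans (m≤n+m _ (2 * T)) κ-large) (≤-trans (connected {V true j} {∂ ∪ (A ∖ V true j)}
              (cover , V⊆A , ∪-⊆ (V⊆A ∘ ∩ˡ) ∖ˡ , inside , (x , V⊆A x∈ , x∉A₂) , #<⇒∃ (V true j) A (proper j∈)))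
              (≤-trans (#-mono {Y = ∂} λ r → [ id , (λ z → ⊥-elim (∖ʳ z (∩ˡ r))) ]′ (∪⁻ (∩ʳ r)))
                (≤-trans (≤-reflexive (#≡wt ∂)) (≤-trans (wt-monoʷ {w' = g} λ v → gd⁻ (∩ʳ v)) (wt-mono g ∩ˡ)))))
        where
        gd ∂ : Fin N → Bool
        gd = ⟪ (λ v → 1 ≤? g v) ⟫
        ∂ = V true j ∩ gd
        gd⁻ : ∀ {v} → v ∈ gd → 1 ≤ g v
        gd⁻ = ∈⟪⟫⁻ (λ v → 1 ≤? g v)
        x∉A₂ : x ∉ ∂ ∪ (A ∖ V true j)
        x∉A₂ r = [ (λ y → x∉ (∩ʳ y)) , (λ y → ∖ʳ y x∈) ]′ (∪⁻ r)
        cover : A ⊆ V true j ∪ (∂ ∪ (A ∖ V true j))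
        cover {y} y∈ = [ ∪ˡ , (λ ¬v → ∪ʳ (∪ʳ (∖⁺ y∈ ¬v))) ]′ (toSum (y ∈? V true j))
        good : ∀ {v} → 1 ≤ g v → v ∈ gd
        good = ∈⟪⟫ (λ v → 1 ≤? g v)
        g≥1 : ∀ {e v} → e ∈ Ω → Touches true v e → lab e ≢ j → v ∈ V true j → 1 ≤ g v
        g≥1 {e} {v} e∈ t ne v∈ = [ (λ l → subst (1 ≤_) (sym (g≥2 l)) 1≤T) ,
          (λ ¬l → subst (1 ≤_) (sym (g<2 ¬l)) (s-pos e∈ t λ bg → ne (#≤1-unique (s≤s⁻¹ (≰⇒> ¬l)) (∩⁺ bg (∈at (label-at e∈ t))) (∩⁺ j∈ (∈at v∈))))) ]′ (toSum (2 ≤? b v))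
        end : ∀ {e v} → e ∈ Ω → Touches true v e → lab e ≢ j → v ∈ ∂ ∪ (A ∖ V true j)
        end {e} {v} e∈ t ne = [ (λ v∈ → ∪ˡ (∩⁺ v∈ (good (g≥1 e∈ t ne v∈)))) , (λ v∉ → ∪ʳ (∖⁺ (∈supp e∈ t) v∉)) ]′ (toSum (v ∈? V true j))
        inside : ∀ {u v} → (u , v) ∈ img true Ω → (u ∈ V true j × v ∈ V true j) ⊎ (u ∈ ∂ ∪ (A ∖ V true j) × v ∈ ∂ ∪ (A ∖ V true j))
        inside z = split (∈img⁻ z)
          where
          split : ∀ {u v} → (∃ λ e → e ∈ Ω × p true e ≡ u × q true e ≡ v) → (u ∈ V true j × v ∈ V true j) ⊎ (u ∈ ∂ ∪ (A ∖ V true j) × v ∈ ∂ ∪ (A ∖ V true j))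
          split (e , e∈ , refl , refl) = decide (lab e Fin.≟ j)
            where
            decide : Dec (lab e ≡ j) → (p true e ∈ V true j × q true e ∈ V true j) ⊎ (p true e ∈ ∂ ∪ (A ∖ V true j) × q true e ∈ ∂ ∪ (A ∖ V true j))
            decide (yes h) = inj₁ (subst (λ i → p true e ∈ V true i) h (label-at e∈ (inj₁ refl)) , subst (λ i → q true e ∈ V true i) h (label-at e∈ (inj₂ refl)))
            decide (no ne) = inj₂ (end e∈ (inj₁ refl) ne , end e∈ (inj₂ refl) ne)
      gain (inj₁ all) = lowest (Fin.any? (λ v → (v ∈? V true j) ×-dec (g v <? T)))
        where
        lowest : Dec (∃ λ v → v ∈ V true j × g v < T) → 2 * (T * τ) ≤ wt g (V true j)
        lowest (no ¬p) = ≤-trans (≤-trans (≤-trans (≤-reflexive (e T τ)) (*-monoˡ-≤ T (≤-trans (*-monoˡ-≤ τ {2} {16} (≤ᵇ⇒≤ 2 16 _)) (≤-trans 16τ≤h (<⇒≤ (big-size j∈))))))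
                  (≤-reflexive (sym (wt-const T (V true j))))) (wt-monoʷ λ v∈ → ≮⇒≥ λ l → ¬p (_ , v∈ , l))
          where
          e : ∀ T τ → 2 * (T * τ) ≡ 2 * τ * T
          e = solve-∀
        lowest (yes (v , v∈ , l)) = ≤-trans (+-cancelʳ-≤ T _ _ (≤-trans (≤-trans (≤-reflexive (+-comm _ T)) (+-monoˡ-≤ (2 * (T * τ)) (m≤m+n T _)))
                  (≤-trans κ-large (≤-trans (min-degree (V⊆A v∈)) split))))
                  (≤-trans (≤-reflexive (#≡wt (V true j))) (wt-monoʷ λ x → ∈⟪⟫⁻ (λ v → 1 ≤? g v) (all x)))
          where
          ¬2 : ¬ (2 ≤ b v)
          ¬2 l2 = <-irrefl (g≥2 l2) l
          s<T : s v < T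
          s<T = subst (_< T) (g<2 ¬2) l
          split : # (nbr v) ≤ # (V true j) + T
          split = ≤-trans (≤-reflexive (#-∖ (nbr v) (V true j))) (#-mono ∩ʳ ⊕ ≤-trans (small-nbrs {nbr v ∖ V true j} λ u → ∖ˡ u , λ e∈ tu tv bg →
            ∖ʳ u (subst (λ i → _ ∈ V true i) (#≤1-unique (s≤s⁻¹ (≰⇒> ¬2)) (∩⁺ bg (∈at (label-at e∈ tv))) (∩⁺ j∈ (∈at v∈))) (label-at e∈ tu))) (<⇒≤ s<T))

    heavy : Heavy A full
    heavy = *-cancelˡ-< 2 _ _ (contraposition final)
      where
      sizes : Fin m → ℕ
      sizes j = # (V true j)
      Wb Ws : ℕ
      Wb = wt w big
      Ws = wt w sm
      wtfull : wt w full ≡ Wb + Ws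
      wtfull = trans (wt-∖ w full big) (cong (_+ Ws) (≤-antisym (wt-mono w ∩ʳ) (wt-mono w λ x → ∩⁺ ∈full x)))
      bigs : Wb + # big * (T * τ) ≡ T * wt sizes big
      bigs = trans (cong (Wb +_) (sym (wt-const (T * τ) big))) (trans (sym (wt-+ w (λ _ → T * τ) big))
        (trans (wt-Sum _ big) (trans (Sum-cong pt) (trans (Sum-*ˡ T _) (cong (T *_) (sym (wt-Sum sizes big)))))))
        where
        pt : ∀ j → ⟦ big j ⟧ * (w j + T * τ) ≡ T * (⟦ big j ⟧ * sizes j)
        pt j = [ (λ j∈ → trans (term-∈ {X = big} _ j∈) (trans (big-full j∈) (cong (T *_) (sym (term-∈ {X = big} _ j∈)))))
               , (λ j∉ → trans (term-∉ {X = big} _ j∉) (trans (sym (*-zeroʳ T)) (cong (T *_) (sym (term-∉ {X = big} _ j∉))))) ]′ (toSum (j ∈? big))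
      inc : wt b A ≡ wt sizes big
      inc = trans (wt-Sum b A) (trans (Sum-cong λ v → cong (⟦ A v ⟧ *_) (sym (*-identityʳ (b v)))) (trans (sym (wt-Sum _ A))
        (trans (incidence (hyper true) {A} {big} (λ _ → 1) (λ _ → V⊆A)) (≤-antisym (wt-monoʷ λ {j} _ → ≤-reflexive (sym (#≡wt (V true j)))) (wt-monoʷ λ {j} _ → ≤-reflexive (#≡wt (V true j)))))))
      final : # A * (2 * T) + # big * (2 * (T * τ)) ≤ Ws + Ws + 2 * T * wt sizes big
      final = begin
        # A * (2 * T) + # big * (2 * (T * τ))         ≡⟨ cong₂ _+_ (sym (wt-const (2 * T) A)) (sym (wt-const (2 * (T * τ)) big)) ⟩
        wt (λ _ → 2 * T) A + wt (λ _ → 2 * (T * τ)) big ≤⟨ +-monoʳ-≤ (wt (λ _ → 2 * T) A) (wt-monoʷ {w' = λ j → wt g (V true j)} {big} big-gain) ⟩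
        wt (λ _ → 2 * T) A + wt (λ j → wt g (V true j)) big ≡⟨ cong (wt (λ _ → 2 * T) A +_) (sym (incidence (hyper true) {A} {big} g (λ _ → V⊆A))) ⟩
        wt (λ _ → 2 * T) A + wt (λ v → b v * g v) A   ≡⟨ wt-+ _ _ A ⟨
        wt (λ v → 2 * T + b v * g v) A                ≤⟨ wt-monoʷ {X = A} pointwise ⟩
        wt (λ v → s v + 2 * T * b v) A                ≡⟨ wt-+ s _ A ⟩
        wt s A + wt (λ v → 2 * T * b v) A             ≤⟨ handshake (hyper true) A sm⁻ ⊕ ≤-reflexive scale ⟩
        Ws + Ws + 2 * T * wt b A                      ≡⟨ cong (λ x → Ws + Ws + 2 * T * x) inc ⟩
        Ws + Ws + 2 * T * wt sizes big                ∎
        where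
        open ≤-Reasoning
        scale : wt (λ v → 2 * T * b v) A ≡ 2 * T * wt b A
        scale = trans (wt-Sum _ A) (trans (Sum-cong λ v → e ⟦ A v ⟧ (2 * T) (b v)) (trans (Sum-*ˡ (2 * T) _) (cong (2 * T *_) (sym (wt-Sum b A)))))
          where
          e : ∀ a t b → a * (t * b) ≡ t * (a * b)
          e = solve-∀
      contraposition : # A * (2 * T) + # big * (2 * (T * τ)) ≤ Ws + Ws + 2 * T * wt sizes big → 2 * (T * # A) < 2 * (wt w full + T * τ)
      contraposition f = lin (1 + (T * τ + T * τ ∸ 2)) (f ⊕ ≤-reflexive (cong (2 *_) (sym bigs)) ⊕ ≤-reflexive (cong (2 *_) (sym wtfull)))
        (trans (e₁ (# A) T (# big) τ Ws Wb (wt sizes big) (wt w full) (T * τ + T * τ ∸ 2)) (trans (cong (λ x → x + (2 * (T * # A) + Ws + Ws + 2 * T * wt sizes big + 2 * (Wb + # big * (T * τ)) + 2 * wt w full))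
            (m∸n+n≡m {T * τ + T * τ} {2} (1≤Tτ ⊕ 1≤Tτ)))
          (e₂ (# A) T (# big) τ Ws Wb (wt sizes big) (wt w full))))
        where
        1≤Tτ : 1 ≤ T * τ
        1≤Tτ = *-mono-≤ 1≤T 1≤τ
        e₁ : ∀ a T n τ Ws Wb S W x → suc (2 * (T * a)) + (Ws + Ws + 2 * T * S + 2 * (Wb + n * (T * τ)) + 2 * W) + (1 + x)
             ≡ x + 2 + (2 * (T * a) + Ws + Ws + 2 * T * S + 2 * (Wb + n * (T * τ)) + 2 * W)
        e₁ = solve-∀
        e₂ : ∀ a T n τ Ws Wb S W → T * τ + T * τ + (2 * (T * a) + Ws + Ws + 2 * T * S + 2 * (Wb + n * (T * τ)) + 2 * W)
             ≡ 2 * (W + T * τ) + (a * (2 * T) + n * (2 * (T * τ)) + 2 * (T * S) + 2 * (Wb + Ws))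
        e₂ = solve-∀

#-⊆⊇ : ∀ {n} {X Y : Fin n → Bool} → X ⊆ Y → Y ⊆ X → # X ≡ # Y
#-⊆⊇ h k = ≤-antisym (#-mono h) (#-mono k)

module Merge {P N} {GR : GraphRank P N} (free : GraphRank.Free GR) {TG : TwoGraphs GR} (C : Classes TG)
             (M : Merging.Mergeable free C) where
  open Parameters P
  open GraphRank GR
  open TwoGraphs TG
  open Classes C
  open Merging.Mergeable M

  lab' : Fin m → Fin m
  lab' e with lab e ∈? Y
  ... | yes _ = j₀
  ... | no _ = lab e

  lab'-in : ∀ {e} → lab e ∈ Y → lab' e ≡ j₀
  lab'-in {e} y with lab e ∈? Y
  ... | yes _ = refl
  ... | no ¬y = ⊥-elim (¬y y)

  lab'-out : ∀ {e} → lab e ∉ Y → lab' e ≡ lab e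
  lab'-out {e} ¬y with lab e ∈? Y
  ... | yes y = ⊥-elim (¬y y)
  ... | no _ = refl

  big' : Fin m → Bool
  big' = ⁅ j₀ ⁆ ∪ (big ∖ Y)

  E' : Fin m → Fin m → Bool
  E' j = Ω ∩ fib lab' j

  E'⊆edges : E' j₀ ⊆ edges Y
  E'⊆edges {e} r = [ ∈edges (∩ˡ r) , (λ ¬y → ⊥-elim (¬y (subst (_∈ Y) (sym (trans (sym (lab'-out ¬y)) (∈fib⁻ (∩ʳ r)))) j₀∈))) ]′ (toSum (lab e ∈? Y))

  edges⊆E' : edges Y ⊆ E' j₀
  edges⊆E' r = ∩⁺ (∩ˡ r) (∈fib (lab'-in (∈edges-lab r)))

  E'⊆E : ∀ {j} → j ≢ j₀ → E' j ⊆ E j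
  E'⊆E {j} ne {e} r = [ (λ y → ⊥-elim (ne (trans (sym (∈fib⁻ (∩ʳ r))) (lab'-in y)))) , (λ ¬y → ∩⁺ (∩ˡ r) (∈fib (trans (sym (lab'-out ¬y)) (∈fib⁻ (∩ʳ r))))) ]′ (toSum (lab e ∈? Y))

  E⊆E' : ∀ {j} → j ∉ Y → E j ⊆ E' j
  E⊆E' {j} j∉ {e} r = ∩⁺ (∩ˡ r) (∈fib (trans (lab'-out λ y → j∉ (subst (_∈ Y) (∈fib⁻ (∩ʳ r)) y)) (∈fib⁻ (∩ʳ r))))

  supp-cong : ∀ {X X' : Fin m → Bool} σ → X ⊆ X' → X' ⊆ X → # (supp σ X) ≡ # (supp σ X')
  supp-cong σ h k = #-⊆⊇ (λ x → let e , e∈ , t = ∈supp⁻ x in ∈supp (h e∈) t) (λ x → let e , e∈ , t = ∈supp⁻ x in ∈supp (k e∈) t)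

  big'-cases : ∀ {j} → j ∈ big' → (j ≡ j₀) ⊎ (j ∈ big × j ∉ Y × j ≢ j₀)
  big'-cases b with ∪⁻ b
  ... | inj₁ x = inj₁ (sym (∈⁅⁆⁻ x))
  ... | inj₂ x = inj₂ (∖ˡ x , ∖ʳ x , λ { refl → ∖ʳ x j₀∈ })

  module _ {j} (b : j ∈ big × j ∉ Y × j ≢ j₀) where
    same-class : ∀ σ → # (supp σ (E j)) ≡ # (supp σ (E' j))
    same-class σ = supp-cong σ (E⊆E' (proj₁ (proj₂ b))) (E'⊆E (proj₂ (proj₂ b)))

  new-class : ∀ σ → # (supp σ (edges Y)) ≡ # (supp σ (E' j₀))
  new-class σ = supp-cong σ edges⊆E' E'⊆edges

  merged : Classes TG
  merged = record
    { Ω = Ω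
    ; lab = lab'
    ; big = big'
    ; small-lab = λ {e} e∈ ¬b → [ (λ y → ⊥-elim (¬b (∪ˡ (subst (_∈ ⁅ j₀ ⁆) (sym (lab'-in y)) (∈⁅⁆ j₀)))))
        , (λ ¬y → trans (lab'-out ¬y) (small-lab e∈ λ b → ¬b (∪ʳ (subst (_∈ (big ∖ Y)) (sym (lab'-out ¬y)) (∖⁺ b ¬y))))) ]′ (toSum (lab e ∈? Y))
    ; big-size = λ b → size' (big'-cases b)
    ; big-same = λ b → same' (big'-cases b)
    ; big-rigid = λ b → rigid' (big'-cases b) }
    where
    size' : ∀ {j} → (j ≡ j₀) ⊎ (j ∈ big × j ∉ Y × j ≢ j₀) → h < # (supp true (E' j))
    size' (inj₁ refl) = subst (h <_) (new-class true) size
    size' (inj₂ b) = subst (h <_) (same-class b true) (big-size (proj₁ b))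
    same' : ∀ {j} → (j ≡ j₀) ⊎ (j ∈ big × j ∉ Y × j ≢ j₀) → # (supp true (E' j)) ≡ # (supp false (E' j))
    same' (inj₁ refl) = trans (sym (new-class true)) (trans same (new-class false))
    same' (inj₂ b) = trans (sym (same-class b true)) (trans (big-same (proj₁ b)) (same-class b false))
    rigid' : ∀ {j} → (j ≡ j₀) ⊎ (j ∈ big × j ∉ Y × j ≢ j₀) → ρ (# (supp true (E' j))) ≤ rM (E' j)
    rigid' (inj₁ refl) = subst (λ a → ρ a ≤ rM (E' j₀)) (new-class true) (≤-trans rigidY (rM-mono edges⊆E'))
    rigid' {j} (inj₂ b) = subst (λ a → ρ a ≤ rM (E' j)) (same-class b true) (≤-trans (big-rigid (proj₁ b)) (rM-mono (E⊆E' (proj₁ (proj₂ b)))))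

used : ∀ {P N} {GR : GraphRank P N} {TG : TwoGraphs GR} (C : Classes TG) → Fin (TwoGraphs.m TG) → Bool
used C = ⟪ (λ j → Fin.any? λ e → e ∈? Classes.E C j) ⟫

module _ {P N} {GR : GraphRank P N} (free : GraphRank.Free GR) {TG : TwoGraphs GR} (C : Classes TG)
         (M : Merging.Mergeable free C) where
  open Merge free C M
  open Classes C using (E; edges; ∈edges-lab)
  open Merging.Mergeable M

  used⁺ : ∀ (C : Classes TG) {j} → (∃ λ e → e ∈ Classes.E C j) → j ∈ used C
  used⁺ C = ∈⟪⟫ (λ j → Fin.any? λ e → e ∈? Classes.E C j)

  used⁻ : ∀ (C : Classes TG) {j} → j ∈ used C → ∃ λ e → e ∈ Classes.E C j
  used⁻ C = ∈⟪⟫⁻ (λ j → Fin.any? λ e → e ∈? Classes.E C j)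

  merged-fewer : # (used merged) < # (used C)
  merged-fewer = #-strict sub (used⁺ C used₁) gone
    where
    sub : used merged ⊆ used C
    sub {j} u with used⁻ merged u | j Fin.≟ j₀
    ... | _ | yes refl = used⁺ C used₀
    ... | e , e∈ | no ne = used⁺ C (e , E'⊆E ne e∈)
    gone : j₁ ∉ used merged
    gone u with used⁻ merged u
    ... | e , e∈ with E'⊆E (j₀≢j₁ ∘ sym) e∈
    ...   | r = j₀≢j₁ (trans (sym (lab'-in (subst (_∈ Y) (sym (∈fib⁻ (∩ʳ r))) j₁∈))) (∈fib⁻ (∩ʳ e∈)))

module BirigidSubgraph {P N} {GR : GraphRank P N} (free : GraphRank.Free GR) (TG : TwoGraphs GR) (Ω : Fin (TwoGraphs.m TG) → Bool)
             (κ : ℕ) (κ-large : 2 * Parameters.T P + 2 * (Parameters.T P * Parameters.τ P) ≤ κ)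
             (connected : ConnectedE κ (TwoGraphs.supp TG true Ω) (TwoGraphs.img TG true Ω))
             (κ<A : κ < # (TwoGraphs.supp TG true Ω)) where
  open Parameters P
  open GraphRank GR
  open TwoGraphs TG
  open CoreI free TG Ω κ κ-large connected κ<A

  singletons : Classes TG
  singletons = record
    { Ω = Ω ; lab = id ; big = ∅ ; small-lab = λ _ _ → refl
    ; big-size = ∅⁻ ; big-same = ∅⁻ ; big-rigid = ∅⁻ }

  go : ∀ n (C : Classes TG) → Classes.Ω C ≡ Ω → # (used C) ≤ n → Cl (Birigid TG Ω)
  go n C Ω≡ l with Fin.any? (λ j → (j ∈? Classes.big C) ×-dec (# A ≤? # (Classes.V C true j)))
  ... | yes (j , j∈ , le) = ret record
          { B = Classes.E C j ; B⊆ = λ r → subst (_ ∈_) Ω≡ (∩ˡ r) ; spans = le ; same = Classes.big-same C j∈ ; rigidB = Classes.big-rigid C j∈ }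
  ... | no ¬p = Merging.find free C _ {true} {A} {full} ≤-refl (λ _ → Count.V⊆A C Ω≡ (λ j∈ → ≰⇒> λ le → ¬p (_ , j∈ , le)))
                  (≤-trans (≤-trans (*-monoˡ-≤ τ {2} {32} (≤ᵇ⇒≤ 2 32 _)) 32τ≤T) (≤-trans (≤-trans (m≤m+n T _) (≤-trans (m≤m+n _ _) κ-large)) (<⇒≤ κ<A)))
                  (Count.heavy C Ω≡ (λ j∈ → ≰⇒> λ le → ¬p (_ , j∈ , le)))
                >>= next n l
    where
    next : ∀ n → # (used C) ≤ n → Merging.Mergeable free C → Cl (Birigid TG Ω)
    next zero l M = ⊥-elim (<⇒≱ (merged-fewer free C M) (≤-trans l z≤n))
    next (suc n) l M = go n (Merge.merged free C M) Ω≡ (s≤s⁻¹ (≤-trans (merged-fewer free C M) l))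

  birigid : Cl (Birigid TG Ω)
  birigid = go _ singletons refl ≤-refl

module StarsI {P N} {GR : GraphRank P N} (free : GraphRank.Free GR) (TG : TwoGraphs GR)
             (κ : ℕ) (κ-large : 2 * Parameters.T P + 2 * (Parameters.T P * Parameters.τ P) ≤ κ)
             (connected : ConnectedE (suc κ) (TwoGraphs.supp TG true full) (TwoGraphs.img TG true full))
             (κ<A : suc κ < # (TwoGraphs.supp TG true full)) where
  open Parameters P
  open GraphRank GR
  open TwoGraphs TG

  private
    A : Fin N → Bool
    A = supp true full

    avoiding : Fin N → Fin m → Bool
    avoiding v = ⟪ (λ e → ¬? (touches? true v e)) ⟫

    avoiding⁻ : ∀ {v e} → e ∈ avoiding v → ¬ Touches true v e
    avoiding⁻ {v} = ∈⟪⟫⁻ (λ e → ¬? (touches? true v e))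

    avoiding⁺ : ∀ {v e} → ¬ Touches true v e → e ∈ avoiding v
    avoiding⁺ {v} = ∈⟪⟫ (λ e → ¬? (touches? true v e))

    1≤κ : 1 ≤ κ
    1≤κ = ≤-trans (≤-trans 1≤τ (≤-trans (m≤m+n τ (31 * τ)) 32τ≤T)) (≤-trans (m≤m+n T _) (≤-trans (m≤m+n _ _) κ-large))

    end∈A : ∀ {e v} → Touches true v e → v ∈ A
    end∈A t = ∈supp ∈full t

    supp-avoiding⊆ : ∀ {v} → supp true (avoiding v) ⊆ A ∖ ⁅ v ⁆
    supp-avoiding⊆ {v} x with ∈supp⁻ x
    ... | e , e∈ , t = ∖⁺ (end∈A t) λ r → avoiding⁻ e∈ (subst (λ y → Touches true y e) (sym (∈⁅⁆⁻ r)) t)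

    third : ∀ u v → ∃ λ x → x ∈ A × x ∉ ⁅ u ⁆ ∪ ⁅ v ⁆
    third u v = #<⇒∃ (⁅ u ⁆ ∪ ⁅ v ⁆) A (≤-trans (s≤s (≤-trans (#-add≤ ⁅ u ⁆ v) (s≤s (≤-reflexive (#-⁅⁆ u))))) (≤-trans (s≤s (s≤s 1≤κ)) κ<A))

    supp-avoiding⊇ : ∀ {v} → A ∖ ⁅ v ⁆ ⊆ supp true (avoiding v)
    supp-avoiding⊇ {v} {u} r = stable (u ∈? supp true (avoiding v)) λ u∉ →
      <⇒≱ (s≤s (≤-trans (≤-trans (#-mono {Y = ⁅ v ⁆} λ s → [ (λ x → ⊥-elim (∖ʳ (∩ʳ s) x)) , id ]′ (∪⁻ (∩ˡ s))) (≤-reflexive (#-⁅⁆ v))) 1≤κ))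
        (connected ((λ {y} y∈ → cover y∈ (u Fin.≟ y)) , (λ s → [ (λ x → ⁅⁆-⊆ (∖ˡ r) x) , (λ x → v∈A u∉ x) ]′ (∪⁻ s)) , ∖ˡ , inside u∉ ,
          (u , ∖ˡ r , λ s → ∖ʳ s (∈⁅⁆ u)) , third u v))
      where
      cover : ∀ {y} → y ∈ A → Dec (u ≡ y) → y ∈ (⁅ u ⁆ ∪ ⁅ v ⁆) ∪ (A ∖ ⁅ u ⁆)
      cover y∈ (yes refl) = ∪ˡ (∪ˡ (∈⁅⁆ u))
      cover y∈ (no ¬e) = ∪ʳ (∖⁺ y∈ (¬e ∘ ∈⁅⁆⁻))
      edge : u ∉ supp true (avoiding v) → ∀ {e} → Touches true u e → Touches true v e
      edge u∉ {e} t = stable (touches? true v e) λ ¬t → u∉ (∈supp (avoiding⁺ ¬t) t)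
      v∈A : u ∉ supp true (avoiding v) → ∀ {x} → x ∈ ⁅ v ⁆ → x ∈ A
      v∈A u∉ x with ∈supp⁻ (∖ˡ r)
      ... | e , _ , t = ⁅⁆-⊆ (end∈A (edge u∉ t)) x
      inside : u ∉ supp true (avoiding v) → ∀ {x y} → (x , y) ∈ img true full →
        (x ∈ ⁅ u ⁆ ∪ ⁅ v ⁆ × y ∈ ⁅ u ⁆ ∪ ⁅ v ⁆) ⊎ (x ∈ A ∖ ⁅ u ⁆ × y ∈ A ∖ ⁅ u ⁆)
      inside u∉ z with ∈img⁻ z
      ... | e , _ , refl , refl with u Fin.≟ p true e | u Fin.≟ q true e
      ...   | no a | no b = inj₂ (∖⁺ (end∈A (inj₁ refl)) (a ∘ ∈⁅⁆⁻) , ∖⁺ (end∈A (inj₂ refl)) (b ∘ ∈⁅⁆⁻))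
      ...   | yes refl | _ with edge u∉ {e} (inj₁ refl)
      ...     | inj₁ refl = ⊥-elim (∖ʳ r (∈⁅⁆ v))
      ...     | inj₂ refl = inj₁ (∪ˡ (∈⁅⁆ u) , ∪ʳ (∈⁅⁆ v))
      inside u∉ z | e , _ , refl , refl | no _ | yes refl with edge u∉ {e} (inj₂ refl)
      ...     | inj₁ refl = inj₁ (∪ʳ (∈⁅⁆ v) , ∪ˡ (∈⁅⁆ u))
      ...     | inj₂ refl = ⊥-elim (∖ʳ r (∈⁅⁆ v))

    connected-avoiding : ∀ {v} → v ∈ A → ConnectedE κ (supp true (avoiding v)) (img true (avoiding v))
    connected-avoiding {v} v∈ {A₁} {A₂} (A⊆ , A₁⊆ , A₂⊆ , inside , (u , u∈ , u∉) , (y , y∈ , y∉)) =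
      s≤s⁻¹ (≤-trans (connected {A₁ ∪ ⁅ v ⁆} {A₂ ∪ ⁅ v ⁆}
        ( (λ {x} x∈ → cover x∈ (v Fin.≟ x)) , ∪-⊆ (in-A ∘ A₁⊆) (⁅⁆-⊆ v∈) , ∪-⊆ (in-A ∘ A₂⊆) (⁅⁆-⊆ v∈) , inside'
        , (u , in-A u∈ , λ r → [ u∉ , (λ s → ∖ʳ (supp-avoiding⊆ u∈) s) ]′ (∪⁻ r)) , (y , in-A y∈ , λ r → [ y∉ , (λ s → ∖ʳ (supp-avoiding⊆ y∈) s) ]′ (∪⁻ r))))
        (≤-trans (#-mono {Y = (A₁ ∩ A₂) ∪ ⁅ v ⁆} λ r → both (∪⁻ (∩ˡ r)) (∪⁻ (∩ʳ r))) (#-add≤ (A₁ ∩ A₂) v)))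
      where
      in-A : supp true (avoiding v) ⊆ A
      in-A x = ∖ˡ (supp-avoiding⊆ x)
      both : ∀ {x} → x ∈ A₁ ⊎ x ∈ ⁅ v ⁆ → x ∈ A₂ ⊎ x ∈ ⁅ v ⁆ → x ∈ (A₁ ∩ A₂) ∪ ⁅ v ⁆
      both (inj₁ a) (inj₁ b) = ∪ˡ (∩⁺ a b)
      both (inj₂ a) _ = ∪ʳ a
      both _ (inj₂ b) = ∪ʳ b
      cover : ∀ {x} → x ∈ A → Dec (v ≡ x) → x ∈ (A₁ ∪ ⁅ v ⁆) ∪ (A₂ ∪ ⁅ v ⁆)
      cover x∈ (yes refl) = ∪ˡ (∪ʳ (∈⁅⁆ v))
      cover x∈ (no ¬e) = [ ∪ˡ ∘ ∪ˡ , ∪ʳ ∘ ∪ˡ ]′ (∪⁻ (A⊆ (supp-avoiding⊇ (∖⁺ x∈ (¬e ∘ ∈⁅⁆⁻)))))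
      side : ∀ {x} → x ∈ A → x ∈ A₁ ∪ ⁅ v ⁆ ⊎ x ∈ A₂ ∪ ⁅ v ⁆
      side {x} x∈ = ∪⁻ (cover x∈ (v Fin.≟ x))
      inside' : ∀ {x z} → (x , z) ∈ img true full → (x ∈ A₁ ∪ ⁅ v ⁆ × z ∈ A₁ ∪ ⁅ v ⁆) ⊎ (x ∈ A₂ ∪ ⁅ v ⁆ × z ∈ A₂ ∪ ⁅ v ⁆)
      inside' k with ∈img⁻ k
      ... | e , _ , refl , refl with touches? true v e
      ...   | no ¬t = [ (λ { (a , b) → inj₁ (∪ˡ a , ∪ˡ b) }) , (λ { (a , b) → inj₂ (∪ˡ a , ∪ˡ b) }) ]′ (inside (∈img (avoiding⁺ ¬t)))
      ...   | yes (inj₁ refl) = [ (λ b → inj₁ (∪ʳ (∈⁅⁆ v) , b)) , (λ b → inj₂ (∪ʳ (∈⁅⁆ v) , b)) ]′ (side (end∈A {e} (inj₂ refl)))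
      ...   | yes (inj₂ refl) = [ (λ b → inj₁ (b , ∪ʳ (∈⁅⁆ v))) , (λ b → inj₂ (b , ∪ʳ (∈⁅⁆ v))) ]′ (side (end∈A {e} (inj₁ refl)))

    #avoiding : ∀ {v} → v ∈ A → suc (# (supp true (avoiding v))) ≡ # A
    #avoiding {v} v∈ = trans (cong suc (#-⊆⊇ supp-avoiding⊆ supp-avoiding⊇)) (sym (#-del A v∈))

    weaken : ConnectedE κ A (img true full)
    weaken s = ≤-trans (n≤1+n κ) (connected s)

  Star : Fin N → Set
  Star v = ∃ λ x → ∀ e → (Touches true v e → Touches false x e) × (Touches false x e → Touches true v e)

  star : Birigid TG full → ∀ {v} → v ∈ A → Birigid TG (avoiding v) → Star v
  star F {v} v∈ D = found (#<⇒∃ DH BH (≤-reflexive (sym #BH)))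
    where
    module F = Birigid F
    module D = Birigid D
    BH DH : Fin N → Bool
    BH = supp false F.B
    DH = supp false D.B
    supp⊆ : ∀ {σ X Y} → X ⊆ Y → supp σ X ⊆ supp σ Y
    supp⊆ h r = let e , e∈ , t = ∈supp⁻ r in ∈supp (h e∈) t
    in-BH : supp false full ⊆ BH
    in-BH {y} r with ∈supp⁻ r
    ... | e , _ , t = stable (y ∈? BH) λ y∉ → <⇒≱ (rM-pendant free false (λ _ → ∈full) y∉ ∈full t)
          (≤-trans (rM≤ρ true {full} {A} id) (≤-trans (≤-reflexive (cong ρ (≤-antisym F.spans (#-mono (supp⊆ λ _ → ∈full))))) F.rigidB))
    #D : # (supp true D.B) ≡ # (supp true (avoiding v))
    #D = ≤-antisym (#-mono (supp⊆ D.B⊆)) D.spans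
    DH⊆BH : DH ⊆ BH
    DH⊆BH r = in-BH (supp⊆ (λ _ → ∈full) r)
    #BH : # BH ≡ suc (# DH)
    #BH = trans (sym F.same) (trans (≤-antisym (#-mono (supp⊆ λ _ → ∈full)) F.spans) (trans (sym (#avoiding v∈)) (cong suc (trans (sym #D) D.same))))
    supp-add : ∀ {σ e S} → supp σ D.B ⊆ S → (∀ {y} → Touches σ y e → y ∈ S) → supp σ (D.B ∪ ⁅ e ⁆) ⊆ S
    supp-add {σ} h k r with ∈supp⁻ r
    ... | f , f∈ , t with ∪⁻ f∈
    ...   | inj₁ g = h (∈supp g t)
    ...   | inj₂ g = k (subst (Touches σ _) (sym (∈⁅⁆⁻ g)) t)
    found : (∃ λ x → x ∈ BH × x ∉ DH) → Star v
    found (x , x∈ , x∉) = x , λ e → to , from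
      where
      rest : ∀ {y} → y ∈ BH → y ≢ x → y ∈ DH
      rest {y} y∈ ne = [ id , (λ r → ⊥-elim (ne (sym (∈⁅⁆⁻ r)))) ]′
        (∪⁻ (⊆-#-⊇ {X = DH ∪ ⁅ x ⁆} {BH} (∪-⊆ DH⊆BH (⁅⁆-⊆ x∈)) (≤-reflexive (trans #BH (sym (#-add DH x∉)))) y∈))
      to : ∀ {e} → Touches true v e → Touches false x e
      to {e} t = stable (touches? false x e) λ ¬t → <⇒≱ (rM-pendant free true ∪ˡ (λ r → ∖ʳ (supp-avoiding⊆ (supp⊆ D.B⊆ r)) (∈⁅⁆ v)) (∪ʳ (∈⁅⁆ e)) t)
        (≤-trans (rM≤ρ false {D.B ∪ ⁅ e ⁆} {DH} (supp-add id λ {y} s → rest (in-BH (∈supp ∈full s)) λ { refl → ¬t s }))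
          (≤-trans (≤-reflexive (cong ρ (sym D.same))) D.rigidB))
      from : ∀ {e} → Touches false x e → Touches true v e
      from {e} t = stable (touches? true v e) λ ¬t → <⇒≱ (rM-pendant free false ∪ˡ x∉ (∪ʳ (∈⁅⁆ e)) t)
        (≤-trans (rM≤ρ true {D.B ∪ ⁅ e ⁆} {supp true (avoiding v)} (supp-add {true} {e} {supp true (avoiding v)} (supp⊆ {true} {D.B} {avoiding v} D.B⊆) (λ {y} s → ∈supp {true} {avoiding v} {y} {e} (avoiding⁺ ¬t) s)))
          (≤-trans (≤-reflexive (cong ρ (sym #D))) D.rigidB))

  stars : Cl (∀ v → v ∈ A → Star v)
  stars = BirigidSubgraph.birigid free TG full κ κ-large weaken (≤-trans (n≤1+n _) κ<A) >>= λ F →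
    Cl-Fin λ v → case v (v ∈? A) F
    where
    case : ∀ v → Dec (v ∈ A) → Birigid TG full → Cl (v ∈ A → Star v)
    case v (no v∉) F = ret λ v∈ → ⊥-elim (v∉ v∈)
    case v (yes v∈) F = BirigidSubgraph.birigid free TG (avoiding v) κ κ-large (connected-avoiding v∈)
      (s≤s⁻¹ (≤-trans κ<A (≤-reflexive (sym (#avoiding v∈))))) >>= λ D → ret λ _ → star F v∈ D

#-cover-by : ∀ {n m} {X : Fin m → Bool} (S : Fin n → Bool) (F : Fin n → Fin m → Bool) {d} →
  (∀ {x} → x ∈ X → ∃ λ s → s ∈ S × x ∈ F s) → (∀ {s} → s ∈ S → # (F s) ≤ d) → # X ≤ # S * d
#-cover-by {n} {m} S F {d} cov small = ≤-trans (#-cover F' (λ x∈ → let s , s∈ , h = cov x∈ in s , F'⁺ (s∈ , h)))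
    (≤-trans (Sum-mono pt) (≤-reflexive (trans (sym (wt-Sum (λ _ → d) S)) (wt-const d S))))
  where
  F' : Fin n → Fin m → Bool
  F' s = ⟪ (λ x → (s ∈? S) ×-dec (x ∈? F s)) ⟫
  F'⁺ : ∀ {s x} → s ∈ S × x ∈ F s → x ∈ F' s
  F'⁺ {s} = ∈⟪⟫ (λ x → (s ∈? S) ×-dec (x ∈? F s))
  F'⁻ : ∀ {s x} → x ∈ F' s → s ∈ S × x ∈ F s
  F'⁻ {s} = ∈⟪⟫⁻ (λ x → (s ∈? S) ×-dec (x ∈? F s))
  pt : ∀ s → # (F' s) ≤ ⟦ S s ⟧ * d
  pt s = [ (λ s∈ → ≤-trans (#-mono λ x → proj₂ (F'⁻ x)) (≤-trans (small s∈) (≤-reflexive (sym (term-∈ {X = S} d s∈)))))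
         , (λ s∉ → ≤-trans (≮⇒≥ λ l → s∉ (proj₁ (F'⁻ (proj₂ (#-pos l))))) z≤n) ]′ (toSum (s ∈? S))

-- Rank functions of bounded rank in which stars, but no other large sets, have small rank.

module _ {N : ℕ} where
  Joins : ESet N → Fin N → Fin N → Set
  Joins X u v = (u , v) ∈ X ⊎ (v , u) ∈ X

  Scattered : ℕ → ESet N → Set
  Scattered t X = ∀ T → # T ≤ t → ∃ λ u → ∃ λ v → (u , v) ∈ X × u ≢ v × u ∉ T × v ∉ T

  BigStar : ℕ → Fin N → ESet N → Set
  BigStar d x X = Σ (Fin N → Bool) λ Y → d ≤ # Y × (∀ {y} → y ∈ Y → y ≢ x × Joins X x y)

  StarAt : Fin N → ESet N → Set
  StarAt x X = ∀ {u v} → (u , v) ∈ X → u ≢ v → x ≡ u ⊎ x ≡ v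

record Stellar {N : ℕ} (R : ESet N → ℕ) (t d b : ℕ) : Set where
  field
    s top : ℕ
    s<top : s < top
    s≤b : s ≤ b
    scattered : ∀ {X} → Scattered t X → top ≤ R X
    big-star : ∀ {x X} → BigStar d x X → s ≤ R X
    not-star : ∀ {x X u v} → BigStar d x X → (u , v) ∈ X → u ≢ v → x ≢ u → x ≢ v → s < R X
    star : ∀ {x X} → StarAt x X → R X ≤ s

Stellar-Sum : ∀ {k N t d b} (R : Fin (suc k) → ESet N → ℕ) → (∀ i → Stellar (R i) t d b) →
  Stellar (λ X → Sum (λ i → R i X)) t d (suc k * b)
Stellar-Sum {k} {b = b} R S = record
  { s = Sum s ; top = Sum top
  ; s<top = Sum-strict (λ i → <⇒≤ (s<top i)) zero (s<top zero)
  ; s≤b = ≤-trans (Sum-mono s≤b) (≤-reflexive (Sum-const {suc k} b))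
  ; scattered = λ h → Sum-mono λ i → scattered i h
  ; big-star = λ h → Sum-mono λ i → big-star i h
  ; not-star = λ h e ne a b → Sum-strict (λ i → big-star i h) zero (not-star zero h e ne a b)
  ; star = λ h → Sum-mono λ i → star i h }
  where
  s top : Fin (suc k) → ℕ
  s i = Stellar.s (S i)
  top i = Stellar.top (S i)
  open module St i = Stellar (S i) hiding (s; top)

module StarsII {P N} {GR : GraphRank P N} (TG : TwoGraphs GR) {t d b : ℕ} (St : Stellar (GraphRank.R GR) t d b) where
  open GraphRank GR using (R)
  open TwoGraphs TG
  open Stellar St

  starσ : Bool → Fin N → Fin m → Bool
  starσ σ x = ⟪ (λ e → touches? σ x e) ⟫

  private
    ∈star : ∀ {σ x e} → Touches σ x e → e ∈ starσ σ x
    ∈star {σ} {x} = ∈⟪⟫ (λ e → touches? σ x e)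

    ∈star⁻ : ∀ {σ x e} → e ∈ starσ σ x → Touches σ x e
    ∈star⁻ {σ} {x} = ∈⟪⟫⁻ (λ e → touches? σ x e)

    -- the other ends of the edges of F at x
    leaves : ∀ σ x F → ∃ λ Y → # (F ∩ starσ σ x) ≤ 2 * # Y × (∀ {y} → y ∈ Y → y ≢ x × Joins (img σ F) x y)
    leaves σ x F = Y , count , Y⁻
      where
      Yp Yq Y : Fin N → Bool
      Yp = ⟪ (λ y → Fin.any? λ e → (e ∈? F) ×-dec ((x Fin.≟ p σ e) ×-dec (y Fin.≟ q σ e))) ⟫
      Yq = ⟪ (λ y → Fin.any? λ e → (e ∈? F) ×-dec ((x Fin.≟ q σ e) ×-dec (y Fin.≟ p σ e))) ⟫
      Y = Yp ∪ Yq
      Y⁻ : ∀ {y} → y ∈ Y → y ≢ x × Joins (img σ F) x y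
      Y⁻ r = [ (λ a → go (∈⟪⟫⁻ (λ y → Fin.any? λ e → (e ∈? F) ×-dec ((x Fin.≟ p σ e) ×-dec (y Fin.≟ q σ e))) a))
             , (λ a → go' (∈⟪⟫⁻ (λ y → Fin.any? λ e → (e ∈? F) ×-dec ((x Fin.≟ q σ e) ×-dec (y Fin.≟ p σ e))) a)) ]′ (∪⁻ r)
        where
        go : ∀ {y} → (∃ λ e → e ∈ F × x ≡ p σ e × y ≡ q σ e) → y ≢ x × Joins (img σ F) x y
        go (e , e∈ , refl , refl) = (λ r → p≢q σ e (sym r)) , inj₁ (∈img e∈)
        go' : ∀ {y} → (∃ λ e → e ∈ F × x ≡ q σ e × y ≡ p σ e) → y ≢ x × Joins (img σ F) x y
        go' (e , e∈ , refl , refl) = p≢q σ e , inj₂ (∈img e∈)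
      Fp Fq : Fin m → Bool
      Fp = F ∩ ⟪ (λ e → x Fin.≟ p σ e) ⟫
      Fq = F ∩ ⟪ (λ e → x Fin.≟ q σ e) ⟫
      count : # (F ∩ starσ σ x) ≤ 2 * # Y
      count = ≤-trans (#-mono {Y = Fp ∪ Fq} λ r → [ (λ a → ∪ˡ (∩⁺ (∩ˡ r) (∈⟪⟫ (λ e → x Fin.≟ p σ e) a))) , (λ a → ∪ʳ (∩⁺ (∩ˡ r) (∈⟪⟫ (λ e → x Fin.≟ q σ e) a))) ]′ (∈star⁻ (∩ʳ r)))
        (≤-trans (#-∪≤ Fp Fq) (≤-trans
          ((#-inj (q σ) (λ r → ∪ˡ (∈⟪⟫ (λ y → Fin.any? λ e → (e ∈? F) ×-dec ((x Fin.≟ p σ e) ×-dec (y Fin.≟ q σ e))) (_ , ∩ˡ r , ∈⟪⟫⁻ (λ e → x Fin.≟ p σ e) (∩ʳ r) , refl)))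
              λ r s e → pq-inj σ (trans (sym (∈⟪⟫⁻ (λ e → x Fin.≟ p σ e) (∩ʳ r))) (∈⟪⟫⁻ (λ e → x Fin.≟ p σ e) (∩ʳ s))) e)
          ⊕ (#-inj (p σ) (λ r → ∪ʳ (∈⟪⟫ (λ y → Fin.any? λ e → (e ∈? F) ×-dec ((x Fin.≟ q σ e) ×-dec (y Fin.≟ p σ e))) (_ , ∩ˡ r , ∈⟪⟫⁻ (λ e → x Fin.≟ q σ e) (∩ʳ r) , refl)))
              λ r s e → pq-inj σ e (trans (sym (∈⟪⟫⁻ (λ e → x Fin.≟ q σ e) (∩ʳ r))) (∈⟪⟫⁻ (λ e → x Fin.≟ q σ e) (∩ʳ s)))))
          (≤-reflexive (cong (# Y +_) (sym (+-identityʳ (# Y)))))))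

    is-scattered : ∀ σ {F} → (∀ x → # (F ∩ starσ σ x) < 2 * d) → t * (2 * d) < # F → Scattered t (img σ F)
    is-scattered σ {F} low many T #T = found (Fin.any? λ e → (e ∈? F) ×-dec (¬? (p σ e ∈? T) ×-dec ¬? (q σ e ∈? T)))
      where
      found : Dec (∃ λ e → e ∈ F × p σ e ∉ T × q σ e ∉ T) → ∃ λ u → ∃ λ v → (u , v) ∈ img σ F × u ≢ v × u ∉ T × v ∉ T
      found (yes (e , e∈ , a , b)) = _ , _ , ∈img e∈ , p≢q σ e , a , b
      found (no ¬p) = ⊥-elim (<⇒≱ many (≤-trans (#-cover-by T (λ x → F ∩ starσ σ x) covered (λ {x} _ → <⇒≤ (low x))) (*-monoˡ-≤ (2 * d) #T)))
        where
        covered : ∀ {e} → e ∈ F → ∃ λ x → x ∈ T × e ∈ F ∩ starσ σ x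
        covered {e} e∈ = [ (λ a → p σ e , a , ∩⁺ e∈ (∈star (inj₁ refl))) , (λ ¬a → [ (λ b → q σ e , b , ∩⁺ e∈ (∈star (inj₂ refl))) ,
          (λ ¬b → ⊥-elim (¬p (e , e∈ , ¬a , ¬b))) ]′ (toSum (q σ e ∈? T))) ]′ (toSum (p σ e ∈? T))

  large-small-rank : ∀ σ {X} → rM X ≤ s → suc (t * (2 * d)) + s ≤ # X → ∃ λ x → X ⊆ starσ σ x
  large-small-rank σ {X} small large = go (rM≥ σ X)
    where
    go : (∃ λ F → F ⊆ X × R (img σ F) + # (X ∖ F) ≤ rM X) → ∃ λ x → X ⊆ starσ σ x
    go (F , F⊆ , l) = centre (Fin.any? λ x → 2 * d ≤? # (F ∩ starσ σ x))
      where
      RF : R (img σ F) + # (X ∖ F) ≤ s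
      RF = ≤-trans l small
      #F : t * (2 * d) < # F
      #F = +-cancelʳ-≤ s _ _ (≤-trans large (≤-trans (≤-reflexive (#-⊆ F⊆)) (+-monoʳ-≤ (# F) (≤-trans (m≤n+m _ _) RF))))
      centre : Dec (∃ λ x → 2 * d ≤ # (F ∩ starσ σ x)) → ∃ λ x → X ⊆ starσ σ x
      centre (no ¬p) = ⊥-elim (<⇒≱ s<top (≤-trans (scattered (is-scattered σ (λ x → ≰⇒> λ h → ¬p (x , h)) #F)) (≤-trans (m≤m+n _ _) RF)))
      centre (yes (x , h)) = x , λ {e} e∈ → ∈star (stable (touches? σ x e) λ ¬t →
          <⇒≱ (not-star big (∈img (X⊆F e∈)) (p≢q σ e) (¬t ∘ inj₁) (¬t ∘ inj₂)) (≤-trans (m≤m+n _ _) RF))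
        where
        big : BigStar d x (img σ F)
        big = let Y , c , y = leaves σ x F in Y , *-cancelˡ-≤ 2 (≤-trans h c) , y
        X⊆F : X ⊆ F
        X⊆F = ⊆-#-⊇ F⊆ (≤-trans (≤-reflexive (#-⊆ F⊆)) (≤-trans (+-monoʳ-≤ (# F) (+-cancelˡ-≤ s _ 0 (≤-trans (+-monoˡ-≤ _ (big-star big)) (≤-trans RF (≤-reflexive (sym (+-identityʳ s))))))) (≤-reflexive (+-identityʳ _))))

  private
    star-rank : ∀ σ x → rM (starσ σ x) ≤ s
    star-rank σ x = ≤-trans (rM≤R σ (starσ σ x)) (star at-x)
      where
      at-x : StarAt x (img σ (starσ σ x))
      at-x y ne = let e , e∈ , a , b = ∈img⁻ y in [ (λ r → inj₁ (trans r a)) , (λ r → inj₂ (trans r b)) ]′ (∈star⁻ e∈)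

    two-common : ∀ σ {v w} → v ≢ w → # (starσ σ v ∩ starσ σ w) ≤ 2
    two-common σ {v} {w} ne = ≤-trans (#-mono {Y = S₁ ∪ S₂} λ r → cases (∈star⁻ (∩ˡ r)) (∈star⁻ (∩ʳ r))) (≤-trans (#-∪≤ S₁ S₂)
      (#≤1 S₁ (λ r s → let a , b = S₁⁻ r; c , d = S₁⁻ s in pq-inj σ (trans (sym a) c) (trans (sym b) d))
       ⊕ #≤1 S₂ (λ r s → let a , b = S₂⁻ r; c , d = S₂⁻ s in pq-inj σ (trans (sym a) c) (trans (sym b) d))))
      where
      S₁ S₂ : Fin m → Bool
      S₁ = ⟪ (λ e → (v Fin.≟ p σ e) ×-dec (w Fin.≟ q σ e)) ⟫
      S₂ = ⟪ (λ e → (w Fin.≟ p σ e) ×-dec (v Fin.≟ q σ e)) ⟫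
      S₁⁻ : ∀ {e} → e ∈ S₁ → v ≡ p σ e × w ≡ q σ e
      S₁⁻ = ∈⟪⟫⁻ (λ e → (v Fin.≟ p σ e) ×-dec (w Fin.≟ q σ e))
      S₂⁻ : ∀ {e} → e ∈ S₂ → w ≡ p σ e × v ≡ q σ e
      S₂⁻ = ∈⟪⟫⁻ (λ e → (w Fin.≟ p σ e) ×-dec (v Fin.≟ q σ e))
      cases : ∀ {e} → Touches σ v e → Touches σ w e → e ∈ S₁ ∪ S₂
      cases (inj₁ a) (inj₁ b) = ⊥-elim (ne (trans a (sym b)))
      cases (inj₂ a) (inj₂ b) = ⊥-elim (ne (trans a (sym b)))
      cases (inj₁ a) (inj₂ b) = ∪ˡ (∈⟪⟫ (λ e → (v Fin.≟ p σ e) ×-dec (w Fin.≟ q σ e)) (a , b))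
      cases (inj₂ a) (inj₁ b) = ∪ʳ (∈⟪⟫ (λ e → (w Fin.≟ p σ e) ×-dec (v Fin.≟ q σ e)) (b , a))

  stars : ∀ {v} → 3 ≤ # (starσ true v) → suc (t * (2 * d)) + b ≤ # (starσ true v) →
    ∃ λ x → ∀ e → (Touches true v e → Touches false x e) × (Touches false x e → Touches true v e)
  stars {v} three large = go (large-small-rank false (star-rank true v) enough)
    where
    enough : suc (t * (2 * d)) + s ≤ # (starσ true v)
    enough = ≤-trans (+-monoʳ-≤ (suc (t * (2 * d))) s≤b) large
    go : (∃ λ x → starσ true v ⊆ starσ false x) → ∃ λ x → ∀ e → (Touches true v e → Touches false x e) × (Touches false x e → Touches true v e)
    go (x , sub) = x , λ e → (λ t → ∈star⁻ (sub (∈star t))) , λ t → back (large-small-rank true (star-rank false x) (≤-trans enough (#-mono sub))) t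
      where
      back : (∃ λ w → starσ false x ⊆ starσ true w) → ∀ {e} → Touches false x e → Touches true v e
      back (w , sup) {e} t = subst (λ z → Touches true z e) (sym v≡w) (∈star⁻ (sup (∈star t)))
        where
        v≡w : v ≡ w
        v≡w = stable (v Fin.≟ w) λ ne → <⇒≱ three (≤-trans (#-mono λ r → ∩⁺ r (sup (sub r))) (two-common true ne))

open import Defs hiding (IndepSystem; IsMatroid; module IsMatroid)

-- Complete graphs

mU : ℕ → ℕ
mU zero = 0
mU (suc N) = mU N + N

edgeU : ∀ N → Fin (mU N) → Edge
edgeU (suc N) i = [ edgeU N , (λ j → mkEdge (toℕ j) N (Fin.toℕ<n j)) ]′ (splitAt (mU N) i)

Edge-≡ : ∀ {e e'} → lo e ≡ lo e' → hi e ≡ hi e' → e ≡ e'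
Edge-≡ {mkEdge a b l} {mkEdge .a .b l'} refl refl = cong (mkEdge a b) (<-irrelevant l l')

hiU< : ∀ N i → hi (edgeU N i) < N
hiU< (suc N) i with splitAt (mU N) i
... | inj₁ j = ≤-trans (hiU< N j) (n≤1+n N)
... | inj₂ j = ≤-refl

injU : ∀ N {i j} → edgeU N i ≡ edgeU N j → i ≡ j
injU (suc N) {i} {j} e with splitAt (mU N) i in ei | splitAt (mU N) j in ej
... | inj₁ a | inj₁ b = trans (sym (Fin.splitAt⁻¹-↑ˡ ei)) (trans (cong (_↑ˡ N) (injU N e)) (Fin.splitAt⁻¹-↑ˡ ej))
... | inj₁ a | inj₂ b = ⊥-elim (<-irrefl (cong hi e) (hiU< N a))
... | inj₂ a | inj₁ b = ⊥-elim (<-irrefl (cong hi (sym e)) (hiU< N b))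
... | inj₂ a | inj₂ b = trans (sym (Fin.splitAt⁻¹-↑ʳ ei)) (trans (cong (mU N ↑ʳ_) (Fin.toℕ-injective (cong lo e))) (Fin.splitAt⁻¹-↑ʳ ej))

indexU : ∀ N (e : Edge) → hi e < N → ∃ λ i → edgeU N i ≡ e
indexU (suc N) e l with hi e ≟ N
... | yes refl = mU N ↑ʳ fromℕ< (lo<hi e) , trans (cong [ edgeU N , _ ]′ (Fin.splitAt-↑ʳ (mU N) N (fromℕ< (lo<hi e)))) (Edge-≡ (Fin.toℕ-fromℕ< (lo<hi e)) refl)
... | no ne with indexU N e (≤∧≢⇒< (s≤s⁻¹ l) ne)
...   | i , p = i ↑ˡ N , trans (cong [ edgeU N , _ ]′ (Fin.splitAt-↑ˡ (mU N) i N)) p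

U : ℕ → Graph
U N = record { m = mU N ; edge = edgeU N ; edge-inj = injU N }

Bounded : ℕ → Graph → Set
Bounded N G = ∀ i → hi (edge G i) < N

module Ends {N} (G : Graph) (bd : Bounded N G) where
  pG qG : Fin (m G) → Fin N
  pG i = fromℕ< (<-trans (lo<hi (edge G i)) (bd i))
  qG i = fromℕ< (bd i)

  toℕ-pG : ∀ i → toℕ (pG i) ≡ lo (edge G i)
  toℕ-pG i = Fin.toℕ-fromℕ< _

  toℕ-qG : ∀ i → toℕ (qG i) ≡ hi (edge G i)
  toℕ-qG i = Fin.toℕ-fromℕ< _

  pG<qG : ∀ i → toℕ (pG i) < toℕ (qG i)
  pG<qG i = subst₂ _<_ (sym (toℕ-pG i)) (sym (toℕ-qG i)) (lo<hi (edge G i))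

  pG≢qG : ∀ i → pG i ≢ qG i
  pG≢qG i e = <-irrefl (cong toℕ e) (pG<qG i)

  pqG-inj : ∀ {i j} → pG i ≡ pG j → qG i ≡ qG j → i ≡ j
  pqG-inj {i} {j} a b = edge-inj G (Edge-≡ (trans (sym (toℕ-pG i)) (trans (cong toℕ a) (toℕ-pG j))) (trans (sym (toℕ-qG i)) (trans (cong toℕ b) (toℕ-qG j))))

  imgG : (Fin (m G) → Bool) → ESet N
  imgG X = ⟪ (λ x → Fin.any? λ e → (e ∈? X) ×-dec ((pG e Fin.≟ proj₁ x) ×-dec (qG e Fin.≟ proj₂ x))) ⟫

  ∈imgG : ∀ {X e} → e ∈ X → (pG e , qG e) ∈ imgG X
  ∈imgG {X} e∈ = ∈⟪⟫ (λ x → Fin.any? λ e → (e ∈? X) ×-dec ((pG e Fin.≟ proj₁ x) ×-dec (qG e Fin.≟ proj₂ x))) (_ , e∈ , refl , refl)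

  ∈imgG⁻ : ∀ {X u v} → (u , v) ∈ imgG X → ∃ λ e → e ∈ X × pG e ≡ u × qG e ≡ v
  ∈imgG⁻ {X} = ∈⟪⟫⁻ (λ x → Fin.any? λ e → (e ∈? X) ×-dec ((pG e Fin.≟ proj₁ x) ×-dec (qG e Fin.≟ proj₂ x)))

module UEnds N = Ends (U N) (hiU< N) renaming (pG to pU; qG to qU; toℕ-pG to toℕ-pU; toℕ-qG to toℕ-qU; pG≢qG to pU≢qU; pqG-inj to pqU-inj; pG<qG to pU<qU; imgG to imgU; ∈imgG to ∈imgU; ∈imgG⁻ to ∈imgU⁻)

-- every pair of distinct vertices is an edge of the complete graph
pairU : ∀ {N} (u v : Fin N) → u ≢ v → ∃ λ i → (UEnds.pU N i ≡ u × UEnds.qU N i ≡ v) ⊎ (UEnds.pU N i ≡ v × UEnds.qU N i ≡ u)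
pairU {N} u v u≢v with <-cmp (toℕ u) (toℕ v)
... | tri< l _ _ = let i , e = indexU N (mkEdge (toℕ u) (toℕ v) l) (Fin.toℕ<n v) in
        i , inj₁ (Fin.toℕ-injective (trans (UEnds.toℕ-pU N i) (cong lo e)) , Fin.toℕ-injective (trans (UEnds.toℕ-qU N i) (cong hi e)))
... | tri≈ _ e _ = ⊥-elim (u≢v (Fin.toℕ-injective e))
... | tri> _ _ l = let i , e = indexU N (mkEdge (toℕ v) (toℕ u) l) (Fin.toℕ<n u) in
        i , inj₂ (Fin.toℕ-injective (trans (UEnds.toℕ-pU N i) (cong lo e)) , Fin.toℕ-injective (trans (UEnds.toℕ-qU N i) (cong hi e)))

-- Graph isomorphisms

V-≡ : ∀ {G} {u v : V G} → proj₁ u ≡ proj₁ v → u ≡ v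
V-≡ {u = u , p} {.u , q} refl = cong (u ,_) (Bool.T-irrelevant p q)

vertex⁺ : ∀ {G v} i → v ≡ lo (edge G i) ⊎ v ≡ hi (edge G i) → IsVertex G v
vertex⁺ i h = fromWitness (i , h)

vertex⁻ : ∀ {G v} → IsVertex G v → ∃ λ i → v ≡ lo (edge G i) ⊎ v ≡ hi (edge G i)
vertex⁻ = toWitness

joins-left : ∀ {e u v} → joins e u v → u ≡ lo e ⊎ u ≡ hi e
joins-left (inj₁ (a , b)) = inj₁ (sym a)
joins-left (inj₂ (a , b)) = inj₂ (sym b)

joins-right : ∀ {e u v} → joins e u v → v ≡ lo e ⊎ v ≡ hi e
joins-right (inj₁ (a , b)) = inj₂ (sym b)
joins-right (inj₂ (a , b)) = inj₁ (sym a)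

module MakeIso {G H : Graph} (f g : ℕ → ℕ) (ψ : Fin (m G) → Fin (m H)) (ψ' : Fin (m H) → Fin (m G))
  (fψ : ∀ i → joins (edge H (ψ i)) (f (lo (edge G i))) (f (hi (edge G i))))
  (gψ : ∀ i → joins (edge G (ψ' i)) (g (lo (edge H i))) (g (hi (edge H i))))
  (gf : ∀ v → IsVertex G v → g (f v) ≡ v) (fg : ∀ v → IsVertex H v → f (g v) ≡ v) where

  private
    map-vertex : ∀ {G H : Graph} (f : ℕ → ℕ) (ψ : Fin (m G) → Fin (m H)) →
      (∀ i → joins (edge H (ψ i)) (f (lo (edge G i))) (f (hi (edge G i)))) → ∀ v → IsVertex G v → IsVertex H (f v)
    map-vertex {G} {H} f ψ fψ v x with vertex⁻ {G} x
    ... | i , inj₁ refl = vertex⁺ {H} (ψ i) (joins-left {edge H (ψ i)} (fψ i))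
    ... | i , inj₂ refl = vertex⁺ {H} (ψ i) (joins-right {edge H (ψ i)} (fψ i))

    map-adj : ∀ {G H : Graph} (f : ℕ → ℕ) (ψ : Fin (m G) → Fin (m H)) →
      (∀ i → joins (edge H (ψ i)) (f (lo (edge G i))) (f (hi (edge G i)))) → ∀ {u v} → Adj G u v → Adj H (f u) (f v)
    map-adj f ψ fψ (i , inj₁ (refl , refl)) = ψ i , fψ i
    map-adj f ψ fψ (i , inj₂ (refl , refl)) = ψ i , [ inj₂ , inj₁ ]′ (fψ i)

    F : V G → V H
    F (v , x) = f v , map-vertex {G} {H} f ψ fψ v x
    F' : V H → V G
    F' (v , x) = g v , map-vertex {H} {G} g ψ' gψ v x
    bij : V G ⤖ V H
    bij = mk⤖ {to = F} ((λ {u} {v} e → V-≡ {G} (trans (sym (gf (proj₁ u) (proj₂ u))) (trans (cong g (cong proj₁ e)) (gf (proj₁ v) (proj₂ v))))) ,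
      λ y → F' y , λ { refl → V-≡ {H} (fg (proj₁ y) (proj₂ y)) })

  iso : GraphIso G H
  iso = bij , λ u v → mk⇔ (map-adj {G} {H} f ψ fψ) λ a →
    subst₂ (Adj G) (gf (proj₁ u) (proj₂ u)) (gf (proj₁ v) (proj₂ v)) (map-adj {H} {G} g ψ' gψ a)

  induced : Induced G H iso ψ
  induced = fψ

-- Permutations of the vertices of a complete graph

record Perm (N : ℕ) : Set where
  field
    π π' : Fin N → Fin N
    π'π : ∀ x → π' (π x) ≡ x
    ππ' : ∀ x → π (π' x) ≡ x

  inverse : Perm N
  inverse = record { π = π' ; π' = π ; π'π = ππ' ; ππ' = π'π }

  π-inj : ∀ {x y} → π x ≡ π y → x ≡ y
  π-inj {x} {y} e = trans (sym (π'π x)) (trans (cong π' e) (π'π y))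

swap : ∀ {N} → Fin N → Fin N → Fin N → Fin N
swap a b x with x Fin.≟ a
... | yes _ = b
... | no _ with x Fin.≟ b
...   | yes _ = a
...   | no _ = x

module _ {N} (a b : Fin N) where
  swap-a : swap a b a ≡ b
  swap-a with a Fin.≟ a
  ... | yes _ = refl
  ... | no ¬e = ⊥-elim (¬e refl)

  swap-b : swap a b b ≡ a
  swap-b with b Fin.≟ a
  ... | yes e = e
  ... | no _ with b Fin.≟ b
  ...   | yes _ = refl
  ...   | no ¬e = ⊥-elim (¬e refl)

  swap-≢ : ∀ {x} → x ≢ a → x ≢ b → swap a b x ≡ x
  swap-≢ {x} x≢a x≢b with x Fin.≟ a
  ... | yes e = ⊥-elim (x≢a e)
  ... | no _ with x Fin.≟ b
  ...   | yes e = ⊥-elim (x≢b e)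
  ...   | no _ = refl

  swap-swap : ∀ x → swap a b (swap a b x) ≡ x
  swap-swap x = go (x Fin.≟ a) (x Fin.≟ b)
    where
    go : Dec (x ≡ a) → Dec (x ≡ b) → swap a b (swap a b x) ≡ x
    go (yes refl) _ = trans (cong (swap a b) swap-a) swap-b
    go (no _) (yes refl) = trans (cong (swap a b) swap-b) swap-a
    go (no p) (no q) = trans (cong (swap a b) (swap-≢ p q)) (swap-≢ p q)

  transposition : Perm N
  transposition = record { π = swap a b ; π' = swap a b ; π'π = swap-swap ; ππ' = swap-swap }

module PermuteU {N} (P : Perm N) where
  open Perm P
  open UEnds N

  private
    image : ∀ i → ∃ λ j → (pU j ≡ π (pU i) × qU j ≡ π (qU i)) ⊎ (pU j ≡ π (qU i) × qU j ≡ π (pU i))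
    image i = pairU (π (pU i)) (π (qU i)) (pU≢qU i ∘ π-inj)

  ψ : Fin (mU N) → Fin (mU N)
  ψ i = proj₁ (image i)

  ψ-ends : ∀ i → (pU (ψ i) ≡ π (pU i) × qU (ψ i) ≡ π (qU i)) ⊎ (pU (ψ i) ≡ π (qU i) × qU (ψ i) ≡ π (pU i))
  ψ-ends i = proj₂ (image i)

  lift : ℕ → ℕ
  lift n with n <? N
  ... | yes l = toℕ (π (fromℕ< l))
  ... | no _ = n

  lift-toℕ : ∀ x → lift (toℕ x) ≡ toℕ (π x)
  lift-toℕ x with toℕ x <? N
  ... | yes l = cong (toℕ ∘ π) (Fin.fromℕ<-toℕ x l)
  ... | no ¬l = ⊥-elim (¬l (Fin.toℕ<n x))

  joins-ψ : ∀ i → joins (edgeU N (ψ i)) (lift (lo (edgeU N i))) (lift (hi (edgeU N i)))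
  joins-ψ i = subst₂ (joins (edgeU N (ψ i))) (trans (sym (lift-toℕ (pU i))) (cong lift (toℕ-pU i))) (trans (sym (lift-toℕ (qU i))) (cong lift (toℕ-qU i))) (go (ψ-ends i))
    where
    go : _ → joins (edgeU N (ψ i)) (toℕ (π (pU i))) (toℕ (π (qU i)))
    go (inj₁ (a , b)) = inj₁ (trans (sym (toℕ-pU (ψ i))) (cong toℕ a) , trans (sym (toℕ-qU (ψ i))) (cong toℕ b))
    go (inj₂ (a , b)) = inj₂ (trans (sym (toℕ-pU (ψ i))) (cong toℕ a) , trans (sym (toℕ-qU (ψ i))) (cong toℕ b))

ψψ' : ∀ {N} (P : Perm N) i → PermuteU.ψ P (PermuteU.ψ (Perm.inverse P) i) ≡ i
ψψ' {N} P i = go (PermuteU.ψ-ends P (PermuteU.ψ (Perm.inverse P) i)) (PermuteU.ψ-ends (Perm.inverse P) i)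
  where
  open Perm P
  open UEnds N
  j = PermuteU.ψ (Perm.inverse P) i
  k = PermuteU.ψ P j
  cross : pU k ≡ qU i → qU k ≡ pU i → k ≡ i
  cross a b = ⊥-elim (<-asym (pU<qU k) (subst₂ _<_ (cong toℕ (sym b)) (cong toℕ (sym a)) (pU<qU i)))
  go : (pU k ≡ π (pU j) × qU k ≡ π (qU j)) ⊎ (pU k ≡ π (qU j) × qU k ≡ π (pU j)) →
       (pU j ≡ π' (pU i) × qU j ≡ π' (qU i)) ⊎ (pU j ≡ π' (qU i) × qU j ≡ π' (pU i)) → k ≡ i
  go (inj₁ (a , b)) (inj₁ (c , d)) = pqU-inj (trans a (trans (cong π c) (ππ' _))) (trans b (trans (cong π d) (ππ' _)))
  go (inj₁ (a , b)) (inj₂ (c , d)) = cross (trans a (trans (cong π c) (ππ' _))) (trans b (trans (cong π d) (ππ' _)))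
  go (inj₂ (a , b)) (inj₁ (c , d)) = cross (trans a (trans (cong π d) (ππ' _))) (trans b (trans (cong π c) (ππ' _)))
  go (inj₂ (a , b)) (inj₂ (c , d)) = pqU-inj (trans a (trans (cong π d) (ππ' _))) (trans b (trans (cong π c) (ππ' _)))

isoU : ∀ {N} (P : Perm N) → Σ (GraphIso (U N) (U N)) λ φ → Induced (U N) (U N) φ (PermuteU.ψ P)
isoU {N} P = MI.iso , MI.induced
  where
  P' = Perm.inverse P
  below : ∀ v → IsVertex (U N) v → ∃ λ (x : Fin N) → toℕ x ≡ v
  below v x with vertex⁻ {U N} x
  ... | i , inj₁ refl = _ , UEnds.toℕ-pU N i
  ... | i , inj₂ refl = _ , UEnds.toℕ-qU N i
  back : ∀ (P : Perm N) v → IsVertex (U N) v → PermuteU.lift (Perm.inverse P) (PermuteU.lift P v) ≡ v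
  back P v x with below v x
  ... | y , refl = trans (cong (PermuteU.lift (Perm.inverse P)) (PermuteU.lift-toℕ P y))
    (trans (PermuteU.lift-toℕ (Perm.inverse P) (Perm.π P y)) (cong toℕ (Perm.π'π P y)))
  module MI = MakeIso {U N} {U N} (PermuteU.lift P) (PermuteU.lift P') (PermuteU.ψ P) (PermuteU.ψ P') (PermuteU.joins-ψ P) (PermuteU.joins-ψ P')
                (back P) (back P')

-- The rank function of a family on the subgraphs of a complete graph

Decidable-on : GraphMatroidFamily → ℕ → Set
Decidable-on 𝓕 N = ∀ X → Dec (Ind 𝓕 (U N) X)

Cl-Subset : ∀ n {P : S.Subset n → Set} → (∀ X → Cl (P X)) → Cl (∀ X → P X)
Cl-Subset zero h = h Data.Vec.[] >>= λ p → ret λ { Data.Vec.[] → p }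
Cl-Subset (suc n) h = Cl-Subset n (λ X → h (true Data.Vec.∷ X)) >>= λ p → Cl-Subset n (λ X → h (false Data.Vec.∷ X)) >>= λ q →
  ret λ { (true Data.Vec.∷ X) → p X ; (false Data.Vec.∷ X) → q X }

decidable-on : ∀ 𝓕 N → Cl (Decidable-on 𝓕 N)
decidable-on 𝓕 N = Cl-Subset (mU N) λ X → em (Ind 𝓕 (U N) X)

module FamilyRank (𝓕 : GraphMatroidFamily) (N : ℕ) (dec : Decidable-on 𝓕 N) where
  open UEnds N
  open MatroidRank (matroid 𝓕 (U N)) dec public using (In; In⇒rank; rank⇒In; rankFn; base; base-⊆; base-In; ≤rank; In-⊆)
  open RankFn rankFn public renaming (mono to rk-mono; submod to rk-submod) using (rk; rk≤#; rk-∅; isSubmodular; Indep; rk-add)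

  idx : ESet N → Fin (mU N) → Bool
  idx X = ⟪ (λ i → ((pU i , qU i) ∈? X) ⊎-dec ((qU i , pU i) ∈? X)) ⟫

  ∈idx : ∀ {X i} → (pU i , qU i) ∈ X ⊎ (qU i , pU i) ∈ X → i ∈ idx X
  ∈idx {X} = ∈⟪⟫ (λ i → ((pU i , qU i) ∈? X) ⊎-dec ((qU i , pU i) ∈? X))

  ∈idx⁻ : ∀ {X i} → i ∈ idx X → (pU i , qU i) ∈ X ⊎ (qU i , pU i) ∈ X
  ∈idx⁻ {X} = ∈⟪⟫⁻ (λ i → ((pU i , qU i) ∈? X) ⊎-dec ((qU i , pU i) ∈? X))

  opaque
    r : ESet N → ℕ
    r X = rk (idx X)

    r-rk : ∀ X → r X ≡ rk (idx X)
    r-rk X = refl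

  idx-mono : ∀ {X Y} → X ⊑ Y → idx X ⊆ idx Y
  idx-mono h {i} x with ∈idx⁻ x
  ... | inj₁ y = ∈idx (h y (pU≢qU i))
  ... | inj₂ y = ∈idx ([ inj₂ , inj₁ ]′ (h y (pU≢qU i ∘ sym)))

  idx-∪ : ∀ {X Y} → idx (X ∪ Y) ⊆ idx X ∪ idx Y
  idx-∪ x with ∈idx⁻ x
  ... | inj₁ y = [ ∪ˡ ∘ ∈idx ∘ inj₁ , ∪ʳ ∘ ∈idx ∘ inj₁ ]′ (∪⁻ y)
  ... | inj₂ y = [ ∪ˡ ∘ ∈idx ∘ inj₂ , ∪ʳ ∘ ∈idx ∘ inj₂ ]′ (∪⁻ y)

  r-mono : ∀ {X Y} → X ⊑ Y → r X ≤ r Y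
  r-mono {X} {Y} h = subst₂ _≤_ (sym (r-rk X)) (sym (r-rk Y)) (rk-mono (idx-mono h))

  r-submod : ∀ {W I X Y} → I ⊑ X → I ⊑ Y → W ⊑ X ∪ Y → r W + r I ≤ r X + r Y
  r-submod {W} {I} {X} {Y} a b c = subst₂ _≤_ (sym (cong₂ _+_ (r-rk W) (r-rk I))) (sym (cong₂ _+_ (r-rk X) (r-rk Y)))
    (rk-submod (idx-mono a) (idx-mono b) (idx-∪ ∘ idx-mono c))

  r-single : ∀ u v → r (single u v) ≤ 1
  r-single u v = ≤-trans (≤-reflexive (r-rk _)) (≤-trans (rk≤# _) (#≤1 _ λ x y → go (∈idx⁻ x) (∈idx⁻ y)))
    where
    go : ∀ {i j} → (pU i , qU i) ∈ single u v ⊎ (qU i , pU i) ∈ single u v → (pU j , qU j) ∈ single u v ⊎ (qU j , pU j) ∈ single u v → i ≡ j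
    go {i} {j} (inj₁ x) (inj₁ y) = let a , b = ∈single⁻ x; c , d = ∈single⁻ y in pqU-inj (trans a (sym c)) (trans b (sym d))
    go {i} {j} (inj₂ x) (inj₂ y) = let a , b = ∈single⁻ x; c , d = ∈single⁻ y in pqU-inj (trans b (sym d)) (trans a (sym c))
    go {i} {j} (inj₁ x) (inj₂ y) = let a , b = ∈single⁻ x; c , d = ∈single⁻ y in
      ⊥-elim (<-asym (pU<qU i) (subst₂ _<_ (cong toℕ (trans d (sym b))) (cong toℕ (trans c (sym a))) (pU<qU j)))
    go {i} {j} (inj₂ x) (inj₁ y) = let a , b = ∈single⁻ x; c , d = ∈single⁻ y in
      ⊥-elim (<-asym (pU<qU i) (subst₂ _<_ (cong toℕ (trans c (sym a))) (cong toℕ (trans d (sym b))) (pU<qU j)))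

  r-∅ : ∀ {X} → X ⊑ ∅ → r X ≡ 0
  r-∅ {X} h = n≤0⇒n≡0 (≤-trans (≤-reflexive (r-rk X)) (≤-trans (rk≤# (idx X)) (≮⇒≥ λ l → let i , x = #-pos l in
    [ (λ y → [ ∅⁻ , ∅⁻ ]′ (h y (pU≢qU i))) , (λ y → [ ∅⁻ , ∅⁻ ]′ (h y (pU≢qU i ∘ sym))) ]′ (∈idx⁻ x))))

  r-add : ∀ X u v → r (X ∪ single u v) ≤ suc (r X)
  r-add X u v = ≤-trans (m≤m+n _ (r ∅)) (≤-trans (r-submod {X ∪ single u v} {∅} {X} {single u v} (λ x _ → ∅⁻ x) (λ x _ → ∅⁻ x) ⊑-refl)
    (≤-trans (+-monoʳ-≤ (r X) (r-single u v)) (≤-reflexive (+-comm _ 1))))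

  permute : Perm N → ESet N → ESet N
  permute P X (u , v) = X (Perm.π P u , Perm.π P v)

  r-permute≤ : ∀ P X → r (permute P X) ≤ r X
  r-permute≤ P X = subst₂ _≤_ (sym (r-rk (permute P X))) (sym (r-rk X)) (≤-trans sizes (≤rank (idx X) B'⊆ B'-In))
    where
    open Perm P
    open PermuteU P
    module P' = PermuteU inverse
    B B' : Fin (mU N) → Bool
    B = base (idx (permute P X))
    B' = B ∘ P'.ψ
    ψ'ψ : ∀ i → P'.ψ (ψ i) ≡ i
    ψ'ψ = ψψ' inverse
    at-perm : ∀ {u v} → (u , v) ∈ permute P X → (π u , π v) ∈ X
    at-perm x = ∈⁺ (∈⁻ x)
    B'⊆ : B' ⊆ idx X
    B'⊆ {j} b = ∈idx (go (P'.ψ-ends j) (∈idx⁻ (base-⊆ (idx (permute P X)) (∈⁺ {X = B} (∈⁻ b)))))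
      where
      back : ∀ {u v a b} → u ≡ π' a → v ≡ π' b → (u , v) ∈ permute P X → (a , b) ∈ X
      back {a = a} {b} refl refl x = subst₂ (λ s t → (s , t) ∈ X) (ππ' a) (ππ' b) (at-perm x)
      go : _ → _ → (pU j , qU j) ∈ X ⊎ (qU j , pU j) ∈ X
      go (inj₁ (a , b)) (inj₁ x) = inj₁ (back a b x)
      go (inj₁ (a , b)) (inj₂ x) = inj₂ (back b a x)
      go (inj₂ (a , b)) (inj₁ x) = inj₂ (back a b x)
      go (inj₂ (a , b)) (inj₂ x) = inj₁ (back b a x)
    sizes : # B ≤ # B'
    sizes = #-inj ψ (λ {i} b → ∈⁺ (trans (cong B (ψ'ψ i)) (∈⁻ b))) (λ {i} {j} _ _ e → trans (sym (ψ'ψ i)) (trans (cong P'.ψ e) (ψ'ψ j)))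
    B'-In : In B'
    B'-In = Equivalence.from (iso-inv 𝓕 (U N) (U N) (proj₁ (isoU P)) ψ (proj₂ (isoU P)) (tabulate B'))
      (IsMatroid.indep-⊆ (matroid 𝓕 (U N)) _ _ (λ x → tab∈ (∈⁺ (trans (cong B (sym (ψ'ψ _))) (trans (sym (lookup∘tabulate B' (ψ _))) (∈⁻ (tab∈⁻ x))))))
        (base-In (idx (permute P X))))

  r-permute : ∀ P X → r (permute P X) ≡ r X
  r-permute P X = ≤-antisym (r-permute≤ P X) (≤-trans (r-mono (λ x _ → inj₁ (∈⁺ (trans (cong X (cong₂ _,_ (Perm.ππ' P _) (Perm.ππ' P _))) (∈⁻ x)))))
    (r-permute≤ (Perm.inverse P) (permute P X)))

  module OfGraph (G : Graph) (bd : Bounded N G) where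
    open Ends G bd

    ι : Fin (m G) → Fin (mU N)
    ι i = proj₁ (indexU N (edge G i) (bd i))

    ι-edge : SubgraphEmb G (U N) ι
    ι-edge i = proj₂ (indexU N (edge G i) (bd i))

    ι-inj : ∀ {i j} → ι i ≡ ι j → i ≡ j
    ι-inj {i} {j} e = edge-inj G (trans (sym (ι-edge i)) (trans (cong (edgeU N) e) (ι-edge j)))

    pι : ∀ i → pU (ι i) ≡ pG i
    pι i = Fin.toℕ-injective (trans (toℕ-pU (ι i)) (trans (cong lo (ι-edge i)) (sym (toℕ-pG i))))

    qι : ∀ i → qU (ι i) ≡ qG i
    qι i = Fin.toℕ-injective (trans (toℕ-qU (ι i)) (trans (cong hi (ι-edge i)) (sym (toℕ-qG i))))

    idx⁺ : ∀ {X i} → i ∈ X → ι i ∈ idx (imgG X)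
    idx⁺ {X} {i} x = ∈idx (inj₁ (subst₂ (λ a b → (a , b) ∈ imgG X) (sym (pι i)) (sym (qι i)) (∈imgG x)))

    idx⁻ : ∀ {X j} → j ∈ idx (imgG X) → ∃ λ i → i ∈ X × ι i ≡ j
    idx⁻ {X} {j} x with ∈idx⁻ x
    ... | inj₁ y = let i , i∈ , a , b = ∈imgG⁻ y in i , i∈ , pqU-inj (trans (pι i) a) (trans (qι i) b)
    ... | inj₂ y = let i , i∈ , a , b = ∈imgG⁻ y in ⊥-elim (<-asym (pU<qU j) (subst₂ _<_ (cong toℕ a) (cong toℕ b) (pG<qG i)))

    #idx : ∀ X → # (idx (imgG X)) ≡ # X
    #idx X = ≤-antisym le (#-inj ι idx⁺ (λ _ _ → ι-inj))
      where
      preimage' : Fin (mU N) → Fin (m G) → Bool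
      preimage' j = X ∩ fib ι j
      le : # (idx (imgG X)) ≤ # X
      le = ≤-trans (≤-reflexive (#-Sum _)) (≤-trans (Sum-mono pt) (≤-reflexive (sym (#-fibers ι X))))
        where
        pt : ∀ j → ⟦ idx (imgG X) j ⟧ ≤ # (X ∩ fib ι j)
        pt j with j ∈? idx (imgG X)
        ... | no ¬x = ≤-trans (≤-reflexive (⟦⟧-∉ (¬x ∘ ∈⁺))) z≤n
        ... | yes x = let i , i∈ , e = idx⁻ x in ≤-trans (⟦⟧≤1 _) (∈⇒#-pos (∩⁺ i∈ (∈fib e)))

    private
      restriction : ∀ X → Ind 𝓕 G (tabulate X) ⇔ Ind 𝓕 (U N) (tabulate (idx (imgG X)))
      restriction X = restrict 𝓕 G (U N) ι ι-edge (tabulate X) (tabulate (idx (imgG X))) λ j →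
        mk⇔ (λ x → let i , i∈ , e = idx⁻ (tab∈⁻ x) in i , tab∈ i∈ , e) λ { (i , i∈ , refl) → tab∈ (idx⁺ (tab∈⁻ i∈)) }

    Ind⇒r : ∀ {X} → Ind 𝓕 G (tabulate X) → # X ≤ r (imgG X)
    Ind⇒r {X} i = subst₂ _≤_ (#idx X) (sym (r-rk (imgG X))) (In⇒rank (Equivalence.to (restriction X) i))

    r⇒Ind : ∀ {X} → # X ≤ r (imgG X) → Ind 𝓕 G (tabulate X)
    r⇒Ind {X} l = Equivalence.from (restriction X) (rank⇒In (subst₂ _≤_ (sym (#idx X)) (r-rk (imgG X)) l))

-- Subgraphs of a complete graph, given by a set of edges

module SubU {N : ℕ} (W : Fin (mU N) → Bool) where
  open UEnds N

  en : Fin (# W) → Fin (mU N)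
  en = proj₁ (enumerate W)

  en∈ : ∀ i → en i ∈ W
  en∈ = proj₁ (proj₂ (enumerate W))

  en-inj : ∀ {i j} → en i ≡ en j → i ≡ j
  en-inj = proj₁ (proj₂ (proj₂ (enumerate W)))

  en-onto : ∀ {j} → j ∈ W → ∃ λ i → en i ≡ j
  en-onto = proj₂ (proj₂ (proj₂ (enumerate W)))

  subU : Graph
  subU = record { m = # W ; edge = edgeU N ∘ en ; edge-inj = en-inj ∘ injU N }

  bounded : Bounded N subU
  bounded i = hiU< N (en i)

  Joined : Fin N → Fin N → Set
  Joined u v = (u , v) ∈ imgU W ⊎ (v , u) ∈ imgU W

  joined? : ∀ u v → Dec (Joined u v)
  joined? u v = ((u , v) ∈? imgU W) ⊎-dec ((v , u) ∈? imgU W)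

  joined-edge : ∀ {u v} → Joined u v → ∃ λ i → (pU (en i) ≡ u × qU (en i) ≡ v) ⊎ (pU (en i) ≡ v × qU (en i) ≡ u)
  joined-edge (inj₁ x) with ∈imgU⁻ x
  ... | e , e∈ , a , b with en-onto e∈
  ...   | i , refl = i , inj₁ (a , b)
  joined-edge (inj₂ x) with ∈imgU⁻ x
  ... | e , e∈ , a , b with en-onto e∈
  ...   | i , refl = i , inj₂ (a , b)

  edge-joined : ∀ i → Joined (pU (en i)) (qU (en i))
  edge-joined i = inj₁ (∈imgU (en∈ i))

  joined-sym : ∀ {u v} → Joined u v → Joined v u
  joined-sym = [ inj₂ , inj₁ ]′

  joined-adj : ∀ {u v} → Joined u v → Adj subU (toℕ u) (toℕ v)
  joined-adj j with joined-edge j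
  ... | i , inj₁ (refl , refl) = i , inj₁ (sym (toℕ-pU _) , sym (toℕ-qU _))
  ... | i , inj₂ (refl , refl) = i , inj₂ (sym (toℕ-pU _) , sym (toℕ-qU _))

  joined-vertex : ∀ {u v} → Joined u v → IsVertex subU (toℕ u)
  joined-vertex j with joined-edge j
  ... | i , inj₁ (refl , refl) = vertex⁺ {subU} i (inj₁ (toℕ-pU _))
  ... | i , inj₂ (refl , refl) = vertex⁺ {subU} i (inj₂ (toℕ-qU _))

  module Connectivity {c : ℕ} {A : Fin N → Bool} (1≤c : 1 ≤ c) (within : WithinE A (imgU W)) (con : ConnectedE c A (imgU W)) (c<A : c < # A) where

    nb : Fin N → Fin N → Bool
    nb v = ⟪ (λ u → joined? u v) ⟫

    nb⁺ : ∀ {u v} → Joined u v → u ∈ nb v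
    nb⁺ {v = v} = ∈⟪⟫ (λ u → joined? u v)

    nb⁻ : ∀ {u v} → u ∈ nb v → Joined u v
    nb⁻ {v = v} = ∈⟪⟫⁻ (λ u → joined? u v)

    joined-A : ∀ {u v} → Joined u v → u ∈ A
    joined-A (inj₁ x) = proj₁ (within x)
    joined-A (inj₂ x) = proj₂ (within x)

    degree≥c : ∀ {v} → v ∈ A → c ≤ # (nb v)
    degree≥c {v} v∈ with ⊆-or-∃ A (nb v ∪ ⁅ v ⁆)
    ... | inj₁ h = s≤s⁻¹ (≤-trans c<A (≤-trans (#-mono h) (#-add≤ (nb v) v)))
    ... | inj₂ (x , x∈ , x∉) = ≤-trans (con ((λ {y} y∈ → cover y∈ (v Fin.≟ y)) , ∪-⊆ (joined-A ∘ nb⁻) (⁅⁆-⊆ v∈) , ∖ˡ , inside ,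
          (v , v∈ , λ r → ∖ʳ r (∈⁅⁆ v)) , (x , x∈ , x∉))) (#-mono λ r → [ id , (λ y → ⊥-elim (∖ʳ (∩ʳ r) y)) ]′ (∪⁻ (∩ˡ r)))
      where
      cover : ∀ {y} → y ∈ A → Dec (v ≡ y) → y ∈ (nb v ∪ ⁅ v ⁆) ∪ (A ∖ ⁅ v ⁆)
      cover y∈ (yes refl) = ∪ˡ (∪ʳ (∈⁅⁆ v))
      cover y∈ (no ¬e) = ∪ʳ (∖⁺ y∈ (¬e ∘ ∈⁅⁆⁻))
      inside : ∀ {u y} → (u , y) ∈ imgU W → (u ∈ nb v ∪ ⁅ v ⁆ × y ∈ nb v ∪ ⁅ v ⁆) ⊎ (u ∈ A ∖ ⁅ v ⁆ × y ∈ A ∖ ⁅ v ⁆)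
      inside {u} {y} z with v Fin.≟ u | v Fin.≟ y
      ... | yes refl | _ = inj₁ (∪ʳ (∈⁅⁆ v) , ∪ˡ (nb⁺ (inj₂ z)))
      ... | no _ | yes refl = inj₁ (∪ˡ (nb⁺ (inj₁ z)) , ∪ʳ (∈⁅⁆ v))
      ... | no a | no b = inj₂ (∖⁺ (proj₁ (within z)) (a ∘ ∈⁅⁆⁻) , ∖⁺ (proj₂ (within z)) (b ∘ ∈⁅⁆⁻))

    A-vertex : ∀ {v} → v ∈ A → IsVertex subU (toℕ v)
    A-vertex {v} v∈ = let u , u∈ = #-pos (≤-trans 1≤c (degree≥c v∈)) in joined-vertex (joined-sym (nb⁻ u∈))

    vertex-A : ∀ {v} → IsVertex subU v → ∃ λ x → x ∈ A × toℕ x ≡ v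
    vertex-A x with vertex⁻ {subU} x
    ... | i , inj₁ refl = _ , joined-A (edge-joined i) , toℕ-pU _
    ... | i , inj₂ refl = _ , joined-A (joined-sym (edge-joined i)) , toℕ-qU _

    module Reaching (L : List ℕ) (short : length L < c) where
      open LMD Data.Nat._≟_ using () renaming (_∈?_ to _∈L?_)

      LS : Fin N → Bool
      LS = ⟪ (λ x → toℕ x ∈L? L) ⟫

      LS⁻ : ∀ {x} → x ∈ LS → toℕ x LM.∈ L
      LS⁻ = ∈⟪⟫⁻ (λ x → toℕ x ∈L? L)

      LS⁺ : ∀ {x} → toℕ x LM.∈ L → x ∈ LS
      LS⁺ = ∈⟪⟫ (λ x → toℕ x ∈L? L)

      #LS : # LS ≤ length L
      #LS = ≤-trans (#-cover F λ {u} u∈ → Any.index (LS⁻ u∈) , F⁺ (Any.lookup-index (LS⁻ u∈)))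
        (≤-trans (Sum-mono λ j → #≤1 (F j) λ x y → Fin.toℕ-injective (trans (F⁻ x) (sym (F⁻ y)))) (≤-reflexive (trans (Sum-const {length L} 1) (*-identityʳ _))))
        where
        F : Fin (length L) → Fin N → Bool
        F j = ⟪ (λ x → toℕ x Data.Nat.≟ List.lookup L j) ⟫
        F⁺ : ∀ {j x} → toℕ x ≡ List.lookup L j → x ∈ F j
        F⁺ {j} = ∈⟪⟫ (λ x → toℕ x Data.Nat.≟ List.lookup L j)
        F⁻ : ∀ {j x} → x ∈ F j → toℕ x ≡ List.lookup L j
        F⁻ {j} = ∈⟪⟫⁻ (λ x → toℕ x Data.Nat.≟ List.lookup L j)

      reach : ∀ u → u ∈ A → ∀ v → v ∈ A → ¬ (toℕ v LM.∈ L) → Reach subU L (toℕ u) (toℕ v)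
      reach u u∈ v v∈ v∉L = go N ⁅ u ⁆ (λ x → subst (λ y → Reach subU L (toℕ u) (toℕ y)) (∈⁅⁆⁻ x) here) (∈⁅⁆ u) (m≤m+n N _)
        where
        go : ∀ n S → (∀ {x} → x ∈ S → Reach subU L (toℕ u) (toℕ x)) → u ∈ S → N ≤ n + # S → Reach subU L (toℕ u) (toℕ v)
        go n S R u∈S l with Fin.any? (λ w → Fin.any? λ z → (w ∈? S) ×-dec (¬? (z ∈? S) ×-dec (¬? (z ∈? LS) ×-dec joined? w z)))
        go zero S R u∈S l | yes (w , z , w∈ , z∉ , z∉L , j) =
          ⊥-elim (<⇒≱ (≤-trans (s≤s l) (≤-reflexive (sym (#-add S z∉)))) (#≤n (S ∪ ⁅ z ⁆)))
        go (suc n) S R u∈S l | yes (w , z , w∈ , z∉ , z∉L , j) = go n (S ∪ ⁅ z ⁆)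
          (λ x → [ R , (λ y → subst (λ y → Reach subU L (toℕ u) (toℕ y)) (∈⁅⁆⁻ y) (step (R w∈) (joined-adj j) (z∉L ∘ LS⁺))) ]′ (∪⁻ x))
          (∪ˡ u∈S) (≤-trans l (≤-reflexive (trans (sym (+-suc n (# S))) (cong (n +_) (sym (#-add S z∉))))))
        go n S R u∈S l | no closed = [ R , (λ v∉ → ⊥-elim (<⇒≱ short (≤-trans (cut v∉) (≤-trans (#-mono both⊆) #LS)))) ]′ (toSum (v ∈? S))
          where
          A₁ A₂ : Fin N → Bool
          A₁ = A ∩ (S ∪ LS)
          A₂ = A ∖ S
          both⊆ : A₁ ∩ A₂ ⊆ LS
          both⊆ r = [ (λ s → ⊥-elim (∖ʳ (∩ʳ r) s)) , id ]′ (∪⁻ (∩ʳ (∩ˡ r)))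
          next : ∀ {w z} → w ∈ S → Joined w z → z ∈ S ∪ LS
          next {w} {z} w∈ j = stable (z ∈? (S ∪ LS)) λ z∉ → closed (w , z , w∈ , z∉ ∘ ∪ˡ , z∉ ∘ ∪ʳ , j)
          cut : v ∉ S → c ≤ # (A₁ ∩ A₂)
          cut v∉ = con ((λ {x} x∈ → [ (λ s → ∪ˡ (∩⁺ x∈ (∪ˡ s))) , (λ s → ∪ʳ (∖⁺ x∈ s)) ]′ (toSum (x ∈? S))) , ∩ˡ , ∖ˡ , inside ,
            (u , u∈ , λ r → ∖ʳ r u∈S) , (v , v∈ , λ r → [ v∉ , (λ s → v∉L (LS⁻ s)) ]′ (∪⁻ (∩ʳ r))))
            where
            inside : ∀ {x y} → (x , y) ∈ imgU W → (x ∈ A₁ × y ∈ A₁) ⊎ (x ∈ A₂ × y ∈ A₂)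
            inside {x} {y} z with x ∈? S | y ∈? S
            ... | yes a | _ = inj₁ (∩⁺ (proj₁ (within z)) (∪ˡ a) , ∩⁺ (proj₂ (within z)) (next a (inj₁ z)))
            ... | no _ | yes b = inj₁ (∩⁺ (proj₁ (within z)) (next b (inj₂ z)) , ∩⁺ (proj₂ (within z)) (∪ˡ b))
            ... | no a | no b = inj₂ (∖⁺ (proj₁ (within z)) a , ∖⁺ (proj₂ (within z)) b)

    isConnected : ∀ {c'} → c' ≤ c → IsConnected c' subU
    isConnected {c'} c'≤c = vertices , λ L short u v uV vV u∉ v∉ → connected L short (vertex-A uV) (vertex-A vV) v∉
      where
      connected : ∀ L → length L < c' → ∀ {u v} → (∃ λ x → x ∈ A × toℕ x ≡ u) → (∃ λ x → x ∈ A × toℕ x ≡ v) → ¬ (v LM.∈ L) → Reach subU L u v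
      connected L short (x , x∈ , refl) (y , y∈ , refl) v∉ = Reaching.reach L (≤-trans short c'≤c) x x∈ y y∈ v∉
      vertices : ∃ λ (L : List ℕ) → Unique L × length L ≡ suc c' × All (IsVertex subU) L
      vertices with subset-of-size A (suc c') (≤-trans (s≤s c'≤c) c<A)
      ... | B , B⊆ , eB with enumerate B
      ...   | f , f∈ , f-inj , _ = List.tabulate (toℕ ∘ f) , Unique.tabulate⁺ (f-inj ∘ Fin.toℕ-injective) ,
                trans (List.length-tabulate (toℕ ∘ f)) eB , All.tabulate⁺ (λ i → A-vertex (B⊆ (f∈ i)))

module SwapLemma (𝓕 : GraphMatroidFamily) (N : ℕ) (dec : Decidable-on 𝓕 N) (W : Fin (mU N) → Bool)
  {c : ℕ} {A : Fin N → Bool} (3≤c : 3 ≤ c) (within : WithinE A (UEnds.imgU N W)) (con : ConnectedE c A (UEnds.imgU N W)) (c<A : c < # A) where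
  open UEnds N
  open FamilyRank 𝓕 N dec
  open SubU {N} W
  open Connectivity (≤-trans (s≤s z≤n) 3≤c) within con c<A
  private
    module O = OfGraph subU bounded

  ι≡en : ∀ i → O.ι i ≡ en i
  ι≡en i = injU N (O.ι-edge i)

  module _ {e f} (e∈ : e ∈ W) (f∈ : f ∈ W) (e≢f : e ≢ f)
    (e⇒f : ∀ {S} → S ⊆ W → e ∉ S → f ∉ S → In (S ∪ ⁅ e ⁆) → In (S ∪ ⁅ f ⁆))
    (f⇒e : ∀ {S} → S ⊆ W → e ∉ S → f ∉ S → In (S ∪ ⁅ f ⁆) → In (S ∪ ⁅ e ⁆)) where
   module _ (e' f' : Fin (# W)) (en-e : en e' ≡ e) (en-f : en f' ≡ f) where
    ψ : Fin (# W) → Fin (# W)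
    ψ = swap e' f'
    im : (Fin (# W) → Bool) → Fin (mU N) → Bool
    im Z = idx (Ends.imgG subU bounded Z)
    im⁺ : ∀ {Z i} → i ∈ Z → en i ∈ im Z
    im⁺ {Z} {i} x = subst (_∈ im Z) (ι≡en i) (O.idx⁺ x)
    im⁻ : ∀ {Z j} → j ∈ im Z → ∃ λ i → i ∈ Z × en i ≡ j
    im⁻ x = let i , i∈ , p = O.idx⁻ x in i , i∈ , trans (sym (ι≡en i)) p
    im⊆W : ∀ {Z} → im Z ⊆ W
    im⊆W x with im⁻ x
    ... | i , _ , refl = en∈ i
    transfer : ∀ Z → In (im Z) → In (im (Z ∘ ψ))
    transfer Z h with e' ∈? Z | f' ∈? Z
    ... | yes a | yes b = In-⊆ sub h
      where
      sub : im (Z ∘ ψ) ⊆ im Z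
      sub x with im⁻ x
      ... | i , i∈ , refl with i Fin.≟ e' | i Fin.≟ f'
      ...   | yes refl | _ = im⁺ a
      ...   | no _ | yes refl = im⁺ b
      ...   | no p | no q = im⁺ (∈⁺ (trans (cong Z (sym (swap-≢ e' f' p q))) (∈⁻ i∈)))
    ... | no a | no b = In-⊆ sub h
      where
      sub : im (Z ∘ ψ) ⊆ im Z
      sub x with im⁻ x
      ... | i , i∈ , refl with i Fin.≟ e' | i Fin.≟ f'
      ...   | yes refl | _ = ⊥-elim (b (∈⁺ (trans (cong Z (sym (swap-a e' f'))) (∈⁻ i∈))))
      ...   | no _ | yes refl = ⊥-elim (a (∈⁺ (trans (cong Z (sym (swap-b e' f'))) (∈⁻ i∈))))
      ...   | no p | no q = im⁺ (∈⁺ (trans (cong Z (sym (swap-≢ e' f' p q))) (∈⁻ i∈)))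
    ... | yes a | no b = In-⊆ sub (e⇒f {im Z ∖ ⁅ e ⁆} (im⊆W ∘ ∖ˡ) (λ x → ∖ʳ x (∈⁅⁆ e)) (λ x → f∉ (∖ˡ x)) (In-⊆ (∪-⊆ ∖ˡ (⁅⁆-⊆ (subst (_∈ im Z) en-e (im⁺ a)))) h))
      where
      f∉ : f ∉ im Z
      f∉ x with im⁻ x
      ... | i , i∈ , p = b (subst (_∈ Z) (en-inj (trans p (sym en-f))) i∈)
      sub : im (Z ∘ ψ) ⊆ (im Z ∖ ⁅ e ⁆) ∪ ⁅ f ⁆
      sub x with im⁻ x
      ... | i , i∈ , refl with i Fin.≟ e' | i Fin.≟ f'
      ...   | yes refl | _ = ⊥-elim (b (∈⁺ (trans (cong Z (sym (swap-a e' f'))) (∈⁻ i∈))))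
      ...   | no _ | yes refl = ∪ʳ (subst (_∈ ⁅ f ⁆) (sym en-f) (∈⁅⁆ f))
      ...   | no p | no q = ∪ˡ (∖⁺ (im⁺ (∈⁺ (trans (cong Z (sym (swap-≢ e' f' p q))) (∈⁻ i∈)))) λ y → p (en-inj (trans (sym (∈⁅⁆⁻ y)) (sym en-e))))
    ... | no a | yes b = In-⊆ sub (f⇒e {im Z ∖ ⁅ f ⁆} (im⊆W ∘ ∖ˡ) (λ x → e∉ (∖ˡ x)) (λ x → ∖ʳ x (∈⁅⁆ f)) (In-⊆ (∪-⊆ ∖ˡ (⁅⁆-⊆ (subst (_∈ im Z) en-f (im⁺ b)))) h))
      where
      e∉ : e ∉ im Z
      e∉ x with im⁻ x
      ... | i , i∈ , p = a (subst (_∈ Z) (en-inj (trans p (sym en-e))) i∈)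
      sub : im (Z ∘ ψ) ⊆ (im Z ∖ ⁅ f ⁆) ∪ ⁅ e ⁆
      sub x with im⁻ x
      ... | i , i∈ , refl with i Fin.≟ e' | i Fin.≟ f'
      ...   | yes refl | _ = ∪ʳ (subst (_∈ ⁅ e ⁆) (sym en-e) (∈⁅⁆ e))
      ...   | no _ | yes refl = ⊥-elim (a (∈⁺ (trans (cong Z (sym (swap-b e' f'))) (∈⁻ i∈))))
      ...   | no p | no q = ∪ˡ (∖⁺ (im⁺ (∈⁺ (trans (cong Z (sym (swap-≢ e' f' p q))) (∈⁻ i∈)))) λ y → q (en-inj (trans (sym (∈⁅⁆⁻ y)) (sym en-f))))
    Ind⇒In : ∀ {Y} → Ind 𝓕 subU Y → In (im (lookup Y))
    Ind⇒In {Y} i = rank⇒In (subst₂ _≤_ (sym (O.#idx (lookup Y))) (r-rk _) (O.Ind⇒r (subst (Ind 𝓕 subU) (sym (tabulate∘lookup Y)) i)))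
    In⇒Ind : ∀ {Z} → In (im Z) → Ind 𝓕 subU (tabulate Z)
    In⇒Ind {Z} i = O.r⇒Ind (subst₂ _≤_ (O.#idx Z) (sym (r-rk _)) (In⇒rank i))
    matroidIso : IsMatroidIso (Ind 𝓕 subU) (Ind 𝓕 subU) ψ
    matroidIso Y = mk⇔ (λ i → In⇒Ind (transfer (lookup Y) (Ind⇒In i))) λ i →
      subst (Ind 𝓕 subU) (trans (tabulate-cong λ j → trans (lookup∘tabulate (λ k → lookup Y (ψ k)) (ψ j)) (cong (lookup Y) (swap-swap e' f' j))) (tabulate∘lookup Y))
        (In⇒Ind {lookup (preimage ψ Y) ∘ ψ} (transfer (lookup (preimage ψ Y)) (Ind⇒In i)))
    bij : Fin (# W) ⤖ Fin (# W)
    bij = mk⤖ {to = ψ} ((λ {x} {y} p → trans (sym (swap-swap e' f' x)) (trans (cong ψ p) (swap-swap e' f' y))) ,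
      λ y → ψ y , λ { refl → swap-swap e' f' y })
    module _ (φ : GraphIso subU subU) (φ-induced : Induced subU subU φ ψ) where
      image : ∀ {v} → IsVertex subU v → ℕ
      image {v} x = proj₁ (Bijection.to (proj₁ φ) (v , x))
      On : Fin (# W) → ℕ → Set
      On i v = v ≡ lo (edge subU i) ⊎ v ≡ hi (edge subU i)
      image-on : ∀ {v} (x : IsVertex subU v) i → On i v → On (ψ i) (image x)
      image-on {v} x i (inj₁ refl) = subst (λ y → On (ψ i) (proj₁ (Bijection.to (proj₁ φ) y))) (V-≡ {subU} refl) (joins-left {edge subU (ψ i)} (φ-induced i))
      image-on {v} x i (inj₂ refl) = subst (λ y → On (ψ i) (proj₁ (Bijection.to (proj₁ φ) y))) (V-≡ {subU} refl) (joins-right {edge subU (ψ i)} (φ-induced i))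
      -- an end of e that is not an end of f, and two further edges there
      private-end : ∃ λ a → ∃ λ b → ((pU e ≡ a × qU e ≡ b) ⊎ (pU e ≡ b × qU e ≡ a)) × pU f ≢ a × qU f ≢ a
      private-end with pU f Fin.≟ pU e | qU f Fin.≟ pU e
      ... | no p | no q = pU e , qU e , inj₁ (refl , refl) , p , q
      ... | yes p | _ = qU e , pU e , inj₂ (refl , refl) , (λ r → pU≢qU e (trans (sym p) r)) , λ r → e≢f (pqU-inj (sym p) (sym r))
      ... | no _ | yes q = qU e , pU e , inj₂ (refl , refl) , (λ r → <-asym (pU<qU e) (subst₂ _<_ (cong toℕ r) (cong toℕ q) (pU<qU f))) , λ r → pU≢qU e (trans (sym q) r)
      module _ {a b} (ends : (pU e ≡ a × qU e ≡ b) ⊎ (pU e ≡ b × qU e ≡ a)) (p≢ : pU f ≢ a) (q≢ : qU f ≢ a) where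
        a∈ : a ∈ A
        a∈ = [ (λ (p , _) → subst (_∈ A) p (proj₁ (within (∈imgU e∈)))) , (λ (_ , q) → subst (_∈ A) q (proj₂ (within (∈imgU e∈)))) ]′ ends
        module _ {y₁ y₂} (y₁∈ : y₁ ∈ nb a) (y₁∉ : y₁ ∉ ⁅ b ⁆) (y₂∈ : y₂ ∈ nb a) (y₂∉ : y₂ ∉ ⁅ b ⁆ ∪ ⁅ y₁ ⁆) where
          aV : IsVertex subU (toℕ a)
          aV = A-vertex a∈
          on-a : ∀ i → (pU (en i) ≡ a) ⊎ (qU (en i) ≡ a) → On i (toℕ a)
          on-a i (inj₁ refl) = inj₁ (toℕ-pU _)
          on-a i (inj₂ refl) = inj₂ (toℕ-qU _)
          -- the edge from a to a neighbour other than b is fixed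
          image-in : ∀ {y} → y ∈ nb a → y ∉ ⁅ b ⁆ → image aV ≡ toℕ a ⊎ image aV ≡ toℕ y
          image-in {y} y∈ y∉ = go (joined-edge (nb⁻ y∈))
            where
            go : (∃ λ i → (pU (en i) ≡ y × qU (en i) ≡ a) ⊎ (pU (en i) ≡ a × qU (en i) ≡ y)) → image aV ≡ toℕ a ⊎ image aV ≡ toℕ y
            go (i , h) = locate h (subst (λ k → On k (image aV)) (swap-≢ e' f' i≢e i≢f) (image-on aV i (on-a i (at-a h))))
              where
              at-a : (pU (en i) ≡ y × qU (en i) ≡ a) ⊎ (pU (en i) ≡ a × qU (en i) ≡ y) → (pU (en i) ≡ a) ⊎ (qU (en i) ≡ a)
              at-a (inj₁ (_ , q)) = inj₂ q
              at-a (inj₂ (p , _)) = inj₁ p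
              i≢f : i ≢ f'
              i≢f refl = [ (λ p → p≢ (trans (cong pU (sym en-f)) p)) , (λ q → q≢ (trans (cong qU (sym en-f)) q)) ]′ (at-a h)
              i≢e : i ≢ e'
              i≢e refl = y∉ (subst (_∈ ⁅ b ⁆) (other ends (subst (λ k → (pU k ≡ y × qU k ≡ a) ⊎ (pU k ≡ a × qU k ≡ y)) en-e h)) (∈⁅⁆ b))
                where
                other : (pU e ≡ a × qU e ≡ b) ⊎ (pU e ≡ b × qU e ≡ a) → (pU e ≡ y × qU e ≡ a) ⊎ (pU e ≡ a × qU e ≡ y) → b ≡ y
                other (inj₁ (p , q)) (inj₁ (r , s)) = ⊥-elim (pU≢qU e (trans p (sym s)))
                other (inj₁ (p , q)) (inj₂ (r , s)) = trans (sym q) s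
                other (inj₂ (p , q)) (inj₁ (r , s)) = trans (sym p) r
                other (inj₂ (p , q)) (inj₂ (r , s)) = ⊥-elim (pU≢qU e (trans r (sym q)))
              locate : (pU (en i) ≡ y × qU (en i) ≡ a) ⊎ (pU (en i) ≡ a × qU (en i) ≡ y) → On i (image aV) → image aV ≡ toℕ a ⊎ image aV ≡ toℕ y
              locate (inj₁ (refl , refl)) (inj₁ l) = inj₂ (trans l (sym (toℕ-pU _)))
              locate (inj₁ (refl , refl)) (inj₂ l) = inj₁ (trans l (sym (toℕ-qU _)))
              locate (inj₂ (refl , refl)) (inj₁ l) = inj₁ (trans l (sym (toℕ-pU _)))
              locate (inj₂ (refl , refl)) (inj₂ l) = inj₂ (trans l (sym (toℕ-qU _)))
          fixed : image aV ≡ toℕ a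
          fixed = go (image-in y₁∈ y₁∉) (image-in y₂∈ (y₂∉ ∘ ∪ˡ))
            where
            go : image aV ≡ toℕ a ⊎ image aV ≡ toℕ y₁ → image aV ≡ toℕ a ⊎ image aV ≡ toℕ y₂ → image aV ≡ toℕ a
            go (inj₁ p) _ = p
            go (inj₂ _) (inj₁ q) = q
            go (inj₂ p) (inj₂ q) = ⊥-elim (y₂∉ (∪ʳ (subst (_∈ ⁅ y₁ ⁆) (Fin.toℕ-injective (trans (sym p) q)) (∈⁅⁆ y₁))))
          e-at-a : (pU (en e') ≡ a) ⊎ (qU (en e') ≡ a)
          e-at-a = [ (λ (p , _) → inj₁ (trans (cong pU en-e) p)) , (λ (_ , q) → inj₂ (trans (cong qU en-e) q)) ]′ ends
          on-f : On f' (image aV)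
          on-f = subst (λ k → On k (image aV)) (swap-a e' f') (image-on aV e' (on-a e' e-at-a))
          absurd : ⊥
          absurd = [ (λ l → p≢ (Fin.toℕ-injective (trans (toℕ-pU f) (trans (cong (lo ∘ edgeU N) (sym en-f)) (trans (sym l) fixed)))))
                   , (λ l → q≢ (Fin.toℕ-injective (trans (toℕ-qU f) (trans (cong (hi ∘ edgeU N) (sym en-f)) (trans (sym l) fixed))))) ]′ on-f

        two-neighbours : ⊥
        two-neighbours =
          let y₁ , y₁∈ , y₁∉ = #<⇒∃ ⁅ b ⁆ (nb a) (≤-trans (s≤s (≤-trans (≤-reflexive (#-⁅⁆ b)) (s≤s z≤n))) (≤-trans 3≤c (degree≥c a∈)))
              y₂ , y₂∈ , y₂∉ = #<⇒∃ (⁅ b ⁆ ∪ ⁅ y₁ ⁆) (nb a) (≤-trans (s≤s (≤-trans (#-add≤ ⁅ b ⁆ y₁) (s≤s (≤-reflexive (#-⁅⁆ b))))) (≤-trans 3≤c (degree≥c a∈)))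
          in absurd y₁∈ y₁∉ y₂∈ y₂∉

      no-iso : ⊥
      no-iso = let a , b , ends , p≢ , q≢ = private-end in two-neighbours ends p≢ q≢

   -- two edges of a highly connected reconstructible graph cannot be exchanged
   no-swap : Reconstructible (Ind 𝓕) subU → ⊥
   no-swap rec =
     let e' , en-e = en-onto e∈
         f' , en-f = en-onto f∈
         φ , ind = rec subU (bij e' f' en-e en-f) (matroidIso e' f' en-e en-f)
     in no-iso e' f' en-e en-f φ ind

Whitney-at : ℕ → GraphMatroidFamily → Set
Whitney-at c 𝓕 = ∀ G → IsConnected c G → Reconstructible (Ind 𝓕) G

module Rigidity (𝓕 : GraphMatroidFamily) (N : ℕ) (dec : Decidable-on 𝓕 N) {c c' : ℕ} (3≤c : 3 ≤ c) (c'≤c : c' ≤ c)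
  (whitney : Whitney-at c' 𝓕) where
  open UEnds N
  open FamilyRank 𝓕 N dec

  -- an edge outside the span of Y keeps every independent subset of Y independent
  In-add : ∀ {Y S e} → rk Y < rk (Y ∪ ⁅ e ⁆) → S ⊆ Y → e ∉ S → In S → In (S ∪ ⁅ e ⁆)
  In-add {Y} {S} {e} l h e∉ i = rank⇒In (≤-trans (≤-reflexive (#-add S e∉)) (≤-trans (s≤s (In⇒rank i))
    (lin 0 (Submodular.diminishing isSubmodular {S} {Y} {⁅ e ⁆} h ⊕ l) (arith (rk S) (rk Y) (rk (S ∪ ⁅ e ⁆)) (rk (Y ∪ ⁅ e ⁆))))))
    where
    arith : ∀ s y se ye → suc s + (y + se + ye) + 0 ≡ se + (ye + s + suc y)
    arith = solve-∀

  rk-img : ∀ Z → rk (idx (imgU Z)) ≤ rk Z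
  rk-img Z = rk-mono λ {j} x → [ (λ y → go y) , (λ y → swapped y) ]′ (∈idx⁻ x)
    where
    go : ∀ {j} → (pU j , qU j) ∈ imgU Z → j ∈ Z
    go y = let i , i∈ , a , b = ∈imgU⁻ y in subst (_∈ Z) (pqU-inj a b) i∈
    swapped : ∀ {j} → (qU j , pU j) ∈ imgU Z → j ∈ Z
    swapped {j} y = let i , i∈ , a , b = ∈imgU⁻ y in ⊥-elim (<-asym (pU<qU j) (subst₂ _<_ (cong toℕ a) (cong toℕ b) (pU<qU i)))

  module _ {A : Fin N → Bool} (c<A : c < # A) where
    WA : Fin (mU N) → Bool
    WA = idx (clique A)

    WA⁻ : ∀ {i} → i ∈ WA → pU i ∈ A × qU i ∈ A
    WA⁻ x = [ ∈clique⁻ , (λ y → let a , b = ∈clique⁻ y in b , a) ]′ (∈idx⁻ x)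

    WA⁺ : ∀ {i} → pU i ∈ A → qU i ∈ A → i ∈ WA
    WA⁺ a b = ∈idx (inj₁ (∈clique a b))

    img-within : ∀ {W} → W ⊆ WA → WithinE A (imgU W)
    img-within h x with ∈imgU⁻ x
    ... | i , i∈ , refl , refl = WA⁻ (h i∈)

    img-connected : ∀ {X W} → WithinE A X → ConnectedE c A X → idx X ⊆ W → ConnectedE c A (imgU W)
    img-connected {X} {W} within con h {A₁} {A₂} (A⊆ , A₁⊆ , A₂⊆ , inside , r) = con (A⊆ , A₁⊆ , A₂⊆ , inside' , r)
      where
      inside' : ∀ {u v} → (u , v) ∈ X → (u ∈ A₁ × v ∈ A₁) ⊎ (u ∈ A₂ × v ∈ A₂)
      inside' {u} {v} x with u Fin.≟ v
      ... | yes refl = [ (λ a → inj₁ (a , a)) , (λ a → inj₂ (a , a)) ]′ (∪⁻ (A⊆ (proj₁ (within x))))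
      ... | no ne with pairU u v ne
      ...   | i , inj₁ (refl , refl) = inside (∈imgU (h (∈idx (inj₁ x))))
      ...   | i , inj₂ (refl , refl) = [ (λ (a , b) → inj₁ (b , a)) , (λ (a , b) → inj₂ (b , a)) ]′ (inside (∈imgU (h (∈idx (inj₂ x)))))

    no-series : ∀ {W e f Yₑ Y_f} → W ⊆ WA → ConnectedE c A (imgU W) → e ∈ W → f ∈ W → e ≢ f →
      (∀ {S} → S ⊆ W → e ∉ S → f ∉ S → S ⊆ Yₑ × S ⊆ Y_f) →
      rk Yₑ < rk (Yₑ ∪ ⁅ e ⁆) → rk Y_f < rk (Y_f ∪ ⁅ f ⁆) → ⊥
    no-series {W} {e} {f} h con e∈ f∈ ne sub le lf =
      SwapLemma.no-swap 𝓕 N dec W 3≤c (img-within h) con c<A e∈ f∈ ne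
        (λ S⊆ e∉ f∉ i → In-add lf (proj₂ (sub S⊆ e∉ f∉)) f∉ (In-⊆ ∪ˡ i))
        (λ S⊆ e∉ f∉ i → In-add le (proj₁ (sub S⊆ e∉ f∉)) e∉ (In-⊆ ∪ˡ i))
        (whitney _ (SubU.Connectivity.isConnected W (≤-trans (s≤s z≤n) 3≤c) (img-within h) con c<A c'≤c))

    rigid : ∀ {X} → WithinE A X → ConnectedE c A X → r (clique A) ≤ r X
    rigid {X} within con = ≮⇒≥ λ l → maximal (subst₂ _<_ (r-rk X) (r-rk (clique A)) l)
      where
      X⊆ : idx X ⊆ WA
      X⊆ = idx-mono λ x _ → inj₁ (∈clique (proj₁ (within x)) (proj₂ (within x)))
      Maximal : Fin (mU N) → (Fin (mU N) → Bool) → Set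
      Maximal i Y = i ∈ WA → i ∈ Y ⊎ rk WA ≤ rk (Y ∪ ⁅ i ⁆)
      hyperplane : ∀ Y → idx X ⊆ Y → Y ⊆ WA → rk Y < rk WA → (∀ i → Maximal i Y) → ⊥
      hyperplane Y X⊆Y Y⊆ l max = missing (⊆-or-∃ WA Y)
        where
        outside : ∀ {i} → i ∈ WA → i ∉ Y → rk Y < rk (Y ∪ ⁅ i ⁆)
        outside i∈ i∉ = ≤-trans l ([ (λ y → ⊥-elim (i∉ y)) , id ]′ (max _ i∈))
        two : ∀ {e} → e ∈ WA → e ∉ Y → (WA ⊆ Y ∪ ⁅ e ⁆) ⊎ (∃ λ f → f ∈ WA × f ∉ Y ∪ ⁅ e ⁆) → ⊥
        two {e} e∈ e∉ (inj₂ (f , f∈ , f∉)) = no-series {(Y ∪ ⁅ e ⁆) ∪ ⁅ f ⁆} {e} {f} {Y} {Y} (∪-⊆ (∪-⊆ Y⊆ (⁅⁆-⊆ e∈)) (⁅⁆-⊆ f∈))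
          (img-connected within con (∪ˡ ∘ ∪ˡ ∘ X⊆Y)) (∪ˡ (∪ʳ (∈⁅⁆ e))) (∪ʳ (∈⁅⁆ f)) (λ { refl → f∉ (∪ʳ (∈⁅⁆ e)) })
          (λ {S} S⊆ e∉S f∉S → inY S⊆ e∉S f∉S , inY S⊆ e∉S f∉S) (outside e∈ e∉) (outside f∈ (f∉ ∘ ∪ˡ))
          where
          inY : ∀ {S} → S ⊆ (Y ∪ ⁅ e ⁆) ∪ ⁅ f ⁆ → e ∉ S → f ∉ S → S ⊆ Y
          inY {S} S⊆ e∉S f∉S s = [ (λ x → [ id , (λ y → ⊥-elim (e∉S (subst (_∈ S) (sym (∈⁅⁆⁻ y)) s))) ]′ (∪⁻ x)) ,
            (λ y → ⊥-elim (f∉S (subst (_∈ S) (sym (∈⁅⁆⁻ y)) s))) ]′ (∪⁻ (S⊆ s))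
        two {e} e∈ e∉ (inj₁ all) = coloop (#<⇒∃ (⁅ pU e ⁆ ∪ ⁅ qU e ⁆) A
            (≤-trans (s≤s (≤-trans (#-add≤ ⁅ pU e ⁆ (qU e)) (s≤s (≤-reflexive (#-⁅⁆ (pU e)))))) (≤-trans 3≤c (<⇒≤ c<A))))
          where
          -- e is a coloop of the complete graph, hence so is an adjacent edge
          coloop : (∃ λ x → x ∈ A × x ∉ ⁅ pU e ⁆ ∪ ⁅ qU e ⁆) → ⊥
          coloop (x , x∈ , x∉) = adjacent (pairU (pU e) x λ { refl → x∉ (∪ˡ (∈⁅⁆ (pU e))) })
            where
            q≢x : qU e ≢ x
            q≢x refl = x∉ (∪ʳ (∈⁅⁆ (qU e)))
            p≢x : pU e ≢ x
            p≢x refl = x∉ (∪ˡ (∈⁅⁆ (pU e)))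
            σ : Fin N → Fin N
            σ = swap (qU e) x
            σA : ∀ {y} → y ∈ A → σ y ∈ A
            σA {y} y∈ = go (y Fin.≟ qU e) (y Fin.≟ x)
              where
              go : Dec (y ≡ qU e) → Dec (y ≡ x) → σ y ∈ A
              go (yes refl) _ = subst (_∈ A) (sym (swap-a (qU e) x)) x∈
              go (no _) (yes refl) = subst (_∈ A) (sym (swap-b (qU e) x)) (proj₂ (WA⁻ e∈))
              go (no p) (no q) = subst (_∈ A) (sym (swap-≢ (qU e) x p q)) y∈
            σ-p : ∀ {y} → σ y ≡ pU e → y ≡ pU e
            σ-p {y} h = trans (sym (swap-swap (qU e) x y)) (trans (cong σ h) (swap-≢ (qU e) x (pU≢qU e) p≢x))
            σ-q : ∀ {y} → σ y ≡ qU e → y ≡ x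
            σ-q {y} h = trans (sym (swap-swap (qU e) x y)) (trans (cong σ h) (swap-a (qU e) x))
            adjacent : (∃ λ f → (pU f ≡ pU e × qU f ≡ x) ⊎ (pU f ≡ x × qU f ≡ pU e)) → ⊥
            adjacent (f , ends) = no-series {WA} {e} {f} {WA ∖ ⁅ e ⁆} {WA ∖ ⁅ f ⁆} id (img-connected within con X⊆) e∈ f∈
              (λ { refl → [ (λ (_ , b) → q≢x b) , (λ (a , _) → p≢x a) ]′ ends })
              (λ {S} S⊆ e∉S f∉S → (λ s → ∖⁺ (S⊆ s) λ y → e∉S (subst (_∈ S) (sym (∈⁅⁆⁻ y)) s)) , λ s → ∖⁺ (S⊆ s) λ y → f∉S (subst (_∈ S) (sym (∈⁅⁆⁻ y)) s))
              (≤-trans drop-e (rk-mono ∖∪')) (≤-trans (≤-trans (s≤s drop-f) drop-e) (rk-mono ∖∪'))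
              where
              f∈ : f ∈ WA
              f∈ = [ (λ (a , b) → WA⁺ (subst (_∈ A) (sym a) (proj₁ (WA⁻ e∈))) (subst (_∈ A) (sym b) x∈))
                   , (λ (a , b) → WA⁺ (subst (_∈ A) (sym a) x∈) (subst (_∈ A) (sym b) (proj₁ (WA⁻ e∈)))) ]′ ends
              ∖∪' : ∀ {e} → WA ⊆ (WA ∖ ⁅ e ⁆) ∪ ⁅ e ⁆
              ∖∪' x = [ ∪ʳ , ∪ˡ ]′ (∪⁻ (∖∪ x))
              drop-e : rk (WA ∖ ⁅ e ⁆) < rk WA
              drop-e = ≤-trans (s≤s (rk-mono λ y → [ id , (λ z → ⊥-elim (∖ʳ y z)) ]′ (∪⁻ (all (∖ˡ y))))) l
              drop-f : rk (WA ∖ ⁅ f ⁆) ≤ rk (WA ∖ ⁅ e ⁆)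
              drop-f = begin
                rk (WA ∖ ⁅ f ⁆)                                     ≤⟨ rk-mono moved ⟩
                rk (idx (permute τ (imgU (WA ∖ ⁅ e ⁆))))            ≡⟨ r-rk _ ⟨
                r (permute τ (imgU (WA ∖ ⁅ e ⁆)))                   ≡⟨ r-permute τ _ ⟩
                r (imgU (WA ∖ ⁅ e ⁆))                               ≡⟨ r-rk _ ⟩
                rk (idx (imgU (WA ∖ ⁅ e ⁆)))                        ≤⟨ rk-img _ ⟩
                rk (WA ∖ ⁅ e ⁆)                                     ∎
                where
                open ≤-Reasoning
                τ : Perm N
                τ = transposition (qU e) x
                moved : WA ∖ ⁅ f ⁆ ⊆ idx (permute τ (imgU (WA ∖ ⁅ e ⁆)))
                moved {i} i∈ = go (pairU (σ (pU i)) (σ (qU i)) λ h → pU≢qU i (Perm.π-inj τ h))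
                  where
                  A² : pU i ∈ A × qU i ∈ A
                  A² = WA⁻ (∖ˡ i∈)
                  i≢f : i ≢ f
                  i≢f refl = ∖ʳ i∈ (∈⁅⁆ f)
                  not-f : ∀ {a b} → (a ≡ pU i × b ≡ qU i) ⊎ (a ≡ qU i × b ≡ pU i) → a ≡ pU e → b ≡ x → ⊥
                  not-f (inj₁ (refl , refl)) h k = i≢f ([ (λ (a , b) → pqU-inj (trans h (sym a)) (trans k (sym b)))
                    , (λ (a , b) → ⊥-elim (<-asym (pU<qU i) (subst₂ _<_ (cong toℕ (trans a (sym k))) (cong toℕ (trans b (sym h))) (pU<qU f)))) ]′ ends)
                  not-f (inj₂ (refl , refl)) h k = i≢f ([ (λ (a , b) → ⊥-elim (<-asym (pU<qU i) (subst₂ _<_ (cong toℕ (trans a (sym h))) (cong toℕ (trans b (sym k))) (pU<qU f))))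
                    , (λ (a , b) → pqU-inj (trans k (sym a)) (trans h (sym b))) ]′ ends)
                  go : (∃ λ j → (pU j ≡ σ (pU i) × qU j ≡ σ (qU i)) ⊎ (pU j ≡ σ (qU i) × qU j ≡ σ (pU i))) → i ∈ idx (permute τ (imgU (WA ∖ ⁅ e ⁆)))
                  go (j , inj₁ (a , b)) = ∈idx (inj₁ (∈⁺ (∈⁻ (subst₂ (λ s t → (s , t) ∈ imgU (WA ∖ ⁅ e ⁆)) a b (∈imgU j∈)))))
                    where
                    j∈ : j ∈ WA ∖ ⁅ e ⁆
                    j∈ = ∖⁺ (WA⁺ (subst (_∈ A) (sym a) (σA (proj₁ A²))) (subst (_∈ A) (sym b) (σA (proj₂ A²)))) λ y →
                      let ej = ∈⁅⁆⁻ y in not-f (inj₁ (refl , refl)) (σ-p (trans (sym a) (cong pU (sym ej)))) (σ-q (trans (sym b) (cong qU (sym ej))))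
                  go (j , inj₂ (a , b)) = ∈idx (inj₂ (∈⁺ (∈⁻ (subst₂ (λ s t → (s , t) ∈ imgU (WA ∖ ⁅ e ⁆)) a b (∈imgU j∈)))))
                    where
                    j∈ : j ∈ WA ∖ ⁅ e ⁆
                    j∈ = ∖⁺ (WA⁺ (subst (_∈ A) (sym a) (σA (proj₂ A²))) (subst (_∈ A) (sym b) (σA (proj₁ A²)))) λ y →
                      let ej = ∈⁅⁆⁻ y in not-f (inj₂ (refl , refl)) (σ-p (trans (sym a) (cong pU (sym ej)))) (σ-q (trans (sym b) (cong qU (sym ej))))
        missing : (WA ⊆ Y) ⊎ (∃ λ e → e ∈ WA × e ∉ Y) → ⊥
        missing (inj₁ h) = <⇒≱ l (rk-mono h)
        missing (inj₂ (e , e∈ , e∉)) = two e∈ e∉ (⊆-or-∃ WA (Y ∪ ⁅ e ⁆))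
      maximal : rk (idx X) < rk WA → ⊥
      maximal l = let Y , X⊆Y , (Y⊆ , lY) , max = iterate∪ (λ Y → Y ⊆ WA × rk Y < rk WA) Maximal
                        (λ h q i∈ → [ (λ y → inj₁ (h y)) , (λ y → inj₂ (≤-trans y (rk-mono (∪-mono h id)))) ]′ (q i∈)) (idx X) (X⊆ , l) enlarge
                  in hyperplane Y X⊆Y Y⊆ lY max
        where
        enlarge : ∀ i Y → idx X ⊆ Y → Y ⊆ WA × rk Y < rk WA → Σ (Fin (mU N) → Bool) λ Z → Y ⊆ Z × (Z ⊆ WA × rk Z < rk WA) × Maximal i Z
        enlarge i Y _ (h , l) with i ∈? WA | rk (Y ∪ ⁅ i ⁆) <? rk WA
        ... | no i∉ | _ = Y , id , (h , l) , λ i∈ → ⊥-elim (i∉ i∈)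
        ... | yes i∈ | yes l' = Y ∪ ⁅ i ⁆ , ∪ˡ , (∪-⊆ h (⁅⁆-⊆ i∈) , l') , λ _ → inj₁ (∪ʳ (∈⁅⁆ i))
        ... | yes i∈ | no l' = Y , id , (h , l) , λ _ → inj₂ (≮⇒≥ l')

parameters : (c K : ℕ) → 1 ≤ c → Parameters
parameters c K 1≤c = record
  { c = c ; K = K ; τ = τ ; T = 16 * τ + 16 * τ ; β = 8 * (K + 2) ; h = 16 * τ
  ; 1≤c = 1≤c ; 2c≤τ = 2c≤τ ; T≡2h = refl ; 16τ≤h = ≤-refl
  ; β4τ = ≤-reflexive (e₁ τ K)
  ; split-cost = ≤-reflexive (e₂ c K)
  ; 4β<T = lin (32 * c + 128 * K + 190) (128 ⊛ *-monoˡ-≤ (K + 2) 1≤c) (e₃ c K) }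
  where
  τ = c + K + 4 * (c * (K + 2))
  2c≤τ : c + c ≤ τ
  2c≤τ = lin (K + 4 * (c * K) + 7 * c) (≤-refl {c}) (e c K)
    where
    e : ∀ c K → c + c + c + (K + 4 * (c * K) + 7 * c) ≡ c + K + 4 * (c * (K + 2)) + c
    e = solve-∀
  e₁ : ∀ t K → (16 * t + 16 * t) * (K + 2) ≡ 8 * (K + 2) * (4 * t)
  e₁ = solve-∀
  e₂ : ∀ c K → (16 * (c + K + 4 * (c * (K + 2))) + 16 * (c + K + 4 * (c * (K + 2)))) * c + (16 * (c + K + 4 * (c * (K + 2))) + 16 * (c + K + 4 * (c * (K + 2)))) * K
       + 8 * (K + 2) * (c * (16 * (c + K + 4 * (c * (K + 2)))))
       ≡ (16 * (c + K + 4 * (c * (K + 2))) + 16 * (c + K + 4 * (c * (K + 2)))) * (c + K + 4 * (c * (K + 2)))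
  e₂ = solve-∀
  e₃ : ∀ c K → 4 * (8 * (K + 2)) + 2 + 128 * (c * (K + 2)) + (32 * c + 128 * K + 190)
       ≡ 16 * (c + K + 4 * (c * (K + 2))) + 16 * (c + K + 4 * (c * (K + 2))) + 128 * (1 * (K + 2))
  e₃ = solve-∀

-- Symmetric rank functions on the subgraphs of a complete graph: those of a single family,
-- and sums of such.
record SymmetricRank (k N : ℕ) : Set where
  field
    R : ESet N → ℕ
    mono : ∀ {X Y} → X ⊑ Y → R X ≤ R Y
    submod : ∀ {W I X Y} → I ⊑ X → I ⊑ Y → W ⊑ X ∪ Y → R W + R I ≤ R X + R Y
    empty : ∀ {X} → X ⊑ ∅ → R X ≡ 0
    add : ∀ X u v → R (X ∪ single u v) ≤ R X + k
    permuted : ∀ (P : Perm N) {X Y} → X ⊆ (λ (u , v) → Y (Perm.π P u , Perm.π P v)) → R X ≤ R Y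

  Rigid : ℕ → Set
  Rigid c = ∀ {A X} → WithinE A X → ConnectedE c A X → c < # A → R (clique A) ≤ R X

module SymmetricProperties {k N} (S : SymmetricRank k N) where
  open SymmetricRank S

  clique-mono : ∀ {A B : Fin N → Bool} → A ⊆ B → clique A ⊑ clique B
  clique-mono h x _ = inj₁ (let a , b = ∈clique⁻ x in ∈clique (h a) (h b))

  -- a set of edges built in a symmetric way from A has a rank depending only on the size of A
  module _ (F : (Fin N → Bool) → ESet N) (F-mono : ∀ {A B} → A ⊆ B → F A ⊑ F B)
           (F-swap : ∀ {A a b u v} → (u , v) ∈ F A → (swap a b u , swap a b v) ∈ F (A ∘ swap a b)) where

    size-invariant : ∀ n {A B : Fin N → Bool} → # (A ∖ B) ≤ n → # A ≡ # B → R (F A) ≤ R (F B)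
    size-invariant n {A} {B} l e = go n l (⊆-or-∃ A B)
      where
      go : ∀ n → # (A ∖ B) ≤ n → (A ⊆ B) ⊎ (∃ λ a → a ∈ A × a ∉ B) → R (F A) ≤ R (F B)
      go n l (inj₁ h) = mono (F-mono h)
      go zero l (inj₂ (a , a∈ , a∉)) = ⊥-elim (<⇒≱ (∈⇒#-pos (∖⁺ a∈ a∉)) l)
      go (suc n) l (inj₂ (a , a∈ , a∉)) = swapped (⊆-or-∃ B A)
        where
        swapped : (B ⊆ A) ⊎ (∃ λ b → b ∈ B × b ∉ A) → R (F A) ≤ R (F B)
        swapped (inj₁ h) = ⊥-elim (a∉ (⊆-#-⊇ h (≤-reflexive e) a∈))
        swapped (inj₂ (b , b∈ , b∉)) = ≤-trans (permuted τ λ {(u , v)} x → ∈⁺ (∈⁻ (F-swap {A} {a} {b} x))) (size-invariant n smaller same)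
          where
          τ : Perm N
          τ = transposition a b
          A' : Fin N → Bool
          A' = A ∘ swap a b
          A'⁻ : ∀ {x} → x ∈ A' → swap a b x ∈ A
          A'⁻ x = ∈⁺ (∈⁻ x)
          same : # A' ≡ # B
          same = trans (≤-antisym (#-inj (swap a b) A'⁻ λ _ _ → Perm.π-inj τ)
            (#-inj (swap a b) (λ {x} x∈ → ∈⁺ (trans (cong A (swap-swap a b x)) (∈⁻ x∈))) λ _ _ → Perm.π-inj τ)) e
          sub : A' ∖ B ⊆ A ∖ B
          sub {x} r = [ (λ p → ⊥-elim (b∉ (subst (_∈ A) (trans (cong (swap a b) p) (swap-a a b)) (A'⁻ (∖ˡ r)))))
                      , (λ p → [ (λ q → ⊥-elim (∖ʳ r (subst (_∈ B) (sym q) b∈))) , (λ q → ∖⁺ (subst (_∈ A) (swap-≢ a b p q) (A'⁻ (∖ˡ r))) (∖ʳ r)) ]′ (toSum (x Fin.≟ b))) ]′ (toSum (x Fin.≟ a))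
          smaller : # (A' ∖ B) ≤ n
          smaller = s≤s⁻¹ (≤-trans (#-strict sub (∖⁺ a∈ a∉) λ r → b∉ (subst (_∈ A) (swap-a a b) (A'⁻ (∖ˡ r)))) l)

  ∘swap⁺ : ∀ {A : Fin N → Bool} {a b x} → x ∈ A → swap a b x ∈ A ∘ swap a b
  ∘swap⁺ {A} {a} {b} {x} x∈ = ∈⁺ (trans (cong A (swap-swap a b x)) (∈⁻ x∈))

  clique-size : ∀ n {A B : Fin N → Bool} → # (A ∖ B) ≤ n → # A ≡ # B → R (clique A) ≤ R (clique B)
  clique-size = size-invariant clique clique-mono λ x → let p , q = ∈clique⁻ x in ∈clique (∘swap⁺ p) (∘swap⁺ q)

  listed : ∀ {t} → (Fin t → Fin N × Fin N) → ESet N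
  listed f = ⟪ (λ x → Fin.any? λ i → (proj₁ (f i) Fin.≟ proj₁ x) ×-dec (proj₂ (f i) Fin.≟ proj₂ x)) ⟫

  ∈listed : ∀ {t} {f : Fin t → Fin N × Fin N} i → f i ∈ listed f
  ∈listed {f = f} i = ∈⟪⟫ (λ x → Fin.any? λ i → (proj₁ (f i) Fin.≟ proj₁ x) ×-dec (proj₂ (f i) Fin.≟ proj₂ x)) (i , refl , refl)

  ∈listed⁻ : ∀ {t} {f : Fin t → Fin N × Fin N} {u v} → (u , v) ∈ listed f → ∃ λ i → proj₁ (f i) ≡ u × proj₂ (f i) ≡ v
  ∈listed⁻ {f = f} = ∈⟪⟫⁻ (λ x → Fin.any? λ i → (proj₁ (f i) Fin.≟ proj₁ x) ×-dec (proj₂ (f i) Fin.≟ proj₂ x))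

  add-listed : ∀ {t} (f : Fin t → Fin N × Fin N) X → R (X ∪ listed f) ≤ R X + t * k
  add-listed {zero} f X = ≤-trans (mono (⊑-∪ ⊑-refl λ x _ → ⊥-elim (case (∈listed⁻ {f = f} x)))) (m≤m+n _ _)
    where
    case : ∀ {P : Fin 0 → Set} → ∃ P → ⊥
    case (() , _)
  add-listed {suc t} f X = ≤-trans (mono sub) (≤-trans (add-listed (f ∘ suc) (X ∪ single (proj₁ (f zero)) (proj₂ (f zero))))
    (≤-trans (+-monoˡ-≤ (t * k) (add X _ _)) (≤-reflexive (+-assoc (R X) k (t * k)))))
    where
    sub : X ∪ listed f ⊑ (X ∪ single (proj₁ (f zero)) (proj₂ (f zero))) ∪ listed (f ∘ suc)
    sub {u} {v} x _ = inj₁ ([ ∪ˡ ∘ ∪ˡ , (λ y → pick (∈listed⁻ {f = f} y)) ]′ (∪⁻ x))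
      where
      pick : (∃ λ i → proj₁ (f i) ≡ u × proj₂ (f i) ≡ v) → (u , v) ∈ (X ∪ single (proj₁ (f zero)) (proj₂ (f zero))) ∪ listed (f ∘ suc)
      pick (zero , refl , refl) = ∪ˡ (∪ʳ ∈single)
      pick (suc i , refl , refl) = ∪ʳ (∈listed {f = f ∘ suc} i)

  first : ℕ → Fin N → Bool
  first a = ⟪ (λ x → toℕ x <? a) ⟫

  #first : ∀ {a} → a ≤ N → # (first a) ≡ a
  #first {a} l = ≤-antisym upper lower
    where
    lower : a ≤ # (first a)
    lower = ≤-trans (≤-trans (≤-reflexive (sym (trans (Sum-const {a} 1) (*-identityʳ a)))) (≤-reflexive (trans (Sum-cong λ _ → refl) (sym (#-Sum (full {Fin a}))))))
      (#-inj (λ i → fromℕ< (≤-trans (Fin.toℕ<n i) l)) (λ {i} _ → ∈⟪⟫ (λ x → toℕ x <? a) (subst (_< a) (sym (Fin.toℕ-fromℕ< _)) (Fin.toℕ<n i)))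
        λ {i} {j} _ _ e → Fin.toℕ-injective (trans (sym (Fin.toℕ-fromℕ< _)) (trans (cong toℕ e) (Fin.toℕ-fromℕ< _))))
    upper : # (first a) ≤ a
    upper = ≮⇒≥ λ lt → <⇒≱ lt (bound a refl)
      where
      bound : ∀ b → b ≡ a → # (first a) ≤ b
      bound zero refl = ≮⇒≥ λ l → let x , x∈ = #-pos l in n≮0 (∈⟪⟫⁻ (λ x → toℕ x <? 0) x∈)
      bound (suc b) refl = ≤-trans (#-inj {m = suc b} clamp {S = full} (λ _ → ∈full) inj) (#≤n full)
        where
        clamp : Fin N → Fin (suc b)
        clamp x with toℕ x <? suc b
        ... | yes l = fromℕ< l
        ... | no _ = zero
        clamp-toℕ : ∀ {x} → toℕ x < suc b → toℕ (clamp x) ≡ toℕ x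
        clamp-toℕ {x} l with toℕ x <? suc b
        ... | yes l' = Fin.toℕ-fromℕ< l'
        ... | no ¬l = ⊥-elim (¬l l)
        inj : ∀ {x y} → x ∈ first (suc b) → y ∈ first (suc b) → clamp x ≡ clamp y → x ≡ y
        inj x∈ y∈ e = Fin.toℕ-injective (trans (sym (clamp-toℕ (∈⟪⟫⁻ (λ x → toℕ x <? suc b) x∈))) (trans (cong toℕ e) (clamp-toℕ (∈⟪⟫⁻ (λ x → toℕ x <? suc b) y∈))))

  ρ : ℕ → ℕ
  ρ a = R (clique (first a))

  R-clique : ∀ A → R (clique A) ≡ ρ (# A)
  R-clique A = ≤-antisym (clique-size _ ≤-refl (sym (#first (#≤n A)))) (clique-size _ ≤-refl (#first (#≤n A)))

  module _ {c} (1≤c : 1 ≤ c) (rigid : Rigid c) where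

    ρ-step : ∀ {a} → suc a ≤ N → ρ (suc a) ≤ c * k + ρ a
    ρ-step {a} l = extend (subset-of-size A (a ⊓ c) (≤-trans (m⊓n≤m a c) (≤-reflexive (sym #A)))) (#<⇒∃ A full
        (≤-trans (≤-reflexive (cong suc #A)) (≤-trans l (≤-reflexive (sym #full)))))
      where
      A : Fin N → Bool
      A = first a
      #A : # A ≡ a
      #A = #first (≤-trans (n≤1+n a) l)
      #full : # {N} full ≡ N
      #full = trans (#-Sum full) (trans (Sum-const {N} 1) (*-identityʳ N))
      extend : (Σ (Fin N → Bool) λ B → B ⊆ A × # B ≡ a ⊓ c) → (∃ λ v → v ∈ full × v ∉ A) → ρ (suc a) ≤ c * k + ρ a
      extend (B , B⊆ , #B) (v , _ , v∉) = begin
        ρ (suc a)                    ≡⟨ cong ρ (trans (cong suc (sym #A)) (sym (#-add A v∉))) ⟩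
        ρ (# (A ∪ ⁅ v ⁆))            ≡⟨ R-clique (A ∪ ⁅ v ⁆) ⟨
        R (clique (A ∪ ⁅ v ⁆))       ≤⟨ spanning ⟩
        R (clique A ∪ listed star)   ≤⟨ add-listed star (clique A) ⟩
        R (clique A) + # B * k       ≤⟨ +-mono-≤ (≤-reflexive refl) (*-monoˡ-≤ k (≤-trans (≤-reflexive #B) (m⊓n≤n a c))) ⟩
        ρ a + c * k                  ≡⟨ +-comm (ρ a) (c * k) ⟩
        c * k + ρ a                  ∎
        where
        open ≤-Reasoning
        star : Fin (# B) → Fin N × Fin N
        star i = v , proj₁ (enumerate B) i
        star∈ : ∀ {b} → b ∈ B → (v , b) ∈ listed star
        star∈ b∈ = let i , e = proj₂ (proj₂ (proj₂ (enumerate B))) b∈ in subst (λ b → (v , b) ∈ listed star) e (∈listed {f = star} i)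
        star⁻ : ∀ {x y} → (x , y) ∈ listed star → x ≡ v × y ∈ B
        star⁻ x = let i , p , q = ∈listed⁻ {f = star} x in sym p , subst (_∈ B) q (proj₁ (proj₂ (enumerate B)) i)
        v∈ : v ∈ A ∪ ⁅ v ⁆
        v∈ = ∪ʳ (∈⁅⁆ v)
        #Av : # (A ∪ ⁅ v ⁆) ≡ suc a
        #Av = trans (#-add A v∉) (cong suc #A)
        within : WithinE (A ∪ ⁅ v ⁆) (clique A ∪ listed star)
        within x = [ (λ y → let p , q = ∈clique⁻ y in ∪ˡ p , ∪ˡ q) , (λ y → let p , q = star⁻ y in subst (_∈ A ∪ ⁅ v ⁆) (sym p) v∈ , ∪ˡ (B⊆ q)) ]′ (∪⁻ x)
        spanning : R (clique (A ∪ ⁅ v ⁆)) ≤ R (clique A ∪ listed star)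
        spanning with a ≤? c
        ... | yes a≤c = mono λ {x} {y} z ne → let p , q = ∈clique⁻ z in all ne (∪⁻ p) (∪⁻ q)
          where
          A⊆B : A ⊆ B
          A⊆B = ⊆-#-⊇ B⊆ (≤-reflexive (trans #A (trans (sym (m≤n⇒m⊓n≡m a≤c)) (sym #B))))
          all : ∀ {x y} → x ≢ y → x ∈ A ⊎ x ∈ ⁅ v ⁆ → y ∈ A ⊎ y ∈ ⁅ v ⁆ → (x , y) ∈ clique A ∪ listed star ⊎ (y , x) ∈ clique A ∪ listed star
          all ne (inj₁ p) (inj₁ q) = inj₁ (∪ˡ (∈clique p q))
          all {x} {y} ne (inj₁ p) (inj₂ q) = inj₂ (∪ʳ (subst (λ y → (y , x) ∈ listed star) (∈⁅⁆⁻ q) (star∈ (A⊆B p))))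
          all {x} {y} ne (inj₂ p) (inj₁ q) = inj₁ (∪ʳ (subst (λ x → (x , y) ∈ listed star) (∈⁅⁆⁻ p) (star∈ (A⊆B q))))
          all ne (inj₂ p) (inj₂ q) = ⊥-elim (ne (trans (sym (∈⁅⁆⁻ p)) (∈⁅⁆⁻ q)))
        ... | no a≰c = rigid within con (≤-trans (≰⇒> a≰c) (≤-trans (n≤1+n a) (≤-reflexive (sym #Av))))
          where
          #B≡c : # B ≡ c
          #B≡c = trans #B (m≥n⇒m⊓n≡n (<⇒≤ (≰⇒> a≰c)))
          con : ConnectedE c (A ∪ ⁅ v ⁆) (clique A ∪ listed star)
          con {A₁} {A₂} (A⊆ , A₁⊆ , A₂⊆ , inside , (u , u∈ , u∉) , (y , y∈ , y∉)) = side (⊆-or-∃ A A₁) (⊆-or-∃ A A₂)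
            where
            nbrs : ∀ {A₁ A₂} → (∀ {s t} → (s , t) ∈ clique A ∪ listed star → (s ∈ A₁ × t ∈ A₁) ⊎ (s ∈ A₂ × t ∈ A₂)) → A ⊆ A₁ → v ∉ A₁ → B ⊆ A₁ ∩ A₂
            nbrs inside h v∉ b = [ (λ (p , _) → ⊥-elim (v∉ p)) , (λ (_ , q) → ∩⁺ (h (B⊆ b)) q) ]′ (inside (∪ʳ (star∈ b)))
            off : ∀ {A₁ y} → A ⊆ A₁ → y ∈ A ∪ ⁅ v ⁆ → y ∉ A₁ → v ∉ A₁
            off {A₁} h y∈ y∉ = [ (λ p → ⊥-elim (y∉ (h p))) , (λ p q → y∉ (subst (_∈ A₁) (∈⁅⁆⁻ p) q)) ]′ (∪⁻ y∈)
            side : (A ⊆ A₁) ⊎ (∃ λ s → s ∈ A × s ∉ A₁) → (A ⊆ A₂) ⊎ (∃ λ s → s ∈ A × s ∉ A₂) → c ≤ # (A₁ ∩ A₂)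
            side (inj₁ h) _ = ≤-trans (≤-reflexive (sym #B≡c)) (#-mono (nbrs inside h (off h y∈ y∉)))
            side (inj₂ _) (inj₁ h) = ≤-trans (≤-reflexive (sym #B≡c)) (#-mono λ b → let r = nbrs (λ x → [ inj₂ , inj₁ ]′ (inside x)) h (off h u∈ u∉) b in ∩⁺ (∩ʳ r) (∩ˡ r))
            side (inj₂ (s , s∈ , s∉)) (inj₂ (t , t∈ , t∉)) = ⊥-elim ([ (λ (p , _) → s∉ p) , (λ (_ , q) → t∉ q) ]′ (inside (∪ˡ (∈clique s∈ t∈))))

    ρ-bound : ∀ {a} → a ≤ N → ρ a ≤ c * k * a
    ρ-bound {zero} l = ≤-trans (≤-reflexive (empty λ x _ → ⊥-elim (n≮0 (∈⟪⟫⁻ (λ x → toℕ x <? 0) (proj₁ (∈clique⁻ x)))))) z≤n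
    ρ-bound {suc a} l = ≤-trans (ρ-step l) (≤-trans (+-monoʳ-≤ (c * k) (ρ-bound (≤-trans (n≤1+n a) l))) (≤-reflexive (sym (*-suc (c * k) a))))

    repair : ∀ {A A₁ A₂ : Fin N → Bool} → A ⊆ A₁ ∪ A₂ → A₁ ⊆ A → A₂ ⊆ A → c + c ≤ # A₁ → c + c ≤ # A₂ →
      ∃ λ M → ρ (# A) ≤ R ((clique A₁ ∪ clique A₂) ∪ M) × (∀ X → R (X ∪ M) ≤ R X + (c + c) * k)
    repair {A} {A₁} {A₂} A⊆ A₁⊆ A₂⊆ l₁ l₂ = go (subset-of-size A₁ (c + c) l₁) (subset-of-size A₂ (c + c) l₂)
      where
      go : (Σ (Fin N → Bool) λ B → B ⊆ A₁ × # B ≡ c + c) → (Σ (Fin N → Bool) λ B → B ⊆ A₂ × # B ≡ c + c) →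
        ∃ λ M → ρ (# A) ≤ R ((clique A₁ ∪ clique A₂) ∪ M) × (∀ X → R (X ∪ M) ≤ R X + (c + c) * k)
      go (B₁ , B₁⊆ , #B₁) (B₂ , B₂⊆ , #B₂) = go' (enumerate B₁) (subst (λ n → Σ (Fin n → Fin N) λ f → (∀ i → f i ∈ B₂) × (∀ {i j} → f i ≡ f j → i ≡ j)) (trans #B₂ (sym #B₁))
          (proj₁ (enumerate B₂) , proj₁ (proj₂ (enumerate B₂)) , proj₁ (proj₂ (proj₂ (enumerate B₂)))))
        where
        t = # B₁
        go' : (Σ (Fin t → Fin N) λ f → (∀ i → f i ∈ B₁) × (∀ {i j} → f i ≡ f j → i ≡ j) × (∀ {x} → x ∈ B₁ → ∃ λ i → f i ≡ x)) →
              (Σ (Fin t → Fin N) λ f → (∀ i → f i ∈ B₂) × (∀ {i j} → f i ≡ f j → i ≡ j)) →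
              ∃ λ M → ρ (# A) ≤ R ((clique A₁ ∪ clique A₂) ∪ M) × (∀ X → R (X ∪ M) ≤ R X + (c + c) * k)
        go' (a , a∈ , a-inj , _) (b , b∈ , b-inj) = listed f , ≤-trans (≤-reflexive (sym (R-clique A))) (rigid within con c<A) ,
            λ X → ≤-trans (add-listed f X) (≤-reflexive (cong (λ n → R X + n * k) #B₁))
          where
          f : Fin t → Fin N × Fin N
          f i = a i , b i
          c<A : c < # A
          c<A = ≤-trans (≤-trans (≤-reflexive (+-comm 1 c)) (+-monoʳ-≤ c 1≤c)) (≤-trans l₁ (#-mono A₁⊆))
          X : ESet N
          X = (clique A₁ ∪ clique A₂) ∪ listed f
          within : WithinE A X
          within x = [ [ (λ y → let p , q = ∈clique⁻ y in A₁⊆ p , A₁⊆ q) , (λ y → let p , q = ∈clique⁻ y in A₂⊆ p , A₂⊆ q) ]′ ∘ ∪⁻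
            , (λ y → let i , p , q = ∈listed⁻ {f = f} y in subst (_∈ A) p (A₁⊆ (B₁⊆ (a∈ i))) , subst (_∈ A) q (A₂⊆ (B₂⊆ (b∈ i)))) ]′ (∪⁻ x)
          con : ConnectedE c A X
          con {S₁} {S₂} (S⊆ , S₁⊆ , S₂⊆ , inside , (u , u∈ , u∉) , (y , y∈ , y∉)) = decide (side A₁ ∪ˡ) (side A₂ ∪ʳ)
            where
            side : ∀ C → (∀ {x} → x ∈ clique C → x ∈ clique A₁ ∪ clique A₂) → C ⊆ S₁ ⊎ C ⊆ S₂
            side C h with ⊆-or-∃ C S₁ | ⊆-or-∃ C S₂
            ... | inj₁ p | _ = inj₁ p
            ... | inj₂ _ | inj₁ q = inj₂ q
            ... | inj₂ (s , s∈ , s∉) | inj₂ (r , r∈ , r∉) = ⊥-elim ([ (λ (p , _) → s∉ p) , (λ (_ , q) → r∉ q) ]′ (inside (∪ˡ (h (∈clique s∈ r∈)))))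
            -- every added edge has an end in the separator, and no vertex ends more than two of them
            count : A₁ ⊆ S₁ → A₂ ⊆ S₂ → c ≤ # (S₁ ∩ S₂)
            count h₁ h₂ = *-cancelˡ-≤ 2 (≤-trans (≤-reflexive (trans (cong (c +_) (+-identityʳ c)) (trans (sym #B₁) (sym t≡))))
              (≤-trans (#-mono {Y = Ia ∪ Ib} λ {i} _ → [ (λ (_ , q) → ∪ʳ (Ib⁺ (∩⁺ q (h₂ (B₂⊆ (b∈ i)))))) , (λ (p , _) → ∪ˡ (Ia⁺ (∩⁺ (h₁ (B₁⊆ (a∈ i))) p))) ]′ (inside (∪ʳ (∈listed {f = f} i))))
              (≤-trans (#-∪≤ Ia Ib) (≤-trans (#-inj a Ia⁻ (λ _ _ → a-inj) ⊕ #-inj b Ib⁻ (λ _ _ → b-inj)) (≤-reflexive (cong (# (S₁ ∩ S₂) +_) (sym (+-identityʳ _))))))))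
              where
              Ia Ib : Fin t → Bool
              Ia = ⟪ (λ i → a i ∈? (S₁ ∩ S₂)) ⟫
              Ib = ⟪ (λ i → b i ∈? (S₁ ∩ S₂)) ⟫
              Ia⁺ : ∀ {i} → a i ∈ S₁ ∩ S₂ → i ∈ Ia
              Ia⁺ = ∈⟪⟫ (λ i → a i ∈? (S₁ ∩ S₂))
              Ia⁻ : ∀ {i} → i ∈ Ia → a i ∈ S₁ ∩ S₂
              Ia⁻ = ∈⟪⟫⁻ (λ i → a i ∈? (S₁ ∩ S₂))
              Ib⁺ : ∀ {i} → b i ∈ S₁ ∩ S₂ → i ∈ Ib
              Ib⁺ = ∈⟪⟫ (λ i → b i ∈? (S₁ ∩ S₂))
              Ib⁻ : ∀ {i} → i ∈ Ib → b i ∈ S₁ ∩ S₂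
              Ib⁻ = ∈⟪⟫⁻ (λ i → b i ∈? (S₁ ∩ S₂))
              t≡ : # {t} full ≡ t
              t≡ = trans (#-Sum full) (trans (Sum-const {t} 1) (*-identityʳ t))
            count' : A₁ ⊆ S₂ → A₂ ⊆ S₁ → c ≤ # (S₁ ∩ S₂)
            count' h₁ h₂ = *-cancelˡ-≤ 2 (≤-trans (≤-reflexive (trans (cong (c +_) (+-identityʳ c)) (trans (sym #B₁) (sym t≡))))
              (≤-trans (#-mono {Y = Ia ∪ Ib} λ {i} _ → [ (λ (p , _) → ∪ˡ (Ia⁺ (∩⁺ p (h₁ (B₁⊆ (a∈ i)))))) , (λ (_ , q) → ∪ʳ (Ib⁺ (∩⁺ (h₂ (B₂⊆ (b∈ i))) q))) ]′ (inside (∪ʳ (∈listed {f = f} i))))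
              (≤-trans (#-∪≤ Ia Ib) (≤-trans (#-inj a Ia⁻ (λ _ _ → a-inj) ⊕ #-inj b Ib⁻ (λ _ _ → b-inj)) (≤-reflexive (cong (# (S₁ ∩ S₂) +_) (sym (+-identityʳ _))))))))
              where
              Ia Ib : Fin t → Bool
              Ia = ⟪ (λ i → a i ∈? (S₁ ∩ S₂)) ⟫
              Ib = ⟪ (λ i → b i ∈? (S₁ ∩ S₂)) ⟫
              Ia⁺ : ∀ {i} → a i ∈ S₁ ∩ S₂ → i ∈ Ia
              Ia⁺ = ∈⟪⟫ (λ i → a i ∈? (S₁ ∩ S₂))
              Ia⁻ : ∀ {i} → i ∈ Ia → a i ∈ S₁ ∩ S₂
              Ia⁻ = ∈⟪⟫⁻ (λ i → a i ∈? (S₁ ∩ S₂))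
              Ib⁺ : ∀ {i} → b i ∈ S₁ ∩ S₂ → i ∈ Ib
              Ib⁺ = ∈⟪⟫ (λ i → b i ∈? (S₁ ∩ S₂))
              Ib⁻ : ∀ {i} → i ∈ Ib → b i ∈ S₁ ∩ S₂
              Ib⁻ = ∈⟪⟫⁻ (λ i → b i ∈? (S₁ ∩ S₂))
              t≡ : # {t} full ≡ t
              t≡ = trans (#-Sum full) (trans (Sum-const {t} 1) (*-identityʳ t))
            decide : A₁ ⊆ S₁ ⊎ A₁ ⊆ S₂ → A₂ ⊆ S₁ ⊎ A₂ ⊆ S₂ → c ≤ # (S₁ ∩ S₂)
            decide (inj₁ p) (inj₁ q) = ⊥-elim (y∉ ([ p , q ]′ (∪⁻ (A⊆ y∈))))
            decide (inj₂ p) (inj₂ q) = ⊥-elim (u∉ ([ p , q ]′ (∪⁻ (A⊆ u∈))))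
            decide (inj₁ p) (inj₂ q) = count p q
            decide (inj₂ p) (inj₁ q) = count' p q

    graphRank : GraphRank (parameters c ((c + c) * k) 1≤c) N
    graphRank = record
      { R = R ; ρ = ρ ; mono = mono ; submod = submod ; R-clique = R-clique
      ; ρ≤ = λ {a} l → ≤-trans (ρ-bound l) (*-monoˡ-≤ a ck≤)
      ; ρ-step = λ l → ≤-trans (ρ-step l) (+-monoˡ-≤ _ ck≤)
      ; repair = λ A⊆ A₁⊆ A₂⊆ l₁ l₂ → repair A⊆ A₁⊆ A₂⊆ (≤-trans 2c≤τ l₁) (≤-trans 2c≤τ l₂)
      ; rigid = λ within con l → ≤-trans (≤-reflexive (sym (R-clique _))) (rigid within con (≤-trans (s≤s c≤2τ) l)) }
      where
      open Parameters (parameters c ((c + c) * k) 1≤c) using (2c≤τ; τ)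
      ck≤ : c * k ≤ (c + c) * k
      ck≤ = *-monoˡ-≤ k (m≤m+n c c)
      c≤2τ : c ≤ 2 * τ
      c≤2τ = ≤-trans (m≤m+n c c) (≤-trans 2c≤τ (m≤m+n τ _))

SymmetricRank-Sum : ∀ {k N} → (Fin k → SymmetricRank 1 N) → SymmetricRank k N
SymmetricRank-Sum {k} {N} S = record
  { R = R
  ; mono = λ h → Sum-mono λ i → SymmetricRank.mono (S i) h
  ; submod = λ {W} {I} {X} {Y} a b c → subst₂ _≤_ (Sum-+ (λ i → r i W) (λ i → r i I)) (Sum-+ (λ i → r i X) (λ i → r i Y))
      (Sum-mono λ i → SymmetricRank.submod (S i) a b c)
  ; empty = λ h → Sum-0 λ i → SymmetricRank.empty (S i) h
  ; add = λ X u v → ≤-trans (Sum-mono λ i → SymmetricRank.add (S i) X u v) (≤-reflexive (trans (Sum-+ (λ i → r i X) (λ _ → 1))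
      (cong (R X +_) (trans (Sum-const {k} 1) (*-identityʳ k)))))
  ; permuted = λ P h → Sum-mono λ i → SymmetricRank.permuted (S i) P h }
  where
  r : Fin k → ESet N → ℕ
  r i = SymmetricRank.R (S i)
  R : ESet N → ℕ
  R X = Sum (λ i → r i X)

Rigid-Sum : ∀ {k N c} (S : Fin k → SymmetricRank 1 N) → (∀ i → SymmetricRank.Rigid (S i) c) → SymmetricRank.Rigid (SymmetricRank-Sum S) c
Rigid-Sum S h within con l = Sum-mono λ i → h i within con l

symmetricRank : ∀ 𝓕 N → Decidable-on 𝓕 N → SymmetricRank 1 N
symmetricRank 𝓕 N dec = record
  { R = r ; mono = r-mono ; submod = r-submod ; empty = r-∅
  ; add = λ X u v → ≤-trans (r-add X u v) (≤-reflexive (+-comm 1 _))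
  ; permuted = λ P {X} {Y} h → ≤-trans (r-mono (⊆⇒⊑ λ { {u , v} x → ∈⁺ (∈⁻ (h x)) })) (≤-reflexive (r-permute P Y)) }
  where
    open FamilyRank 𝓕 N dec

module UnionOfFamilies {k} (𝓜 : Fin k → GraphMatroidFamily) (N : ℕ) (dec : ∀ i → Decidable-on (𝓜 i) N) where
  private
    module F i = FamilyRank (𝓜 i) N (dec i)

  S : SymmetricRank k N
  S = SymmetricRank-Sum (λ i → symmetricRank (𝓜 i) N (dec i))

  open SymmetricRank S using (R)

  module OnGraph (G : Graph) (bd : Bounded N G) where
    open Ends G bd
    private
      module O i = F.OfGraph i G bd

    img-mono : ∀ {X Y} → X ⊆ Y → imgG X ⊆ imgG Y
    img-mono h {u , v} x with ∈imgG⁻ x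
    ... | e , e∈ , refl , refl = ∈imgG (h e∈)

    img-∪ : ∀ {X Y} → imgG (X ∪ Y) ⊆ imgG X ∪ imgG Y
    img-∪ {X} {Y} {u , v} x with ∈imgG⁻ x
    ... | e , e∈ , refl , refl = [ ∪ˡ ∘ ∈imgG , ∪ʳ ∘ ∈imgG ]′ (∪⁻ e∈)

    rankOn : Fin k → RankFn (m G)
    rankOn i = record
      { rk = λ X → F.r i (imgG X)
      ; isSubmodular = record
        { mono = λ h → F.r-mono i (⊆⇒⊑ (img-mono h))
        ; submod = λ a b c → F.r-submod i (⊆⇒⊑ (img-mono a)) (⊆⇒⊑ (img-mono b)) (⊆⇒⊑ (img-∪ ∘ img-mono c)) }
      ; rk≤# = λ X → ≤-trans (≤-reflexive (F.r-rk i _)) (≤-trans (F.rk≤# i _) (≤-reflexive (O.#idx i X))) }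

    RG : (Fin (m G) → Bool) → ℕ
    RG X = R (imgG X)

    RG-submodular : Submodular RG
    RG-submodular = Submodular-Sum {r = λ i X → F.r i (imgG X)} λ i → RankFn.isSubmodular (rankOn i)

    RG-∅ : RG ∅ ≡ 0
    RG-∅ = Sum-0 λ i → F.r-∅ i λ x _ → let e , e∈ , _ = ∈imgG⁻ x in ∅⁻ e∈

    look∈ : ∀ {n} {Y : S.Subset n} {x} → x S.∈ Y → x ∈ lookup Y
    look∈ p = ∈⁺ ([]=⇒lookup p)

    look∈⁻ : ∀ {n} {Y : S.Subset n} {x} → x ∈ lookup Y → x S.∈ Y
    look∈⁻ {Y = Y} {x} p = lookup⇒[]= x Y (∈⁻ p)

    union⇒spread : ∀ {Y} → UnionInd 𝓜 G Y → Spread RG (lookup Y)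
    union⇒spread {Y} (I , ind , cover) F F⊆ = ≤-trans (#-cover (λ j → F ∩ lookup (I j)) covered) (Sum-mono λ j →
      ≤-trans (RankFn.indep-⊆' (rankOn j) ∩ʳ (O.Ind⇒r j (subst (Ind (𝓜 j) G) (sym (tabulate∘lookup (I j))) (ind j))))
        (RankFn.mono (rankOn j) ∩ˡ))
      where
      covered : ∀ {e} → e ∈ F → ∃ λ j → e ∈ F ∩ lookup (I j)
      covered {e} e∈ = let j , e∈I = Equivalence.to (cover e) (look∈⁻ (F⊆ e∈)) in j , ∩⁺ e∈ (look∈ e∈I)

    spread⇒union : ∀ {Z} → Spread RG Z → UnionInd 𝓜 G (tabulate Z)
    spread⇒union {Z} sp = let J , ind , cover , _ , J⊆ = MatroidUnion.spread⇒partition rankOn sp in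
      (λ j → tabulate (J j)) , (λ j → O.r⇒Ind j (ind j)) ,
      λ e → mk⇔ (λ x → let j , y = cover (tab∈⁻ x) in j , tab∈ y) λ (j , x) → tab∈ ([ ∅⁻ , id ]′ (∪⁻ (J⊆ j (tab∈⁻ x))))

    spread-cong : ∀ {Z Z'} → (∀ i → Z i ≡ Z' i) → Spread RG Z → Spread RG Z'
    spread-cong e sp F h = sp F (≗⇒⊇ e ∘ h)

  module Pair {P : Parameters} (GR : GraphRank P N) (GR-R : ∀ X → GraphRank.R GR X ≡ R X)
    (G H : Graph) (bdG : Bounded N G) (bdH : Bounded N H) (ψ : Fin (m G) → Fin (m H)) (ψ' : Fin (m H) → Fin (m G)) (ψψ' : ∀ j → ψ (ψ' j) ≡ j) (ψ'ψ : ∀ i → ψ' (ψ i) ≡ i)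
    (iso : IsMatroidIso (UnionInd 𝓜 G) (UnionInd 𝓜 H) ψ) where
    private
      module G = OnGraph G bdG
      module H = OnGraph H bdH
      module EG = Ends G bdG
      module EH = Ends H bdH

    -- both graphs on the edge set of G
    RH : (Fin (m G) → Bool) → ℕ
    RH X = H.RG (X ∘ ψ')

    ∘ψ' : ∀ {X Y : Fin (m G) → Bool} → X ⊆ Y → X ∘ ψ' ⊆ Y ∘ ψ'
    ∘ψ' h x = ∈⁺ (∈⁻ (h (∈⁺ (∈⁻ x))))

    RH-submodular : Submodular RH
    RH-submodular = record
      { mono = λ {X} {Y} h → Submodular.mono H.RG-submodular (∘ψ' {X} {Y} h)
      ; submod = λ {W} {I} {X} {Y} a b c → Submodular.submod H.RG-submodular (∘ψ' {I} {X} a) (∘ψ' {I} {Y} b)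
          λ x → [ ∪ˡ ∘ (λ y → ∈⁺ (∈⁻ y)) , ∪ʳ ∘ (λ y → ∈⁺ (∈⁻ y)) ]′ (∪⁻ (c (∈⁺ (∈⁻ x)))) }

    RH-∅ : RH ∅ ≡ 0
    RH-∅ = n≤0⇒n≡0 (≤-trans (Submodular.mono H.RG-submodular {∅ ∘ ψ'} {∅} λ x → ∅⁻ {A = Fin (m G)} (∈⁺ (∈⁻ x))) (≤-reflexive H.RG-∅))

    #∘ψ' : ∀ X → # X ≡ # (X ∘ ψ')
    #∘ψ' X = ≤-antisym (#-inj ψ (λ {i} x → ∈⁺ (trans (cong X (ψ'ψ i)) (∈⁻ x))) λ {i} {j} _ _ e → trans (sym (ψ'ψ i)) (trans (cong ψ' e) (ψ'ψ j)))
      (#-inj ψ' (λ x → ∈⁺ (∈⁻ x)) λ {i} {j} _ _ e → trans (sym (ψψ' i)) (trans (cong ψ e) (ψψ' j)))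

    G⇒H : ∀ {Z} → Spread G.RG Z → Spread RH Z
    G⇒H {Z} sp F F⊆ = ≤-trans (≤-reflexive (#∘ψ' F)) (spH (F ∘ ψ') λ {j} x → ∈⁺ (trans (lookup∘tabulate (Z ∘ ψ') j) (∈⁻ (F⊆ (∈⁺ (∈⁻ x))))))
      where
      spH : Spread H.RG (lookup (tabulate (Z ∘ ψ')))
      spH = H.union⇒spread (Equivalence.from (iso (tabulate (Z ∘ ψ')))
        (subst (UnionInd 𝓜 G) (tabulate-cong λ i → sym (trans (lookup∘tabulate (Z ∘ ψ') (ψ i)) (cong Z (ψ'ψ i)))) (G.spread⇒union sp)))

    H⇒G : ∀ {Z} → Spread RH Z → Spread G.RG Z
    H⇒G {Z} sp = G.spread-cong (λ i → lookup∘tabulate Z i) (G.union⇒spread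
      (subst (UnionInd 𝓜 G) (tabulate-cong λ i → trans (lookup∘tabulate (Z ∘ ψ') (ψ i)) (cong Z (ψ'ψ i)))
        (Equivalence.to (iso (tabulate (Z ∘ ψ'))) (H.spread⇒union spH))))
      where
      spH : Spread H.RG (Z ∘ ψ')
      spH F F⊆ = ≤-trans (#-inj ψ' {F} {F ∘ ψ} (λ {j} x → ∈⁺ (trans (cong F (ψψ' j)) (∈⁻ x))) λ {i} {j} _ _ e → trans (sym (ψψ' i)) (trans (cong ψ e) (ψψ' j)))
        (≤-trans (sp (F ∘ ψ) λ {i} x → ∈⁺ (trans (cong Z (sym (ψ'ψ i))) (∈⁻ (F⊆ (∈⁺ (∈⁻ x))))))
          (Submodular.mono H.RG-submodular λ {j} x → ∈⁺ (trans (cong F (sym (ψψ' j))) (∈⁻ x))))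

    pp qq : Bool → Fin (m G) → Fin N
    pp true = EG.pG
    pp false = EH.pG ∘ ψ
    qq true = EG.qG
    qq false = EH.qG ∘ ψ

    private
      RR : Bool → (Fin (m G) → Bool) → ℕ
      RR true = G.RG
      RR false = RH

      minmaxG : ∀ X → ∃ λ Z → Z ⊆ X × Spread G.RG Z × ∃ λ F → F ⊆ X × G.RG F + # (X ∖ F) ≤ # Z
      minmaxG = UnionRank.minmax G.RG-submodular G.RG-∅
      minmaxH : ∀ X → ∃ λ Z → Z ⊆ X × Spread RH Z × ∃ λ F → F ⊆ X × RH F + # (X ∖ F) ≤ # Z
      minmaxH = UnionRank.minmax RH-submodular RH-∅

    opaque
      rM : (Fin (m G) → Bool) → ℕ
      rM X = # (proj₁ (minmaxG X))

      rM≤ : ∀ σ {X F} → F ⊆ X → rM X ≤ RR σ F + # (X ∖ F)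
      rM≤ true {X} h = UnionRank.spread≤ G.RG-submodular (proj₁ (proj₂ (proj₂ (minmaxG X)))) (proj₁ (proj₂ (minmaxG X)))
      rM≤ false {X} h = UnionRank.spread≤ RH-submodular (G⇒H (proj₁ (proj₂ (proj₂ (minmaxG X))))) (proj₁ (proj₂ (minmaxG X)))

      rM≥ : ∀ σ X → ∃ λ F → F ⊆ X × RR σ F + # (X ∖ F) ≤ rM X
      rM≥ true X = proj₂ (proj₂ (proj₂ (minmaxG X)))
      rM≥ false X = let Z' , Z'⊆ , sp , F' , F'⊆ , l = minmaxH X
                        Z , Z⊆ , _ , F , F⊆ , l' = minmaxG X in
        F' , F'⊆ , ≤-trans l (≤-trans (UnionRank.spread≤ G.RG-submodular (H⇒G sp) Z'⊆) l')

    twoGraphs : TwoGraphs GR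
    twoGraphs = record
      { m = m G
      ; p = pp
      ; q = qq
      ; p≢q = λ { true e → EG.pG≢qG e ; false e → EH.pG≢qG (ψ e) }
      ; pq-inj = λ { true a b → EG.pqG-inj a b ; false {e} {f} a b → trans (sym (ψ'ψ e)) (trans (cong ψ' (EH.pqG-inj a b)) (ψ'ψ f)) }
      ; rM = rM
      ; rM≤ = λ { true {X} {F} h → ≤-trans (rM≤ true h) (+-monoˡ-≤ (# (X ∖ F)) (R≤ (fwdG F)))
                ; false {X} {F} h → ≤-trans (rM≤ false h) (+-monoˡ-≤ (# (X ∖ F)) (R≤ (fwdH F))) }
      ; rM≥ = λ { true X → let F , F⊆ , l = rM≥ true X in F , F⊆ , ≤-trans (+-monoˡ-≤ (# (X ∖ F)) (R≥ (bwdG F))) l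
                ; false X → let F , F⊆ , l = rM≥ false X in F , F⊆ , ≤-trans (+-monoˡ-≤ (# (X ∖ F)) (R≥ (bwdH F))) l } }
      where
      im : Bool → (Fin (m G) → Bool) → ESet N
      im σ X = ⟪ (λ x → Fin.any? λ e → (e ∈? X) ×-dec ((pp σ e Fin.≟ proj₁ x) ×-dec (qq σ e Fin.≟ proj₂ x))) ⟫
      im⁺ : ∀ σ {X u v} → (∃ λ e → e ∈ X × pp σ e ≡ u × qq σ e ≡ v) → (u , v) ∈ im σ X
      im⁺ σ {X} = ∈⟪⟫ (λ x → Fin.any? λ e → (e ∈? X) ×-dec ((pp σ e Fin.≟ proj₁ x) ×-dec (qq σ e Fin.≟ proj₂ x)))
      im⁻ : ∀ σ {X u v} → (u , v) ∈ im σ X → ∃ λ e → e ∈ X × pp σ e ≡ u × qq σ e ≡ v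
      im⁻ σ {X} = ∈⟪⟫⁻ (λ x → Fin.any? λ e → (e ∈? X) ×-dec ((pp σ e Fin.≟ proj₁ x) ×-dec (qq σ e Fin.≟ proj₂ x)))
      R≤ : ∀ {X Y} → X ⊑ Y → R X ≤ GraphRank.R GR Y
      R≤ {X} {Y} h = ≤-trans (SymmetricRank.mono S h) (≤-reflexive (sym (GR-R Y)))
      R≥ : ∀ {X Y} → X ⊑ Y → GraphRank.R GR X ≤ R Y
      R≥ {X} {Y} h = ≤-trans (≤-reflexive (GR-R X)) (SymmetricRank.mono S h)
      fwdG : ∀ F → EG.imgG F ⊑ im true F
      fwdG F x _ = inj₁ (im⁺ true (EG.∈imgG⁻ x))
      bwdG : ∀ F → im true F ⊑ EG.imgG F
      bwdG F x _ = inj₁ (let e , e∈ , a , b = im⁻ true x in subst₂ (λ u v → (u , v) ∈ EG.imgG F) a b (EG.∈imgG e∈))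
      fwdH : ∀ F → EH.imgG (F ∘ ψ') ⊑ im false F
      fwdH F x _ = inj₁ (let j , j∈ , a , b = EH.∈imgG⁻ x in im⁺ false (ψ' j , ∈⁺ (∈⁻ j∈) , trans (cong EH.pG (ψψ' j)) a , trans (cong EH.qG (ψψ' j)) b))
      bwdH : ∀ F → im false F ⊑ EH.imgG (F ∘ ψ')
      bwdH F x _ = inj₁ (let e , e∈ , a , b = im⁻ false x in
        subst₂ (λ u v → (u , v) ∈ EH.imgG (F ∘ ψ')) a b (EH.∈imgG (∈⁺ (trans (cong F (ψ'ψ e)) (∈⁻ e∈)))))

-- If ψ maps stars to stars then it is induced by a graph isomorphism.

At : ℕ → Edge → Set
At v e = v ≡ lo e ⊎ v ≡ hi e

at? : ∀ v e → Dec (At v e)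
at? v e = (v Data.Nat.≟ lo e) ⊎-dec (v Data.Nat.≟ hi e)

module StarsToIso (G H : Graph) (ψ : Fin (m G) → Fin (m H)) (ψ' : Fin (m H) → Fin (m G)) (ψψ' : ∀ j → ψ (ψ' j) ≡ j) (ψ'ψ : ∀ i → ψ' (ψ i) ≡ i) where

  MapsStar : ℕ → ℕ → Set
  MapsStar v x = ∀ i → (At v (edge G i) → At x (edge H (ψ i))) × (At x (edge H (ψ i)) → At v (edge G i))

  mapsStar? : ∀ v x → Dec (MapsStar v x)
  mapsStar? v x = Fin.all? λ i → (at? v (edge G i) →-dec at? x (edge H (ψ i))) ×-dec (at? x (edge H (ψ i)) →-dec at? v (edge G i))
    where
      open import Relation.Nullary.Decidable using (_→-dec_)

  -- x is an end of the image of an edge at v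
  Star-of : Fin (m G) → ℕ → Set
  Star-of i v = MapsStar v (lo (edge H (ψ i))) ⊎ MapsStar v (hi (edge H (ψ i)))

  Stars : Set
  Stars = ∀ i → Star-of i (lo (edge G i)) × Star-of i (hi (edge G i))

  stars? : Dec Stars
  stars? = Fin.all? λ i → star? i (lo (edge G i)) ×-dec star? i (hi (edge G i))
    where
    star? : ∀ i v → Dec (Star-of i v)
    star? i v = mapsStar? v (lo (edge H (ψ i))) ⊎-dec mapsStar? v (hi (edge H (ψ i)))

  module _ (stars : Stars) (deg2 : ∀ v i → At v (edge G i) → ∃ λ j → At v (edge G j) × i ≢ j) where

    image : ∀ {v} i → At v (edge G i) → ∃ (MapsStar v)
    image i (inj₁ refl) = [ (λ s → _ , s) , (λ s → _ , s) ]′ (proj₁ (stars i))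
    image i (inj₂ refl) = [ (λ s → _ , s) , (λ s → _ , s) ]′ (proj₂ (stars i))

    ends-determine : ∀ (e f : Edge) {u v} → u ≢ v → At u e → At v e → At u f → At v f → e ≡ f
    ends-determine e f ne (inj₁ a) (inj₁ b) _ _ = ⊥-elim (ne (trans a (sym b)))
    ends-determine e f ne (inj₂ a) (inj₂ b) _ _ = ⊥-elim (ne (trans a (sym b)))
    ends-determine e f ne _ _ (inj₁ a) (inj₁ b) = ⊥-elim (ne (trans a (sym b)))
    ends-determine e f ne _ _ (inj₂ a) (inj₂ b) = ⊥-elim (ne (trans a (sym b)))
    ends-determine e f ne (inj₁ a) (inj₂ b) (inj₁ c) (inj₂ d) = Edge-≡ (trans (sym a) c) (trans (sym b) d)
    ends-determine e f ne (inj₂ a) (inj₁ b) (inj₂ c) (inj₁ d) = Edge-≡ (trans (sym b) d) (trans (sym a) c)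
    ends-determine e f ne (inj₁ a) (inj₂ b) (inj₂ c) (inj₁ d) = ⊥-elim (<-asym (lo<hi e) (subst₂ _<_ (trans (sym d) b) (trans (sym c) a) (lo<hi f)))
    ends-determine e f ne (inj₂ a) (inj₁ b) (inj₁ c) (inj₂ d) = ⊥-elim (<-asym (lo<hi e) (subst₂ _<_ (trans (sym c) a) (trans (sym d) b) (lo<hi f)))

    MapsStar-inj : ∀ {u v x} i → At u (edge G i) → MapsStar u x → MapsStar v x → u ≡ v
    MapsStar-inj {u} {v} {x} i ui mu mv with u Data.Nat.≟ v
    ... | yes e = e
    ... | no ne = let j , uj , i≢j = deg2 u i ui in
      ⊥-elim (i≢j (edge-inj G (ends-determine (edge G i) (edge G j) ne ui (proj₂ (mv i) (proj₁ (mu i) ui)) uj (proj₂ (mv j) (proj₁ (mu j) uj)))))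

    vertex-at : ∀ {K : Graph} {v} → IsVertex K v → ∃ λ i → At v (edge K i)
    vertex-at {K} = vertex⁻ {K}

    f : ℕ → ℕ
    f v with isVertex? G v
    ... | yes (i , t) = proj₁ (image i t)
    ... | no _ = 0

    f-maps : ∀ {v} i → At v (edge G i) → MapsStar v (f v)
    f-maps {v} i t with isVertex? G v
    ... | yes (j , s) = proj₂ (image j s)
    ... | no ¬p = ⊥-elim (¬p (i , t))

    f-inj : ∀ {u v} i j → At u (edge G i) → At v (edge G j) → f u ≡ f v → u ≡ v
    f-inj {u} {v} i j s t e = MapsStar-inj i s (f-maps i s) (subst (MapsStar v) (sym e) (f-maps j t))

    at-joins : ∀ {e u v} → u ≢ v → At u e → At v e → joins e u v
    at-joins ne (inj₁ a) (inj₁ b) = ⊥-elim (ne (trans a (sym b)))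
    at-joins ne (inj₁ a) (inj₂ b) = inj₁ (sym a , sym b)
    at-joins ne (inj₂ a) (inj₁ b) = inj₂ (sym b , sym a)
    at-joins ne (inj₂ a) (inj₂ b) = ⊥-elim (ne (trans a (sym b)))

    lo≢hi : ∀ e → lo e ≢ hi e
    lo≢hi e p = <-irrefl p (lo<hi e)

    fψ : ∀ i → joins (edge H (ψ i)) (f (lo (edge G i))) (f (hi (edge G i)))
    fψ i = at-joins {edge H (ψ i)} (lo≢hi (edge G i) ∘ f-inj i i (inj₁ refl) (inj₂ refl)) (proj₁ (f-maps i (inj₁ refl) i) (inj₁ refl)) (proj₁ (f-maps i (inj₂ refl) i) (inj₂ refl))

    preimage-of : ∀ {x} j → At x (edge H j) → ∃ λ v → At v (edge G (ψ' j)) × f v ≡ x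
    preimage-of {x} j t = go t (subst (λ k → joins (edge H k) (f (lo (edge G (ψ' j)))) (f (hi (edge G (ψ' j))))) (ψψ' j) (fψ (ψ' j)))
      where
      go : At x (edge H j) → joins (edge H j) (f (lo (edge G (ψ' j)))) (f (hi (edge G (ψ' j)))) → ∃ λ v → At v (edge G (ψ' j)) × f v ≡ x
      go (inj₁ refl) (inj₁ (a , b)) = _ , inj₁ refl , sym a
      go (inj₁ refl) (inj₂ (a , b)) = _ , inj₂ refl , sym a
      go (inj₂ refl) (inj₁ (a , b)) = _ , inj₂ refl , sym b
      go (inj₂ refl) (inj₂ (a , b)) = _ , inj₁ refl , sym b

    g : ℕ → ℕ
    g x with isVertex? H x
    ... | yes (j , t) = proj₁ (preimage-of j t)
    ... | no _ = 0

    g-spec : ∀ {x} j → At x (edge H j) → (∃ λ i → At (g x) (edge G i)) × f (g x) ≡ x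
    g-spec {x} j t with isVertex? H x
    ... | yes (k , s) = let v , a , e = preimage-of k s in (_ , a) , e
    ... | no ¬p = ⊥-elim (¬p (j , t))

    g-at : ∀ {x} j → At x (edge H j) → At (g x) (edge G (ψ' j))
    g-at {x} j t = let (i , a) , e = g-spec j t in
      proj₂ (f-maps i a (ψ' j)) (subst₂ (λ y k → At y (edge H k)) (sym e) (sym (ψψ' j)) t)

    gψ : ∀ j → joins (edge G (ψ' j)) (g (lo (edge H j))) (g (hi (edge H j)))
    gψ j = at-joins {edge G (ψ' j)} (λ e → lo≢hi (edge H j) (trans (sym (proj₂ (g-spec j (inj₁ refl)))) (trans (cong f e) (proj₂ (g-spec j (inj₂ refl))))))
      (g-at j (inj₁ refl)) (g-at j (inj₂ refl))

    isomorphism : Σ (GraphIso G H) λ φ → Induced G H φ ψ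
    isomorphism = MI.iso , MI.induced
      where
      gf : ∀ v → IsVertex G v → g (f v) ≡ v
      gf v x = let i , t = vertex-at {G} x
                   (j , a) , e = g-spec (ψ i) (proj₁ (f-maps i t i) t) in f-inj j i a t e
      fg : ∀ x → IsVertex H x → f (g x) ≡ x
      fg x y = let j , t = vertex-at {H} y in proj₂ (g-spec j t)
      module MI = MakeIso {G} {H} f g ψ ψ' fψ gψ gf fg

module Spanning {N} (S : SymmetricRank 1 N) where
  open SymmetricRank S renaming (R to r)
  open SymmetricProperties S

  Spans : ESet N → Fin N → Fin N → Set
  Spans X u v = r (X ∪ single u v) ≤ r X

  spans? : ∀ X u v → Dec (Spans X u v)
  spans? X u v = r (X ∪ single u v) ≤? r X

  ∈⇒Spans : ∀ {X u v} → Joins X u v → Spans X u v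
  ∈⇒Spans j = mono (⊑-∪ ⊑-refl (single-⊑ j))

  Spans-sym : ∀ {X u v} → Spans X u v → Spans X v u
  Spans-sym h = ≤-trans (mono (⊑-∪ (⊑-∪ˡ ⊑-refl) (⊑-∪ʳ (single-⊑ (inj₂ ∈single))))) h

  Spans-mono : ∀ {X Y u v} → X ⊑ Y → Spans X u v → Spans Y u v
  Spans-mono {X} {Y} {u} {v} h s = +-cancelʳ-≤ (r X) _ _ (≤-trans (submod {Y ∪ single u v} {X} {Y} {X ∪ single u v} h (⊑-∪ˡ ⊑-refl)
    (⊑-∪ (⊑-∪ˡ ⊑-refl) (⊑-∪ʳ (⊑-∪ʳ ⊑-refl)))) (+-monoʳ-≤ (r Y) s))

  absorb : ∀ {X Z} → (∀ {u v} → (u , v) ∈ Z → u ≢ v → Spans X u v) → r (X ∪ Z) ≤ r X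
  absorb {X} {Z} h = finish (iterate∪ (λ Y → r Y ≤ r X) Q (λ sub q z ne → sub (q z ne)) X ≤-refl enlarge)
    where
    Q : Fin (N * N) → ESet N → Set
    Q i Y = remQuot {N} N i ∈ Z → proj₁ (remQuot {N} N i) ≢ proj₂ (remQuot {N} N i) → remQuot {N} N i ∈ Y
    enlarge : ∀ i Y → X ⊆ Y → r Y ≤ r X → Σ (ESet N) λ Y' → Y ⊆ Y' × r Y' ≤ r X × Q i Y'
    enlarge i Y sub l with remQuot {N} N i ∈? Z | proj₁ (remQuot {N} N i) Fin.≟ proj₂ (remQuot {N} N i)
    ... | no ¬z | _ = Y , id , l , λ z → ⊥-elim (¬z z)
    ... | yes _ | yes e = Y , id , l , λ _ ne → ⊥-elim (ne e)
    ... | yes z | no ne = Y ∪ single _ _ , ∪ˡ , ≤-trans (Spans-mono (⊆⇒⊑ sub) (h z ne)) l , λ _ _ → ∪ʳ ∈single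
    finish : (Σ (ESet N) λ Y → X ⊆ Y × r Y ≤ r X × (∀ i → Q i Y)) → r (X ∪ Z) ≤ r X
    finish (Y , sub , l , q) = ≤-trans (mono (⊑-∪ (⊆⇒⊑ sub) λ {u} {v} z ne → inj₁ (inY z ne))) l
      where
      inY : ∀ {u v} → (u , v) ∈ Z → u ≢ v → (u , v) ∈ Y
      inY {u} {v} z ne = subst (_∈ Y) e (q (combine u v) (subst (_∈ Z) (sym e) z) λ x → ne (trans (sym (cong proj₁ e)) (trans x (cong proj₂ e))))
        where
        e : remQuot {N} N (combine u v) ≡ (u , v)
        e = Fin.remQuot-combine u v

  Spans-trans : ∀ {X Z u v} → (∀ {a b} → (a , b) ∈ Z → a ≢ b → Spans X a b) → Spans (X ∪ Z) u v → Spans X u v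
  Spans-trans {X} {Z} h s = ≤-trans (mono (⊑-∪ (⊑-∪ˡ (⊑-∪ˡ ⊑-refl)) (⊑-∪ʳ ⊑-refl))) (≤-trans s (absorb h))

  Preserved : ESet N → Fin N → Fin N → Set
  Preserved X a b = ∀ {u v} → (u , v) ∈ X → (swap a b u , swap a b v) ∈ X

  Spans-swap : ∀ {X a b u v} → Preserved X a b → Spans X u v → Spans X (swap a b u) (swap a b v)
  Spans-swap {X} {a} {b} {u} {v} pres s = ≤-trans (permuted (transposition a b) λ {(x , y)} z →
      ∈⁺ (∈⁻ ([ (λ w → ∪ˡ (pres w)) , (λ w → ∪ʳ (back w)) ]′ (∪⁻ z)))) s
    where
    back : ∀ {x y} → (x , y) ∈ single (swap a b u) (swap a b v) → (swap a b x , swap a b y) ∈ single u v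
    back w with ∈single⁻ w
    ... | refl , refl = subst₂ (λ p q → (p , q) ∈ single u v) (sym (swap-swap a b u)) (sym (swap-swap a b v)) ∈single

  avoids-preserved : ∀ {X a b} → Avoids X a → Avoids X b → Preserved X a b
  avoids-preserved {X} {a} {b} ha hb {u} {v} x = let p , q = ha x; p' , q' = hb x in
    subst₂ (λ s t → (s , t) ∈ X) (sym (swap-≢ a b p p')) (sym (swap-≢ a b q q')) x

  -- if X is symmetric on a set of vertices then it spans all pairs in it as soon as it spans one
  Spans-all : ∀ {X} (O : Fin N → Set) → (∀ {a b} → O a → O b → Preserved X a b) →
    ∀ {u v y z} → O u → O v → O y → O z → u ≢ v → y ≢ z → Spans X u v → Spans X y z
  Spans-all {X} O pres {u} {v} {y} {z} Ou Ov Oy Oz u≢v y≢z s =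
    subst₂ (Spans X) (swap-≢ v' z (λ e → v'≢y (sym e)) y≢z) (swap-a v' z)
      (Spans-swap (pres Ov' Oz) (subst (λ a → Spans X a v') (swap-a u y) (Spans-swap (pres Ou Oy) s)))
    where
    v' : Fin N
    v' = swap u y v
    v'≢y : v' ≢ y
    v'≢y e = u≢v (Perm.π-inj (transposition u y) (trans (swap-a u y) (sym e)))
    Ov' : O v'
    Ov' = go (v Fin.≟ y)
      where
      go : Dec (v ≡ y) → O v'
      go (yes refl) = subst O (sym (swap-b u y)) Ou
      go (no ne) = subst O (sym (swap-≢ u y (u≢v ∘ sym) ne)) Ov

  incident : (Fin N → Bool) → ESet N
  incident Z = ⟪ (λ e → (proj₁ e ∈? Z) ⊎-dec (proj₂ e ∈? Z)) ⟫

  ∈incident : ∀ {Z u v} → u ∈ Z ⊎ v ∈ Z → (u , v) ∈ incident Z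
  ∈incident {Z} = ∈⟪⟫ (λ e → (proj₁ e ∈? Z) ⊎-dec (proj₂ e ∈? Z))

  ∈incident⁻ : ∀ {Z u v} → (u , v) ∈ incident Z → u ∈ Z ⊎ v ∈ Z
  ∈incident⁻ {Z} = ∈⟪⟫⁻ (λ e → (proj₁ e ∈? Z) ⊎-dec (proj₂ e ∈? Z))

  incident-mono : ∀ {Z Z'} → Z ⊆ Z' → incident Z ⊑ incident Z'
  incident-mono h x _ = inj₁ (∈incident ([ inj₁ ∘ h , inj₂ ∘ h ]′ (∈incident⁻ x)))

  incident-size : ∀ {Z Z' : Fin N → Bool} → # Z ≡ # Z' → r (incident Z) ≤ r (incident Z')
  incident-size = size-invariant incident incident-mono
    (λ x → ∈incident ([ inj₁ ∘ ∘swap⁺ , inj₂ ∘ ∘swap⁺ ]′ (∈incident⁻ x))) _ ≤-refl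

  incident-preserved : ∀ {Z a b} → a ∉ Z → b ∉ Z → Preserved (incident Z) a b
  incident-preserved {Z} {a} {b} a∉ b∉ x = ∈incident ([ inj₁ ∘ fixed , inj₂ ∘ fixed ]′ (∈incident⁻ x))
    where
    fixed : ∀ {u} → u ∈ Z → swap a b u ∈ Z
    fixed u∈ = subst (_∈ Z) (sym (swap-≢ a b (λ { refl → a∉ u∈ }) (λ { refl → b∉ u∈ }))) u∈

  top : ℕ
  top = r (clique full)

  top≤ : ∀ {X} → (∀ {u v} → u ≢ v → Spans X u v) → top ≤ r X
  top≤ h = ≤-trans (mono (⊑-∪ʳ ⊑-refl)) (absorb {Z = clique full} λ _ → h)

  ≤top : ∀ X → r X ≤ top
  ≤top X = mono λ _ _ → inj₁ (∈clique ∈full ∈full)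

  g : ℕ → ℕ
  g z = r (incident (first z))

  g-incident : ∀ Z → r (incident Z) ≡ g (# Z)
  g-incident Z = ≤-antisym (incident-size (sym (#first (#≤n Z)))) (incident-size (#first (#≤n Z)))

  full-incident : ∀ {Z u v} → u ∉ Z → v ∉ Z → u ≢ v → Spans (incident Z) u v → top ≤ r (incident Z)
  full-incident {Z} u∉ v∉ ne s = top≤ λ {y} {z} y≢z → [ (λ y∈ → ∈⇒Spans (inj₁ (∈incident (inj₁ y∈)))) ,
    (λ y∉ → [ (λ z∈ → ∈⇒Spans (inj₁ (∈incident (inj₂ z∈)))) , (λ z∉ → Spans-all (_∉ Z) (λ a b → incident-preserved a b) u∉ v∉ y∉ z∉ ne y≢z s) ]′ (toSum (z ∈? Z))) ]′ (toSum (y ∈? Z))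

  -- the ranks of the unions of stars are strictly concave until they reach the total rank
  g-concave : ∀ {z} → suc (suc z) ≤ N → g z < top → suc (g (suc (suc z)) + g z) ≤ g (suc z) + g (suc z)
  g-concave {z} l below = go (#<⇒∃ Z full (≤-trans (≤-trans (≤-reflexive (cong suc #Z)) (≤-trans (n≤1+n _) l)) (≤-reflexive (sym #full))))
    where
    #full : # {N} full ≡ N
    #full = trans (#-Sum full) (trans (Sum-const {N} 1) (*-identityʳ N))
    Z : Fin N → Bool
    Z = first z
    #Z : # Z ≡ z
    #Z = #first (≤-trans (n≤1+n z) (≤-trans (n≤1+n (suc z)) l))
    go : (∃ λ v → v ∈ full × v ∉ Z) → suc (g (suc (suc z)) + g z) ≤ g (suc z) + g (suc z)
    go (v , _ , v∉) = go' (#<⇒∃ (Z ∪ ⁅ v ⁆) full (≤-trans (≤-trans (≤-reflexive (cong suc (trans (#-add Z v∉) (cong suc #Z)))) l) (≤-reflexive (sym #full))))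
      where
      go' : (∃ λ w → w ∈ full × w ∉ Z ∪ ⁅ v ⁆) → suc (g (suc (suc z)) + g z) ≤ g (suc z) + g (suc z)
      go' (w , _ , w∉) = subst₂ _≤_ (cong (λ x → suc (x + g z)) e₂) (cong₂ _+_ e₁ e₁')
          (≤-trans (≤-trans (≤-reflexive (sym (+-suc _ _))) (+-monoʳ-≤ (r (incident ((Z ∪ ⁅ v ⁆) ∪ ⁅ w ⁆))) raise)) sub)
        where
        v≢w : v ≢ w
        v≢w refl = w∉ (∪ʳ (∈⁅⁆ v))
        e₁ : r (incident (Z ∪ ⁅ v ⁆)) ≡ g (suc z)
        e₁ = trans (g-incident _) (cong g (trans (#-add Z v∉) (cong suc #Z)))
        e₁' : r (incident (Z ∪ ⁅ w ⁆)) ≡ g (suc z)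
        e₁' = trans (g-incident _) (cong g (trans (#-add Z (w∉ ∘ ∪ˡ)) (cong suc #Z)))
        e₂ : r (incident ((Z ∪ ⁅ v ⁆) ∪ ⁅ w ⁆)) ≡ g (suc (suc z))
        e₂ = trans (g-incident _) (cong g (trans (#-add _ w∉) (cong suc (trans (#-add Z v∉) (cong suc #Z)))))
        raise : g z < r (incident Z ∪ single v w)
        raise = ≰⇒> λ h → <⇒≱ below (≤-trans (full-incident v∉ (w∉ ∘ ∪ˡ) v≢w h) (≤-reflexive (trans (g-incident Z) (cong g #Z))))
        sub : r (incident ((Z ∪ ⁅ v ⁆) ∪ ⁅ w ⁆)) + r (incident Z ∪ single v w) ≤ r (incident (Z ∪ ⁅ v ⁆)) + r (incident (Z ∪ ⁅ w ⁆))
        sub = submod (⊑-∪ (incident-mono ∪ˡ) (single-⊑ (inj₁ (∈incident (inj₁ (∪ʳ (∈⁅⁆ v))))))) (⊑-∪ (incident-mono ∪ˡ) (single-⊑ (inj₁ (∈incident (inj₂ (∪ʳ (∈⁅⁆ w)))))))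
          λ x _ → inj₁ ([ left , right ]′ (∈incident⁻ x))
          where
          left : ∀ {a b} → a ∈ (Z ∪ ⁅ v ⁆) ∪ ⁅ w ⁆ → (a , b) ∈ incident (Z ∪ ⁅ v ⁆) ∪ incident (Z ∪ ⁅ w ⁆)
          left y = [ (λ p → ∪ˡ (∈incident (inj₁ p))) , (λ p → ∪ʳ (∈incident (inj₁ (∪ʳ p)))) ]′ (∪⁻ y)
          right : ∀ {a b} → b ∈ (Z ∪ ⁅ v ⁆) ∪ ⁅ w ⁆ → (a , b) ∈ incident (Z ∪ ⁅ v ⁆) ∪ incident (Z ∪ ⁅ w ⁆)
          right y = [ (λ p → ∪ˡ (∈incident (inj₂ p))) , (λ p → ∪ʳ (∈incident (inj₂ (∪ʳ p)))) ]′ (∪⁻ y)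

  g-mono : ∀ {y z} → y ≤ z → z ≤ N → g y ≤ g z
  g-mono {y} {z} l lN = mono (incident-mono λ x → ∈⟪⟫ (λ x → toℕ x <? z) (≤-trans (∈⟪⟫⁻ (λ x → toℕ x <? y) x) l))

  module _ {b : ℕ} (top≤b : top ≤ b) where
    private
      r≤b : ∀ X → r X ≤ b
      r≤b X = ≤-trans (≤top X) top≤b

    scattered-spans : ∀ {X} → Scattered (2 + 2 * b) X → ∀ {y z} → y ≢ z → Spans X y z
    scattered-spans {X} sc {y} {z} y≢z = go (suc b) 0 ∅ (⁅ y ⁆ ∪ ⁅ z ⁆) refl z≤n (λ x _ → ⊥-elim (∅⁻ x)) (λ x → ⊥-elim (∅⁻ x))
        (∪ˡ (∈⁅⁆ y)) (∪ʳ (∈⁅⁆ z)) (≤-trans (#-add≤ ⁅ y ⁆ z) (s≤s (≤-reflexive (#-⁅⁆ y))))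
      where
      -- a subset P of X of rank at least j on a set T of at most 2 + 2j vertices, disjoint from y and z
      go : ∀ n j (P : ESet N) (T : Fin N → Bool) → j + n ≡ suc b → j ≤ r P → P ⊑ X →
        (∀ {u v} → (u , v) ∈ P → (u ∈ T × v ∈ T) × (u ≢ y × u ≢ z) × (v ≢ y × v ≢ z)) →
        y ∈ T → z ∈ T → # T ≤ 2 + 2 * j → Spans X y z
      go zero j P T e rank _ _ _ _ _ = ⊥-elim (<⇒≱ (≤-trans (≤-reflexive (sym (trans (sym (+-identityʳ j)) e))) rank) (r≤b P))
      go (suc n) j P T e rank P⊑ inT y∈ z∈ #T = pick (sc T (≤-trans #T (+-monoʳ-≤ 2 (*-monoʳ-≤ 2 j≤b))))
        where
        j≤b : j ≤ b
        j≤b = s≤s⁻¹ (≤-trans (s≤s (m≤m+n j n)) (≤-reflexive (trans (sym (+-suc j n)) e)))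
        pick : (∃ λ u → ∃ λ v → (u , v) ∈ X × u ≢ v × u ∉ T × v ∉ T) → Spans X y z
        pick (u , v , x , u≢v , u∉ , v∉) = decide (spans? P u v)
          where
          off : ∀ {a} → a ∉ T → Avoids P a
          off a∉ p = let (s , t) , _ = inT p in (λ { refl → a∉ s }) , (λ { refl → a∉ t })
          decide : Dec (Spans P u v) → Spans X y z
          decide (yes s) = Spans-mono P⊑ (Spans-all (Avoids P) (λ a b → avoids-preserved a b) (off u∉) (off v∉)
            (λ p → let _ , (a , _) , (c , _) = inT p in a , c) (λ p → let _ , (_ , a) , (_ , c) = inT p in a , c) u≢v y≢z s)
          decide (no ¬s) = go n (suc j) (P ∪ single u v) (T ∪ (⁅ u ⁆ ∪ ⁅ v ⁆)) (trans (sym (+-suc j n)) e) (≤-trans (s≤s rank) (≰⇒> ¬s)) (⊑-∪ P⊑ (single-⊑ (inj₁ x)))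
              inT' (∪ˡ y∈) (∪ˡ z∈)
              (≤-trans (#-∪≤ T _) (≤-trans (+-mono-≤ #T (≤-trans (#-add≤ ⁅ u ⁆ v) (s≤s (≤-reflexive (#-⁅⁆ u))))) (≤-reflexive (grow j))))
            where
            grow : ∀ j → 2 + 2 * j + 2 ≡ 2 + 2 * suc j
            grow = solve-∀
            inT' : ∀ {p q} → (p , q) ∈ P ∪ single u v → (p ∈ T ∪ (⁅ u ⁆ ∪ ⁅ v ⁆) × q ∈ T ∪ (⁅ u ⁆ ∪ ⁅ v ⁆)) × (p ≢ y × p ≢ z) × (q ≢ y × q ≢ z)
            inT' pq with ∪⁻ pq
            ... | inj₁ w = let (a , b) , c = inT w in (∪ˡ a , ∪ˡ b) , c
            ... | inj₂ w with ∈single⁻ w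
            ...   | refl , refl = (∪ʳ (∪ˡ (∈⁅⁆ u)) , ∪ʳ (∪ʳ (∈⁅⁆ v))) , ((λ { refl → u∉ y∈ }) , (λ { refl → u∉ z∈ })) , ((λ { refl → v∉ y∈ }) , (λ { refl → v∉ z∈ }))

    big-star-spans : ∀ {x X} → BigStar (2 + b) x X → ∀ {w} → w ≢ x → Spans X x w
    big-star-spans {x} {X} (Y , d≤ , Y⁻) {w} w≢x = go (suc b) 0 ∅ ∅ refl z≤n (λ x _ → ⊥-elim (∅⁻ x)) (λ x → ⊥-elim (∅⁻ x)) (λ x → ⊥-elim (∅⁻ x)) (≤-reflexive #-∅)
      where
      go : ∀ n j (P : ESet N) (L : Fin N → Bool) → j + n ≡ suc b → j ≤ r P → P ⊑ X →
        (∀ {u v} → (u , v) ∈ P → u ≡ x × v ∈ L) → (∀ {v} → v ∈ L → (x , v) ∈ P) → # L ≤ j → Spans X x w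
      go zero j P L e rank _ _ _ _ = ⊥-elim (<⇒≱ (≤-trans (≤-reflexive (sym (trans (sym (+-identityʳ j)) e))) rank) (r≤b P))
      go (suc n) j P L e rank P⊑ P⁻ P⁺ #L = pick (#<⇒∃ (L ∪ ⁅ w ⁆) Y (≤-trans (s≤s (≤-trans (#-add≤ L w) (s≤s (≤-trans #L j≤b)))) d≤))
        where
        j≤b : j ≤ b
        j≤b = s≤s⁻¹ (≤-trans (s≤s (m≤m+n j n)) (≤-reflexive (trans (sym (+-suc j n)) e)))
        pick : (∃ λ y → y ∈ Y × y ∉ L ∪ ⁅ w ⁆) → Spans X x w
        pick (y , y∈ , y∉) = decide (toSum (w ∈? L)) (spans? P x y)
          where
          y≢x : y ≢ x
          y≢x = proj₁ (Y⁻ y∈)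
          off : ∀ {a} → a ∉ L → a ≢ x → Avoids P a
          off a∉ ne p = let s , t = P⁻ p in (λ q → ne (trans (sym q) s)) , (λ { refl → a∉ t })
          decide : (w ∈ L) ⊎ (w ∉ L) → Dec (Spans P x y) → Spans X x w
          decide (inj₁ w∈) _ = Spans-mono P⊑ (∈⇒Spans (inj₁ (P⁺ w∈)))
          decide (inj₂ w∉) (yes s) = Spans-mono P⊑ (subst₂ (Spans P) (swap-≢ y w (y≢x ∘ sym) (w≢x ∘ sym)) (swap-a y w)
            (Spans-swap (avoids-preserved (off (y∉ ∘ ∪ˡ) y≢x) (off w∉ w≢x)) s))
          decide (inj₂ _) (no ¬s) = go n (suc j) (P ∪ single x y) (L ∪ ⁅ y ⁆) (trans (sym (+-suc j n)) e) (≤-trans (s≤s rank) (≰⇒> ¬s))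
              (⊑-∪ P⊑ (single-⊑ (proj₂ (Y⁻ y∈)))) P'⁻
              (λ v∈ → [ ∪ˡ ∘ P⁺ , (λ z → ∪ʳ (subst (λ v → (x , v) ∈ single x y) (∈⁅⁆⁻ z) ∈single)) ]′ (∪⁻ v∈)) (≤-trans (#-add≤ L y) (s≤s #L))
            where
            P'⁻ : ∀ {u v} → (u , v) ∈ P ∪ single x y → u ≡ x × v ∈ L ∪ ⁅ y ⁆
            P'⁻ p with ∪⁻ p
            ... | inj₁ q = let s , t = P⁻ q in s , ∪ˡ t
            ... | inj₂ q with ∈single⁻ q
            ...   | refl , refl = refl , ∪ʳ (∈⁅⁆ y)

    stellar : g 1 < top → Stellar r (2 + 2 * b) (2 + b) b
    stellar s<top = record
      { s = g 1 ; top = top ; s<top = s<top ; s≤b = r≤b _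
      ; scattered = λ sc → top≤ λ ne → scattered-spans sc ne
      ; big-star = λ {x} {X} B → ≤-trans (≤-reflexive (sym (centre {x}))) (≤-trans (mono (⊑-∪ʳ ⊑-refl)) (star-spanned B))
      ; not-star = λ {x} {X} {u} {v} B e∈ u≢v x≢u x≢v → ≰⇒> λ h → <⇒≱ s<top (≤-trans
          (full-incident {⁅ x ⁆} (x≢u ∘ ∈⁅⁆⁻) (x≢v ∘ ∈⁅⁆⁻) u≢v
            (≤-trans (mono (⊑-∪ (⊑-∪ʳ ⊑-refl) (⊑-∪ˡ (single-⊑ (inj₁ e∈))))) (≤-trans (star-spanned {x} {X} B) (≤-trans h (≤-reflexive (sym (centre {x})))))))
          (≤-reflexive (centre {x})))
      ; star = λ {x} {X} st → ≤-trans (mono λ e ne → inj₁ (∈incident ([ (λ p → inj₁ (subst (_∈ ⁅ x ⁆) p (∈⁅⁆ x))) , (λ p → inj₂ (subst (_∈ ⁅ x ⁆) p (∈⁅⁆ x))) ]′ (st e ne)))) (≤-reflexive (centre {x})) }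
      where
      centre : ∀ {x} → r (incident ⁅ x ⁆) ≡ g 1
      centre {x} = trans (g-incident ⁅ x ⁆) (cong g (#-⁅⁆ x))
      star-spanned : ∀ {x X} → BigStar (2 + b) x X → r (X ∪ incident ⁅ x ⁆) ≤ r X
      star-spanned {x} {X} B = absorb λ e ne → [ (λ p → at (∈⁅⁆⁻ p) ne) , (λ p → Spans-sym (at (∈⁅⁆⁻ p) (ne ∘ sym))) ]′ (∈incident⁻ e)
        where
        at : ∀ {u v} → x ≡ u → u ≢ v → Spans X u v
        at refl ne = big-star-spans B (ne ∘ sym)

module Concavity {N} (S : SymmetricRank 1 N) where
  open Spanning S

  g-strict : ∀ {z} → suc (suc z) ≤ N → g z < top → suc (g z) ≤ g (suc z)
  g-strict {z} l below = lin 0 (g-concave l below ⊕ g-mono (n≤1+n (suc z)) l) (e (g z) (g (suc z)) (g (suc (suc z))))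
    where
    e : ∀ a b c → suc a + (b + b + c) + 0 ≡ b + (suc (c + a) + b)
    e = solve-∀

  size≤g : ∀ {z} → suc (suc z) ≤ N → g z < top → z ≤ g z
  size≤g {zero} _ _ = z≤n
  size≤g {suc z} l below = ≤-trans (s≤s (size≤g l' below')) (g-strict l' below')
    where
    l' = ≤-trans (n≤1+n (suc (suc z))) l
    below' = ≤-trans (s≤s (g-mono (n≤1+n z) (≤-trans (n≤1+n (suc z)) l'))) below

  module _ {z} (l : suc (suc z) ≤ N) (below : g z < top) where
    private
      z≤N : z ≤ N
      z≤N = ≤-trans (n≤1+n z) (≤-trans (n≤1+n (suc z)) l)

      j≤z : ∀ {i j} → j + i ≡ z → j ≤ z
      j≤z {i} {j} e = ≤-trans (m≤m+n j i) (≤-reflexive e)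

      below-at : ∀ {j} → j ≤ z → g j < top
      below-at j≤ = ≤-trans (s≤s (g-mono j≤ z≤N)) below

    increments : ∀ i j → j + i ≡ z → suc i + g j ≤ g (suc j)
    increments zero j e = g-strict (≤-trans (s≤s (s≤s (j≤z e))) l) (below-at (j≤z e))
    increments (suc i) j e = lin 0 (increments i (suc j) (trans (sym (+-suc j i)) e) ⊕ g-concave (≤-trans (s≤s (s≤s (j≤z e))) l) (below-at (j≤z e)))
        (arith i (g j) (g (suc j)) (g (suc (suc j))))
      where
      arith : ∀ i a b c → suc (suc i) + a + (c + (b + b)) + 0 ≡ b + (suc i + b + suc (c + a))
      arith = solve-∀

    g-quadratic : ∀ i j → j + i ≡ z → i * i + 2 * g j ≤ 2 * g z
    g-quadratic zero j e = ≤-reflexive (cong (λ j → 2 * g j) (trans (sym (+-identityʳ j)) e))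
    g-quadratic (suc i) j e = lin 3 (g-quadratic i (suc j) (trans (sym (+-suc j i)) e) ⊕ 2 ⊛ increments (suc i) j e) (arith i (g j) (g (suc j)) (g z))
      where
      arith : ∀ i a b c → suc i * suc i + 2 * a + (2 * c + 2 * b) + 3 ≡ 2 * c + (i * i + 2 * b + 2 * (suc (suc i) + a))
      arith = solve-∀

    private
      cheap : ∀ D n → n * D ≤ g n ⊎ (∃ λ j → j < n × g (suc j) < g j + D)
      cheap D zero = inj₁ z≤n
      cheap D (suc n) with cheap D n | g (suc n) <? g n + D
      ... | inj₂ (j , j< , h) | _ = inj₂ (j , ≤-trans j< (n≤1+n n) , h)
      ... | inj₁ h | yes h' = inj₂ (n , ≤-refl , h')
      ... | inj₁ h | no h' = inj₁ (≤-trans (+-monoʳ-≤ D h) (≤-trans (≤-reflexive (+-comm D (g n))) (≮⇒≥ h')))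

    cheap-increment : ∀ {D} → g z < z * D → ∃ λ j → j < z × g (suc j) < g j + D
    cheap-increment {D} few = [ (λ h → ⊥-elim (<⇒≱ few h)) , id ]′ (cheap D z)

  top≤-increment : ∀ d j → d + suc (suc j) ≤ N → g (suc j) ≤ g j + d → top ≤ g j + d * d
  top≤-increment d j l h with g j <? top
  ... | no ¬below = ≤-trans (≮⇒≥ ¬below) (m≤m+n _ _)
  top≤-increment zero j l h | yes below = ⊥-elim (<⇒≱ (g-strict l below) (≤-trans h (≤-reflexive (+-identityʳ _))))
  top≤-increment (suc d) j l h | yes below = lin d (top≤-increment d (suc j) (≤-trans (≤-reflexive (+-suc d _)) l)
      (lin 0 (g-concave (≤-trans (m≤n+m _ (suc d)) l) below ⊕ h) (e₁ (g j) (g (suc j)) (g (suc (suc j))) d)) ⊕ h) (e₂ (g j) (g (suc j)) top d)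
    where
    e₁ : ∀ a b c d → c + (b + b + (a + suc d)) + 0 ≡ b + d + (suc (c + a) + b)
    e₁ = solve-∀
    e₂ : ∀ a b t d → t + (b + d * d + (a + suc d)) + d ≡ a + suc d * suc d + (t + b)
    e₂ = solve-∀

  few-stars⇒bounded : ∀ {D z} → 1 ≤ z → D + suc (suc z) ≤ N → g z < z * D → g z < top → top ≤ 3 * (D * D) × g 1 < top
  few-stars⇒bounded {D} {z} 1≤z l few below = bound (cheap-increment l' below few) , ≤-trans (s≤s (g-mono 1≤z z≤N)) below
    where
    l' : suc (suc z) ≤ N
    l' = ≤-trans (m≤n+m _ D) l
    z≤N : z ≤ N
    z≤N = ≤-trans (n≤1+n z) (≤-trans (n≤1+n (suc z)) l')
    z<2D : z < 2 * D
    z<2D = *-cancelˡ-< z z (2 * D) (≤-trans (s≤s (≤-trans (m≤m+n (z * z) _) (g-quadratic l' below z 0 refl)))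
      (≤-trans (*-monoʳ-< 2 few) (≤-reflexive (arith z D))))
      where
      arith : ∀ z D → 2 * (z * D) ≡ z * (2 * D)
      arith = solve-∀
    bound : (∃ λ j → j < z × g (suc j) < g j + D) → top ≤ 3 * (D * D)
    bound (j , j<z , h) = lin 0 (top≤-increment D j (≤-trans (+-monoʳ-≤ D (s≤s (s≤s (<⇒≤ j<z)))) l) (<⇒≤ h) ⊕ g-mono (<⇒≤ j<z) z≤N ⊕ <⇒≤ few ⊕ *-monoˡ-≤ D (<⇒≤ z<2D))
      (arith (g j) (g z) (z * D) D top)
      where
      arith : ∀ a b c D t → t + (a + D * D + b + c + 2 * D * D) + 0 ≡ 3 * (D * D) + (t + a + b + c)
      arith = solve-∀

module _ {N : ℕ} where
  open UEnds N

  EndsOf : Fin (mU N) → Fin N → Fin N → Set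
  EndsOf e u v = (pU e ≡ u × qU e ≡ v) ⊎ (pU e ≡ v × qU e ≡ u)

  HasLeaf : (Fin (mU N) → Bool) → Set
  HasLeaf Z = ∃ λ e → e ∈ Z × ∃ λ u → ∃ λ v → EndsOf e u v × (∀ {f} → f ∈ Z → f ≢ e → pU f ≢ v × qU f ≢ v)

  edgesAt : Fin N → Fin (mU N) → Bool
  edgesAt v = ⟪ (λ e → (v Fin.≟ pU e) ⊎-dec (v Fin.≟ qU e)) ⟫

  ∈edgesAt : ∀ {v e} → v ≡ pU e ⊎ v ≡ qU e → e ∈ edgesAt v
  ∈edgesAt {v} = ∈⟪⟫ (λ e → (v Fin.≟ pU e) ⊎-dec (v Fin.≟ qU e))

  ∈edgesAt⁻ : ∀ {v e} → e ∈ edgesAt v → v ≡ pU e ⊎ v ≡ qU e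
  ∈edgesAt⁻ {v} = ∈⟪⟫⁻ (λ e → (v Fin.≟ pU e) ⊎-dec (v Fin.≟ qU e))

-- A circuit C of a sparse graph is covered by the few vertices whose stars it spans.
module Circuit {N} (S : SymmetricRank 1 N) (C₀ : Fin (mU N) → Bool) {D : ℕ}
  (nonempty : 0 < # C₀)
  (dependent : suc (SymmetricRank.R S (UEnds.imgU N C₀)) ≤ # C₀)
  (spanned : ∀ {e} → e ∈ C₀ → Spanning.Spans S (UEnds.imgU N (C₀ ∖ ⁅ e ⁆)) (UEnds.pU N e) (UEnds.qU N e))
  (leaf : ∀ {Z} → Z ⊆ C₀ → 0 < # Z → Cl (HasLeaf {N} Z))
  (degree : ∀ v → # (C₀ ∩ edgesAt {N} v) ≤ D)
  (low : SymmetricRank.R S (UEnds.imgU N C₀) < Spanning.top S) (few : # C₀ ≤ Spanning.top S)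
  (room : D + (2 + (4 * Spanning.top S)) ≤ N) where
  open SymmetricRank S renaming (R to r)
  open SymmetricProperties S
  open Spanning S
  open Concavity S
  open UEnds N

  private
    C : ESet N
    C = imgU C₀

    full? : ∀ x → Dec (∀ y → y ≢ x → Spans C x y)
    full? x = Fin.all? λ y → map′ (λ { (inj₁ e) ne → ⊥-elim (ne e) ; (inj₂ s) _ → s }) (λ h → [ inj₁ , (λ ne → inj₂ (h ne)) ]′ (toSum (y Fin.≟ x))) ((y Fin.≟ x) ⊎-dec spans? C x y)

    Z₀ : Fin N → Bool
    Z₀ = ⟪ full? ⟫

    Z₀⁺ : ∀ {x} → (∀ y → y ≢ x → Spans C x y) → x ∈ Z₀
    Z₀⁺ = ∈⟪⟫ full?

    Z₀⁻ : ∀ {x} → x ∈ Z₀ → ∀ y → y ≢ x → Spans C x y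
    Z₀⁻ = ∈⟪⟫⁻ full?

    Z₀-spanned : ∀ {u v} → (u , v) ∈ incident Z₀ → u ≢ v → Spans C u v
    Z₀-spanned x ne = [ (λ z → Z₀⁻ z _ (ne ∘ sym)) , (λ z → Spans-sym (Z₀⁻ z _ ne)) ]′ (∈incident⁻ x)

    gZ₀ : g (# Z₀) ≤ r C
    gZ₀ = ≤-trans (≤-reflexive (sym (g-incident Z₀))) (≤-trans (mono (⊑-∪ʳ ⊑-refl)) (absorb Z₀-spanned))

    top+2≤N : 2 + top ≤ N
    top+2≤N = ≤-trans (≤-trans (s≤s (s≤s (m≤m+n top _))) (m≤n+m _ D)) room

    #Z₀<top : # Z₀ < top
    #Z₀<top = ≰⇒> λ l → let below = ≤-trans (s≤s (≤-trans (g-mono l (#≤n Z₀)) gZ₀)) low in <⇒≱ below (size≤g top+2≤N below)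

    touched : Fin N → Bool
    touched = ⟪ (λ v → Fin.any? λ e → (e ∈? C₀) ×-dec ((v Fin.≟ pU e) ⊎-dec (v Fin.≟ qU e))) ⟫

    touched⁺ : ∀ {v e} → e ∈ C₀ → v ≡ pU e ⊎ v ≡ qU e → v ∈ touched
    touched⁺ a b = ∈⟪⟫ (λ v → Fin.any? λ e → (e ∈? C₀) ×-dec ((v Fin.≟ pU e) ⊎-dec (v Fin.≟ qU e))) (_ , a , b)

    #touched : # touched ≤ # C₀ + # C₀
    #touched = ≤-trans (#-cover-by C₀ (λ e → ⁅ pU e ⁆ ∪ ⁅ qU e ⁆) covered λ {e} _ → ≤-trans (#-add≤ ⁅ pU e ⁆ (qU e)) (s≤s (≤-reflexive (#-⁅⁆ (pU e)))))
        (≤-reflexive (e (# C₀)))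
      where
      e : ∀ x → x * 2 ≡ x + x
      e = solve-∀
      covered : ∀ {v} → v ∈ touched → ∃ λ e → e ∈ C₀ × v ∈ ⁅ pU e ⁆ ∪ ⁅ qU e ⁆
      covered t = let e , e∈ , h = ∈⟪⟫⁻ (λ v → Fin.any? λ e → (e ∈? C₀) ×-dec ((v Fin.≟ pU e) ⊎-dec (v Fin.≟ qU e))) t in
        e , e∈ , [ (λ x → ∪ˡ (subst (_∈ ⁅ pU e ⁆) (sym x) (∈⁅⁆ _))) , (λ x → ∪ʳ (subst (_∈ ⁅ qU e ⁆) (sym x) (∈⁅⁆ _))) ]′ h

    fresh : Fin N → Bool
    fresh = full ∖ (touched ∪ Z₀)

    #fresh : 2 + top ≤ # fresh
    #fresh = +-cancelʳ-≤ (3 * top) _ _ (≤-trans (≤-trans (≤-reflexive (e top)) (≤-trans (m≤n+m _ D) room)) (≤-trans (≤-reflexive (sym #full)) (≤-trans (≤-reflexive (#-∖ full (touched ∪ Z₀)))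
        (≤-trans (+-monoˡ-≤ _ (≤-trans (#-mono (∩ʳ {X = full})) (≤-trans (#-∪≤ touched Z₀) (+-mono-≤ (≤-trans #touched (+-mono-≤ few few)) (<⇒≤ #Z₀<top)))))
          (≤-reflexive (e' top (# fresh)))))))
      where
      #full : # {N} full ≡ N
      #full = trans (#-Sum full) (trans (Sum-const {N} 1) (*-identityʳ N))
      e : ∀ t → 2 + t + 3 * t ≡ 2 + 4 * t
      e = solve-∀
      e' : ∀ t f → t + t + t + f ≡ f + 3 * t
      e' = solve-∀

    closure? : ∀ x → Dec (Spans C (proj₁ x) (proj₂ x))
    closure? x = spans? C (proj₁ x) (proj₂ x)

    -- the edges of C avoiding Z₀ have a leaf, whose end of degree one can be moved to any fresh vertex
    uncovered : Fin (mU N) → Bool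
    uncovered = ⟪ (λ e → (e ∈? C₀) ×-dec (¬? (pU e ∈? Z₀) ×-dec ¬? (qU e ∈? Z₀))) ⟫

    uncovered⁺ : ∀ {e} → e ∈ C₀ × pU e ∉ Z₀ × qU e ∉ Z₀ → e ∈ uncovered
    uncovered⁺ = ∈⟪⟫ (λ e → (e ∈? C₀) ×-dec (¬? (pU e ∈? Z₀) ×-dec ¬? (qU e ∈? Z₀)))

    uncovered⁻ : ∀ {e} → e ∈ uncovered → e ∈ C₀ × pU e ∉ Z₀ × qU e ∉ Z₀
    uncovered⁻ = ∈⟪⟫⁻ (λ e → (e ∈? C₀) ×-dec (¬? (pU e ∈? Z₀) ×-dec ¬? (qU e ∈? Z₀)))

    no-leaf : HasLeaf {N} uncovered → ⊥
    no-leaf (e , e∈ , u , v , ends , alone) = u∉ (Z₀⁺ λ y y≢u → Spans-trans {C} {⟪ closure? ⟫} (λ x _ → ∈⟪⟫⁻ closure? x)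
        (big-star-spans {top} ≤-refl (fresh , #fresh , λ f → fresh≢u f , inj₁ (∪ʳ (∈⟪⟫ closure? (moved f)))) y≢u))
      where
      at-end : ∀ {P : Fin N → Set} → EndsOf e u v → P (pU e) → P (qU e) → P u × P v
      at-end (inj₁ (refl , refl)) a b = a , b
      at-end (inj₂ (refl , refl)) a b = b , a
      u∉ : u ∉ Z₀
      u∉ = let _ , a , b = uncovered⁻ {e} e∈ in proj₁ (at-end {_∉ Z₀} ends a b)
      v∉ : v ∉ Z₀
      v∉ = let _ , a , b = uncovered⁻ {e} e∈ in proj₂ (at-end {_∉ Z₀} ends a b)
      uv-touched : u ∈ touched × v ∈ touched
      uv-touched = let c = proj₁ (uncovered⁻ {e} e∈) in at-end {_∈ touched} ends (touched⁺ {e = e} c (inj₁ refl)) (touched⁺ {e = e} c (inj₂ refl))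
      u≢v : u ≢ v
      u≢v h = [ (λ (a , b) → pU≢qU e (trans a (trans h (sym b)))) , (λ (a , b) → pU≢qU e (trans a (trans (sym h) (sym b)))) ]′ ends
      fresh≢u : ∀ {y} → y ∈ fresh → y ≢ u
      fresh≢u f refl = ∖ʳ f (∪ˡ (proj₁ uv-touched))
      rest : Fin (mU N) → Bool
      rest = uncovered ∖ ⁅ e ⁆
      X : ESet N
      X = incident Z₀ ∪ imgU rest
      C∖e⊑X : imgU (C₀ ∖ ⁅ e ⁆) ⊑ X
      C∖e⊑X x _ = inj₁ (locate (∈imgU⁻ x))
        where
        locate : ∀ {a b} → (∃ λ f → f ∈ C₀ ∖ ⁅ e ⁆ × pU f ≡ a × qU f ≡ b) → (a , b) ∈ X
        locate (f , f∈ , refl , refl) = ([ (λ a → ∪ˡ (∈incident (inj₁ a))) , (λ ¬a → [ (λ b → ∪ˡ (∈incident (inj₂ b))) ,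
          (λ ¬b → ∪ʳ (∈imgU {rest} {f} (∖⁺ (uncovered⁺ {f} (∖ˡ f∈ , ¬a , ¬b)) (∖ʳ f∈)))) ]′ (toSum (qU f ∈? Z₀))) ]′ (toSum (pU f ∈? Z₀)))
      X-spanned : ∀ {a b} → (a , b) ∈ X → a ≢ b → Spans C a b
      X-spanned x ne = [ (λ z → Z₀-spanned z ne) , (λ z → ∈⇒Spans (inj₁ (in-C (∈imgU⁻ z)))) ]′ (∪⁻ x)
        where
        in-C : ∀ {a b} → (∃ λ f → f ∈ rest × pU f ≡ a × qU f ≡ b) → (a , b) ∈ C
        in-C (f , f∈ , refl , refl) = ∈imgU {C₀} {f} (proj₁ (uncovered⁻ {f} (∖ˡ f∈)))
      X-spans : Spans X u v
      X-spans = [ (λ { (refl , refl) → s }) , (λ { (refl , refl) → Spans-sym s }) ]′ ends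
        where
        s : Spans X (pU e) (qU e)
        s = Spans-mono C∖e⊑X (spanned (proj₁ (uncovered⁻ {e} e∈)))
      moved : ∀ {y} → y ∈ fresh → Spans C u y
      moved {y} f = Spans-trans {C} {X} X-spanned (Spans-mono (⊑-∪ʳ ⊑-refl)
          (subst₂ (Spans X) (swap-≢ v y u≢v (fresh≢u f ∘ sym)) (swap-a v y) (Spans-swap preserved X-spans)))
        where
        avoid-v : Avoids (imgU rest) v
        avoid-v x = off (∈imgU⁻ x)
          where
          off : ∀ {a b} → (∃ λ f → f ∈ rest × pU f ≡ a × qU f ≡ b) → a ≢ v × b ≢ v
          off (f , f∈ , refl , refl) = alone {f} (∖ˡ f∈) λ { refl → ∖ʳ f∈ (∈⁅⁆ _) }
        avoid-y : Avoids (imgU rest) y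
        avoid-y x = off (∈imgU⁻ x)
          where
          off : ∀ {a b} → (∃ λ f → f ∈ rest × pU f ≡ a × qU f ≡ b) → a ≢ y × b ≢ y
          off (f' , f'∈ , refl , refl) = let c = proj₁ (uncovered⁻ {f'} (∖ˡ f'∈)) in
            (λ { refl → ∖ʳ f (∪ˡ (touched⁺ c (inj₁ refl))) }) , (λ { refl → ∖ʳ f (∪ˡ (touched⁺ c (inj₂ refl))) })
        preserved : Preserved X v y
        preserved x = [ (λ z → ∪ˡ (incident-preserved v∉ (∖ʳ f ∘ ∪ʳ) z)) , (λ z → ∪ʳ (avoids-preserved avoid-v avoid-y z)) ]′ (∪⁻ x)

    all-covered : ∀ {e} → e ∈ C₀ → pU e ∈ Z₀ ⊎ qU e ∈ Z₀
    all-covered {e} e∈ = [ inj₁ , (λ ¬a → [ inj₂ , (λ ¬b → ⊥-elim (leaf (λ {f} x → proj₁ (uncovered⁻ {f} x)) (∈⇒#-pos {x = e} (uncovered⁺ {e} (e∈ , ¬a , ¬b))) no-leaf)) ]′ (toSum (qU e ∈? Z₀))) ]′ (toSum (pU e ∈? Z₀))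

    #C₀ : # C₀ ≤ # Z₀ * D
    #C₀ = #-cover-by Z₀ (λ v → C₀ ∩ edgesAt v) covered λ {v} _ → degree v
      where
      covered : ∀ {e} → e ∈ C₀ → ∃ λ v → v ∈ Z₀ × e ∈ C₀ ∩ edgesAt v
      covered {e} e∈ = [ (λ z → pU e , z , ∩⁺ e∈ (∈edgesAt {v = pU e} {e} (inj₁ refl))) , (λ z → qU e , z , ∩⁺ e∈ (∈edgesAt {v = qU e} {e} (inj₂ refl))) ]′ (all-covered e∈)

  bounded-rank : top ≤ 3 * (D * D) × g 1 < top
  bounded-rank = few-stars⇒bounded {D} {# Z₀} (pos (≤-trans nonempty #C₀)) (≤-trans (+-monoʳ-≤ D (s≤s (s≤s (≤-trans (<⇒≤ #Z₀<top) (m≤m+n top _))))) room)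
      (≤-trans (s≤s gZ₀) (≤-trans dependent #C₀)) (≤-trans (s≤s gZ₀) low)
    where
    pos : ∀ {z} → 0 < z * D → 1 ≤ z
    pos {suc z} _ = s≤s z≤n

module SparseGraph (𝓕 : GraphMatroidFamily) (N : ℕ) (dec : Decidable-on 𝓕 N) {c c' : ℕ} (3≤c : 3 ≤ c) (c'≤c : c' ≤ c)
  (whitney : Whitney-at c' 𝓕) where
  open UEnds N
  open FamilyRank 𝓕 N dec
  open Rigidity 𝓕 N dec 3≤c c'≤c whitney using (rk-img)
  private
    S = symmetricRank 𝓕 N dec
    module Sp = Spanning S

  r-img : ∀ Z → r (imgU Z) ≡ rk Z
  r-img Z = trans (r-rk (imgU Z)) (≤-antisym (rk-img Z) (rk-mono λ z → ∈idx (inj₁ (∈imgU z))))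

  ≤top-rk : ∀ Z → rk Z ≤ Sp.top
  ≤top-rk Z = ≤-trans (≤-reflexive (sym (r-img Z))) (Sp.≤top (imgU Z))

  In? : ∀ Z → Dec (In Z)
  In? Z = dec (tabulate Z)

  minimal : ∀ n {Z} → # Z ≤ n → ¬ In Z → Σ (Fin (mU N) → Bool) λ C → C ⊆ Z × ¬ In C × (∀ {e} → e ∈ C → In (C ∖ ⁅ e ⁆))
  minimal n {Z} l ¬i = go n l (Fin.any? λ e → (e ∈? Z) ×-dec ¬? (In? (Z ∖ ⁅ e ⁆)))
    where
    go : ∀ n → # Z ≤ n → Dec (∃ λ e → e ∈ Z × ¬ In (Z ∖ ⁅ e ⁆)) → Σ (Fin (mU N) → Bool) λ C → C ⊆ Z × ¬ In C × (∀ {e} → e ∈ C → In (C ∖ ⁅ e ⁆))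
    go n l (no ¬p) = Z , id , ¬i , λ {e} e∈ → stable (In? (Z ∖ ⁅ e ⁆)) λ ¬j → ¬p (e , e∈ , ¬j)
    go zero l (yes (e , e∈ , _)) = ⊥-elim (<⇒≱ (∈⇒#-pos e∈) l)
    go (suc n) l (yes (e , e∈ , ¬j)) = let C , C⊆ , rest = minimal n (s≤s⁻¹ (≤-trans (≤-reflexive (sym (#-del Z e∈))) l)) ¬j in C , ∖ˡ ∘ C⊆ , rest

  module _ (W : Fin (mU N) → Bool) {A : Fin N → Bool} {D : ℕ} (within : WithinE A (imgU W)) (con : ConnectedE c A (imgU W)) (c<A : c < # A)
    (two : 2 ≤ # W) (leaf : ∀ {Z} → Z ⊆ W → 0 < # Z → # Z ≤ Sp.top → Cl (HasLeaf {N} Z)) (degree : ∀ v → # (W ∩ edgesAt {N} v) ≤ D)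
    (room : D + (2 + (4 * Sp.top)) ≤ N) where

    private
      Dependent : (Fin (mU N) → Bool) → Set
      Dependent Z = Z ⊆ W × # Z ≤ Sp.top × ¬ In Z

      -- otherwise any two edges of W could be exchanged
      some-dependent : ¬ (∀ Z → Z ⊆ W → # Z ≤ Sp.top → In Z)
      some-dependent all = pick (#-pos {X = W} (≤-trans (s≤s z≤n) two))
        where
        pick : (∃ λ e → e ∈ W) → ⊥
        pick (e , e∈) = pick' (#<⇒∃ ⁅ e ⁆ W (≤-trans (s≤s (≤-reflexive (#-⁅⁆ e))) two))
          where
          pick' : (∃ λ f → f ∈ W × f ∉ ⁅ e ⁆) → ⊥
          pick' (f , f∈ , f∉) = SwapLemma.no-swap 𝓕 N dec W 3≤c within con c<A e∈ f∈ (λ { refl → f∉ (∈⁅⁆ e) }) (exchange f∈) (λ S⊆ e∉ f∉ → exchange e∈ S⊆ f∉ e∉)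
              (whitney _ (SubU.Connectivity.isConnected W (≤-trans (s≤s z≤n) 3≤c) within con c<A c'≤c))
            where
            exchange : ∀ {S e f} → f ∈ W → S ⊆ W → e ∉ S → f ∉ S → In (S ∪ ⁅ e ⁆) → In (S ∪ ⁅ f ⁆)
            exchange {S} {e} {f} f∈ S⊆ e∉ f∉ i = all (S ∪ ⁅ f ⁆) (∪-⊆ S⊆ (⁅⁆-⊆ f∈)) (≤-trans (≤-reflexive (trans (#-add S f∉) (sym (#-add S e∉)))) (≤-trans (In⇒rank i) (≤top-rk _)))

    bounded-rank : Cl (Sp.top ≤ 3 * (D * D) × Sp.g 1 < Sp.top)
    bounded-rank = em (∃ Dependent) >>= λ { (no ¬p) → λ _ → some-dependent λ Z Z⊆ l → stable (In? Z) λ ¬i → ¬p (Z , Z⊆ , l , ¬i)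
                                          ; (yes (Z , Z⊆ , l , ¬i)) → ret (circuit Z Z⊆ l (minimal _ ≤-refl ¬i)) }
      where
      circuit : ∀ Z → Z ⊆ W → # Z ≤ Sp.top → (Σ (Fin (mU N) → Bool) λ C → C ⊆ Z × ¬ In C × (∀ {e} → e ∈ C → In (C ∖ ⁅ e ⁆))) → Sp.top ≤ 3 * (D * D) × Sp.g 1 < Sp.top
      circuit Z Z⊆ l (C , C⊆ , ¬i , minimal) = Circuit.bounded-rank S C {D} (≤-trans (s≤s z≤n) dependent) dependent spanned
          (λ {Y} Y⊆ pos → leaf {Y} (λ y → Z⊆ (C⊆ (Y⊆ y))) pos (≤-trans (#-mono Y⊆) few)) (λ v → ≤-trans (#-mono λ x → ∩⁺ (Z⊆ (C⊆ (∩ˡ x))) (∩ʳ x)) (degree v))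
          (≤-trans dependent few) few room
        where
        few : # C ≤ Sp.top
        few = ≤-trans (#-mono C⊆) l
        dependent : suc (r (imgU C)) ≤ # C
        dependent = ≰⇒> λ h → ¬i (rank⇒In (≤-trans h (≤-reflexive (r-img C))))
        spanned : ∀ {e} → e ∈ C → Sp.Spans (imgU (C ∖ ⁅ e ⁆)) (pU e) (qU e)
        spanned {e} e∈ = ≤-trans (r-mono sub) (≤-trans (s≤s⁻¹ (≤-trans dependent (≤-reflexive (#-del C e∈))))
            (≤-trans (In⇒rank (minimal e∈)) (≤-reflexive (sym (r-img _)))))
          where
          sub : imgU (C ∖ ⁅ e ⁆) ∪ single (pU e) (qU e) ⊑ imgU C
          sub = ⊑-∪ (⊆⇒⊑ λ { {u , v} x → shrink (∈imgU⁻ x) }) (single-⊑ (inj₁ (∈imgU {C} {e} e∈)))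
            where
            shrink : ∀ {u v} → (∃ λ f → f ∈ C ∖ ⁅ e ⁆ × pU f ≡ u × qU f ≡ v) → (u , v) ∈ imgU C
            shrink (f , f∈ , refl , refl) = ∈imgU {C} {f} (∖ˡ f∈)

Unfree : ∀ {N} → SymmetricRank 1 N → Set
Unfree {N} S = Σ (ESet N) λ X → ∃ λ u → ∃ λ v → u ≢ v × Avoids X v × Spanning.Spans S X u v

module _ {N c} (S : SymmetricRank 1 N) (1≤c : 1 ≤ c) (rigid : SymmetricRank.Rigid S c) where
  open SymmetricRank S renaming (R to r)
  open SymmetricProperties S
  open Spanning S

  pendant-spanned⇒bounded : ∀ {A X u v} → u ∈ A → v ∉ A → X ⊑ clique A → Spans X u v → top ≤ c * 1 * # A
  pendant-spanned⇒bounded {A} {X} {u} {v} u∈ v∉ X⊑ s = ≤-trans (top≤ all) (≤-trans (≤-reflexive (R-clique A)) (ρ-bound 1≤c rigid (#≤n A)))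
    where
    flat : ρ (suc (# A)) ≤ ρ (# A)
    flat = ≤-trans (≤-reflexive (trans (cong ρ (sym (#-add A v∉))) (sym (R-clique (A ∪ ⁅ v ⁆))))) (≤-trans (≤-trans (mono (⊑-∪ʳ ⊑-refl)) (absorb pairs)) (≤-reflexive (R-clique A)))
      where
      at-v : ∀ {a} → a ∈ A → Spans (clique A) a v
      at-v {a} a∈ = subst₂ (Spans (clique A)) (swap-a u a) (swap-≢ u a (λ { refl → v∉ u∈ }) (λ { refl → v∉ a∈ })) (Spans-swap (λ x → let p , q = ∈clique⁻ x in ∈clique (inA p) (inA q)) (Spans-mono X⊑ s))
        where
        inA : ∀ {x} → x ∈ A → swap u a x ∈ A
        inA {x} x∈ = [ (λ { refl → subst (_∈ A) (sym (swap-a u a)) a∈ }) , (λ ne → [ (λ { refl → subst (_∈ A) (sym (swap-b u a)) u∈ }) , (λ ne' → subst (_∈ A) (sym (swap-≢ u a ne ne')) x∈) ]′ (toSum (x Fin.≟ a))) ]′ (toSum (x Fin.≟ u))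
      pairs : ∀ {x y} → (x , y) ∈ clique (A ∪ ⁅ v ⁆) → x ≢ y → Spans (clique A) x y
      pairs z ne = let p , q = ∈clique⁻ z in go (∪⁻ p) (∪⁻ q) ne
        where
        go : ∀ {x y} → x ∈ A ⊎ x ∈ ⁅ v ⁆ → y ∈ A ⊎ y ∈ ⁅ v ⁆ → x ≢ y → Spans (clique A) x y
        go (inj₁ p) (inj₁ q) ne = ∈⇒Spans (inj₁ (∈clique p q))
        go (inj₁ p) (inj₂ q) ne = subst (Spans (clique A) _) (∈⁅⁆⁻ q) (at-v p)
        go (inj₂ p) (inj₁ q) ne = Spans-sym (subst (Spans (clique A) _) (∈⁅⁆⁻ p) (at-v q))
        go (inj₂ p) (inj₂ q) ne = ⊥-elim (ne (trans (sym (∈⁅⁆⁻ p)) (∈⁅⁆⁻ q)))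
    pendant : ∀ {B a w} → # B ≡ # A → a ∈ B → w ∉ B → Spans (clique B) a w
    pendant {B} {a} {w} e a∈ w∉ = ≤-trans (mono (⊑-∪ (clique-mono ∪ˡ) (single-⊑ (inj₁ (∈clique (∪ˡ a∈) (∪ʳ (∈⁅⁆ w)))))))
      (≤-trans (≤-reflexive (trans (R-clique (B ∪ ⁅ w ⁆)) (cong ρ (trans (#-add B w∉) (cong suc e))))) (≤-trans flat (≤-reflexive (trans (cong ρ (sym e)) (sym (R-clique B))))))
    all : ∀ {x y} → x ≢ y → Spans (clique A) x y
    all {x} {y} ne = go (toSum (x ∈? A)) (toSum (y ∈? A))
      where
      go : x ∈ A ⊎ x ∉ A → y ∈ A ⊎ y ∉ A → Spans (clique A) x y
      go (inj₁ p) (inj₁ q) = ∈⇒Spans (inj₁ (∈clique p q))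
      go (inj₁ p) (inj₂ q) = pendant refl p q
      go (inj₂ p) (inj₁ q) = Spans-sym (pendant refl q p)
      go (inj₂ p) (inj₂ q) = Spans-trans {Z = clique B} B-spanned (Spans-mono (⊑-∪ʳ ⊑-refl) (pendant #B (∪ʳ (∈⁅⁆ x)) y∉B))
        where
        B : Fin N → Bool
        B = (A ∖ ⁅ u ⁆) ∪ ⁅ x ⁆
        #B : # B ≡ # A
        #B = trans (#-add (A ∖ ⁅ u ⁆) (p ∘ ∖ˡ)) (sym (#-del A u∈))
        y∉B : y ∉ B
        y∉B b = [ (λ a → q (∖ˡ a)) , (λ a → ne (∈⁅⁆⁻ a)) ]′ (∪⁻ b)
        B-spanned : ∀ {a b} → (a , b) ∈ clique B → a ≢ b → Spans (clique A) a b
        B-spanned z ne = let s , t = ∈clique⁻ z in go' (∪⁻ s) (∪⁻ t) ne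
          where
          go' : ∀ {a b} → a ∈ A ∖ ⁅ u ⁆ ⊎ a ∈ ⁅ x ⁆ → b ∈ A ∖ ⁅ u ⁆ ⊎ b ∈ ⁅ x ⁆ → a ≢ b → Spans (clique A) a b
          go' (inj₁ s) (inj₁ t) ne = ∈⇒Spans (inj₁ (∈clique (∖ˡ s) (∖ˡ t)))
          go' (inj₁ s) (inj₂ t) ne = subst (Spans (clique A) _) (∈⁅⁆⁻ t) (pendant refl (∖ˡ s) p)
          go' (inj₂ s) (inj₁ t) ne = Spans-sym (subst (Spans (clique A) _) (∈⁅⁆⁻ s) (pendant refl (∖ˡ t) p))
          go' (inj₂ s) (inj₂ t) ne = ⊥-elim (ne (trans (sym (∈⁅⁆⁻ s)) (∈⁅⁆⁻ t)))

-- A pendant edge spanned in K_n stays spanned in every larger complete graph.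
module _ (𝓕 : GraphMatroidFamily) {n N c : ℕ} (n≤N : n ≤ N) (dec : Decidable-on 𝓕 n) (dec' : Decidable-on 𝓕 N)
  (1≤c : 1 ≤ c) (rigid : SymmetricRank.Rigid (symmetricRank 𝓕 N dec') c) where
  private
    S = symmetricRank 𝓕 N dec'
    module Sp = Spanning S
    module F = FamilyRank 𝓕 n dec
    module F' = FamilyRank 𝓕 N dec'
    bd : Bounded N (U n)
    bd i = ≤-trans (hiU< n i) n≤N
    module O = F'.OfGraph (U n) bd
    module E = UEnds n
    module E' = Ends (U n) bd

    toℕ-p : ∀ i → toℕ (E'.pG i) ≡ toℕ (E.pU i)
    toℕ-p i = trans (E'.toℕ-pG i) (sym (E.toℕ-pU i))
    toℕ-q : ∀ i → toℕ (E'.qG i) ≡ toℕ (E.qU i)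
    toℕ-q i = trans (E'.toℕ-qG i) (sym (E.toℕ-qU i))

  unfree⇒bounded : Unfree (symmetricRank 𝓕 n dec) → Sp.top ≤ c * 1 * n
  unfree⇒bounded (X , u , v , u≢v , avoids , s) = go (pairU u v u≢v)
    where
    B : Fin (mU n) → Bool
    B = F.base (F.idx X)
    module _ (e : Fin (mU n)) (a b : Fin N) (ea : toℕ a ≡ toℕ u) (eb : toℕ b ≡ toℕ v) (e-in : single (E.pU e) (E.qU e) ⊑ single u v) (e-v : v ≡ E.pU e ⊎ v ≡ E.qU e)
             (joins-e : ∀ {Y} → e ∈ Y → Joins (E'.imgG Y) a b) where
      off : ∀ {f} → f ∈ B → E.pU f ≢ v × E.qU f ≢ v
      off f∈ = [ avoids , (λ x → let p , q = avoids x in q , p) ]′ (F.∈idx⁻ (F.base-⊆ (F.idx X) f∈))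
      e∉ : e ∉ B
      e∉ x = let p , q = off x in [ (λ h → p (sym h)) , (λ h → q (sym h)) ]′ e-v
      spanned : Sp.Spans (E'.imgG B) a b
      spanned = ≤-trans (F'.r-mono sub) (≤-trans (s≤s⁻¹ (≤-trans (≰⇒> dependent) (≤-reflexive (#-add B e∉)))) (O.Ind⇒r (F.base-In (F.idx X))))
        where
        sub : E'.imgG B ∪ single a b ⊑ E'.imgG (B ∪ ⁅ e ⁆)
        sub = ⊑-∪ (⊆⇒⊑ λ { {x , y} z → grow (E'.∈imgG⁻ z) }) (single-⊑ (joins-e (∪ʳ (∈⁅⁆ e))))
          where
          grow : ∀ {x y} → (∃ λ f → f ∈ B × E'.pG f ≡ x × E'.qG f ≡ y) → (x , y) ∈ E'.imgG (B ∪ ⁅ e ⁆)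
          grow (f , f∈ , refl , refl) = E'.∈imgG {B ∪ ⁅ e ⁆} {f} (∪ˡ f∈)
        dependent : ¬ (# (B ∪ ⁅ e ⁆) ≤ F'.r (E'.imgG (B ∪ ⁅ e ⁆)))
        dependent h = <⇒≱ (≤-reflexive (sym (#-add B e∉))) (≤-trans (F.≤rank (F.idx (X ∪ single u v)) (∪-⊆ (λ x → F.idx-mono (⊑-∪ˡ ⊑-refl) (F.base-⊆ (F.idx X) x)) (⁅⁆-⊆ e∈)) (O.r⇒Ind h))
            (≤-trans (≤-reflexive (sym (F.r-rk _))) (≤-trans s (≤-reflexive (F.r-rk X)))))
          where
          e∈ : e ∈ F.idx (X ∪ single u v)
          e∈ = F.∈idx ([ (λ x → inj₁ (∪ʳ x)) , (λ x → inj₂ (∪ʳ x)) ]′ (e-in ∈single (E.pU≢qU e)))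
      A : Fin N → Bool
      A = SymmetricProperties.first S n ∖ ⁅ b ⁆
      inA : ∀ {x} → toℕ x < n → x ≢ b → x ∈ A
      inA l ne = ∖⁺ (∈⟪⟫ (λ x → toℕ x <? n) l) λ z → ne (sym (∈⁅⁆⁻ z))
      X⊑ : E'.imgG B ⊑ clique A
      X⊑ z _ = inj₁ (place (E'.∈imgG⁻ z))
        where
        place : ∀ {x y} → (∃ λ f → f ∈ B × E'.pG f ≡ x × E'.qG f ≡ y) → (x , y) ∈ clique A
        place (f , f∈ , refl , refl) = ∈clique
          (inA (subst (_< n) (sym (toℕ-p f)) (Fin.toℕ<n _)) λ h → proj₁ (off f∈) (Fin.toℕ-injective (trans (sym (toℕ-p f)) (trans (cong toℕ h) eb))))
          (inA (subst (_< n) (sym (toℕ-q f)) (Fin.toℕ<n _)) λ h → proj₂ (off f∈) (Fin.toℕ-injective (trans (sym (toℕ-q f)) (trans (cong toℕ h) eb))))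
      finish : Sp.top ≤ c * 1 * n
      finish = ≤-trans (pendant-spanned⇒bounded S 1≤c rigid (inA (subst (_< n) (sym ea) (Fin.toℕ<n u)) λ h → u≢v (Fin.toℕ-injective (trans (sym ea) (trans (cong toℕ h) eb)))) (λ z → ∖ʳ z (∈⁅⁆ b)) X⊑ spanned)
        (*-monoʳ-≤ (c * 1) (≤-trans (#-mono ∖ˡ) (≤-reflexive (SymmetricProperties.#first S n≤N))))
    go : (∃ λ e → (E.pU e ≡ u × E.qU e ≡ v) ⊎ (E.pU e ≡ v × E.qU e ≡ u)) → Sp.top ≤ c * 1 * n
    go (e , inj₁ (refl , refl)) = finish e (E'.pG e) (E'.qG e) (toℕ-p e) (toℕ-q e) ⊑-refl (inj₂ refl) λ {Y} x → inj₁ (E'.∈imgG {Y} {e} x)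
    go (e , inj₂ (refl , refl)) = finish e (E'.qG e) (E'.pG e) (toℕ-q e) (toℕ-p e) (single-⊑ (inj₂ ∈single)) (inj₁ refl) λ {Y} x → inj₂ (E'.∈imgG {Y} {e} x)

-- Graphs with bounded degrees, many edges and no short cycles: a maximal graph with degrees at most D
-- and no short cycles has few vertices of degree less than D, because these are close to each other.
module Girth (N D b : ℕ) where
  open UEnds N

  Leafy : (Fin (mU N) → Bool) → Set
  Leafy W = ∀ {Z} → Z ⊆ W → 0 < # Z → # Z ≤ b → Cl (HasLeaf {N} Z)

  Sparse : (Fin (mU N) → Bool) → Set
  Sparse W = (∀ v → # (W ∩ edgesAt {N} v) ≤ D) × Leafy W

  maximal : ∀ n W → mU N ≤ n + # W → Sparse W → Cl (Σ (Fin (mU N) → Bool) λ W → Sparse W × (∀ {e} → e ∉ W → ¬ Sparse (W ∪ ⁅ e ⁆)))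
  maximal n W l s = em (∃ λ e → e ∉ W × Sparse (W ∪ ⁅ e ⁆)) >>= go n l
    where
    go : ∀ n → mU N ≤ n + # W → Dec (∃ λ e → e ∉ W × Sparse (W ∪ ⁅ e ⁆)) → Cl (Σ (Fin (mU N) → Bool) λ W → Sparse W × (∀ {e} → e ∉ W → ¬ Sparse (W ∪ ⁅ e ⁆)))
    go n l (no ¬p) = ret (W , s , λ {e} e∉ s' → ¬p (e , e∉ , s'))
    go zero l (yes (e , e∉ , _)) = ⊥-elim (<⇒≱ (≤-trans (s≤s l) (≤-reflexive (sym (#-add W e∉)))) (#≤n (W ∪ ⁅ e ⁆)))
    go (suc n) l (yes (e , e∉ , s')) = maximal n (W ∪ ⁅ e ⁆) (≤-trans l (≤-reflexive (trans (sym (+-suc n (# W))) (cong (n +_) (sym (#-add W e∉)))))) s'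

  module Balls (W : Fin (mU N) → Bool) (sparse : Sparse W) (max : ∀ {e} → e ∉ W → ¬ Sparse (W ∪ ⁅ e ⁆)) where
    Adjacent : Fin N → Fin N → Set
    Adjacent x y = ∃ λ e → e ∈ W × EndsOf e x y

    ends? : ∀ e x y → Dec (EndsOf e x y)
    ends? e x y = ((pU e Fin.≟ x) ×-dec (qU e Fin.≟ y)) ⊎-dec ((pU e Fin.≟ y) ×-dec (qU e Fin.≟ x))

    adjacent? : ∀ x y → Dec (Adjacent x y)
    adjacent? x y = Fin.any? λ e → (e ∈? W) ×-dec ends? e x y

    ball : ℕ → Fin N → Fin N → Bool
    ball zero a = ⁅ a ⁆
    ball (suc n) a = ball n a ∪ ⟪ (λ y → Fin.any? λ x → (x ∈? ball n a) ×-dec adjacent? x y) ⟫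

    ball-snoc : ∀ n {a x y} → x ∈ ball n a → Adjacent x y → y ∈ ball (suc n) a
    ball-snoc n {a} x∈ h = ∪ʳ (∈⟪⟫ (λ y → Fin.any? λ x → (x ∈? ball n a) ×-dec adjacent? x y) (_ , x∈ , h))

    ball-suc⁻ : ∀ n {a y} → y ∈ ball (suc n) a → y ∈ ball n a ⊎ (∃ λ x → x ∈ ball n a × Adjacent x y)
    ball-suc⁻ n {a} y∈ = [ inj₁ , (λ h → inj₂ (∈⟪⟫⁻ (λ y → Fin.any? λ x → (x ∈? ball n a) ×-dec adjacent? x y) h)) ]′ (∪⁻ y∈)

    centre∈ball : ∀ n a → a ∈ ball n a
    centre∈ball zero a = ∈⁅⁆ a
    centre∈ball (suc n) a = ∪ˡ (centre∈ball n a)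

    ball-cons : ∀ n {a x y} → Adjacent a x → y ∈ ball n x → y ∈ ball (suc n) a
    ball-cons zero {a} {x} h y∈ = ball-snoc zero (∈⁅⁆ a) (subst (Adjacent a) (∈⁅⁆⁻ y∈) h)
    ball-cons (suc n) h y∈ = [ (λ z → ∪ˡ (ball-cons n h z)) , (λ (z , z∈ , k) → ball-snoc (suc n) (ball-cons n h z∈) k) ]′ (ball-suc⁻ n y∈)

    #neighbours : ∀ x → # (⟪ adjacent? x ⟫) ≤ D
    #neighbours x = ≤-trans (#-cover-by (W ∩ edgesAt x) (λ e → ⟪ ends? e x ⟫) covered λ {e} _ → #≤1 _ λ i j → unique e (∈⟪⟫⁻ (ends? e x) i) (∈⟪⟫⁻ (ends? e x) j))
        (≤-trans (≤-reflexive (*-identityʳ _)) (proj₁ sparse x))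
      where
      covered : ∀ {y} → y ∈ ⟪ adjacent? x ⟫ → ∃ λ e → e ∈ W ∩ edgesAt x × y ∈ ⟪ ends? e x ⟫
      covered h = let e , e∈ , k = ∈⟪⟫⁻ (adjacent? x) h in
        e , ∩⁺ e∈ (∈edgesAt ([ (λ (a , _) → inj₁ (sym a)) , (λ (_ , a) → inj₂ (sym a)) ]′ k)) , ∈⟪⟫ (ends? e x) k
      unique : ∀ e {y z} → EndsOf e x y → EndsOf e x z → y ≡ z
      unique e (inj₁ (a , b)) (inj₁ (c , d)) = trans (sym b) d
      unique e (inj₂ (a , b)) (inj₂ (c , d)) = trans (sym a) c
      unique e (inj₁ (a , b)) (inj₂ (c , d)) = ⊥-elim (pU≢qU e (trans a (sym d)))
      unique e (inj₂ (a , b)) (inj₁ (c , d)) = ⊥-elim (pU≢qU e (trans c (sym b)))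

    #ball : ∀ n a → # (ball n a) ≤ suc D ^ n
    #ball zero a = ≤-reflexive (#-⁅⁆ a)
    #ball (suc n) a = ≤-trans (#-∪≤ (ball n a) _) (≤-trans (+-monoʳ-≤ (# (ball n a)) (#-cover-by (ball n a) (λ x → ⟪ adjacent? x ⟫)
        (λ h → let x , x∈ , k = ∈⟪⟫⁻ (λ y → Fin.any? λ x → (x ∈? ball n a) ×-dec adjacent? x y) h in x , x∈ , ∈⟪⟫ (adjacent? x) k) (λ {x} _ → #neighbours x)))
      (≤-trans (≤-reflexive (sym (*-suc (# (ball n a)) D))) (≤-trans (*-monoˡ-≤ (suc D) (#ball n a)) (≤-reflexive (*-comm (suc D ^ n) (suc D))))))

    LeavesIn : (Fin (mU N) → Bool) → Fin N → Fin N → Set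
    LeavesIn Z a b = ∀ {e x y} → e ∈ Z → EndsOf e x y → (∀ {f} → f ∈ Z → f ≢ e → pU f ≢ y × qU f ≢ y) → y ≡ a ⊎ y ≡ b

    LeavesIn-sym : ∀ {Z a b} → LeavesIn Z a b → LeavesIn Z b a
    LeavesIn-sym h e∈ ends alone = [ inj₂ , inj₁ ]′ (h e∈ ends alone)

    EndsOf-sym : ∀ {e : Fin (mU N)} {x y : Fin N} → EndsOf e x y → EndsOf e y x
    EndsOf-sym (inj₁ h) = inj₂ h
    EndsOf-sym (inj₂ h) = inj₁ h

    -- a set of edges without leaves other than a and b contains a path from a to b: remove the leaves
    path : ∀ n Z a c → # Z ≡ suc n → suc n ≤ b → Z ⊆ W → LeavesIn Z a c → Cl (c ∈ ball (suc n) a)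
    path n Z a c #Z n≤b Z⊆ leaves = leaf >>= at
      where
      leaf : Cl (HasLeaf {N} Z)
      leaf = proj₂ sparse {Z} Z⊆ (≤-trans (s≤s z≤n) (≤-reflexive (sym #Z))) (≤-trans (≤-reflexive #Z) n≤b)
      Alone : Fin (mU N) → Fin N → Set
      Alone e y = ∀ {f} → f ∈ Z → f ≢ e → pU f ≢ y × qU f ≢ y
      -- e = {a , x} is the only edge of Z at a
      peel : ∀ n {e x a c} → # Z ≡ suc n → suc n ≤ b → LeavesIn Z a c → e ∈ Z → EndsOf e x a → Alone e a → Cl (Adjacent a x × c ∈ ball n x)
      peel zero {e} {x} {a} {c} #Z _ leaves e∈ ends alone = [ (λ x≡a → ⊥-elim (x≢a x≡a)) , (λ x≡c → ret (adj , subst (c ∈_) (cong ⁅_⁆ (sym x≡c)) (∈⁅⁆ c))) ]′ (leaves {y = x} e∈ (EndsOf-sym {e} ends) only)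
        where
        adj : Adjacent a x
        adj = e , Z⊆ e∈ , EndsOf-sym {e} ends
        x≢a : x ≢ a
        x≢a h = [ (λ (s , t) → pU≢qU e (trans s (trans h (sym t)))) , (λ (s , t) → pU≢qU e (trans s (trans (sym h) (sym t)))) ]′ ends
        only : ∀ {f} → f ∈ Z → f ≢ e → pU f ≢ x × qU f ≢ x
        only {f} f∈ f≢e = ⊥-elim (<⇒≱ (∈⇒#-pos {x = f} (∖⁺ f∈ λ z → f≢e (sym (∈⁅⁆⁻ z)))) (s≤s⁻¹ (≤-trans (≤-reflexive (sym (#-del Z e∈))) (≤-reflexive #Z))))
      peel (suc n) {e} {x} {a} {c} #Z n≤b leaves e∈ ends alone = path n (Z ∖ ⁅ e ⁆) x c (suc-injective (trans (sym (#-del Z e∈)) #Z)) (≤-trans (n≤1+n _) n≤b) (Z⊆ ∘ ∖ˡ) leaves' >>= λ k → ret (adj , k)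
        where
        adj : Adjacent a x
        adj = e , Z⊆ e∈ , EndsOf-sym {e} ends
        leaves' : LeavesIn (Z ∖ ⁅ e ⁆) x c
        leaves' {f} {s} {y} f∈ ends' alone' = [ inj₁ , (λ y≢x → [ (λ y≡a → ⊥-elim (not-a y≡a)) , inj₂ ]′ (leaves {y = y} (∖ˡ f∈) ends' (alone'' y≢x))) ]′ (toSum (y Fin.≟ x))
          where
          f≢e : f ≢ e
          f≢e h = ∖ʳ f∈ (subst (_∈ ⁅ e ⁆) (sym h) (∈⁅⁆ e))
          not-a : y ≢ a
          not-a h = let p , q = alone (∖ˡ f∈) f≢e in [ (λ (_ , t) → q (trans t h)) , (λ (t , _) → p (trans t h)) ]′ ends'
          alone'' : y ≢ x → ∀ {i} → i ∈ Z → i ≢ f → pU i ≢ y × qU i ≢ y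
          alone'' y≢x {i} i∈ i≢f = [ (λ h → subst (λ i → pU i ≢ y × qU i ≢ y) (sym h) e-off) , (λ ne → alone' (∖⁺ i∈ λ z → ne (sym (∈⁅⁆⁻ z))) i≢f) ]′ (toSum (i Fin.≟ e))
            where
            e-off : pU e ≢ y × qU e ≢ y
            e-off = [ (λ (s , t) → (λ h → y≢x (trans (sym h) s)) , λ h → not-a (trans (sym h) t)) , (λ (s , t) → (λ h → not-a (trans (sym h) s)) , λ h → y≢x (trans (sym h) t)) ]′ ends
      at : HasLeaf {N} Z → Cl (c ∈ ball (suc n) a)
      at (e , e∈ , x , y , ends , alone) = [ (λ h → start h) , (λ h → finish h) ]′ (leaves e∈ ends alone)
        where
        start : y ≡ a → Cl (c ∈ ball (suc n) a)
        start h = peel n {e} {x} {a} {c} #Z n≤b leaves e∈ (subst (EndsOf e x) h ends) (λ f∈ ne → subst (λ y → _ ≢ y × _ ≢ y) h (alone f∈ ne)) >>= λ (k , l) → ret (ball-cons n k l)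
        finish : y ≡ c → Cl (c ∈ ball (suc n) a)
        finish h = peel n {e} {x} {c} {a} #Z n≤b (LeavesIn-sym {Z} leaves) e∈ (subst (EndsOf e x) h ends) (λ f∈ ne → subst (λ y → _ ≢ y × _ ≢ y) h (alone f∈ ne)) >>= λ (k , l) → ret (ball-sym (suc n) (ball-cons n k l))
          where
          Adjacent-sym : ∀ {x y} → Adjacent x y → Adjacent y x
          Adjacent-sym (e , e∈ , k) = e , e∈ , EndsOf-sym {e} k
          ball-sym : ∀ n {x y} → x ∈ ball n y → y ∈ ball n x
          ball-sym zero {x} {y} h = subst (λ z → y ∈ ⁅ z ⁆) (∈⁅⁆⁻ h) (∈⁅⁆ y)
          ball-sym (suc n) h = [ (λ z → ∪ˡ (ball-sym n z)) , (λ (z , z∈ , k) → ball-cons n (Adjacent-sym k) (ball-sym n z∈)) ]′ (ball-suc⁻ n h)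

    ball-mono : ∀ {m n a} → m ≤ n → ball m a ⊆ ball n a
    ball-mono {m} {n} {a} l = go (≤⇒≤′ l)
      where
      go : ∀ {n} → m ≤′ n → ball m a ⊆ ball n a
      go ≤′-refl = id
      go (≤′-step l) x = ∪ˡ (go l x)

    low-close : ∀ {u v} → u ≢ v → # (W ∩ edgesAt u) < D → # (W ∩ edgesAt v) < D → v ∈ ball (suc b) u
    low-close {u} {v} u≢v low-u low-v = stable (v ∈? ball (suc b) u) λ far → go far (pairU u v u≢v)
      where
      go : v ∉ ball (suc b) u → (∃ λ e → EndsOf e u v) → ⊥
      go far (e , ends) = max e∉ (degrees , leafy)
        where
        e∉ : e ∉ W
        e∉ e∈ = far (ball-mono {1} {suc b} (s≤s z≤n) (ball-snoc 0 (∈⁅⁆ u) (e , e∈ , ends)))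
        degrees : ∀ x → # ((W ∪ ⁅ e ⁆) ∩ edgesAt x) ≤ D
        degrees x = [ (λ at-x → ≤-trans (#-mono split) (≤-trans (#-add≤ (W ∩ edgesAt x) e) (at-end ends (∈edgesAt⁻ at-x))))
                    , (λ off → ≤-trans (#-mono λ {f} z → ∩⁺ ([ id , (λ k → ⊥-elim (off (subst (_∈ edgesAt x) (sym (∈⁅⁆⁻ k)) (∩ʳ {X = W ∪ ⁅ e ⁆} z)))) ]′ (∪⁻ (∩ˡ z))) (∩ʳ z)) (proj₁ sparse x)) ]′ (toSum (e ∈? edgesAt x))
          where
          split : (W ∪ ⁅ e ⁆) ∩ edgesAt x ⊆ (W ∩ edgesAt x) ∪ ⁅ e ⁆
          split z = [ (λ k → ∪ˡ (∩⁺ k (∩ʳ z))) , ∪ʳ ]′ (∪⁻ (∩ˡ z))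
          is-u : x ≡ u → suc (# (W ∩ edgesAt x)) ≤ D
          is-u h = subst (λ x → # (W ∩ edgesAt x) < D) (sym h) low-u
          is-v : x ≡ v → suc (# (W ∩ edgesAt x)) ≤ D
          is-v h = subst (λ x → # (W ∩ edgesAt x) < D) (sym h) low-v
          at-end : EndsOf e u v → x ≡ pU e ⊎ x ≡ qU e → suc (# (W ∩ edgesAt x)) ≤ D
          at-end (inj₁ (s , t)) = [ (λ h → is-u (trans h s)) , (λ h → is-v (trans h t)) ]′
          at-end (inj₂ (s , t)) = [ (λ h → is-v (trans h s)) , (λ h → is-u (trans h t)) ]′
        leafy : Leafy (W ∪ ⁅ e ⁆)
        leafy {Z} Z⊆ pos #Z ¬leaf = [ with-e , without-e ]′ (toSum (e ∈? Z))
          where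
          without-e : e ∉ Z → ⊥
          without-e e∉ = proj₂ sparse {Z} (λ {f} f∈ → [ id , (λ k → ⊥-elim (e∉ (subst (_∈ Z) (sym (∈⁅⁆⁻ k)) f∈))) ]′ (∪⁻ (Z⊆ f∈))) pos #Z ¬leaf
          with-e : e ∈ Z → ⊥
          with-e e∈ = count (# (Z ∖ ⁅ e ⁆)) refl
            where
            count : ∀ n → # (Z ∖ ⁅ e ⁆) ≡ n → ⊥
            count zero k = ¬leaf (e , e∈ , u , v , ends , λ {f} f∈ f≢e → ⊥-elim (<⇒≱ (∈⇒#-pos {x = f} (∖⁺ f∈ λ z → f≢e (sym (∈⁅⁆⁻ z)))) (≤-reflexive k)))
            count (suc n) k = path n (Z ∖ ⁅ e ⁆) u v k n≤b (λ f∈ → [ id , (λ z → ⊥-elim (∖ʳ f∈ z)) ]′ (∪⁻ (Z⊆ (∖ˡ f∈)))) leaves λ near → far (ball-mono {suc n} {suc b} (≤-trans n≤b (n≤1+n b)) near)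
              where
              n≤b : suc n ≤ b
              n≤b = ≤-trans (≤-reflexive (sym k)) (≤-trans (#-mono ∖ˡ) #Z)
              leaves : LeavesIn (Z ∖ ⁅ e ⁆) u v
              leaves {f} {x} {y} f∈ ends' alone = [ inj₁ , (λ y≢u → [ inj₂ , (λ y≢v → ⊥-elim (¬leaf (f , ∖ˡ f∈ , x , y , ends' , λ {i} i∈ i≢f → still y≢u y≢v i∈ i≢f))) ]′ (toSum (y Fin.≟ v))) ]′ (toSum (y Fin.≟ u))
                where
                still : y ≢ u → y ≢ v → ∀ {i} → i ∈ Z → i ≢ f → pU i ≢ y × qU i ≢ y
                still y≢u y≢v {i} i∈ i≢f = [ (λ h → subst (λ i → pU i ≢ y × qU i ≢ y) (sym h) e-off) , (λ ne → alone (∖⁺ i∈ λ z → ne (sym (∈⁅⁆⁻ z))) i≢f) ]′ (toSum (i Fin.≟ e))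
                  where
                  e-off : pU e ≢ y × qU e ≢ y
                  e-off = [ (λ (s , t) → (λ h → y≢u (trans (sym h) s)) , λ h → y≢v (trans (sym h) t)) , (λ (s , t) → (λ h → y≢v (trans (sym h) s)) , λ h → y≢u (trans (sym h) t)) ]′ ends

    low : Fin N → Bool
    low = ⟪ (λ v → # (W ∩ edgesAt v) <? D) ⟫

    #low : # low ≤ suc D ^ suc b
    #low = [ (λ (u , u∈) → ≤-trans (#-mono λ {v} v∈ → near u (∈⟪⟫⁻ low? u∈) (∈⟪⟫⁻ low? v∈)) (#ball (suc b) u))
           , (λ ¬p → ≤-trans (≮⇒≥ λ l → ¬p (#-pos l)) z≤n) ]′ (toSum (Fin.any? (_∈? low)))
      where
      low? : ∀ v → Dec (# (W ∩ edgesAt v) < D)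
      low? v = # (W ∩ edgesAt v) <? D
      near : ∀ u {v} → # (W ∩ edgesAt u) < D → # (W ∩ edgesAt v) < D → v ∈ ball (suc b) u
      near u {v} lu lv = [ (λ h → subst (_∈ ball (suc b) u) h (centre∈ball (suc b) u)) , (λ ne → low-close ne lu lv) ]′ (toSum (u Fin.≟ v))

  empty : Sparse ∅
  empty = (λ v → ≤-trans (#-mono {Y = ∅} ∩ˡ) (≤-trans (≤-reflexive #-∅) z≤n)) , λ {Z} Z⊆ pos _ → ⊥-elim (<⇒≱ pos (≤-trans (#-mono Z⊆) (≤-reflexive #-∅)))

module TestGraph (P : Parameters) (b : ℕ) where
  open Parameters P

  D M size : ℕ
  D = 2 * suc T
  M = suc D ^ suc b
  size = suc T * M + β * (M * δ) + τ

  module _ {N : ℕ} (size≤N : size ≤ N) where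
    open UEnds N
    open Girth N D b

    private
      H : Hypergraph P N (mU N)
      H = record
        { V = λ j → ⁅ pU j ⁆ ∪ ⁅ qU j ⁆ ; w = λ _ → 1 ; p = pU ; q = qU ; big = ∅ ; small-w = λ _ → ≤-refl
        ; small-V = λ _ x → [ (λ y → inj₁ (sym (∈⁅⁆⁻ y))) , (λ y → inj₂ (sym (∈⁅⁆⁻ y))) ]′ (∪⁻ x)
        ; p∈V = λ _ _ → ∪ˡ (∈⁅⁆ _) ; q∈V = λ _ _ → ∪ʳ (∈⁅⁆ _) ; pq-inj = λ _ _ _ _ → pqU-inj
        ; big-V = λ x → ⊥-elim (∅⁻ x) ; big-w = λ x → ⊥-elim (∅⁻ x) }
      open Hypergraph H

      ranked : Ranked H
      ranked = record
        { R = λ _ → 0 ; ρ = λ _ → 0 ; R-mono = λ _ → z≤n ; ρ≤ = λ _ → z≤n ; ρ-step = λ _ → z≤n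
        ; repair = λ _ _ _ _ _ _ _ _ _ → z≤n ; rigid = λ _ _ _ → z≤n }

      #full : # {N} full ≡ N
      #full = trans (#-Sum full) (trans (Sum-const {N} 1) (*-identityʳ N))

      module _ {W} (sparse : Sparse W) (max : ∀ {e} → e ∉ W → ¬ Sparse (W ∪ ⁅ e ⁆)) where
        open Balls W sparse max

        deg≥ : ∀ v → # (W ∩ edgesAt v) ≤ deg W v
        deg≥ v = ≤-trans (#-mono λ {e} x → ∩⁺ (∩ˡ x) (∈at (at-v {e} (∈edgesAt⁻ (∩ʳ {X = W} x))))) (≤-reflexive (#≡wt _))
          where
          at-v : ∀ {e} → v ≡ pU e ⊎ v ≡ qU e → v ∈ ⁅ pU e ⁆ ∪ ⁅ qU e ⁆
          at-v {e} = [ (λ h → ∪ˡ (subst (_∈ ⁅ pU e ⁆) (sym h) (∈⁅⁆ _))) , (λ h → ∪ʳ (subst (_∈ ⁅ qU e ⁆) (sym h) (∈⁅⁆ _))) ]′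

        high : ∀ {v} → v ∉ low → D ≤ deg W v
        high {v} v∉ = ≤-trans (≮⇒≥ λ l → v∉ (∈⟪⟫ (λ v → # (W ∩ edgesAt v) <? D) l)) (deg≥ v)

        δ≤D : δ ≤ D
        δ≤D = ≤-trans (≤-trans (*-monoˡ-≤ τ {8} {32} (m≤m+n 8 24)) 32τ≤T) (≤-trans (n≤1+n T) (m≤m+n (suc T) _))

        wt-low : ∀ k → wt (λ v → ⟦ low v ⟧ * k) full ≤ M * k
        wt-low k = ≤-trans (wt≤Sum {w = λ v → ⟦ low v ⟧ * k} {X = full} (λ _ → ≤-refl)) (≤-trans (≤-reflexive (trans (sym (wt-Sum (λ _ → k) low)) (wt-const k low))) (*-monoˡ-≤ k #low))

        deficiency : Q full W ≤ M * δ
        deficiency = ≤-trans (wt-monoʷ {w' = λ v → ⟦ low v ⟧ * δ} {full} λ {v} _ → pt v) (wt-low δ)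
          where
          pt : ∀ v → δ ∸ deg W v ≤ ⟦ low v ⟧ * δ
          pt v = [ (λ v∈ → ≤-trans (m∸n≤m δ (deg W v)) (≤-reflexive (sym (term-∈ {X = low} δ v∈)))) ,
                   (λ v∉ → ≤-trans (≤-reflexive (m≤n⇒m∸n≡0 (≤-trans δ≤D (high v∉)))) z≤n) ]′ (toSum (v ∈? low))

        many-edges : suc T * N ≤ wt w W + suc T * M
        many-edges = *-cancelˡ-≤ 2 (lin 0 (degrees ⊕ handshake H {W} full (λ _ → ∅⁻) ⊕ wt-low D) (arith (suc T) N (wt w W) M (wt (deg W) full) (wt (λ v → ⟦ low v ⟧ * D) full)))
          where
          arith : ∀ t n e m x y → 2 * (t * n) + (x + y + (e + e) + m * (2 * t)) + 0 ≡ 2 * (e + t * m) + (n * (2 * t) + x + y)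
          arith = solve-∀
          degrees : N * D ≤ wt (deg W) full + wt (λ v → ⟦ low v ⟧ * D) full
          degrees = ≤-trans (≤-reflexive (trans (cong (_* D) (sym #full)) (sym (wt-const D full))))
            (≤-trans (wt-monoʷ {w' = λ v → deg W v + ⟦ low v ⟧ * D} {full} λ {v} _ → pt v) (≤-reflexive (wt-+ (deg W) (λ v → ⟦ low v ⟧ * D) full)))
            where
            pt : ∀ v → D ≤ deg W v + ⟦ low v ⟧ * D
            pt v = [ (λ v∈ → ≤-trans (≤-reflexive (sym (term-∈ {X = low} D v∈))) (m≤n+m _ (deg W v))) , (λ v∉ → ≤-trans (high v∉) (m≤m+n _ _)) ]′ (toSum (v ∈? low))

        1≤T : 1 ≤ T
        1≤T = ≤-trans (≤-trans 1≤τ (m≤m+n τ _)) 32τ≤T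

        no-bound : ¬ MainEstimate.Bound ranked full W
        no-bound bound = contra 0 (many-edges ⊕ bound ⊕ β ⊛ deficiency ⊕ ≤-trans (m≤m+n _ τ) size≤N ⊕ *-mono-≤ 1≤T 1≤τ ⊕ T ⊛ ≤-reflexive #full)
          (arith T N (wt w W) M (T * τ) (β * Q full W) (β * (M * δ)) (# {N} full))
          where
          arith : ∀ t n e m x y z f → 1 + (e + suc t * m + (t * f + (t * 0 + y)) + z + n + x + t * n) + 0 ≡ suc t * n + (e + (t * 0 + x)) + y + (suc t * m + z) + 1 + t * f
          arith = solve-∀

        connected : ∀ {A Y} → Connected A Y → ConnectedE c A (imgU Y)
        connected {A} {Y} con {A₁} {A₂} (A⊆ , A₁⊆ , A₂⊆ , inside , r) = con (A⊆ , A₁⊆ , A₂⊆ , inside' , r)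
          where
          inside' : ∀ {j} → j ∈ Y → (⁅ pU j ⁆ ∪ ⁅ qU j ⁆ ⊆ A₁) ⊎ (⁅ pU j ⁆ ∪ ⁅ qU j ⁆ ⊆ A₂)
          inside' {j} j∈ = split (inside (∈imgU {Y} {j} j∈))
            where
            split : (pU j ∈ A₁ × qU j ∈ A₁) ⊎ (pU j ∈ A₂ × qU j ∈ A₂) → (⁅ pU j ⁆ ∪ ⁅ qU j ⁆ ⊆ A₁) ⊎ (⁅ pU j ⁆ ∪ ⁅ qU j ⁆ ⊆ A₂)
            split (inj₁ (a , b)) = inj₁ (∪-⊆ (⁅⁆-⊆ a) (⁅⁆-⊆ b))
            split (inj₂ (a , b)) = inj₂ (∪-⊆ (⁅⁆-⊆ a) (⁅⁆-⊆ b))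

        within-img : ∀ {A Y} → Within A Y → WithinE A (imgU Y)
        within-img {A} {Y} h x = go (∈imgU⁻ x)
          where
          go : ∀ {u v} → (∃ λ j → j ∈ Y × pU j ≡ u × qU j ≡ v) → u ∈ A × v ∈ A
          go (j , j∈ , refl , refl) = h j∈ (∪ˡ (∈⁅⁆ _)) , h j∈ (∪ʳ (∈⁅⁆ _))

        two-edges : ∀ {A Y} → 2 * τ < # A → Heavy A Y → 2 ≤ # Y
        two-edges {A} {Y} large heavy = lin (T * τ) (≤-trans heavy (≤-reflexive (cong (_+ T * τ) (sym (#≡wt Y)))) ⊕ T ⊛ large ⊕ 1≤T) (arith T τ (# A) (# Y))
          where
          arith : ∀ t τ a y → 2 + (y + t * τ + t * a + t) + t * τ ≡ y + (suc (t * a) + t * suc (2 * τ) + 1)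
          arith = solve-∀

    record HighlyConnected : Set where
      field
        W : Fin (mU N) → Bool
        A : Fin N → Bool
        within : WithinE A (imgU W)
        con : ConnectedE c A (imgU W)
        c<A : c < # A
        two : 2 ≤ # W
        degrees : ∀ v → # (W ∩ edgesAt {N} v) ≤ D
        leafy : Leafy W

    exists : Cl HighlyConnected
    exists = maximal (mU N) ∅ (m≤m+n _ _) empty >>= λ (W , sparse , max) →
      MainEstimate.estimate ranked N {full} {W} (#≤n full) (λ _ _ → ∈full) (≤-trans (m≤n+m τ _) (≤-trans size≤N (≤-reflexive (sym #full)))) >>= pick W sparse max
      where
      pick : ∀ W (sparse : Sparse W) (max : ∀ {e} → e ∉ W → ¬ Sparse (W ∪ ⁅ e ⁆)) → HeavyConnected full W ⊎ MainEstimate.Bound ranked full W → Cl HighlyConnected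
      pick W sparse max (inj₂ bound) = ⊥-elim (no-bound sparse max bound)
      pick W sparse max (inj₁ (A , Y , _ , Y⊆ , within , con , large , heavy)) = ret record
        { W = Y ; A = A ; within = within-img sparse max {A} {Y} within ; con = connected sparse max {A} {Y} con
        ; c<A = ≤-trans (s≤s (≤-trans (m≤m+n c c) (≤-trans 2c≤τ (m≤m+n τ _)))) large
        ; two = two-edges sparse max {A} {Y} large heavy
        ; degrees = λ v → ≤-trans (#-mono λ x → ∩⁺ (Y⊆ (∩ˡ x)) (∩ʳ x)) (proj₁ sparse v)
        ; leafy = λ {Z} Z⊆ → proj₂ sparse {Z} λ z → Y⊆ (Z⊆ z) }

module Bounds {c : ℕ} (1≤c : 1 ≤ c) where
  -- the bound on the rank of a family that is not free
  rankBound : ℕ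
  rankBound = 3 * (D * D)
    where
      open TestGraph (parameters c 0 1≤c) 0 using (D)

  largeUniverse : ℕ → ℕ
  largeUniverse n = n + (TestGraph.size (parameters c 0 1≤c) b + (TestGraph.D (parameters c 0 1≤c) b + (2 + 4 * b)))
    where b = c * 1 * n

module _ {c c' : ℕ} (1≤c : 1 ≤ c) (3≤c : 3 ≤ c) (c'≤c : c' ≤ c) (𝓕 : GraphMatroidFamily) (whitney : Whitney-at c' 𝓕) where
  open Bounds 1≤c

  symmetricRank-rigid : ∀ N dec → SymmetricRank.Rigid (symmetricRank 𝓕 N dec) c
  symmetricRank-rigid N dec within con c<A = Rigidity.rigid 𝓕 N dec 3≤c c'≤c whitney c<A within con

  stellar-family : ∀ {n N} (dec : Decidable-on 𝓕 n) (dec' : Decidable-on 𝓕 N) → Unfree (symmetricRank 𝓕 n dec) → largeUniverse n ≤ N →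
    Cl (Stellar (SymmetricRank.R (symmetricRank 𝓕 N dec')) (2 + 2 * rankBound) (2 + rankBound) rankBound)
  stellar-family {n} {N} dec dec' unfree large = exists size≤N >>= bounded
    where
    b = c * 1 * n
    open TestGraph (parameters c 0 1≤c) b
    size≤N : size ≤ N
    size≤N = ≤-trans (≤-trans (m≤m+n size _) (m≤n+m _ n)) large
    top = Spanning.top (symmetricRank 𝓕 N dec')
    top≤b : top ≤ b
    top≤b = unfree⇒bounded 𝓕 (≤-trans (m≤m+n n _) large) dec dec' 1≤c (symmetricRank-rigid N dec') unfree
    room : D + (2 + 4 * top) ≤ N
    room = ≤-trans (+-monoʳ-≤ D (+-monoʳ-≤ 2 (*-monoʳ-≤ 4 top≤b))) (≤-trans (≤-trans (m≤n+m _ size) (m≤n+m _ n)) large)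
    bounded : HighlyConnected size≤N → Cl (Stellar (SymmetricRank.R (symmetricRank 𝓕 N dec')) (2 + 2 * rankBound) (2 + rankBound) rankBound)
    bounded G = SparseGraph.bounded-rank 𝓕 N dec' 3≤c c'≤c whitney W {A} {D} within con c<A two (λ {Z} Z⊆ pos l → leafy {Z} Z⊆ pos (≤-trans l top≤b)) degrees room >>= λ (top≤ , s<top) →
        ret (Spanning.stellar (symmetricRank 𝓕 N dec') top≤ s<top)
      where
      open HighlyConnected G

length≤# : ∀ {N} (A : Fin N → Bool) (L : List ℕ) → Unique L → All (λ n → ∃ λ x → x ∈ A × toℕ x ≡ n) L → length L ≤ # A
length≤# A [] _ _ = z≤n
length≤# A (n ∷ L) (n≢ AllPairs.∷ uniq) ((x , x∈ , x≡n) ∷ all) =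
  ≤-trans (s≤s (length≤# (A ∖ ⁅ x ⁆) L uniq (All.zipWith (λ { (ne , y , y∈ , e) → y , ∖⁺ y∈ (λ z → ne (trans (sym x≡n) (trans (cong toℕ (∈⁅⁆⁻ z)) e))) , e }) (n≢ , all))))
    (≤-reflexive (sym (#-del A x∈)))

module ConnectedGraph {N C} (G : Graph) (bd : Bounded N G) (conn : IsConnected C G) {A : Fin N → Bool} {X : ESet N}
  (A⁺ : ∀ i → Ends.pG G bd i ∈ A × Ends.qG G bd i ∈ A) (A⁻ : ∀ {v} → v ∈ A → ∃ λ i → v ≡ Ends.pG G bd i ⊎ v ≡ Ends.qG G bd i)
  (X⁺ : ∀ i → (Ends.pG G bd i , Ends.qG G bd i) ∈ X) (X⁻ : ∀ {u v} → (u , v) ∈ X → ∃ λ i → Ends.pG G bd i ≡ u × Ends.qG G bd i ≡ v) where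
  open Ends G bd

  C<#A : C < # A
  C<#A = let L , uniq , len , vs = proj₁ conn in ≤-trans (≤-reflexive (sym len)) (length≤# A L uniq (All.map (λ {n} v → in-A (vertex⁻ {G} v)) vs))
    where
    in-A : ∀ {n} → (∃ λ i → n ≡ lo (edge G i) ⊎ n ≡ hi (edge G i)) → ∃ λ x → x ∈ A × toℕ x ≡ n
    in-A (i , inj₁ e) = pG i , proj₁ (A⁺ i) , trans (toℕ-pG i) (sym e)
    in-A (i , inj₂ e) = qG i , proj₂ (A⁺ i) , trans (toℕ-qG i) (sym e)

  connectedE : ConnectedE C A X
  connectedE {A₁} {A₂} (A⊆ , A₁⊆ , A₂⊆ , inside , (u , u∈ , u∉) , (v , v∈ , v∉)) =
      ≮⇒≥ λ small → unreachable (proj₂ conn L (≤-trans (s≤s (≤-reflexive len)) small) (toℕ u) (toℕ v) (is-vertex u∈) (is-vertex v∈) (λ z → u∉ (∩ʳ (L⁻ z))) (λ z → v∉ (∩ˡ (L⁻ z))))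
    where
    en = enumerate (A₁ ∩ A₂)
    L : List ℕ
    L = List.tabulate (toℕ ∘ proj₁ en)
    len : length L ≡ # (A₁ ∩ A₂)
    len = List.length-tabulate _
    L⁺ : ∀ {x} → x ∈ A₁ ∩ A₂ → toℕ x LM.∈ L
    L⁺ x∈ = let i , e = proj₂ (proj₂ (proj₂ en)) x∈ in subst (λ x → toℕ x LM.∈ L) e (LM.∈-tabulate⁺ i)
    L⁻ : ∀ {x} → toℕ x LM.∈ L → x ∈ A₁ ∩ A₂
    L⁻ x∈ = let i , e = LM.∈-tabulate⁻ x∈ in subst (_∈ A₁ ∩ A₂) (Fin.toℕ-injective (sym e)) (proj₁ (proj₂ en) i)
    is-vertex : ∀ {x} → x ∈ A → IsVertex G (toℕ x)
    is-vertex x∈ = let i , h = A⁻ x∈ in vertex⁺ {G} i ([ (λ e → inj₁ (trans (cong toℕ e) (toℕ-pG i))) , (λ e → inj₂ (trans (cong toℕ e) (toℕ-qG i))) ]′ h)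
    Near : ℕ → Set
    Near w = ∃ λ x → toℕ x ≡ w × x ∈ A₁ × x ∉ A₂
    across : ∀ {w w'} → Near w → Adj G w w' → ¬ (w' LM.∈ L) → Near w'
    across {w} {w'} (x , x≡w , x∈ , x∉) (i , j) w'∉ = [ from-p , from-q ]′ j
      where
      near : ∀ {y} → toℕ y ≡ w' → y ∈ A₁ → Near w'
      near {y} e y∈ = y , e , y∈ , λ y∈₂ → w'∉ (subst (LM._∈ L) e (L⁺ (∩⁺ y∈ y∈₂)))
      from-p : lo (edge G i) ≡ w × hi (edge G i) ≡ w' → Near w'
      from-p (a , b) = near (trans (toℕ-qG i) b) ([ proj₂ , (λ (z , _) → ⊥-elim (x∉ (subst (_∈ A₂) (Fin.toℕ-injective (trans (toℕ-pG i) (trans a (sym x≡w)))) z))) ]′ (inside (X⁺ i)))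
      from-q : lo (edge G i) ≡ w' × hi (edge G i) ≡ w → Near w'
      from-q (a , b) = near (trans (toℕ-pG i) a) ([ proj₁ , (λ (_ , z) → ⊥-elim (x∉ (subst (_∈ A₂) (Fin.toℕ-injective (trans (toℕ-qG i) (trans b (sym x≡w)))) z))) ]′ (inside (X⁺ i)))
    stays : ∀ {w} → Reach G L (toℕ u) w → Near w
    stays here = u , refl , [ id , (λ z → ⊥-elim (u∉ z)) ]′ (∪⁻ (A⊆ u∈)) , u∉
    stays (step r a w∉) = across (stays r) a w∉
    unreachable : Reach G L (toℕ u) (toℕ v) → ⊥
    unreachable r = let x , e , x∈ , _ = stays r in v∉ (subst (_∈ A₁) (Fin.toℕ-injective e) x∈)

  star? : ∀ v i → Dec (v ≡ pG i ⊎ v ≡ qG i)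
  star? v i = (v Fin.≟ pG i) ⊎-dec (v Fin.≟ qG i)

  star : Fin N → Fin (m G) → Bool
  star v = ⟪ star? v ⟫

  degree : ∀ {v} → v ∈ A → C ≤ 2 * # (star v)
  degree {v} v∈ = ≤-trans (by-cases (⊆-or-∃ A near)) (≤-trans #near (≤-reflexive (*-comm (# (star v)) 2)))
    where
    near? : ∀ y → Dec (∃ λ i → i ∈ star v × (y ≡ pG i ⊎ y ≡ qG i))
    near? y = Fin.any? λ i → (i ∈? star v) ×-dec star? y i
    near : Fin N → Bool
    near = ⟪ near? ⟫
    near⁺ : ∀ {y} i → v ≡ pG i ⊎ v ≡ qG i → y ≡ pG i ⊎ y ≡ qG i → y ∈ near
    near⁺ i a b = ∈⟪⟫ near? (i , ∈⟪⟫ (star? v) a , b)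
    #near : # near ≤ # (star v) * 2
    #near = #-cover-by (star v) (λ i → ⁅ pG i ⁆ ∪ ⁅ qG i ⁆)
      (λ h → let i , i∈ , k = ∈⟪⟫⁻ near? h in i , i∈ , [ (λ e → ∪ˡ (subst (_∈ ⁅ pG i ⁆) (sym e) (∈⁅⁆ _))) , (λ e → ∪ʳ (subst (_∈ ⁅ qG i ⁆) (sym e) (∈⁅⁆ _))) ]′ k)
      λ {i} _ → ≤-trans (#-add≤ ⁅ pG i ⁆ (qG i)) (s≤s (≤-reflexive (#-⁅⁆ (pG i))))
    v-near : v ∈ near
    v-near = let i , h = A⁻ v∈ in near⁺ i h h
    by-cases : (A ⊆ near) ⊎ (∃ λ y → y ∈ A × y ∉ near) → C ≤ # near
    by-cases (inj₁ h) = ≤-trans (<⇒≤ C<#A) (#-mono h)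
    by-cases (inj₂ (y , y∈ , y∉)) = ≤-trans (connectedE {near} {A ∖ ⁅ v ⁆} ((λ {x} x∈ → cover x∈) , near⊆ , ∖ˡ , (λ {a} {b} z → inside (X⁻ z)) , (v , v∈ , λ z → ∖ʳ z (∈⁅⁆ v)) , (y , y∈ , y∉))) (#-mono ∩ˡ)
      where
      cover : ∀ {x} → x ∈ A → x ∈ near ∪ (A ∖ ⁅ v ⁆)
      cover {x} x∈ = [ (λ e → ∪ˡ (subst (_∈ near) e v-near)) , (λ ne → ∪ʳ (∖⁺ x∈ λ z → ne (∈⁅⁆⁻ z))) ]′ (toSum (v Fin.≟ x))
      near⊆ : near ⊆ A
      near⊆ h = let i , _ , k = ∈⟪⟫⁻ near? h in [ (λ e → subst (_∈ A) (sym e) (proj₁ (A⁺ i))) , (λ e → subst (_∈ A) (sym e) (proj₂ (A⁺ i))) ]′ k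
      inside : ∀ {a b} → (∃ λ i → pG i ≡ a × qG i ≡ b) → (a ∈ near × b ∈ near) ⊎ (a ∈ A ∖ ⁅ v ⁆ × b ∈ A ∖ ⁅ v ⁆)
      inside (i , refl , refl) = [ (λ t → inj₁ (near⁺ i t (inj₁ refl) , near⁺ i t (inj₂ refl))) ,
        (λ ¬t → inj₂ (∖⁺ (proj₁ (A⁺ i)) (λ z → ¬t (inj₁ (∈⁅⁆⁻ z))) , ∖⁺ (proj₂ (A⁺ i)) (λ z → ¬t (inj₂ (∈⁅⁆⁻ z))))) ]′ (toSum (star? v i))

module _ {k : ℕ} (𝓜 : Fin (suc k) → GraphMatroidFamily) (c : ℕ) (cs : Fin (suc k) → ℕ) (3≤c : 3 ≤ c) (cs≤c : ∀ i → cs i ≤ c)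
  (whitney : ∀ i → Whitney-at (cs i) (𝓜 i)) where
  private
    1≤c : 1 ≤ c
    1≤c = ≤-trans (s≤s z≤n) 3≤c
    P = parameters c ((c + c) * suc k) 1≤c
  open Bounds 1≤c
  open Parameters P using (T; τ)

  κ bound threshold : ℕ
  κ = 2 * T + 2 * (T * τ)
  bound = suc ((2 + 2 * rankBound) * (2 * (2 + rankBound))) + suc k * rankBound
  threshold = suc κ + 2 * (3 + bound)

  module Universe (N : ℕ) (dec : ∀ i → Decidable-on (𝓜 i) N) (G H : Graph) (conn : IsConnected threshold G) (bdG : Bounded N G) (bdH : Bounded N H)
    (ψ : Fin (m G) → Fin (m H)) (ψ' : Fin (m H) → Fin (m G)) (ψψ' : ∀ j → ψ (ψ' j) ≡ j) (ψ'ψ : ∀ i → ψ' (ψ i) ≡ i)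
    (iso : IsMatroidIso (UnionInd 𝓜 G) (UnionInd 𝓜 H) ψ) where
    module Uf = UnionOfFamilies 𝓜 N dec
    module EG = Ends G bdG
    module EH = Ends H bdH
    open StarsToIso G H ψ ψ' ψψ' ψ'ψ

    family : Fin (suc k) → SymmetricRank 1 N
    family i = symmetricRank (𝓜 i) N (dec i)

    GR : GraphRank P N
    GR = SymmetricProperties.graphRank Uf.S 1≤c (Rigid-Sum family λ i within con l → symmetricRank-rigid 1≤c 3≤c (cs≤c i) (𝓜 i) (whitney i) N (dec i) within con l)

    TG : TwoGraphs GR
    TG = Uf.Pair.twoGraphs GR (λ _ → refl) G H bdG bdH ψ ψ' ψψ' ψ'ψ iso
    open TwoGraphs TG using (Touches; supp; img; ∈supp; ∈supp⁻; ∈img; ∈img⁻)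

    A : Fin N → Bool
    A = supp true full

    on-vertex : ∀ i → EG.pG i ∈ A × EG.qG i ∈ A
    on-vertex i = ∈supp {true} {full} {EG.pG i} {i} ∈full (inj₁ refl) , ∈supp {true} {full} {EG.qG i} {i} ∈full (inj₂ refl)

    on-edge : ∀ {v} → v ∈ A → ∃ λ i → v ≡ EG.pG i ⊎ v ≡ EG.qG i
    on-edge v∈ = let i , _ , t = ∈supp⁻ {true} {full} v∈ in i , t

    edge-of : ∀ {u v} → (u , v) ∈ img true full → ∃ λ i → EG.pG i ≡ u × EG.qG i ≡ v
    edge-of x = let i , _ , a , b = ∈img⁻ {true} {full} x in i , a , b

    edge∈ : ∀ i → (EG.pG i , EG.qG i) ∈ img true full
    edge∈ i = ∈img {true} {full} {i} ∈full

    module Conn = ConnectedGraph {N} {threshold} G bdG conn {A} {img true full} on-vertex on-edge edge∈ edge-of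

    Corresponds : Fin N → Set
    Corresponds v = ∃ λ x → ∀ e → (Touches true v e → Touches false x e) × (Touches false x e → Touches true v e)

    large-star : ∀ {v} → v ∈ A → 3 + bound ≤ # (Conn.star v)
    large-star v∈ = *-cancelˡ-≤ 2 (≤-trans (m≤n+m _ (suc κ)) (Conn.degree v∈))

    deg2 : ∀ v i → At v (edge G i) → ∃ λ j → At v (edge G j) × i ≢ j
    deg2 v i at-v = [ (λ e → second (EG.pG i) (trans (EG.toℕ-pG i) (sym e)) (proj₁ (on-vertex i))) , (λ e → second (EG.qG i) (trans (EG.toℕ-qG i) (sym e)) (proj₂ (on-vertex i))) ]′ at-v
      where
      second : ∀ x → toℕ x ≡ v → x ∈ A → ∃ λ j → At v (edge G j) × i ≢ j
      second x x≡v x∈ = let j , j∈ , j∉ = #<⇒∃ ⁅ i ⁆ (Conn.star x) (≤-trans (s≤s (≤-reflexive (#-⁅⁆ i))) (≤-trans (m≤m+n 2 _) (large-star x∈))) in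
        j , [ (λ h → inj₁ (trans (sym x≡v) (trans (cong toℕ h) (EG.toℕ-pG j)))) , (λ h → inj₂ (trans (sym x≡v) (trans (cong toℕ h) (EG.toℕ-qG j)))) ]′ (∈⟪⟫⁻ (Conn.star? x) j∈) ,
        λ h → j∉ (subst (_∈ ⁅ i ⁆) h (∈⁅⁆ i))

    stars : (∀ v → v ∈ A → Corresponds v) → Stars
    stars corr i = subst (Star-of i) (EG.toℕ-pG i) (star-of (EG.pG i) (inj₁ refl) (corr _ (proj₁ (on-vertex i)))) ,
                   subst (Star-of i) (EG.toℕ-qG i) (star-of (EG.qG i) (inj₂ refl) (corr _ (proj₂ (on-vertex i))))
      where
      star-of : ∀ v → Touches true v i → Corresponds v → Star-of i (toℕ v)
      star-of v t (x , both) = [ (λ h → inj₁ (subst (MapsStar (toℕ v)) (trans (cong toℕ h) (EH.toℕ-pG (ψ i))) maps)) ,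
                                 (λ h → inj₂ (subst (MapsStar (toℕ v)) (trans (cong toℕ h) (EH.toℕ-qG (ψ i))) maps)) ]′ (proj₁ (both i) t)
        where
        touches⇒AtH : ∀ {x} j → Touches false x j → At (toℕ x) (edge H (ψ j))
        touches⇒AtH j = [ (λ h → inj₁ (trans (cong toℕ h) (EH.toℕ-pG (ψ j)))) , (λ h → inj₂ (trans (cong toℕ h) (EH.toℕ-qG (ψ j)))) ]′
        AtH⇒touches : ∀ {x} j → At (toℕ x) (edge H (ψ j)) → Touches false x j
        AtH⇒touches j = [ (λ h → inj₁ (Fin.toℕ-injective (trans h (sym (EH.toℕ-pG (ψ j)))))) , (λ h → inj₂ (Fin.toℕ-injective (trans h (sym (EH.toℕ-qG (ψ j)))))) ]′
        touches⇒AtG : ∀ {x} j → Touches true x j → At (toℕ x) (edge G j)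
        touches⇒AtG j = [ (λ h → inj₁ (trans (cong toℕ h) (EG.toℕ-pG j))) , (λ h → inj₂ (trans (cong toℕ h) (EG.toℕ-qG j))) ]′
        AtG⇒touches : ∀ {x} j → At (toℕ x) (edge G j) → Touches true x j
        AtG⇒touches j = [ (λ h → inj₁ (Fin.toℕ-injective (trans h (sym (EG.toℕ-pG j))))) , (λ h → inj₂ (Fin.toℕ-injective (trans h (sym (EG.toℕ-qG j))))) ]′
        maps : MapsStar (toℕ v) (toℕ x)
        maps j = (λ a → touches⇒AtH {x} j (proj₁ (both j) (AtG⇒touches {v} j a))) , λ a → touches⇒AtG {v} j (proj₂ (both j) (AtH⇒touches {x} j a))

    some-free : ∀ i → ¬ Unfree (family i) → Cl Stars
    some-free i free = StarsI.stars {GR = GR} GR-free TG κ ≤-refl (λ {A₁} {A₂} s → ≤-trans (m≤m+n (suc κ) _) (Conn.connectedE {A₁} {A₂} s)) (≤-trans (s≤s (m≤m+n (suc κ) _)) Conn.C<#A) >>= λ corr → ret (stars corr)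
      where
      GR-free : GraphRank.Free GR
      GR-free {X} {u} {v} u≢v av = Sum-strict (λ j → SymmetricRank.mono (family j) (⊑-∪ˡ {X = X} {X} ⊑-refl)) i (≰⇒> λ s → free (X , u , v , u≢v , av , s))

    all-stellar : (∀ i → Stellar (SymmetricRank.R (family i)) (2 + 2 * rankBound) (2 + rankBound) rankBound) → Stars
    all-stellar st = stars λ v v∈ → StarsII.stars TG (Stellar-Sum (λ i → SymmetricRank.R (family i)) st) {v} (≤-trans (m≤m+n 3 _) (large-star v∈)) (≤-trans (m≤n+m _ 3) (large-star v∈))

  module _ (G H : Graph) (conn : IsConnected threshold G) (ψ : Fin (m G) ⤖ Fin (m H)) (iso : IsMatroidIso (UnionInd 𝓜 G) (UnionInd 𝓜 H) (Bijection.to ψ)) where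
    private
      to = Bijection.to ψ
      from : Fin (m H) → Fin (m G)
      from j = proj₁ (Bijection.surjective ψ j)
      to-from : ∀ j → to (from j) ≡ j
      to-from j = proj₂ (Bijection.surjective ψ j) refl
      from-to : ∀ i → from (to i) ≡ i
      from-to i = Bijection.injective ψ (to-from (to i))

      N₀ : ℕ
      N₀ = suc (Sum (λ i → hi (edge G i)) + Sum (λ j → hi (edge H j)))
      bdG : Bounded N₀ G
      bdG i = s≤s (≤-trans (term≤Sum (λ i → hi (edge G i)) i) (m≤m+n _ _))
      bdH : Bounded N₀ H
      bdH j = s≤s (≤-trans (term≤Sum (λ j → hi (edge H j)) j) (m≤n+m _ _))
      N₁ : ℕ
      N₁ = largeUniverse N₀
      N₀≤N₁ : N₀ ≤ N₁
      N₀≤N₁ = m≤m+n N₀ _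

      module At₀ (dec : ∀ i → Decidable-on (𝓜 i) N₀) = Universe N₀ dec G H conn bdG bdH to from to-from from-to iso
      module At₁ (dec : ∀ i → Decidable-on (𝓜 i) N₁) =
        Universe N₁ dec G H conn (λ i → ≤-trans (bdG i) N₀≤N₁) (λ j → ≤-trans (bdH j) N₀≤N₁) to from to-from from-to iso

      open StarsToIso G H to from to-from from-to

      all-stars : Cl Stars
      all-stars = Cl-Fin (λ i → decidable-on (𝓜 i) N₀) >>= λ dec → Cl-Fin (λ i → em (Unfree (At₀.family dec i))) >>= λ unfree? → cases dec unfree? (Fin.any? λ i → ¬? (unfree? i))
        where
        cases : ∀ dec (unfree? : ∀ i → Dec (Unfree (At₀.family dec i))) → Dec (∃ λ i → ¬ Unfree (At₀.family dec i)) → Cl Stars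
        cases dec unfree? (yes (i , free)) = At₀.some-free dec i free
        cases dec unfree? (no ¬free) = Cl-Fin (λ i → decidable-on (𝓜 i) N₁) >>= λ dec' →
          Cl-Fin (λ i → stellar-family 1≤c 3≤c (cs≤c i) (𝓜 i) (whitney i) (dec i) (dec' i) (stable (unfree? i) λ free → ¬free (i , free)) ≤-refl) >>= λ st →
          ret (At₁.all-stellar dec' st)

      deg2 : ∀ v i → At v (edge G i) → ∃ λ j → At v (edge G j) × i ≢ j
      deg2 v i a = stable (Fin.any? λ j → at? v (edge G j) ×-dec ¬? (i Fin.≟ j)) (Cl-Fin (λ i → decidable-on (𝓜 i) N₀) >>= λ dec → ret (At₀.deg2 dec v i a))

    reconstruct : Σ (GraphIso G H) λ φ → Induced G H φ to
    reconstruct = isomorphism (stable stars? all-stars) deg2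

theorem1p2 : (k : ℕ) (𝓜 : Fin (suc k) → GraphMatroidFamily) →
  (∀ j → WhitneyProperty (Ind (𝓜 j))) → WhitneyProperty (UnionInd 𝓜)
theorem1p2 k 𝓜 w = threshold 𝓜 c cs 3≤c cs≤c whitney , λ G conn H ψ iso → reconstruct 𝓜 c cs 3≤c cs≤c whitney G H conn ψ iso
  where
  cs : Fin (suc k) → ℕ
  cs j = proj₁ (w j)
  c : ℕ
  c = 3 + Sum cs
  3≤c : 3 ≤ c
  3≤c = m≤m+n 3 _
  cs≤c : ∀ i → cs i ≤ c
  cs≤c i = ≤-trans (term≤Sum cs i) (m≤n+m _ 3)
  whitney : ∀ i → Whitney-at (cs i) (𝓜 i)
  whitney i = proj₂ (w i)
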